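{- Let $n\ge 1$ and let ${\bf F}=(F_1,\ldots,F_n)$ be the system of polynomials in $\mathbb{Z}[X_1,\ldots,X_n]$ given by \[F_i(X_1,\ldots,X_n)=X_i\,G_i(X_{i+1},\ldots,X_n)+H_i(X_{i+1},\ldots,X_n),\quad i=1,\ldots,n-1,\qquad F_n=g_nX_n+h_n,\] where $G_i,H_i\in\mathbb{Z}[X_{i+1},\ldots,X_n]$, $g_n,h_n\in\mathbb{Z}$, $g_n\neq 0$. Assume that for each $i=1,\ldots,n-1$ the polynomial $G_i$ has a unique leading monomial, i.e. \[G_i=g_iX_{i+1}^{s_{i,i+1}}\cdots X_n^{s_{i,n}}+\tilde G_i,\qquad g_i\in\mathbb{Z}\setminus\{0\},\ \tilde G_i\in\mathbb{Z}[X_{i+1},\ldots,X_n],\] with $\deg_{X_j}\tilde G_i<s_{i,j}$ and $\deg_{X_j}H_i<s_{i,j}$ for $j=i+1,\ldots,n$, and that $s_{i,i+1}\neq 0$ for $i=1,\ldots,n-1$. Set $d=\max_j\deg F_j$ and $h=\max_j h(F_j)$. Let $k\ge 1$ and suppose that ${\bf F}$ has finitely many periodic points of order $k$ over $\mathbb{C}$. Then there exists an integer $\mathfrak{B}_1\in\mathbb{N}$ with \[\log\mathfrak{B}_1\ll_{d,h,n}k^{n(3n-1)}\] such that if $p$ is a prime not dividing $\mathfrak{B}_1$, then the reduction of ${\bf F}$ modulo $p$ has $O_{d,h,n}(k^{n(n-1)/2})$ periodic points of order $k$ (over $\overline{\mathbb{F}}_p$).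
   Context: For $L\in\mathbb{Z}[X_1,\ldots,X_n]$, the height $h(L)$ is the logarithm of the maximum of the absolute values of its coefficients. ${\bf F}^{(k)}$ denotes the $k$-fold composition ${\bf F}\circ\cdots\circ{\bf F}$. A point ${\bf w}$ is a periodic point of order $k$ (is $k$-periodic) for ${\bf F}$ if ${\bf F}^{(k)}({\bf w})={\bf w}$; for the reduction modulo $p$, one uses the system ${\bf F}_p$ obtained by reducing the coefficients of $F_1,\ldots,F_n$ modulo $p$, with points in $\overline{\mathbb{F}}_p^n$. The notation $f\ll_{d,h,n}g$ and $f=O_{d,h,n}(g)$ means $|f|\le c\,g$ for a constant $c$ depending only on $d,h,n$. -}

module Defs where

open import Level using (Level; 0ℓ; _⊔_) renaming (suc to lsuc)
open import Data.Nat using (ℕ; zero; suc; _≤_; _<_)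
open import Data.Integer as ℤ using (ℤ; +_; -[1+_])
open import Data.Fin using (Fin; toℕ)
open import Data.Vec as V using (Vec; []; _∷_; lookup; tabulate; _[_]≔_)
open import Data.Vec.Relation.Unary.All as VAll using ()
open import Data.List as L using (List; []; _∷_; length; upTo; concatMap; map; foldr)
open import Data.Product using (∃; _×_)
open import Relation.Nullary using (¬_)
open import Relation.Binary.PropositionalEquality using (_≡_)
open import Algebra.Bundles using (CommutativeRing)

-- Polynomials in ℤ[X₁,…,Xₙ] (variable Xⱼ ↔ index j : Fin n, X₁ ↔ 0).
-- A polynomial is its coefficient function on exponent vectors,
-- together with a bound on all exponents occurring in its support.

record Poly (n : ℕ) : Set where
  field
    bound   : ℕ
    coeff   : Vec ℕ n → ℤ
    support : ∀ e → ¬ coeff e ≡ + 0 → VAll.All (_≤ bound) e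
open Poly public

TotDeg≤ : ∀ {n} → Poly n → ℕ → Set
TotDeg≤ P d = ∀ e → ¬ coeff P e ≡ + 0 → V.sum e ≤ d

-- all coefficients have absolute value ≤ H  (i.e. height h(P) ≤ log H)
Coeffs≤ : ∀ {n} → Poly n → ℕ → Set
Coeffs≤ P H = ∀ e → ℤ.∣ coeff P e ∣ ≤ H

OnlyAfter : ∀ {n} → Fin n → Poly n → Set
OnlyAfter {n} i P = ∀ e → ¬ coeff P e ≡ + 0 → ∀ (j : Fin n) → toℕ j ≤ toℕ i → lookup e j ≡ 0

xTimesCoeff : ∀ {n} → Fin n → Poly n → Vec ℕ n → ℤ
xTimesCoeff i G e with lookup e i
... | zero  = + 0
... | suc m = coeff G (e [ i ]≔ m)

box : ℕ → (n : ℕ) → List (Vec ℕ n)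
box b zero    = [] ∷ []
box b (suc n) = concatMap (λ a → map (a ∷_) (box b n)) (upTo (suc b))

module Eval {c ℓ} (R : CommutativeRing c ℓ) where
  open CommutativeRing R

  natCast : ℕ → Carrier
  natCast zero    = 0#
  natCast (suc m) = 1# + natCast m

  intCast : ℤ → Carrier
  intCast (+ m)      = natCast m
  intCast -[1+ m ]   = - natCast (suc m)

  pow : Carrier → ℕ → Carrier
  pow x zero    = 1#
  pow x (suc m) = x * pow x m

  mono : ∀ {n} → Vec Carrier n → Vec ℕ n → Carrier
  mono []       []       = 1#
  mono (x ∷ xs) (a ∷ as) = pow x a * mono xs as

  eval : ∀ {n} → Poly n → Vec Carrier n → Carrier
  eval {n} P x = foldr _+_ 0# (map (λ e → intCast (coeff P e) * mono x e) (box (bound P) n))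

  apply : ∀ {n} → (Fin n → Poly n) → Vec Carrier n → Vec Carrier n
  apply F x = tabulate (λ i → eval (F i) x)

  iter : ∀ {n} → ℕ → (Fin n → Poly n) → Vec Carrier n → Vec Carrier n
  iter zero    F x = x
  iter (suc k) F x = apply F (iter k F x)

  _≋_ : ∀ {n} → Vec Carrier n → Vec Carrier n → Set ℓ
  x ≋ y = ∀ i → lookup x i ≈ lookup y i

  Periodic : ∀ {n} → (Fin n → Poly n) → ℕ → Vec Carrier n → Set ℓ
  Periodic F k w = iter k F w ≋ w

  horner : List Carrier → Carrier → Carrier
  horner []       x = 0#
  horner (a ∷ as) x = a + x * horner as x

record Field c ℓ : Set (lsuc (c ⊔ ℓ)) where
  field
    commRing : CommutativeRing c ℓ
  open CommutativeRing commRing public hiding (ring)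
  field
    1≉0 : ¬ (1# ≈ 0#)
    inv : ∀ x → ¬ (x ≈ 0#) → ∃ λ y → x * y ≈ 1#

module _ {c ℓ} (K : Field c ℓ) where
  open Field K
  open Eval commRing

  AlgClosed : Set (c ⊔ ℓ)
  AlgClosed = ∀ (cs : List Carrier) → 1 ≤ length cs →
              ∃ λ x → pow x (length cs) + horner cs x ≈ 0#

  CharZero : Set ℓ
  CharZero = ∀ m → ¬ (natCast (suc m) ≈ 0#)

  -- characteristic p (for p prime): p · 1 = 0
  CharP : ℕ → Set ℓ
  CharP p = natCast p ≈ 0#

-- The shape hypothesis of Theorem 2.1:
--   Fᵢ = Xᵢ Gᵢ(X_{i+1},…,Xₙ) + Hᵢ(X_{i+1},…,Xₙ)   (i = 1,…,n; for i = n,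
--   Gₙ = gₙ and Hₙ = hₙ are constants), where
--   Gᵢ = gᵢ X^{sᵢ} + G̃ᵢ with gᵢ ≠ 0, X^{sᵢ} a monomial in X_{i+1},…,Xₙ,
--   deg_{Xⱼ} G̃ᵢ < s_{i,j} and deg_{Xⱼ} Hᵢ < s_{i,j} for j > i,
--   and s_{i,i+1} ≠ 0 for i < n.

open import Data.Integer using (_+_)

record Triangular {n : ℕ} (F : Fin n → Poly n) : Set where
  field
    G H      : Fin n → Poly n
    s        : Fin n → Vec ℕ n
    G-vars   : ∀ i → OnlyAfter i (G i)
    H-vars   : ∀ i → OnlyAfter i (H i)
    F-def    : ∀ i e → coeff (F i) e ≡ xTimesCoeff i (G i) e + coeff (H i) e
    s-vars   : ∀ (i j : Fin n) → toℕ j ≤ toℕ i → lookup (s i) j ≡ 0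
    g≢0      : ∀ i → ¬ coeff (G i) (s i) ≡ + 0
    G̃-deg    : ∀ i e → ¬ e ≡ s i → ¬ coeff (G i) e ≡ + 0 →
               ∀ (j : Fin n) → toℕ i < toℕ j → lookup e j < lookup (s i) j
    H-deg    : ∀ i e → ¬ coeff (H i) e ≡ + 0 →
               ∀ (j : Fin n) → toℕ i < toℕ j → lookup e j < lookup (s i) j
    s-next   : ∀ (i j : Fin n) → toℕ j ≡ suc (toℕ i) → ¬ lookup (s i) j ≡ 0

module Submission where

-- The k-th iterate of a triangular system is again triangular and affine in each leading variable, so the
-- periodic points are the solutions of equations Xᵢ Aᵢ(Xᵢ₊₁,…,Xₙ) + Bᵢ(Xᵢ₊₁,…,Xₙ) = 0.  If some Aᵢ vanished at
-- a periodic point in characteristic 0, then Xᵢ could be moved freely there and the earlier variables solved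
-- for, which gives infinitely many periodic points.  Hence for each i the system together with Aᵢ = 0 has no
-- solution, and an arithmetic Nullstellensatz gives an integer of controlled size such that modulo every prime
-- p not dividing it this persists.  Outside the product of these n integers all Aᵢ are nonzero at every periodic
-- point modulo p, so back substitution leaves at most one periodic point.
--
-- For the arithmetic Nullstellensatz, f₁,…,f_s are combined into algebraically independent functions
-- z₀ = y q₀, zᵢ = xᵢ + y qᵢ, over which (by pigeonhole, with small coefficients) each y f_j is made integral.
-- If the f_j have no common zero in characteristic 0 then 1 lies in their radical, so a multiple of y^j by an
-- integer and a fixed denominator stays in a finite module.  This relation can be divided by p as long as q₀ and
-- the leading coefficients are nonzero modulo p, and a common zero modulo p is excluded by letting y → ∞ there.

open import Defs
open import Level using (0ℓ)
open import Data.Nat as ℕ using (ℕ; zero; suc; s≤s; z≤n)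
open import Data.Integer as ℤ using (ℤ; ∣_∣) renaming (+_ to pos; -[1+_] to neg)
open import Data.Fin as Fin using (Fin; zero; suc; finToFun; funToFin; combine; fromℕ<; toℕ)
open import Data.Vec as Vec using (Vec; []; _∷_; lookup; tabulate; zipWith; _[_]≔_)
open import Data.List as List using (List; []; _∷_; length; _++_; concatMap; applyUpTo; foldr)
open import Data.Maybe using (Maybe; just; nothing)
open import Data.Product using (Σ; ∃; _×_; _,_; proj₁; proj₂)
open import Data.Empty using (⊥; ⊥-elim)
open import Relation.Nullary using (¬_; Dec; yes; no; ¬?)
open import Relation.Binary.PropositionalEquality as ≡ using (_≡_)
open import Algebra.Bundles using (CommutativeRing)
open import Algebra.Solver.Ring.AlmostCommutativeRing using (AlmostCommutativeRing; fromCommutativeRing; _-Raw-AlmostCommutative⟶_)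
open import Data.List.Relation.Unary.All as All using (All; []; _∷_)
open import Data.Nat.Divisibility as ℕD using (_∣_; divides)
open import Data.Nat.GCD using (gcd-GCD; gcd[m,n]∣m; gcd[m,n]∣n; module Bézout)
open import Data.Nat.Primality using (Prime; prime⇒irreducible)
open import Data.Sum using (inj₁; inj₂; _⊎_)
open import Data.List.Relation.Unary.Any as Any using (Any; here; there)
open import Data.List.Membership.Propositional using (_∈_)
open import Data.Unit using (⊤; tt)
open import Data.List.Membership.Propositional.Properties using (∈-cartesianProductWith⁺)
open import Data.Nat.Induction using (<-wellFounded)
open import Induction.WellFounded using (Acc; acc)
open import Data.Vec.Relation.Unary.All as VAll using ()
open import Data.List.Relation.Unary.AllPairs using (AllPairs; []; _∷_)
import Data.Nat.Properties as ℕP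
import Data.Integer.Properties as ℤP
import Algebra.Solver.Ring
import Algebra.Properties.Ring
import Algebra.Properties.Semiring.Mult
import Data.Fin.Properties as FinP
import Data.Vec.Properties as VecP
import Data.List.Properties as ListP
import Data.List.Relation.Unary.All.Properties as AllP

-- The certificate for 1 in the radical is never bounded. Its integer is arbitrary, and whatever
-- power of p it carries is cancelled afterwards. The size of each factor of B comes only from
-- relations found by pigeonhole: it is one value of `q₀` times one value of the leading coefficient
-- of a relation for y. The integer in front of y^j may depend on j, being cleared of p for each j
-- separately, but the denominator must not: only then can j exceed its degree along a curve through
-- the supposed common zero. Sizes are measured by values on a grid rather than by coefficients.
-- Such bounds pass directly through sums, products and the iterated substitutions, and the values
-- determine a polynomial whose degree lies below the grid size. The k-th iterate has degree
-- O(k^(n-1)) and values with logarithm O(k^n); the pigeonhole then needs exponents up to L =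
-- O(k^(n²-1)), which gives log B = O(k^(n²+n-1)). Since equality in the given fields is not
-- decidable, polynomials are treated as functions, coefficients are extracted from identities
-- starting at the constant one, and case distinctions take place under double negation.

-- Integers in commutative rings

CRing : Set₁
CRing = CommutativeRing 0ℓ 0ℓ

ℤR : CRing
ℤR = ℤP.+-*-commutativeRing

module RingKit (R : CRing) where
  open CommutativeRing R public
    renaming (zero to *-zero)
  open Eval R public
    using (natCast; intCast; pow; horner)
  open Algebra.Properties.Ring ring public
    using (-‿distribˡ-*; -‿distribʳ-*; -‿+-comm; -‿involutive; -0#≈0#)
  module ×S = Algebra.Properties.Semiring.Mult semiring
  open import Relation.Binary.Reasoning.Setoid setoid public

  natCast-× : ∀ m → natCast m ≡ m ×S.× 1#
  natCast-× zero = ≡.refl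
  natCast-× (suc m) = ≡.cong (1# +_) (natCast-× m)

  natCast-+ : ∀ m n → natCast (m ℕ.+ n) ≈ natCast m + natCast n
  natCast-+ m n rewrite natCast-× (m ℕ.+ n) | natCast-× m | natCast-× n = ×S.×-homo-+ 1# m n

  natCast-* : ∀ m n → natCast (m ℕ.* n) ≈ natCast m * natCast n
  natCast-* m n rewrite natCast-× (m ℕ.* n) | natCast-× m | natCast-× n = ×S.×1-homo-* m n

  intCast-neg : ∀ a → intCast (ℤ.- a) ≈ - intCast a
  intCast-neg (pos zero) = sym -0#≈0#
  intCast-neg (pos (suc n)) = refl
  intCast-neg (neg n) = sym (-‿involutive _)

  cancelˡ : ∀ x y z → (x + y) + - (x + z) ≈ y + - z
  cancelˡ x y z = begin
    (x + y) + - (x + z)     ≈⟨ +-cong (+-comm x y) (sym (-‿+-comm x z)) ⟩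
    (y + x) + (- x + - z)   ≈⟨ +-assoc y x _ ⟩
    y + (x + (- x + - z))   ≈⟨ +-congˡ (sym (+-assoc x (- x) (- z))) ⟩
    y + ((x + - x) + - z)   ≈⟨ +-congˡ (+-congʳ (-‿inverseʳ x)) ⟩
    y + (0# + - z)          ≈⟨ +-congˡ (+-identityˡ _) ⟩
    y + - z                 ∎

  intCast-⊖ : ∀ m n → intCast (m ℤ.⊖ n) ≈ natCast m + - natCast n
  intCast-⊖ m zero = sym (trans (+-congˡ -0#≈0#) (+-identityʳ _))
  intCast-⊖ zero (suc n) = sym (+-identityˡ _)
  intCast-⊖ (suc m) (suc n) rewrite ℤP.[1+m]⊖[1+n]≡m⊖n m n =
    trans (intCast-⊖ m n) (sym (cancelˡ 1# (natCast m) (natCast n)))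

  intCast-+ : ∀ a b → intCast (a ℤ.+ b) ≈ intCast a + intCast b
  intCast-+ (pos m) (pos n) = natCast-+ m n
  intCast-+ (pos m) (neg n) = intCast-⊖ m (suc n)
  intCast-+ (neg m) (pos n) = trans (intCast-⊖ n (suc m)) (+-comm _ _)
  intCast-+ (neg m) (neg n) = begin
    - natCast (suc (suc (m ℕ.+ n)))       ≡⟨ ≡.cong (λ t → - natCast (suc t)) (≡.sym (ℕP.+-suc m n)) ⟩
    - natCast (suc m ℕ.+ suc n)           ≈⟨ -‿cong (natCast-+ (suc m) (suc n)) ⟩
    - (natCast (suc m) + natCast (suc n)) ≈⟨ sym (-‿+-comm _ _) ⟩
    - natCast (suc m) + - natCast (suc n) ∎

  intCast-ℕ* : ∀ m b → intCast (pos m ℤ.* b) ≈ natCast m * intCast b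
  intCast-ℕ* m (pos n) = trans (reflexive (≡.cong intCast (≡.sym (ℤP.pos-* m n)))) (natCast-* m n)
  intCast-ℕ* m (neg n) = begin
    intCast (pos m ℤ.* (neg n))       ≡⟨ ≡.cong intCast (≡.sym (ℤP.neg-distribʳ-* (pos m) (pos (suc n)))) ⟩
    intCast (ℤ.- (pos m ℤ.* pos (suc n)))  ≈⟨ intCast-neg (pos m ℤ.* pos (suc n)) ⟩
    - intCast (pos m ℤ.* pos (suc n))      ≈⟨ -‿cong (intCast-ℕ* m (pos (suc n))) ⟩
    - (natCast m * natCast (suc n))  ≈⟨ -‿distribʳ-* _ _ ⟩
    natCast m * - natCast (suc n)    ∎

  intCast-* : ∀ a b → intCast (a ℤ.* b) ≈ intCast a * intCast b
  intCast-* (pos m) b = intCast-ℕ* m b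
  intCast-* (neg m) b = begin
    intCast ((neg m) ℤ.* b)        ≡⟨ ≡.cong intCast (≡.sym (ℤP.neg-distribˡ-* (pos (suc m)) b)) ⟩
    intCast (ℤ.- (pos (suc m) ℤ.* b))   ≈⟨ intCast-neg (pos (suc m) ℤ.* b) ⟩
    - intCast (pos (suc m) ℤ.* b)       ≈⟨ -‿cong (intCast-ℕ* (suc m) b) ⟩
    - (natCast (suc m) * intCast b) ≈⟨ -‿distribˡ-* _ _ ⟩
    - natCast (suc m) * intCast b   ∎

  intCast-1 : intCast (pos 1) ≈ 1#
  intCast-1 = +-identityʳ 1#

  -- A variant of the integer embedding that sends 1 to 1# definitionally, as the solver needs.
  natC : ℕ → Carrier
  natC 0 = 0#
  natC 1 = 1#
  natC (suc (suc n)) = 1# + natC (suc n)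

  natC≈ : ∀ n → natC n ≈ natCast n
  natC≈ 0 = refl
  natC≈ 1 = sym (+-identityʳ 1#)
  natC≈ (suc (suc n)) = +-congˡ (natC≈ (suc n))

  intC : ℤ → Carrier
  intC (pos n) = natC n
  intC (neg n) = - natC (suc n)

  intC≈ : ∀ a → intC a ≈ intCast a
  intC≈ (pos n) = natC≈ n
  intC≈ (neg n) = -‿cong (natC≈ (suc n))

  acr : AlmostCommutativeRing 0ℓ 0ℓ
  acr = fromCommutativeRing R

  intC-morphism : ℤ.+-*-rawRing -Raw-AlmostCommutative⟶ acr
  intC-morphism = record
    { ⟦_⟧ = intC
    ; +-homo = λ a b → trans (intC≈ (a ℤ.+ b)) (trans (intCast-+ a b) (sym (+-cong (intC≈ a) (intC≈ b))))
    ; *-homo = λ a b → trans (intC≈ (a ℤ.* b)) (trans (intCast-* a b) (sym (*-cong (intC≈ a) (intC≈ b))))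
    ; -‿homo = λ a → trans (intC≈ (ℤ.- a)) (trans (intCast-neg a) (sym (-‿cong (intC≈ a))))
    ; 0-homo = refl
    ; 1-homo = refl
    }

  intC-≟ : ∀ a b → Maybe (intC a ≈ intC b)
  intC-≟ a b with a ℤ.≟ b
  ... | yes eq = just (reflexive (≡.cong intC eq))
  ... | no _ = nothing

  module Solver = Algebra.Solver.Ring ℤ.+-*-rawRing acr intC-morphism intC-≟
  open Solver public using (solve; _:=_; _:+_; _:*_; _:-_; :-_; con)

  x-y≈0⇒x≈y : ∀ {x y} → x + - y ≈ 0# → x ≈ y
  x-y≈0⇒x≈y {x} {y} h = begin
    x               ≈⟨ solve 2 (λ a b → a := (a :+ :- b) :+ b) refl x y ⟩
    (x + - y) + y   ≈⟨ +-congʳ h ⟩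
    0# + y          ≈⟨ +-identityˡ y ⟩
    y               ∎

  x≈y⇒x-y≈0 : ∀ {x y} → x ≈ y → x + - y ≈ 0#
  x≈y⇒x-y≈0 {x} {y} h = trans (+-congʳ h) (-‿inverseʳ y)

  pow-+ : ∀ x m n → pow x (m ℕ.+ n) ≈ pow x m * pow x n
  pow-+ x zero n = sym (*-identityˡ _)
  pow-+ x (suc m) n = trans (*-congˡ (pow-+ x m n)) (sym (*-assoc _ _ _))

  pow-cong : ∀ {x y} n → x ≈ y → pow x n ≈ pow y n
  pow-cong zero h = refl
  pow-cong (suc n) h = *-cong h (pow-cong n h)

  pow-* : ∀ x y n → pow (x * y) n ≈ pow x n * pow y n
  pow-* x y zero = sym (*-identityˡ _)
  pow-* x y (suc n) = begin
    (x * y) * pow (x * y) n          ≈⟨ *-congˡ (pow-* x y n) ⟩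
    (x * y) * (pow x n * pow y n)    ≈⟨ solve 4 (λ a b c d → (a :* b) :* (c :* d) := (a :* c) :* (b :* d)) refl x y (pow x n) (pow y n) ⟩
    (x * pow x n) * (y * pow y n)    ∎

  pow-1 : ∀ n → pow 1# n ≈ 1#
  pow-1 zero = refl
  pow-1 (suc n) = trans (*-identityˡ _) (pow-1 n)

-- Polynomial terms: evaluation, substitution, degree

-- Multivariate integer polynomials, as terms.
data Expr (n : ℕ) : Set where
  con : ℤ → Expr n
  var : Fin n → Expr n
  _⊕_ _⊗_ : Expr n → Expr n → Expr n

infixl 6 _⊕_
infixl 7 _⊗_

⊖_ : ∀ {n} → Expr n → Expr n
⊖ e = con (ℤ.- (pos 1)) ⊗ e

module EvalE (R : CRing) where
  open RingKit R hiding (con)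

  ev : ∀ {n} → Expr n → Vec Carrier n → Carrier
  ev (con c) ρ = intCast c
  ev (var i) ρ = lookup ρ i
  ev (e ⊕ f) ρ = ev e ρ + ev f ρ
  ev (e ⊗ f) ρ = ev e ρ * ev f ρ

  evs : ∀ {n m} → Vec (Expr n) m → Vec Carrier n → Vec Carrier m
  evs es ρ = Vec.map (λ e → ev e ρ) es

  infix 4 _≈ᵥ_
  data _≈ᵥ_ : ∀ {n} → Vec Carrier n → Vec Carrier n → Set where
    [] : [] ≈ᵥ []
    _∷_ : ∀ {n x y} {xs ys : Vec Carrier n} → x ≈ y → xs ≈ᵥ ys → (x ∷ xs) ≈ᵥ (y ∷ ys)

  ≈ᵥ-refl : ∀ {n} {xs : Vec Carrier n} → xs ≈ᵥ xs
  ≈ᵥ-refl {xs = []} = []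
  ≈ᵥ-refl {xs = x ∷ xs} = refl ∷ ≈ᵥ-refl

  ≈ᵥ-sym : ∀ {n} {xs ys : Vec Carrier n} → xs ≈ᵥ ys → ys ≈ᵥ xs
  ≈ᵥ-sym [] = []
  ≈ᵥ-sym (e ∷ es) = sym e ∷ ≈ᵥ-sym es

  ≈ᵥ-trans : ∀ {n} {xs ys zs : Vec Carrier n} → xs ≈ᵥ ys → ys ≈ᵥ zs → xs ≈ᵥ zs
  ≈ᵥ-trans [] [] = []
  ≈ᵥ-trans (e ∷ es) (f ∷ fs) = trans e f ∷ ≈ᵥ-trans es fs

  ≈ᵥ-lookup : ∀ {n} {xs ys : Vec Carrier n} → xs ≈ᵥ ys → ∀ i → lookup xs i ≈ lookup ys i
  ≈ᵥ-lookup (e ∷ es) zero = e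
  ≈ᵥ-lookup (e ∷ es) (suc i) = ≈ᵥ-lookup es i

  ≈ᵥ-from : ∀ {n} {xs ys : Vec Carrier n} → (∀ i → lookup xs i ≈ lookup ys i) → xs ≈ᵥ ys
  ≈ᵥ-from {xs = []} {[]} h = []
  ≈ᵥ-from {xs = _ ∷ _} {_ ∷ _} h = h zero ∷ ≈ᵥ-from (λ i → h (suc i))

  ev-cong : ∀ {n} (e : Expr n) {ρ σ} → ρ ≈ᵥ σ → ev e ρ ≈ ev e σ
  ev-cong (con c) h = refl
  ev-cong (var i) h = ≈ᵥ-lookup h i
  ev-cong (e ⊕ f) h = +-cong (ev-cong e h) (ev-cong f h)
  ev-cong (e ⊗ f) h = *-cong (ev-cong e h) (ev-cong f h)

  ev-⊖ : ∀ {n} (e : Expr n) ρ → ev (⊖ e) ρ ≈ - ev e ρ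
  ev-⊖ e ρ = trans (*-congʳ (-‿cong (+-identityʳ 1#))) (solve 1 (λ a → :- con (pos 1) :* a := :- a) refl (ev e ρ))
    where open RingKit R using (con)

  evs-cong : ∀ {n m} (es : Vec (Expr n) m) {ρ σ} → ρ ≈ᵥ σ → evs es ρ ≈ᵥ evs es σ
  evs-cong [] h = []
  evs-cong (e ∷ es) h = ev-cong e h ∷ evs-cong es h

sub : ∀ {m n} → Expr m → Vec (Expr n) m → Expr n
sub (con c) σ = con c
sub (var i) σ = lookup σ i
sub (e ⊕ f) σ = sub e σ ⊕ sub f σ
sub (e ⊗ f) σ = sub e σ ⊗ sub f σ

wk : ∀ {n} → Expr n → Expr (suc n)
wk (con c) = con c
wk (var i) = var (suc i)
wk (e ⊕ f) = wk e ⊕ wk f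
wk (e ⊗ f) = wk e ⊗ wk f

lookup-map : ∀ {A B : Set} {n} (f : A → B) (xs : Vec A n) i → lookup (Vec.map f xs) i ≡ f (lookup xs i)
lookup-map f (x ∷ xs) zero = ≡.refl
lookup-map f (x ∷ xs) (suc i) = lookup-map f xs i

module EvalE-sub (R : CRing) where
  open EvalE R
  open CommutativeRing R using (Carrier; _+_; _*_)

  ev-sub : ∀ {m n} (e : Expr m) (σ : Vec (Expr n) m) ρ → ev (sub e σ) ρ ≡ ev e (evs σ ρ)
  ev-sub (con c) σ ρ = ≡.refl
  ev-sub (var i) σ ρ = ≡.sym (lookup-map (λ e → ev e ρ) σ i)
  ev-sub (e ⊕ f) σ ρ = ≡.cong₂ _+_ (ev-sub e σ ρ) (ev-sub f σ ρ)
  ev-sub (e ⊗ f) σ ρ = ≡.cong₂ _*_ (ev-sub e σ ρ) (ev-sub f σ ρ)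

  ev-wk : ∀ {n} (e : Expr n) x ρ → ev (wk e) (x ∷ ρ) ≡ ev e ρ
  ev-wk (con c) x ρ = ≡.refl
  ev-wk (var i) x ρ = ≡.refl
  ev-wk (e ⊕ f) x ρ = ≡.cong₂ _+_ (ev-wk e x ρ) (ev-wk f x ρ)
  ev-wk (e ⊗ f) x ρ = ≡.cong₂ _*_ (ev-wk e x ρ) (ev-wk f x ρ)

-- An upper bound for the total degree; cancellation is not taken into account.
deg : ∀ {n} → Expr n → ℕ
deg (con c) = 0
deg (var i) = 1
deg (e ⊕ f) = deg e ℕ.⊔ deg f
deg (e ⊗ f) = deg e ℕ.+ deg f

deg-sub : ∀ {m n} D (e : Expr m) (σ : Vec (Expr n) m) → (∀ i → deg (lookup σ i) ℕ.≤ D) → deg (sub e σ) ℕ.≤ deg e ℕ.* D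
deg-sub D (con c) σ h = ℕ.z≤n
deg-sub D (var i) σ h = ℕP.≤-trans (h i) (ℕP.≤-reflexive (≡.sym (ℕP.*-identityˡ D)))
deg-sub D (e ⊕ f) σ h = ℕP.⊔-lub
  (ℕP.≤-trans (deg-sub D e σ h) (ℕP.*-monoˡ-≤ D (ℕP.m≤m⊔n (deg e) (deg f))))
  (ℕP.≤-trans (deg-sub D f σ h) (ℕP.*-monoˡ-≤ D (ℕP.m≤n⊔m (deg e) (deg f))))
deg-sub D (e ⊗ f) σ h = ℕP.≤-trans (ℕP.+-mono-≤ (deg-sub D e σ h) (deg-sub D f σ h))
  (ℕP.≤-reflexive (≡.sym (ℕP.*-distribʳ-+ D (deg e) (deg f))))

deg-wk : ∀ {n} (e : Expr n) → deg (wk e) ≡ deg e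
deg-wk (con c) = ≡.refl
deg-wk (var i) = ≡.refl
deg-wk (e ⊕ f) = ≡.cong₂ ℕ._⊔_ (deg-wk e) (deg-wk f)
deg-wk (e ⊗ f) = ≡.cong₂ ℕ._+_ (deg-wk e) (deg-wk f)

-- Excluded middle for one proposition, available when the goal is stable under double negation.
¬¬-em : ∀ {ℓ} {A : Set ℓ} → ¬ ¬ Dec A
¬¬-em h = h (no λ a → h (yes a))

cases : ∀ {ℓ} {A : Set ℓ} {B : Set} → (¬ ¬ B → B) → (A → B) → (¬ A → B) → B
cases st f g = st λ k → ¬¬-em λ { (yes a) → k (f a) ; (no na) → k (g na) }

addE : ∀ {n} → List (Expr n) → List (Expr n) → List (Expr n)
addE [] bs = bs
addE (a ∷ as) [] = a ∷ as
addE (a ∷ as) (b ∷ bs) = (a ⊕ b) ∷ addE as bs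

scE : ∀ {n} → Expr n → List (Expr n) → List (Expr n)
scE c = List.map (c ⊗_)

mulE : ∀ {n} → List (Expr n) → List (Expr n) → List (Expr n)
mulE [] bs = []
mulE (a ∷ as) bs = addE (scE a bs) (con (pos 0) ∷ mulE as bs)

-- Coefficients in the first variable, the constant one first. The last ones may be terms with value
-- zero, so the length only bounds the degree from above.
toPoly : ∀ {n} → Expr (suc n) → List (Expr n)
toPoly (con c) = con c ∷ []
toPoly (var zero) = con (pos 0) ∷ con (pos 1) ∷ []
toPoly (var (suc i)) = var i ∷ []
toPoly (e ⊕ f) = addE (toPoly e) (toPoly f)
toPoly (e ⊗ f) = mulE (toPoly e) (toPoly f)

polyE : ∀ {n} → List (Expr n) → Expr (suc n)
polyE [] = con (pos 0)
polyE (c ∷ cs) = wk c ⊕ var zero ⊗ polyE cs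

Deg≤ : ∀ {n} → ℕ → Expr n → Set
Deg≤ d e = deg e ℕ.≤ d

addE-len : ∀ {n} (as bs : List (Expr n)) → length (addE as bs) ≡ length as ℕ.⊔ length bs
addE-len [] bs = ≡.refl
addE-len (a ∷ as) [] = ≡.refl
addE-len (a ∷ as) (b ∷ bs) = ≡.cong suc (addE-len as bs)

scE-len : ∀ {n} (c : Expr n) bs → length (scE c bs) ≡ length bs
scE-len c [] = ≡.refl
scE-len c (b ∷ bs) = ≡.cong suc (scE-len c bs)

mulE-len : ∀ {n} (as bs : List (Expr n)) b → length bs ℕ.≤ suc b → length (mulE as bs) ℕ.≤ length as ℕ.+ b
mulE-len [] bs b h = z≤n
mulE-len (a ∷ as) bs b h = ℕP.≤-trans (ℕP.≤-reflexive (addE-len (scE a bs) _))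
  (ℕP.⊔-lub (ℕP.≤-trans (ℕP.≤-reflexive (scE-len a bs)) (ℕP.≤-trans h (s≤s (ℕP.m≤n+m b _)))) (s≤s (mulE-len as bs b h)))

addE-deg : ∀ {n d} {as bs : List (Expr n)} → All (Deg≤ d) as → All (Deg≤ d) bs → All (Deg≤ d) (addE as bs)
addE-deg [] h = h
addE-deg (x ∷ xs) [] = x ∷ xs
addE-deg (x ∷ xs) (y ∷ ys) = ℕP.⊔-lub x y ∷ addE-deg xs ys

scE-deg : ∀ {n d d'} (c : Expr n) {bs} → deg c ℕ.≤ d → All (Deg≤ d') bs → All (Deg≤ (d ℕ.+ d')) (scE c bs)
scE-deg c h [] = []
scE-deg c h (y ∷ ys) = ℕP.+-mono-≤ h y ∷ scE-deg c h ys

mulE-deg : ∀ {n d d'} {as bs : List (Expr n)} → All (Deg≤ d) as → All (Deg≤ d') bs → All (Deg≤ (d ℕ.+ d')) (mulE as bs)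
mulE-deg [] h = []
mulE-deg (x ∷ xs) h = addE-deg (scE-deg _ x h) (z≤n ∷ mulE-deg xs h)

toPoly-deg : ∀ {n} (e : Expr (suc n)) → All (Deg≤ (deg e)) (toPoly e)
toPoly-deg (con c) = z≤n ∷ []
toPoly-deg (var zero) = z≤n ∷ z≤n ∷ []
toPoly-deg (var (suc i)) = ℕP.≤-refl ∷ []
toPoly-deg (e ⊕ f) = addE-deg (All.map (λ h → ℕP.≤-trans h (ℕP.m≤m⊔n _ _)) (toPoly-deg e))
                              (All.map (λ h → ℕP.≤-trans h (ℕP.m≤n⊔m (deg e) _)) (toPoly-deg f))
toPoly-deg (e ⊗ f) = mulE-deg (toPoly-deg e) (toPoly-deg f)

toPoly-len : ∀ {n} (e : Expr (suc n)) → length (toPoly e) ℕ.≤ suc (deg e)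
toPoly-len (con c) = s≤s z≤n
toPoly-len (var zero) = s≤s (s≤s z≤n)
toPoly-len (var (suc i)) = s≤s z≤n
toPoly-len (e ⊕ f) = ℕP.≤-trans (ℕP.≤-reflexive (addE-len (toPoly e) (toPoly f)))
  (ℕP.⊔-lub (ℕP.≤-trans (toPoly-len e) (s≤s (ℕP.m≤m⊔n _ _))) (ℕP.≤-trans (toPoly-len f) (s≤s (ℕP.m≤n⊔m (deg e) _))))
toPoly-len (e ⊗ f) = ℕP.≤-trans (mulE-len (toPoly e) (toPoly f) (deg f) (toPoly-len f))
  (ℕP.+-monoˡ-≤ (deg f) (toPoly-len e))

-- Polynomials in one variable and vanishing on grids

module Uni (R : CRing) where
  open RingKit R renaming (con to scon)
  open EvalE R
  open EvalE-sub R

  Z : Carrier → Set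
  Z x = x ≈ 0#

  AllZ : List Carrier → Set
  AllZ = All Z

  AllZ⇒0 : ∀ {cs} → AllZ cs → ∀ t → horner cs t ≈ 0#
  AllZ⇒0 [] t = refl
  AllZ⇒0 (z ∷ zs) t = trans (+-cong z (trans (*-congˡ (AllZ⇒0 zs t)) (zeroʳ t))) (+-identityˡ _)

  AllZ-stable : (∀ {x y} → ¬ ¬ (x ≈ y) → x ≈ y) → ∀ cs → ¬ ¬ AllZ cs → AllZ cs
  AllZ-stable st [] h = []
  AllZ-stable st (c ∷ cs) h = st (λ k → h λ { (z ∷ _) → k z }) ∷ AllZ-stable st cs (λ k → h λ { (_ ∷ zs) → k zs })

  horner-cong : ∀ cs {s t} → s ≈ t → horner cs s ≈ horner cs t
  horner-cong [] h = refl
  horner-cong (c ∷ cs) h = +-congˡ (*-cong h (horner-cong cs h))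

  -- Synthetic division: the partial Horner values are the coefficients of the quotient of `x P(x)`
  -- by `x - r`. Adding a constant to `x P(x)` changes only the remainder, so this is also the
  -- quotient of any `a ∷ P`.
  quo : Carrier → List Carrier → List Carrier
  quo r [] = []
  quo r (b ∷ bs) = horner (b ∷ bs) r ∷ quo r bs

  quo-len : ∀ r bs → length (quo r bs) ≡ length bs
  quo-len r [] = ≡.refl
  quo-len r (b ∷ bs) = ≡.cong suc (quo-len r bs)

  quo-id : ∀ r x P → x * horner P x ≈ r * horner P r + (x + - r) * horner (quo r P) x
  quo-id r x [] = solve 2 (λ r x → x :* scon (pos 0) := r :* scon (pos 0) :+ (x :+ :- r) :* scon (pos 0)) refl r x
  quo-id r x (b ∷ bs) = begin
    x * (b + x * horner bs x)
      ≈⟨ *-congˡ (+-congˡ (quo-id r x bs)) ⟩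
    x * (b + (r * horner bs r + (x + - r) * horner (quo r bs) x))
      ≈⟨ solve 5 (λ r x b u v → x :* (b :+ (r :* u :+ (x :+ :- r) :* v)) := r :* (b :+ r :* u) :+ (x :+ :- r) :* ((b :+ r :* u) :+ x :* v)) refl r x b (horner bs r) (horner (quo r bs) x) ⟩
    r * (b + r * horner bs r) + (x + - r) * ((b + r * horner bs r) + x * horner (quo r bs) x) ∎

  -- The passage from `P` to its quotient is unitriangular, so zeros propagate from the top
  -- coefficient down.
  quo-AllZ : ∀ r P → AllZ (quo r P) → AllZ P
  quo-AllZ r [] h = []
  quo-AllZ r (b ∷ bs) (h ∷ hs) = trans (sym (trans (+-congˡ (trans (*-congˡ (AllZ⇒0 ih r)) (zeroʳ r))) (+-identityʳ b))) h ∷ ih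
    where ih = quo-AllZ r bs hs

  Domain : Set
  Domain = ∀ {x y} → x * y ≈ 0# → ¬ (x ≈ 0#) → y ≈ 0#

  Distinct : ∀ {m} → (Fin m → Carrier) → Set
  Distinct f = ∀ i j → f i ≈ f j → i ≡ j

  -- Division by `x - f zero` leaves `quo r P`, one coefficient shorter than `a ∷ P`, which still
  -- vanishes at the remaining points because these differ from `f zero`.
  zeros : Domain → ∀ {m} (f : Fin m → Carrier) → Distinct f → ∀ cs → length cs ℕ.≤ m →
          (∀ i → horner cs (f i) ≈ 0#) → AllZ cs
  zeros dom f df [] l h = []
  zeros dom {suc m} f df (a ∷ P) (s≤s l) h = a≈0 ∷ Pz
    where
    r = f zero
    q0 : ∀ i → horner (quo r P) (f (suc i)) ≈ 0#
    q0 i = dom {f (suc i) + - r} (begin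
      (x + - r) * horner (quo r P) x
        ≈⟨ solve 3 (λ a b c → c := (a :+ (b :+ c)) :+ :- (a :+ b)) refl a (r * horner P r) _ ⟩
      (a + (r * horner P r + (x + - r) * horner (quo r P) x)) + - (a + r * horner P r)
        ≈⟨ +-cong (trans (+-congˡ (sym (quo-id r x P))) (h (suc i))) (trans (-‿cong (h zero)) -0#≈0#) ⟩
      0# + 0# ≈⟨ +-identityˡ 0# ⟩
      0# ∎) (λ e → λsuc (df (suc i) zero (x-y≈0⇒x≈y e)))
      where
      x = f (suc i)
      λsuc : ∀ {k} {i : Fin k} → Fin.suc i ≡ zero → ⊥
      λsuc ()
    df' : Distinct (λ i → f (suc i))
    df' i j e with df (suc i) (suc j) e
    ... | ≡.refl = ≡.refl
    Pz : AllZ P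
    Pz = quo-AllZ r P (zeros dom (λ i → f (suc i)) df' (quo r P) (≡.subst (ℕ._≤ m) (≡.sym (quo-len r P)) l) q0)
    a≈0 : a ≈ 0#
    a≈0 = trans (sym (trans (+-congˡ (trans (*-congˡ (AllZ⇒0 Pz r)) (zeroʳ r))) (+-identityʳ a))) (h zero)

  addL : List Carrier → List Carrier → List Carrier
  addL [] bs = bs
  addL (a ∷ as) [] = a ∷ as
  addL (a ∷ as) (b ∷ bs) = (a + b) ∷ addL as bs

  scL : Carrier → List Carrier → List Carrier
  scL c = List.map (c *_)

  mulL : List Carrier → List Carrier → List Carrier
  mulL [] bs = []
  mulL (a ∷ as) bs = addL (scL a bs) (0# ∷ mulL as bs)

  horner-add : ∀ as bs t → horner (addL as bs) t ≈ horner as t + horner bs t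
  horner-add [] bs t = sym (+-identityˡ _)
  horner-add (a ∷ as) [] t = sym (+-identityʳ _)
  horner-add (a ∷ as) (b ∷ bs) t = trans (+-congˡ (*-congˡ (horner-add as bs t)))
    (solve 5 (λ a b t u v → (a :+ b) :+ t :* (u :+ v) := (a :+ t :* u) :+ (b :+ t :* v)) refl a b t (horner as t) (horner bs t))

  horner-sc : ∀ c bs t → horner (scL c bs) t ≈ c * horner bs t
  horner-sc c [] t = sym (zeroʳ c)
  horner-sc c (b ∷ bs) t = trans (+-congˡ (*-congˡ (horner-sc c bs t)))
    (solve 4 (λ c b t u → c :* b :+ t :* (c :* u) := c :* (b :+ t :* u)) refl c b t (horner bs t))

  horner-mul : ∀ as bs t → horner (mulL as bs) t ≈ horner as t * horner bs t
  horner-mul [] bs t = sym (zeroˡ _)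
  horner-mul (a ∷ as) bs t = begin
    horner (addL (scL a bs) (0# ∷ mulL as bs)) t ≈⟨ horner-add (scL a bs) _ t ⟩
    horner (scL a bs) t + (0# + t * horner (mulL as bs) t) ≈⟨ +-cong (horner-sc a bs t) (+-congˡ (*-congˡ (horner-mul as bs t))) ⟩
    a * horner bs t + (0# + t * (horner as t * horner bs t))
      ≈⟨ solve 4 (λ a t u v → a :* v :+ (scon (pos 0) :+ t :* (u :* v)) := (a :+ t :* u) :* v) refl a t (horner as t) (horner bs t) ⟩
    (a + t * horner as t) * horner bs t ∎

  addL-len : ∀ as bs → length (addL as bs) ≡ length as ℕ.⊔ length bs
  addL-len [] bs = ≡.refl
  addL-len (a ∷ as) [] = ≡.refl
  addL-len (a ∷ as) (b ∷ bs) = ≡.cong suc (addL-len as bs)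

  scL-len : ∀ c bs → length (scL c bs) ≡ length bs
  scL-len c [] = ≡.refl
  scL-len c (b ∷ bs) = ≡.cong suc (scL-len c bs)

  mulL-len : ∀ as bs b → length bs ℕ.≤ suc b → length (mulL as bs) ℕ.≤ length as ℕ.+ b
  mulL-len [] bs b h = z≤n
  mulL-len (a ∷ as) bs b h = ℕP.≤-trans (ℕP.≤-reflexive (addL-len (scL a bs) _))
    (ℕP.⊔-lub (ℕP.≤-trans (ℕP.≤-reflexive (scL-len a bs)) (ℕP.≤-trans h (s≤s (ℕP.m≤n+m b _)))) (s≤s (mulL-len as bs b h)))

  -- Working with functions that agree with some polynomial spares the bookkeeping of coefficients;
  -- the list is opened only where a degree matters.
  PF : (Carrier → Carrier) → Set
  PF φ = Σ (List Carrier) λ cs → ∀ t → φ t ≈ horner cs t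

  pf-con : ∀ c → PF (λ _ → c)
  pf-con c = (c ∷ []) , λ t → sym (trans (+-congˡ (zeroʳ t)) (+-identityʳ c))

  pf-id : PF (λ t → t)
  pf-id = (0# ∷ 1# ∷ []) , λ t → solve 1 (λ t → t := scon (pos 0) :+ t :* (scon (pos 1) :+ t :* scon (pos 0))) refl t

  pf-+ : ∀ {φ ψ} → PF φ → PF ψ → PF (λ t → φ t + ψ t)
  pf-+ (as , h) (bs , k) = addL as bs , λ t → trans (+-cong (h t) (k t)) (sym (horner-add as bs t))

  pf-* : ∀ {φ ψ} → PF φ → PF ψ → PF (λ t → φ t * ψ t)
  pf-* (as , h) (bs , k) = mulL as bs , λ t → trans (*-cong (h t) (k t)) (sym (horner-mul as bs t))

  pf-neg : ∀ {φ} → PF φ → PF (λ t → - φ t)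
  pf-neg {φ} p with pf-* (pf-con (- 1#)) p
  ... | cs , h = cs , λ t → trans (solve 1 (λ a → :- a := (:- scon (pos 1)) :* a) refl (φ t)) (h t)

  pf-pow : ∀ {φ} n → PF φ → PF (λ t → pow (φ t) n)
  pf-pow zero p = pf-con 1#
  pf-pow (suc n) p = pf-* p (pf-pow n p)

  pf-horner : ∀ cs {φ} → PF φ → PF (λ t → horner cs (φ t))
  pf-horner [] p = pf-con 0#
  pf-horner (c ∷ cs) p = pf-+ (pf-con c) (pf-* p (pf-horner cs p))

  pf-cong : ∀ {φ} → PF φ → ∀ {s t} → s ≈ t → φ s ≈ φ t
  pf-cong (cs , h) e = trans (h _) (trans (horner-cong cs e) (sym (h _)))

  pf-comp : ∀ {φ ψ} → PF φ → PF ψ → PF (λ t → φ (ψ t))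
  pf-comp (cs , h) p with pf-horner cs p
  ... | ds , k = ds , λ t → trans (h _) (k t)

  pf-ev : ∀ {n} (e : Expr n) (w : Carrier → Vec Carrier n) → (∀ i → PF (λ t → lookup (w t) i)) → PF (λ t → ev e (w t))
  pf-ev (con c) w h = pf-con _
  pf-ev (var i) w h = h i
  pf-ev (e ⊕ f) w h = pf-+ (pf-ev e w h) (pf-ev f w h)
  pf-ev (e ⊗ f) w h = pf-* (pf-ev e w h) (pf-ev f w h)

  evL : ∀ {n} → List (Expr n) → Vec Carrier n → List Carrier
  evL cs ρ = List.map (λ c → ev c ρ) cs

  -- coefficients are listed from the constant one upwards
  evP : ∀ {n} → List (Expr n) → Carrier → Vec Carrier n → Carrier
  evP cs t ρ = horner (evL cs ρ) t

  evP-add : ∀ {n} (as bs : List (Expr n)) t ρ → evP (addE as bs) t ρ ≈ evP as t ρ + evP bs t ρ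
  evP-add [] bs t ρ = sym (+-identityˡ _)
  evP-add (a ∷ as) [] t ρ = sym (+-identityʳ _)
  evP-add (a ∷ as) (b ∷ bs) t ρ = trans (+-congˡ (*-congˡ (evP-add as bs t ρ)))
    (solve 5 (λ a b t u v → (a :+ b) :+ t :* (u :+ v) := (a :+ t :* u) :+ (b :+ t :* v)) refl (ev a ρ) (ev b ρ) t (evP as t ρ) (evP bs t ρ))

  evP-sc : ∀ {n} (c : Expr n) bs t ρ → evP (scE c bs) t ρ ≈ ev c ρ * evP bs t ρ
  evP-sc c [] t ρ = sym (zeroʳ _)
  evP-sc c (b ∷ bs) t ρ = trans (+-congˡ (*-congˡ (evP-sc c bs t ρ)))
    (solve 4 (λ c b t u → c :* b :+ t :* (c :* u) := c :* (b :+ t :* u)) refl (ev c ρ) (ev b ρ) t (evP bs t ρ))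

  evP-mul : ∀ {n} (as bs : List (Expr n)) t ρ → evP (mulE as bs) t ρ ≈ evP as t ρ * evP bs t ρ
  evP-mul [] bs t ρ = sym (zeroˡ _)
  evP-mul (a ∷ as) bs t ρ = begin
    evP (addE (scE a bs) (con (pos 0) ∷ mulE as bs)) t ρ ≈⟨ evP-add (scE a bs) _ t ρ ⟩
    evP (scE a bs) t ρ + (0# + t * evP (mulE as bs) t ρ) ≈⟨ +-cong (evP-sc a bs t ρ) (+-congˡ (*-congˡ (evP-mul as bs t ρ))) ⟩
    ev a ρ * evP bs t ρ + (0# + t * (evP as t ρ * evP bs t ρ))
      ≈⟨ solve 4 (λ a t u v → a :* v :+ (scon (pos 0) :+ t :* (u :* v)) := (a :+ t :* u) :* v) refl (ev a ρ) t (evP as t ρ) (evP bs t ρ) ⟩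
    (ev a ρ + t * evP as t ρ) * evP bs t ρ ∎

  ev-toPoly : ∀ {n} (e : Expr (suc n)) t ρ → ev e (t ∷ ρ) ≈ evP (toPoly e) t ρ
  ev-toPoly (con c) t ρ = sym (trans (+-congˡ (zeroʳ t)) (+-identityʳ _))
  ev-toPoly (var zero) t ρ = sym (trans (+-identityˡ _) (trans (*-congˡ (trans (+-cong intCast-1 (zeroʳ t)) (+-identityʳ 1#))) (*-identityʳ t)))
  ev-toPoly (var (suc i)) t ρ = sym (trans (+-congˡ (zeroʳ t)) (+-identityʳ _))
  ev-toPoly (e ⊕ f) t ρ = trans (+-cong (ev-toPoly e t ρ) (ev-toPoly f t ρ)) (sym (evP-add (toPoly e) (toPoly f) t ρ))
  ev-toPoly (e ⊗ f) t ρ = trans (*-cong (ev-toPoly e t ρ) (ev-toPoly f t ρ)) (sym (evP-mul (toPoly e) (toPoly f) t ρ))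

  ev-polyE : ∀ {n} (cs : List (Expr n)) t ρ → ev (polyE cs) (t ∷ ρ) ≈ evP cs t ρ
  ev-polyE [] t ρ = refl
  ev-polyE (c ∷ cs) t ρ = +-cong (reflexive (ev-wk c t ρ)) (*-congˡ (ev-polyE cs t ρ))

  Van : ∀ {n} → Expr n → Set
  Van {n} e = ∀ ρ → ev e ρ ≈ 0#

  AllVan⇒evP : ∀ {n} {cs : List (Expr n)} → All Van cs → ∀ t ρ → evP cs t ρ ≈ 0#
  AllVan⇒evP [] t ρ = refl
  AllVan⇒evP (v ∷ vs) t ρ = trans (+-cong (v ρ) (trans (*-congˡ (AllVan⇒evP vs t ρ)) (zeroʳ t))) (+-identityˡ _)

  -- For a fixed grid point in the other variables, the polynomial in the first variable has more
  -- zeros than its degree. Hence each of its coefficients vanishes on the grid of one dimension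
  -- less, and induction applies.
  gridVan : Domain → ∀ {g} (f : Fin g → Carrier) → Distinct f → ∀ {n} (e : Expr n) → deg e ℕ.< g →
            (∀ (a : Vec (Fin g) n) → ev e (Vec.map f a) ≈ 0#) → Van e
  gridVan dom f df {zero} e d h [] = h []
  gridVan dom {g} f df {suc n} e d h (t ∷ ρ) = trans (ev-toPoly e t ρ) (AllVan⇒evP (go (toPoly e) (toPoly-deg e) coefs) t ρ)
    where
    coefs : ∀ a → AllZ (evL (toPoly e) (Vec.map f a))
    coefs a = zeros dom f df _ (ℕP.≤-trans (ℕP.≤-reflexive (len-map (toPoly e))) (ℕP.≤-trans (toPoly-len e) d))
      (λ i → trans (sym (ev-toPoly e (f i) (Vec.map f a))) (h (i ∷ a)))
      where
      len-map : ∀ cs → length (evL cs (Vec.map f a)) ≡ length cs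
      len-map [] = ≡.refl
      len-map (c ∷ cs) = ≡.cong suc (len-map cs)
    go : ∀ cs → All (Deg≤ (deg e)) cs → (∀ a → AllZ (evL cs (Vec.map f a))) → All Van cs
    go [] _ _ = []
    go (c ∷ cs) (dc ∷ dcs) hz = gridVan dom f df c (ℕP.≤-<-trans dc d) (λ a → All.head (hz a)) ∷ go cs dcs (λ a → All.tail (hz a))

-- Infinite integral domains

-- Stability of equality takes the place of decidability. As the conclusions drawn from it are
-- equations, it is enough to have distinct elements under a double negation.
record InfDom : Set₁ where
  field
    ring : CRing
  open CommutativeRing ring using (Carrier; _≈_; _*_; 0#; 1#)
  field
    stable : ∀ {x y} → ¬ ¬ (x ≈ y) → x ≈ y
    domain : Uni.Domain ring
    1≉0 : ¬ (1# ≈ 0#)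
    distinct : ∀ m → ¬ ¬ Σ (Fin m → Carrier) (Uni.Distinct ring)

castℕ : ∀ n → Eval.natCast ℤR n ≡ pos n
castℕ zero = ≡.refl
castℕ (suc n) = ≡.cong (λ t → pos 1 ℤ.+ t) (castℕ n)

castℤ : ∀ c → Eval.intCast ℤR c ≡ c
castℤ (pos n) = castℕ n
castℤ (neg n) = ≡.cong ℤ.-_ (castℕ (suc n))

evℤ : ∀ {n} → Expr n → Vec ℤ n → ℤ
evℤ = EvalE.ev ℤR

ℤ-domain : Uni.Domain ℤR
ℤ-domain {x} h nz with ℤP.i*j≡0⇒i≡0∨j≡0 x h
... | inj₁ e = ⊥-elim (nz e)
... | inj₂ e = e

posFin : ∀ {m} → Fin m → ℤ
posFin i = pos (Fin.toℕ i)

posFin-distinct : ∀ {m} → Uni.Distinct ℤR (posFin {m})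
posFin-distinct i j e = FinP.toℕ-injective (ℤP.+-injective e)

ℤ-stable : ∀ {x y : ℤ} → ¬ ¬ (x ≡ y) → x ≡ y
ℤ-stable {x} {y} h with x ℤ.≟ y
... | yes e = e
... | no n = ⊥-elim (h n)

ℤ-InfDom : InfDom
ℤ-InfDom = record { ring = ℤR ; stable = ℤ-stable ; domain = ℤ-domain ; 1≉0 = λ () ; distinct = λ m k → k (posFin , posFin-distinct) }

module Dom (D : InfDom) where
  open InfDom D public using (stable; domain; 1≉0; distinct)
  open RingKit (InfDom.ring D) public renaming (con to scon)
  open EvalE (InfDom.ring D) public
  open EvalE-sub (InfDom.ring D) public
  open Uni (InfDom.ring D) public

  hornerVan : ∀ cs → (∀ t → horner cs t ≈ 0#) → AllZ cs
  hornerVan cs h = AllZ-stable stable cs λ k → distinct (length cs) λ { (f , df) → k (zeros domain f df cs ℕP.≤-refl (λ i → h (f i))) }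

  -- `t φ(t)` vanishes everywhere, so its coefficients are zero, and these are the coefficients of
  -- `φ` shifted by one place.
  pf-ext0 : ∀ {φ} → PF φ → (∀ t → ¬ (t ≈ 0#) → φ t ≈ 0#) → ∀ t → φ t ≈ 0#
  pf-ext0 {φ} (cs , hφ) h t = trans (hφ t) (AllZ⇒0 (All.tail (hornerVan (0# ∷ cs) van)) t)
    where
    van : ∀ t → horner (0# ∷ cs) t ≈ 0#
    van t = cases {A = t ≈ 0#} stable
      (λ e → trans (+-identityˡ _) (trans (*-congʳ e) (zeroˡ _)))
      (λ ne → trans (+-identityˡ _) (trans (*-congˡ (trans (sym (hφ t)) (h t ne))) (zeroʳ t)))

  pf-≈ : ∀ {φ ψ} → PF φ → (∀ t → ψ t ≈ φ t) → PF ψ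
  pf-≈ (cs , h) e = cs , λ t → trans (e t) (h t)

  pf-div0 : ∀ {φ} → PF φ → φ 0# ≈ 0# → Σ (Carrier → Carrier) λ ψ → PF ψ × (∀ t → φ t ≈ t * ψ t)
  pf-div0 ([] , h) e = (λ _ → 0#) , pf-con 0# , λ t → trans (h t) (sym (zeroʳ t))
  pf-div0 ((a ∷ as) , h) e = horner as , (as , λ t → refl) , λ t → trans (h t) (trans (+-congʳ a0) (+-identityˡ _))
    where
    a0 : a ≈ 0#
    a0 = trans (sym (trans (h 0#) (trans (+-congˡ (zeroˡ _)) (+-identityʳ a)))) e

  pf-extτ : ∀ τ {φ} → PF φ → (∀ t → ¬ (t ≈ τ) → φ t ≈ 0#) → ∀ t → φ t ≈ 0#
  pf-extτ τ {φ} pφ h t = trans (pf-cong pφ (solve 2 (λ t τ → t := (t :+ :- τ) :+ τ) refl t τ))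
    (pf-ext0 (pf-comp pφ (pf-+ pf-id (pf-con τ))) (λ s ne → h (s + τ) λ e → ne (begin
      s ≈⟨ solve 2 (λ s τ → s := (s :+ τ) :+ :- τ) refl s τ ⟩
      (s + τ) + - τ ≈⟨ x≈y⇒x-y≈0 e ⟩
      0# ∎)) (t + - τ))

  -- At t = 0 the product shows that the constant coefficient `b` is zero; then t is divided out of
  -- the second factor and the argument repeated. Comparing leading coefficients instead would
  -- require deciding which one is nonzero.
  pf-dom0 : ∀ {φ} → PF φ → ¬ (φ 0# ≈ 0#) → ∀ bs → (∀ t → φ t * horner bs t ≈ 0#) → AllZ bs
  pf-dom0 pφ n0 [] h = []
  pf-dom0 {φ} pφ n0 (b ∷ bs) h = b0 ∷ pf-dom0 pφ n0 bs (pf-ext0 (pf-* pφ (pf-horner bs pf-id)) λ t nt →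
      domain (begin
        t * (φ t * horner bs t) ≈⟨ solve 3 (λ t a b → t :* (a :* b) := a :* (scon (pos 0) :+ t :* b)) refl t (φ t) (horner bs t) ⟩
        φ t * (0# + t * horner bs t) ≈⟨ *-congˡ (+-congʳ (sym b0)) ⟩
        φ t * (b + t * horner bs t) ≈⟨ h t ⟩
        0# ∎) nt)
    where
    b0 : b ≈ 0#
    b0 = domain (trans (*-congˡ (sym (trans (+-congˡ (zeroˡ _)) (+-identityʳ b)))) (h 0#)) n0

  pf-dom : ∀ {φ ψ} → PF φ → PF ψ → (∀ t → φ t * ψ t ≈ 0#) → ∀ t₀ → ¬ (φ t₀ ≈ 0#) → ∀ t → ψ t ≈ 0#
  pf-dom {φ} {ψ} pφ pψ h t₀ n0 t = begin
      ψ t ≈⟨ pf-cong pψ (solve 2 (λ t a → t := (t :+ :- a) :+ a) refl t t₀) ⟩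
      ψ (s + t₀) ≈⟨ proj₂ pψ' s ⟩
      horner (proj₁ pψ') s ≈⟨ AllZ⇒0 (pf-dom0 pφ' (λ e → n0 (trans (pf-cong pφ (sym (+-identityˡ t₀))) e)) (proj₁ pψ')
            (λ u → trans (*-congˡ (sym (proj₂ pψ' u))) (h (u + t₀)))) s ⟩
      0# ∎
    where
    s = t + - t₀
    pφ' : PF (λ u → φ (u + t₀))
    pφ' = pf-comp pφ (pf-+ pf-id (pf-con t₀))
    pψ' : PF (λ u → ψ (u + t₀))
    pψ' = pf-comp pψ (pf-+ pf-id (pf-con t₀))

  -- Evaluation at 0 kills the lowest coefficient, after which one factor s is cancelled, until only
  -- `h` is left.
  lead-extract : ∀ k h cs → length cs ℕ.≤ k → (∀ s → pow s k * h + horner cs s ≈ 0#) → h ≈ 0#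
  lead-extract zero h [] len f = trans (sym (trans (+-identityʳ _) (*-identityˡ h))) (f 0#)
  lead-extract (suc k) h [] len f = trans (sym (trans (+-identityʳ _) (trans (*-congʳ (pow-1 (suc k))) (*-identityˡ h)))) (f 1#)
  lead-extract (suc k) h (a ∷ cs) (s≤s len) f = lead-extract k h cs len
     (pf-ext0 {λ s → pow s k * h + horner cs s} (pf-+ (pf-* (pf-pow k pf-id) (pf-con h)) (cs , λ t → refl)) λ s ns →
       domain {s} (begin
         s * (pow s k * h + horner cs s) ≈⟨ solve 4 (λ s p h u → s :* (p :* h :+ u) := s :* p :* h :+ (scon (pos 0) :+ s :* u)) refl s (pow s k) h (horner cs s) ⟩
         s * pow s k * h + (0# + s * horner cs s) ≈⟨ +-congˡ (+-congʳ (sym a0)) ⟩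
         s * pow s k * h + (a + s * horner cs s) ≈⟨ f s ⟩
         0# ∎) ns)
    where
    a0 : a ≈ 0#
    a0 = trans (solve 3 (λ a p h → a := (scon (pos 0) :* p) :* h :+ (a :+ scon (pos 0) :* p)) refl a (pow 0# k) h)
           (trans (+-congˡ (+-congˡ (trans (zeroˡ _) (sym (zeroˡ (horner cs 0#)))))) (f 0#))

  -- The constant coefficient is killed by evaluation at 0 and one factor τ is cancelled. This
  -- serves the final step modulo p, where divisibility by a high power of τ meets a fixed degree.
  order-zero : ∀ ℓ ds {M} → length ds ℕ.≤ ℓ → PF M → (∀ τ → horner ds τ ≈ pow τ ℓ * M τ) → AllZ ds
  order-zero ℓ [] len pM h = []
  order-zero (suc ℓ) (d ∷ ds) {M} (s≤s len) pM h = d0 ∷ order-zero ℓ ds len pM λ τ → x-y≈0⇒x≈y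
      (pf-ext0 {λ τ → horner ds τ + - (pow τ ℓ * M τ)} (pf-+ (ds , λ t → refl) (pf-neg (pf-* (pf-pow ℓ pf-id) pM))) (λ s ns → domain {s} (begin
         s * (horner ds s + - (pow s ℓ * M s)) ≈⟨ solve 4 (λ s u p m → s :* (u :+ :- (p :* m)) := (scon (pos 0) :+ s :* u) :+ :- (s :* p :* m)) refl s (horner ds s) (pow s ℓ) (M s) ⟩
         (0# + s * horner ds s) + - (s * pow s ℓ * M s) ≈⟨ +-congʳ (+-congʳ (sym d0)) ⟩
         (d + s * horner ds s) + - (s * pow s ℓ * M s) ≈⟨ x≈y⇒x-y≈0 (h s) ⟩
         0# ∎) ns) τ)
    where
    d0 : d ≈ 0#
    d0 = trans (sym (trans (+-congˡ (zeroˡ _)) (+-identityʳ d))) (trans (h 0#) (trans (*-congʳ (zeroˡ _)) (zeroˡ _)))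

  line : ∀ {n} → Vec Carrier n → Vec Carrier n → Carrier → Vec Carrier n
  line [] [] t = []
  line (a ∷ as) (b ∷ bs) t = (a + t * (b + - a)) ∷ line as bs t

  line-0 : ∀ {n} (a b : Vec Carrier n) → line a b 0# ≈ᵥ a
  line-0 [] [] = []
  line-0 (a ∷ as) (b ∷ bs) = solve 2 (λ a b → a :+ scon (pos 0) :* (b :+ :- a) := a) refl a b ∷ line-0 as bs

  line-1 : ∀ {n} (a b : Vec Carrier n) → line a b 1# ≈ᵥ b
  line-1 [] [] = []
  line-1 (a ∷ as) (b ∷ bs) = solve 2 (λ a b → a :+ scon (pos 1) :* (b :+ :- a) := b) refl a b ∷ line-1 as bs

  pf-line : ∀ {n} (a b : Vec Carrier n) i → PF (λ t → lookup (line a b t) i)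
  pf-line (a ∷ as) (b ∷ bs) zero = pf-+ (pf-con a) (pf-* pf-id (pf-con _))
  pf-line (a ∷ as) (b ∷ bs) (suc i) = pf-line as bs i

  -- On the line from `ρ₀` to `ρ` the claim is about one variable: `G` is nonzero at parameter 0, so
  -- `H` vanishes along the line, in particular at parameter 1.
  expr-dom : ∀ {n} (G H : Expr n) → (∀ ρ → ev G ρ * ev H ρ ≈ 0#) → ∀ ρ₀ → ¬ (ev G ρ₀ ≈ 0#) → Van H
  expr-dom G H h ρ₀ n0 ρ = trans (ev-cong H (≈ᵥ-sym (line-1 ρ₀ ρ)))
    (pf-dom (pf-ev G (line ρ₀ ρ) (pf-line ρ₀ ρ)) (pf-ev H (line ρ₀ ρ) (pf-line ρ₀ ρ)) (λ t → h (line ρ₀ ρ t)) 0#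
       (λ e → n0 (trans (ev-cong G (≈ᵥ-sym (line-0 ρ₀ ρ))) e)) 1#)

  evP-van : ∀ {n} (cs : List (Expr n)) → (∀ t ρ → evP cs t ρ ≈ 0#) → All Van cs
  evP-van cs h = go cs (λ ρ → hornerVan (evL cs ρ) (λ t → h t ρ))
    where
    go : ∀ cs → (∀ ρ → AllZ (evL cs ρ)) → All Van cs
    go [] _ = []
    go (c ∷ cs) h = (λ ρ → All.head (h ρ)) ∷ go cs (λ ρ → All.tail (h ρ))

  toPoly-van : ∀ {n} (e : Expr (suc n)) → Van e → All Van (toPoly e)
  toPoly-van e v = evP-van (toPoly e) (λ t ρ → trans (sym (ev-toPoly e t ρ)) (v (t ∷ ρ)))

  van-stable : ∀ {n} {e : Expr n} → ¬ ¬ Van e → Van e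
  van-stable h ρ = stable λ k → h λ v → k (v ρ)

  NonVan : ∀ {n} → Expr n → Set
  NonVan e = ¬ Van e

  nonvan-* : ∀ {n} (G H : Expr n) → NonVan G → NonVan H → NonVan (G ⊗ H)
  nonvan-* G H ng nh v = ng λ ρ → stable λ k → nh (expr-dom G H v ρ k)

  nonvan-pt : ∀ {n} (e : Expr n) → NonVan e → ¬ ¬ Σ (Vec Carrier n) λ ρ → ¬ (ev e ρ ≈ 0#)
  nonvan-pt e h k = h λ ρ → stable λ n → k (ρ , n)

-- Transfer of identities from the integers

module Hom (R : CRing) where
  open RingKit R hiding (con)
  open EvalE R
  open Uni R using (Van; AllVan⇒evP; ev-toPoly)

  lookup-intCast : ∀ {n} (ρ : Vec ℤ n) i → lookup (Vec.map intCast ρ) i ≈ intCast (lookup ρ i)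
  lookup-intCast ρ i = reflexive (lookup-map intCast ρ i)

  ev-hom : ∀ {n} (e : Expr n) (ρ : Vec ℤ n) → ev e (Vec.map intCast ρ) ≈ intCast (evℤ e ρ)
  ev-hom (con c) ρ = reflexive (≡.cong intCast (≡.sym (castℤ c)))
  ev-hom (var i) ρ = lookup-intCast ρ i
  ev-hom (e ⊕ f) ρ = trans (+-cong (ev-hom e ρ) (ev-hom f ρ)) (sym (intCast-+ (evℤ e ρ) (evℤ f ρ)))
  ev-hom (e ⊗ f) ρ = trans (*-cong (ev-hom e ρ) (ev-hom f ρ)) (sym (intCast-* (evℤ e ρ) (evℤ f ρ)))

  -- Vanishing at all integer points forces all coefficients to be zero, and a zero integer is zero
  -- in every ring. The coefficients are reached one variable at a time.
  transfer : ∀ {n} (e : Expr n) → Uni.Van ℤR e → Van e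
  transfer {zero} e v [] = trans (ev-hom e []) (reflexive (≡.cong intCast (v [])))
  transfer {suc n} e v (t ∷ ρ) = trans (ev-toPoly e t ρ) (AllVan⇒evP (go (toPoly e) (Dom.toPoly-van ℤ-InfDom e v)) t ρ)
    where
    go : ∀ cs → All (Uni.Van ℤR) cs → All Van cs
    go [] [] = []
    go (c ∷ cs) (v ∷ vs) = transfer c v ∷ go cs vs

  transfer≡ : ∀ {n} (e f : Expr n) → (∀ ρ → evℤ e ρ ≡ evℤ f ρ) → ∀ ρ → ev e ρ ≈ ev f ρ
  transfer≡ e f h ρ = x-y≈0⇒x≈y (trans (+-congˡ (sym (ev-⊖ f ρ))) (transfer (e ⊕ ⊖ f) (λ σ →
     ≡.trans (≡.cong₂ ℤ._+_ (h σ) (EvalE.ev-⊖ ℤR f σ)) (ℤP.+-inverseʳ (evℤ f σ))) ρ))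

-- Algebraically closed fields with stable equality

-- Equality in a field is not assumed decidable; with stable equality, classical case distinctions are available for it.
module Stabilise (R : CRing) where
  open CommutativeRing R

  infix 4 _≈'_
  _≈'_ : Carrier → Carrier → Set
  x ≈' y = ¬ ¬ (x ≈ y)

  ret : ∀ {x y} → x ≈ y → x ≈' y
  ret e k = k e

  stR : CRing
  stR = record
    { Carrier = Carrier ; _≈_ = _≈'_ ; _+_ = _+_ ; _*_ = _*_ ; -_ = -_ ; 0# = 0# ; 1# = 1#
    ; isCommutativeRing = record
      { isRing = record
        { +-isAbelianGroup = record
          { isGroup = record
            { isMonoid = record
              { isSemigroup = record
                { isMagma = record
                  { isEquivalence = record { refl = ret refl ; sym = λ e k → e λ e' → k (sym e')
                                           ; trans = λ e f k → e λ e' → f λ f' → k (trans e' f') }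
                  ; ∙-cong = λ e f k → e λ e' → f λ f' → k (+-cong e' f') }
                ; assoc = λ x y z → ret (+-assoc x y z) }
              ; identity = (λ x → ret (+-identityˡ x)) , (λ x → ret (+-identityʳ x)) }
            ; inverse = (λ x → ret (-‿inverseˡ x)) , (λ x → ret (-‿inverseʳ x))
            ; ⁻¹-cong = λ e k → e λ e' → k (-‿cong e') }
          ; comm = λ x y → ret (+-comm x y) }
        ; *-cong = λ e f k → e λ e' → f λ f' → k (*-cong e' f')
        ; *-assoc = λ x y z → ret (*-assoc x y z)
        ; *-identity = (λ x → ret (*-identityˡ x)) , (λ x → ret (*-identityʳ x))
        ; distrib = (λ x y z → ret (distribˡ x y z)) , (λ x y z → ret (distribʳ x y z)) }
      ; *-comm = λ x y → ret (*-comm x y) } }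

  module E = Eval R
  module E' = Eval stR

  natCast≡ : ∀ n → E'.natCast n ≡ E.natCast n
  natCast≡ zero = ≡.refl
  natCast≡ (suc n) = ≡.cong (1# +_) (natCast≡ n)

  intCast≡ : ∀ c → E'.intCast c ≡ E.intCast c
  intCast≡ (pos n) = natCast≡ n
  intCast≡ (neg n) = ≡.cong -_ (natCast≡ (suc n))

  pow≡ : ∀ x n → E'.pow x n ≡ E.pow x n
  pow≡ x zero = ≡.refl
  pow≡ x (suc n) = ≡.cong (x *_) (pow≡ x n)

  horner≡ : ∀ cs x → E'.horner cs x ≡ E.horner cs x
  horner≡ [] x = ≡.refl
  horner≡ (c ∷ cs) x = ≡.cong (λ u → c + x * u) (horner≡ cs x)

record ACF : Set₁ where
  field
    infDom : InfDom
  open Dom infDom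
  field
    inv : ∀ x → ¬ (x ≈ 0#) → ∃ λ y → x * y ≈ 1#
    root : ∀ cs → 1 ℕ.≤ length cs → ∃ λ x → pow x (length cs) + horner cs x ≈ 0#

module FieldACF (K : Field 0ℓ 0ℓ) (ac : AlgClosed K) where
  open Field K using (commRing; 1≉0) renaming (inv to invK)
  open Stabilise commRing using (stR; ret; pow≡; horner≡; intCast≡)
  open RingKit stR renaming (con to scon)
  open Uni stR using (Distinct; Domain; addL; horner-add; addL-len)

  domK : Domain
  domK {x} {y} xy≈0 x≉0 = begin
    y ≈⟨ sym (*-identityˡ y) ⟩
    1# * y ≈⟨ *-congʳ (sym (ret xz≈1)) ⟩
    (x * z) * y ≈⟨ solve 3 (λ x z y → (x :* z) :* y := z :* (x :* y)) refl x z y ⟩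
    z * (x * y) ≈⟨ *-congˡ {z} xy≈0 ⟩
    z * 0# ≈⟨ zeroʳ z ⟩
    0# ∎
    where
    z = proj₁ (invK x λ e → x≉0 (ret e))
    xz≈1 = proj₂ (invK x λ e → x≉0 (ret e))

  1≉0' : ¬ (1# ≈ 0#)
  1≉0' h = h 1≉0

  rootK : ∀ cs → 1 ℕ.≤ length cs → ∃ λ x → pow x (length cs) + horner cs x ≈ 0#
  rootK cs l with ac cs l
  ... | x , e = x , ≡.subst₂ (λ u v → u + v ≈ 0#) (≡.sym (pow≡ x (length cs))) (≡.sym (horner≡ cs x)) (ret e)

  -- Multiplication of a monic polynomial by `t - a`: `cs` holds its coefficients below the leading
  -- one, and `prev` carries the coefficient of the place before.
  go : Carrier → Carrier → List Carrier → List Carrier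
  go prev a [] = (prev + - a) ∷ []
  go prev a (c ∷ cs) = (prev + - (a * c)) ∷ go c a cs

  go-len : ∀ prev a cs → length (go prev a cs) ≡ suc (length cs)
  go-len prev a [] = ≡.refl
  go-len prev a (c ∷ cs) = ≡.cong suc (go-len c a cs)

  go-spec : ∀ prev a cs t → pow t (suc (length cs)) + horner (go prev a cs) t ≈ prev + (t + - a) * (pow t (length cs) + horner cs t)
  go-spec prev a [] t = solve 3 (λ p a t → t :* scon (pos 1) :+ ((p :+ :- a) :+ t :* scon (pos 0)) := p :+ (t :+ :- a) :* (scon (pos 1) :+ scon (pos 0))) refl prev a t
  go-spec prev a (c ∷ cs) t = begin
    t * (t * P) + ((prev + - (a * c)) + t * horner (go c a cs) t)
      ≈⟨ solve 6 (λ t P p a c h → t :* (t :* P) :+ ((p :+ :- (a :* c)) :+ t :* h) := (p :+ :- (a :* c)) :+ t :* (t :* P :+ h)) refl t P prev a c (horner (go c a cs) t) ⟩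
    (prev + - (a * c)) + t * (t * P + horner (go c a cs) t)
      ≈⟨ +-congˡ (*-congˡ (go-spec c a cs t)) ⟩
    (prev + - (a * c)) + t * (c + (t + - a) * (P + horner cs t))
      ≈⟨ solve 6 (λ t P p a c h → (p :+ :- (a :* c)) :+ t :* (c :+ (t :+ :- a) :* (P :+ h)) := p :+ (t :+ :- a) :* (t :* P :+ (c :+ t :* h))) refl t P prev a c (horner cs t) ⟩
    prev + (t + - a) * (t * P + (c + t * horner cs t)) ∎
    where P = pow t (length cs)

  -- The coefficients of the product of all `t - f i`, without the leading 1.
  low : ∀ {m} → (Fin m → Carrier) → List Carrier
  low {zero} f = []
  low {suc m} f = go 0# (f zero) (low (λ i → f (suc i)))

  low-len : ∀ {m} (f : Fin m → Carrier) → length (low f) ≡ m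
  low-len {zero} f = ≡.refl
  low-len {suc m} f = ≡.trans (go-len 0# (f zero) (low (λ i → f (suc i)))) (≡.cong suc (low-len (λ i → f (suc i))))

  low-root : ∀ {m} (f : Fin m → Carrier) i t → t ≈ f i → pow t (length (low f)) + horner (low f) t ≈ 0#
  low-root {suc m} f i t e = trans (≡.subst (λ l → pow t l + horner (low f) t ≈ 0# + (t + - f zero) * Q) (≡.sym (go-len 0# (f zero) L)) (go-spec 0# (f zero) L t))
     (trans (+-identityˡ _) (z i e))
    where
    L = low (λ i → f (suc i))
    Q = pow t (length L) + horner L t
    z : ∀ i → t ≈ f i → (t + - f zero) * Q ≈ 0#
    z zero e = trans (*-congʳ (x≈y⇒x-y≈0 e)) (zeroˡ _)
    z (suc i) e = trans (*-congˡ (low-root (λ i → f (suc i)) i t e)) (zeroʳ _)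

  -- As in Euclid's argument, a root of 1 plus the product of all `t - f i` is different from every
  -- `f i`.
  distinctK : ∀ m → Σ (Fin m → Carrier) Distinct
  distinctK zero = (λ ()) , λ ()
  -- The first element is chosen by hand, since the empty product has degree 0 and offers no root.
  distinctK (suc zero) = (λ _ → 0#) , λ { zero zero _ → ≡.refl }
  distinctK (suc m@(suc _)) with distinctK m
  ... | f , df = g , dg
    where
    L = low f
    L+1 = addL (1# ∷ []) L
    len : length L+1 ≡ length L
    len = ≡.trans (addL-len (1# ∷ []) L) (≡.trans (≡.cong (1 ℕ.⊔_) (low-len f)) (≡.sym (low-len f)))
    rt = rootK L+1 (≡.subst (1 ℕ.≤_) (≡.sym (≡.trans len (low-len f))) (s≤s z≤n))
    x = proj₁ rt
    new : ∀ i → ¬ (x ≈ f i)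
    new i e = 1≉0' (begin
      1# ≈⟨ solve 3 (λ x P h → scon (pos 1) := (P :+ ((scon (pos 1) :+ x :* scon (pos 0)) :+ h)) :+ :- (P :+ h)) refl x (pow x (length L)) (horner L x) ⟩
      (pow x (length L) + ((1# + x * 0#) + horner L x)) + - (pow x (length L) + horner L x)
        ≈⟨ +-cong (trans (+-congˡ (sym (horner-add (1# ∷ []) L x))) (≡.subst (λ l → pow x l + horner L+1 x ≈ 0#) len (proj₂ rt)))
                  (trans (-‿cong (low-root f i x e)) -0#≈0#) ⟩
      0# + 0# ≈⟨ +-identityˡ 0# ⟩
      0# ∎)
    g : Fin (suc m) → Carrier
    g zero = x
    g (suc i) = f i
    dg : Distinct g
    dg zero zero e = ≡.refl
    dg zero (suc j) e = ⊥-elim (new j e)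
    dg (suc i) zero e = ⊥-elim (new i (sym e))
    dg (suc i) (suc j) e = ≡.cong suc (df i j e)

  idom : InfDom
  idom = record { ring = stR ; stable = λ h k → h λ e → e k ; domain = λ {x} {y} → domK {x} {y} ; 1≉0 = 1≉0' ; distinct = λ m k → k (distinctK m) }

  acf : ACF
  acf = record { infDom = idom ; inv = λ x nz → proj₁ (I x nz) , ret (proj₂ (I x nz)) ; root = rootK }
    where
    I : ∀ x → ¬ (x ≈ 0#) → ∃ λ y → Field._≈_ K (Field._*_ K x y) 1#
    I x nz = invK x (λ e → nz (ret e))

  intCast-st : ∀ c → intCast c ≈ 0# → ¬ ¬ Field._≈_ K (Eval.intCast commRing c) 0#
  intCast-st c h = ≡.subst (λ u → u ≈ 0#) (intCast≡ c) h

-- Characteristic p and division by p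

record CharDom (D : InfDom) (p : ℕ) : Set where
  open Dom D
  field
    p≈0 : intCast (pos p) ≈ 0#
    char : ∀ c → intCast c ≈ 0# → ∃ λ c' → c ≡ pos p ℤ.* c'
    p≢0 : ¬ p ≡ 0

intCast-abs : ∀ (R : CRing) c → let open RingKit R in intCast c ≈ 0# → natCast ℤ.∣ c ∣ ≈ 0#
intCast-abs R (pos n) h = h
intCast-abs R (neg n) h = trans (sym (-‿involutive _)) (trans (-‿cong h) -0#≈0#)
  where open RingKit R

-- If p did not divide m, Bézout would write 1 as a combination of p and m, both of which are zero
-- in the domain.
charK : (D : InfDom) (p : ℕ) → Prime p →
        CommutativeRing._≈_ (InfDom.ring D) (Eval.natCast (InfDom.ring D) p) (CommutativeRing.0# (InfDom.ring D)) → CharDom D p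
charK D p pr p0 = record { p≈0 = p0 ; char = ch ; p≢0 = λ { ≡.refl → 0-prime pr } }
  where
  open Dom D
  0-prime : Prime 0 → ⊥
  0-prime ()
  p∣ : ∀ m → natCast m ≈ 0# → p ∣ m
  p∣ m m0 with prime⇒irreducible pr (gcd[m,n]∣m p m)
  ... | inj₂ e = ≡.subst (_∣ m) e (gcd[m,n]∣n p m)
  ... | inj₁ e = ⊥-elim (1≉0 (one (≡.subst (λ g → Bézout.Identity g p m) e (Bézout.identity (gcd-GCD p m)))))
    where
    mul0 : ∀ x y → natCast y ≈ 0# → natCast (x ℕ.* y) ≈ 0#
    mul0 x y y0 = trans (natCast-* x y) (trans (*-congˡ y0) (zeroʳ _))
    fin : ∀ x y u v → natCast u ≈ 0# → natCast v ≈ 0# → 1 ℕ.+ y ℕ.* u ≡ x ℕ.* v → 1# ≈ 0#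
    fin x y u v u0 v0 eq = begin
      1# ≈⟨ sym (+-identityʳ 1#) ⟩
      1# + 0# ≈⟨ +-congˡ (sym (mul0 y u u0)) ⟩
      natCast (1 ℕ.+ y ℕ.* u) ≡⟨ ≡.cong natCast eq ⟩
      natCast (x ℕ.* v) ≈⟨ mul0 x v v0 ⟩
      0# ∎
    one : Bézout.Identity 1 p m → 1# ≈ 0#
    one (Bézout.+- x y eq) = fin x y m p m0 p0 eq
    one (Bézout.-+ x y eq) = fin y x p m p0 m0 eq
  ch : ∀ c → intCast c ≈ 0# → ∃ λ c' → c ≡ pos p ℤ.* c'
  ch c h with p∣ ℤ.∣ c ∣ (intCast-abs (InfDom.ring D) c h)
  ch (pos n) h | divides q eq = pos q , ≡.trans (≡.cong pos (≡.trans eq (ℕP.*-comm q p))) (ℤP.pos-* p q)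
  ch (neg n) h | divides q eq = ℤ.- (pos q) , ≡.trans (≡.cong (λ m → ℤ.- (pos m)) (≡.trans eq (ℕP.*-comm q p)))
     (≡.trans (≡.cong ℤ.-_ (ℤP.pos-* p q)) (ℤP.neg-distribʳ-* (pos p) (pos q)))

module CharP-Div (D : InfDom) (p : ℕ) (cd : CharDom D p) where
  open Dom D
  open CharDom cd
  open Hom (InfDom.ring D)

  -- Over an infinite domain identical vanishing forces every coefficient to be zero there, hence to
  -- be a multiple of p; the quotient is rebuilt variable by variable.
  divide : ∀ {n} (e : Expr n) → Van e → Σ (Expr n) λ e' → ∀ ρ → evℤ e ρ ≡ pos p ℤ.* evℤ e' ρ
  divide {zero} e v with char (evℤ e []) (trans (sym (ev-hom e [])) (v []))
  ... | c , eq = con c , λ { [] → ≡.trans eq (≡.cong (pos p ℤ.*_) (≡.sym (castℤ c))) }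
  divide {suc n} e v = polyE (proj₁ ds) , λ { (t ∷ ρ) → ≡.trans (Uni.ev-toPoly ℤR e t ρ) (≡.trans (proj₂ ds t ρ) (≡.cong (pos p ℤ.*_) (≡.sym (Uni.ev-polyE ℤR (proj₁ ds) t ρ)))) }
    where
    divs : ∀ cs → All Van cs → Σ (List (Expr n)) λ ds → ∀ t ρ → Uni.evP ℤR cs t ρ ≡ pos p ℤ.* Uni.evP ℤR ds t ρ
    divs [] [] = [] , λ t ρ → ≡.sym (ℤP.*-zeroʳ (pos p))
    divs (c ∷ cs) (v ∷ vs) with divide c v | divs cs vs
    ... | d , hd | ds , hds = (d ∷ ds) , λ t ρ → ≡.trans (≡.cong₂ ℤ._+_ (hd ρ) (≡.cong (t ℤ.*_) (hds t ρ)))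
        (RingKit.solve ℤR 4 (λ p d t u → p Z.:* d Z.:+ t Z.:* (p Z.:* u) Z.:= p Z.:* (d Z.:+ t Z.:* u)) ≡.refl (pos p) (evℤ d ρ) t (Uni.evP ℤR ds t ρ))
      where module Z = RingKit ℤR
    ds = divs (toPoly e) (toPoly-van e v)

-- Coefficient arrays and Siegel's lemma

-- Polynomials in M variables with all exponents < L, as nested coefficient vectors.
Cf : ℕ → ℕ → Set
Cf L zero = ℤ
Cf L (suc M) = Vec (Cf L M) L

cfE : ∀ {L} M → Cf L M → Expr M
cfEl : ∀ {L} M {l} → Vec (Cf L M) l → List (Expr M)
cfE zero c = con c
cfE (suc M) v = polyE (cfEl M v)
cfEl M [] = []
cfEl M (c ∷ cs) = cfE M c ∷ cfEl M cs

CfAll : ∀ {L} (P : ℤ → Set) M → Cf L M → Set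
CfAll P zero c = P c
CfAll P (suc M) v = ∀ i → CfAll P M (lookup v i)

CfZ : ∀ {L} M → Cf L M → Set
CfZ = CfAll (_≡ pos 0)

CfB : ∀ {L} → ℕ → ∀ M → Cf L M → Set
CfB X = CfAll (λ c → ∣ c ∣ ℕ.≤ X)

CfZ? : ∀ {L} M (c : Cf L M) → Dec (CfZ M c)
CfZ? zero c = c ℤ.≟ pos 0
CfZ? (suc M) v = FinP.all? (λ i → CfZ? M (lookup v i))

cfEl-len : ∀ {L} M {l} (v : Vec (Cf L M) l) → length (cfEl M v) ≡ l
cfEl-len M [] = ≡.refl
cfEl-len M (c ∷ cs) = ≡.cong suc (cfEl-len M cs)

deg-polyE : ∀ {n} d (cs : List (Expr n)) → All (Deg≤ d) cs → deg (polyE cs) ℕ.≤ d ℕ.+ length cs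
deg-polyE d [] [] = z≤n
deg-polyE d (c ∷ cs) (h ∷ hs) = ℕP.⊔-lub
  (ℕP.≤-trans (ℕP.≤-reflexive (deg-wk c)) (ℕP.≤-trans h (ℕP.m≤m+n d _)))
  (ℕP.≤-trans (s≤s (deg-polyE d cs hs)) (ℕP.≤-reflexive (≡.sym (ℕP.+-suc d (length cs)))))

cfE-deg : ∀ {L} M (c : Cf L M) → deg (cfE M c) ℕ.≤ M ℕ.* L
cfEl-deg : ∀ {L} M {l} (v : Vec (Cf L M) l) → All (Deg≤ (M ℕ.* L)) (cfEl M v)
cfE-deg zero c = z≤n
cfE-deg {L} (suc M) v = ℕP.≤-trans (deg-polyE (M ℕ.* L) (cfEl M v) (cfEl-deg M v))
  (ℕP.≤-reflexive (≡.trans (≡.cong (M ℕ.* L ℕ.+_) (cfEl-len M v)) (ℕP.+-comm (M ℕ.* L) L)))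
cfEl-deg M [] = []
cfEl-deg M (c ∷ cs) = cfE-deg M c ∷ cfEl-deg M cs

Bdd : ∀ {n} → ℕ → Vec ℤ n → Set
Bdd W ρ = ∀ i → ∣ lookup ρ i ∣ ℕ.≤ W

polyE-bd : ∀ {n} B W (cs : List (Expr n)) t ρ → 1 ℕ.≤ W → ∣ t ∣ ℕ.≤ W → All (λ c → ∣ evℤ c ρ ∣ ℕ.≤ B) cs →
           ∣ Uni.evP ℤR cs t ρ ∣ ℕ.≤ B ℕ.* (length cs ℕ.* W ℕ.^ length cs)
polyE-bd B W [] t ρ hW ht [] = z≤n
polyE-bd B W (c ∷ cs) t ρ hW ht (h ∷ hs) = begin
  ∣ evℤ c ρ ℤ.+ t ℤ.* P ∣        ≤⟨ ℤP.∣i+j∣≤∣i∣+∣j∣ (evℤ c ρ) (t ℤ.* P) ⟩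
  ∣ evℤ c ρ ∣ ℕ.+ ∣ t ℤ.* P ∣    ≡⟨ ≡.cong (∣ evℤ c ρ ∣ ℕ.+_) (ℤP.abs-* t P) ⟩
  ∣ evℤ c ρ ∣ ℕ.+ ∣ t ∣ ℕ.* ∣ P ∣ ≤⟨ ℕP.+-mono-≤ (ℕP.≤-trans h (ℕP.≤-trans (ℕP.≤-reflexive (≡.sym (ℕP.*-identityʳ B))) (ℕP.*-monoʳ-≤ B W^≥1)))
                                      (ℕP.*-mono-≤ ht (polyE-bd B W cs t ρ hW ht hs)) ⟩
  B ℕ.* (W ℕ.* w) ℕ.+ W ℕ.* (B ℕ.* (l ℕ.* w)) ≡⟨ solve 4 (λ B W w l → B :* (W :* w) :+ W :* (B :* (l :* w)) := B :* ((con 1 :+ l) :* (W :* w))) ≡.refl B W w l ⟩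
  B ℕ.* (suc l ℕ.* (W ℕ.* w)) ∎
  where
  open ℕP.≤-Reasoning
  open import Data.Nat.Solver using (module +-*-Solver)
  open +-*-Solver
  P = Uni.evP ℤR cs t ρ
  l = length cs
  w = W ℕ.^ l
  W^≥1 : 1 ℕ.≤ W ℕ.* w
  W^≥1 = ℕP.*-mono-≤ hW (ℕP.m^n>0 W ⦃ ℕ.>-nonZero hW ⦄ l)

-- Each variable contributes a factor `L W^L`: there are L summands, and the powers are at most
-- `W^L`.
cfE-bd : ∀ {L} M (c : Cf L M) X W → 1 ℕ.≤ W → CfB X M c → ∀ ρ → Bdd W ρ → ∣ evℤ (cfE M c) ρ ∣ ℕ.≤ X ℕ.* (L ℕ.* W ℕ.^ L) ℕ.^ M
cfEl-bd : ∀ {L} M {l} (v : Vec (Cf L M) l) X W → 1 ℕ.≤ W → (∀ i → CfB X M (lookup v i)) → ∀ ρ → Bdd W ρ →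
          All (λ c → ∣ evℤ c ρ ∣ ℕ.≤ X ℕ.* (L ℕ.* W ℕ.^ L) ℕ.^ M) (cfEl M v)
cfE-bd zero c X W hW hc ρ hρ = ≡.subst₂ ℕ._≤_ (≡.cong ∣_∣ (≡.sym (castℤ c))) (≡.sym (ℕP.*-identityʳ X)) hc
cfE-bd {L} (suc M) v X W hW hc (t ∷ ρ) hρ = begin
  ∣ evℤ (polyE (cfEl M v)) (t ∷ ρ) ∣ ≡⟨ ≡.cong ∣_∣ (Uni.ev-polyE ℤR (cfEl M v) t ρ) ⟩
  ∣ Uni.evP ℤR (cfEl M v) t ρ ∣ ≤⟨ polyE-bd (X ℕ.* Y ℕ.^ M) W (cfEl M v) t ρ hW (hρ zero) (cfEl-bd M v X W hW hc ρ (λ i → hρ (suc i))) ⟩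
  X ℕ.* Y ℕ.^ M ℕ.* (length (cfEl M v) ℕ.* W ℕ.^ length (cfEl M v)) ≡⟨ ≡.cong (λ l → X ℕ.* Y ℕ.^ M ℕ.* (l ℕ.* W ℕ.^ l)) (cfEl-len M v) ⟩
  X ℕ.* Y ℕ.^ M ℕ.* Y ≡⟨ ≡.trans (ℕP.*-assoc X (Y ℕ.^ M) Y) (≡.cong (X ℕ.*_) (ℕP.*-comm (Y ℕ.^ M) Y)) ⟩
  X ℕ.* (Y ℕ.* Y ℕ.^ M) ∎
  where
  open ℕP.≤-Reasoning
  Y = L ℕ.* W ℕ.^ L
cfEl-bd M [] X W hW hc ρ hρ = []
cfEl-bd M (c ∷ cs) X W hW hc ρ hρ = cfE-bd M c X W hW (hc zero) ρ hρ ∷ cfEl-bd M cs X W hW (λ i → hc (suc i)) ρ hρ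

cf-van : ∀ {L} M (c : Cf L M) → Uni.Van ℤR (cfE M c) → CfZ M c
cfl-van : ∀ {L} M {l} (v : Vec (Cf L M) l) → All (Uni.Van ℤR) (cfEl M v) → ∀ i → CfZ M (lookup v i)
cf-van zero c h = ≡.trans (≡.sym (castℤ c)) (h [])
cf-van (suc M) v h = cfl-van M v (Dom.evP-van ℤ-InfDom (cfEl M v) (λ t ρ → ≡.trans (≡.sym (Uni.ev-polyE ℤR (cfEl M v) t ρ)) (h (t ∷ ρ))))
cfl-van M (c ∷ cs) (h ∷ hs) zero = cf-van M c h
cfl-van M (c ∷ cs) (h ∷ hs) (suc i) = cfl-van M cs hs i

cfSub : ∀ {L} M → Cf L M → Cf L M → Cf L M
cfSub zero a b = a ℤ.- b
cfSub (suc M) v w = zipWith (cfSub M) v w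

cfSub-ev : ∀ {L} M (a b : Cf L M) ρ → evℤ (cfE M (cfSub M a b)) ρ ≡ evℤ (cfE M a) ρ ℤ.- evℤ (cfE M b) ρ
cfSub-evl : ∀ {L} M {l} (v w : Vec (Cf L M) l) t ρ → Uni.evP ℤR (cfEl M (zipWith (cfSub M) v w)) t ρ ≡ Uni.evP ℤR (cfEl M v) t ρ ℤ.- Uni.evP ℤR (cfEl M w) t ρ
cfSub-ev zero a b ρ = ≡.trans (castℤ (a ℤ.- b)) (≡.sym (≡.cong₂ ℤ._-_ (castℤ a) (castℤ b)))
cfSub-ev (suc M) v w (t ∷ ρ) = ≡.trans (Uni.ev-polyE ℤR (cfEl M (zipWith (cfSub M) v w)) t ρ) (≡.trans (cfSub-evl M v w t ρ)
  (≡.sym (≡.cong₂ ℤ._-_ (Uni.ev-polyE ℤR (cfEl M v) t ρ) (Uni.ev-polyE ℤR (cfEl M w) t ρ))))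
cfSub-evl M [] [] t ρ = ≡.refl
cfSub-evl M (a ∷ v) (b ∷ w) t ρ = ≡.trans (≡.cong₂ ℤ._+_ (cfSub-ev M a b ρ) (≡.cong (t ℤ.*_) (cfSub-evl M v w t ρ)))
  (solve 5 (λ a b t u v → (a :- b) :+ t :* (u :- v) := (a :+ t :* u) :- (b :+ t :* v)) ≡.refl (evℤ (cfE M a) ρ) (evℤ (cfE M b) ρ) t (Uni.evP ℤR (cfEl M v) t ρ) (Uni.evP ℤR (cfEl M w) t ρ))
  where
  open import Data.Integer.Solver using (module +-*-Solver)
  open +-*-Solver

funToFin-cong : ∀ {m n} (f g : Fin m → Fin n) → (∀ i → f i ≡ g i) → funToFin f ≡ funToFin g
funToFin-cong {zero} f g h = ≡.refl
funToFin-cong {suc m} f g h = ≡.cong₂ combine (h zero) (funToFin-cong (λ i → f (suc i)) (λ i → g (suc i)) (λ i → h (suc i)))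

module Count (L X : ℕ) where
  Cnt : ℕ → ℕ
  Cnt zero = suc X
  Cnt (suc M) = Cnt M ℕ.^ L

  Cnt≡ : ∀ M → Cnt M ≡ suc X ℕ.^ (L ℕ.^ M)
  Cnt≡ zero = ≡.sym (ℕP.*-identityʳ (suc X))
  Cnt≡ (suc M) = ≡.trans (≡.cong (ℕ._^ L) (Cnt≡ M)) (≡.trans (ℕP.^-*-assoc (suc X) (L ℕ.^ M) L) (≡.cong (suc X ℕ.^_) (ℕP.*-comm (L ℕ.^ M) L)))

  -- Only the coefficients 0, ..., X are enumerated, so that differences of two arrays are again
  -- bounded by X.
  dec : ∀ M → Fin (Cnt M) → Cf L M
  dec zero i = posFin i
  dec (suc M) i = tabulate (λ j → dec M (finToFun i j))

  lookup-dec : ∀ M i j → lookup (dec (suc M) i) j ≡ dec M (finToFun i j)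
  lookup-dec M i j = VecP.lookup∘tabulate (λ j → dec M (finToFun i j)) j

  dec-bd : ∀ M i → CfB X M (dec M i)
  dec-bd zero i = ℕP.≤-pred (FinP.toℕ<n i)
  dec-bd (suc M) i j = ≡.subst (CfB X M) (≡.sym (lookup-dec M i j)) (dec-bd M (finToFun i j))

  sub-bd : ∀ M i j → CfB X M (cfSub M (dec M i) (dec M j))
  sub-bd zero i j = ℕP.≤-trans (ℕP.≤-reflexive (≡.cong ∣_∣ (ℤP.m-n≡m⊖n (Fin.toℕ i) (Fin.toℕ j)))) (ℕP.≤-trans (ℤP.∣m⊝n∣≤m⊔n (Fin.toℕ i) (Fin.toℕ j)) (ℕP.⊔-lub (dec-bd zero i) (dec-bd zero j)))
  sub-bd (suc M) i j l = ≡.subst (CfB X M) (≡.sym (≡.trans (VecP.lookup-zipWith (cfSub M) l (dec (suc M) i) (dec (suc M) j)) (≡.cong₂ (cfSub M) (lookup-dec M i l) (lookup-dec M j l))))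
     (sub-bd M (finToFun i l) (finToFun j l))

  dec-inj : ∀ M i j → CfZ M (cfSub M (dec M i) (dec M j)) → i ≡ j
  dec-inj zero i j h = FinP.toℕ-injective (ℤP.+-injective (ℤP.i-j≡0⇒i≡j _ _ h))
  dec-inj (suc M) i j h = ≡.trans (≡.sym (FinP.funToFin-finToFin {L} {Cnt M} i)) (≡.trans
     (funToFin-cong (finToFun i) (finToFun j) (λ l → dec-inj M (finToFun i l) (finToFun j l)
        (≡.subst (CfZ M) (≡.trans (VecP.lookup-zipWith (cfSub M) l (dec (suc M) i) (dec (suc M) j)) (≡.cong₂ (cfSub M) (lookup-dec M i l) (lookup-dec M j l))) (h l))))
     (FinP.funToFin-finToFin {L} {Cnt M} j))

module CountV (E R : ℕ) where
  CntV : ℕ → ℕ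
  CntV zero = R
  CntV (suc N) = CntV N ℕ.^ E

  CntV≡ : ∀ N → CntV N ≡ R ℕ.^ (E ℕ.^ N)
  CntV≡ zero = ≡.sym (ℕP.*-identityʳ R)
  CntV≡ (suc M) = ≡.trans (≡.cong (ℕ._^ E) (CntV≡ M)) (≡.trans (ℕP.^-*-assoc R (E ℕ.^ M) E) (≡.cong (R ℕ.^_) (ℕP.*-comm (E ℕ.^ M) E)))

  enc : ∀ N → (Vec (Fin E) N → Fin R) → Fin (CntV N)
  enc zero h = h []
  enc (suc N) h = funToFin (λ i → enc N (λ v → h (i ∷ v)))

  enc-inj : ∀ N h h' → enc N h ≡ enc N h' → ∀ v → h v ≡ h' v
  enc-inj zero h h' e [] = e
  enc-inj (suc N) h h' e (i ∷ v) = enc-inj N (λ v → h (i ∷ v)) (λ v → h' (i ∷ v))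
    (≡.trans (≡.sym (FinP.finToFun-funToFin (λ i → enc N (λ v → h (i ∷ v))) i)) (≡.trans (≡.cong (λ c → finToFun c i) e) (FinP.finToFun-funToFin (λ i → enc N (λ v → h' (i ∷ v))) i))) v

^-distrib : ∀ a b n → (a ℕ.* b) ℕ.^ n ≡ a ℕ.^ n ℕ.* b ℕ.^ n
^-distrib a b zero = ≡.refl
^-distrib a b (suc n) = ≡.trans (≡.cong (a ℕ.* b ℕ.*_) (^-distrib a b n))
  (solve 4 (λ a b c d → (a :* b) :* (c :* d) := (a :* c) :* (b :* d)) ≡.refl a b (a ℕ.^ n) (b ℕ.^ n))
  where
  open import Data.Nat.Solver using (module +-*-Solver)
  open +-*-Solver

pos∣∣ : ∀ M z → ∣ z ∣ ℕ.≤ M → pos ∣ z ℤ.+ pos M ∣ ≡ z ℤ.+ pos M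
pos∣∣ M (pos n) h = ≡.refl
pos∣∣ M (neg n) h = ≡.trans (≡.cong (λ u → pos ∣ u ∣) (ℤP.⊖-≥ h)) (≡.sym (ℤP.⊖-≥ h))

bucket : ∀ M z → ∣ z ∣ ℕ.≤ M → Fin (suc (M ℕ.+ M))
bucket M z h = fromℕ< {∣ z ℤ.+ pos M ∣} (s≤s (ℕP.≤-trans (ℤP.∣i+j∣≤∣i∣+∣j∣ z (pos M)) (ℕP.+-monoˡ-≤ M h)))

bucket-inj : ∀ M z h z' h' → bucket M z h ≡ bucket M z' h' → z ≡ z'
bucket-inj M z h z' h' e = ∙-cancel (≡.trans (≡.sym (pos∣∣ M z h)) (≡.trans (≡.cong pos (FinP.fromℕ<-injective _ _ _ _ e)) (pos∣∣ M z' h')))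
  where
  ∙-cancel : z ℤ.+ pos M ≡ z' ℤ.+ pos M → z ≡ z'
  ∙-cancel e = ≡.trans (sh z) (≡.trans (≡.cong (ℤ._- pos M) e) (≡.sym (sh z')))
    where
    open import Data.Integer.Solver using (module +-*-Solver)
    open +-*-Solver
    sh : ∀ u → u ≡ (u ℤ.+ pos M) ℤ.- pos M
    sh u = solve 2 (λ u m → u := (u :+ m) :- m) ≡.refl u (pos M)

posFin-Bdd : ∀ {E n} (a : Vec (Fin E) n) → Bdd E (Vec.map posFin a)
posFin-Bdd a i = ≡.subst (λ z → ∣ z ∣ ℕ.≤ _) (≡.sym (lookup-map posFin a i)) (ℕP.<⇒≤ (FinP.toℕ<n (lookup a i)))

-- Pigeonhole (Siegel's lemma) on the values at a grid: N + 1 polynomials in N variables are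
-- algebraically dependent, with small coefficients.
module Perron (N Δ : ℕ) where
  -- After substitution the degree is at most `(N + 1) L Δ`, which is below `E`, so the values at
  -- `E^N` points decide everything. The number of coefficients is `L^(N+1) = 2 E^N`, twice the
  -- number of conditions.
  D L E : ℕ
  D = suc (suc N) ℕ.* Δ
  L = 2 ℕ.* D ℕ.^ N
  E = D ℕ.* L

  Y : ℕ → ℕ
  Y W = (L ℕ.* W ℕ.^ L) ℕ.^ suc N

  module _ (1≤Δ : 1 ℕ.≤ Δ) where
    D≥1 : 1 ℕ.≤ D
    D≥1 = ℕP.*-mono-≤ (s≤s {n = suc N} z≤n) 1≤Δ

    D^≥1 : ∀ n → 1 ℕ.≤ D ℕ.^ n
    D^≥1 n = ℕP.m^n>0 D ⦃ ℕ.>-nonZero D≥1 ⦄ n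

    L≥1 : 1 ℕ.≤ L
    L≥1 = ℕP.*-mono-≤ (s≤s {n = 1} z≤n) (D^≥1 N)

    E≥1 : 1 ℕ.≤ E
    E≥1 = ℕP.*-mono-≤ D≥1 L≥1

    Y≥1 : ∀ W → 1 ℕ.≤ W → 1 ℕ.≤ Y W
    Y≥1 W hW = ℕP.m^n>0 (L ℕ.* W ℕ.^ L) ⦃ ℕ.>-nonZero (ℕP.*-mono-≤ L≥1 (ℕP.m^n>0 W ⦃ ℕ.>-nonZero hW ⦄ L)) ⦄ (suc N)

    L^≡ : L ℕ.^ suc N ≡ 2 ℕ.* E ℕ.^ N
    L^≡ = ≡.trans (ℕP.*-assoc 2 (D ℕ.^ N) (L ℕ.^ N)) (≡.cong (2 ℕ.*_) (≡.sym (^-distrib D L N)))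

    deg<E : (suc N ℕ.* L) ℕ.* Δ ℕ.< E
    deg<E = ℕP.≤-trans (ℕP.+-monoˡ-≤ _ (ℕP.*-mono-≤ 1≤Δ L≥1)) (ℕP.≤-reflexive (solve 3 (λ n L d → d :* L :+ (con 1 :+ n) :* L :* d := (con 2 :+ n) :* d :* L) ≡.refl N L Δ))
      where
      open import Data.Nat.Solver using (module +-*-Solver)
      open +-*-Solver

    perron : ∀ W → 1 ℕ.≤ W → (g : Vec (Expr N) (suc N)) → (∀ i → deg (lookup g i) ℕ.≤ Δ) →
             (∀ (a : Vec (Fin E) N) i → ∣ evℤ (lookup g i) (Vec.map posFin a) ∣ ℕ.≤ W) →
             Σ (Cf L (suc N)) λ c → ¬ CfZ (suc N) c × CfB (2 ℕ.* Y W) (suc N) c × (∀ ρ → evℤ (cfE (suc N) c) (EvalE.evs ℤR g ρ) ≡ pos 0)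
    perron W hW g hdeg hval = c , nz , CountX.sub-bd (suc N) i j , van
      where
      -- With X = 2Y a value lies among 2XY + (2XY + 1) - 2XY + 2XY - 2XY = 2XY + 1 nonnegative or,
      -- with signs, 2M + 1 = 4Y² + 1 integers, fewer than (X + 1)²; the surplus factor 2 in the
      -- number of coefficients turns this into a collision.
      X = 2 ℕ.* Y W
      module CountX = Count L X
      open CountX
      M = X ℕ.* Y W
      open CountV E (suc (M ℕ.+ M))
      pt : Vec (Fin E) N → Vec ℤ (suc N)
      pt a = EvalE.evs ℤR g (Vec.map posFin a)
      ptB : ∀ a → Bdd W (pt a)
      ptB a i = ≡.subst (λ z → ∣ z ∣ ℕ.≤ W) (≡.sym (lookup-map (λ e → evℤ e (Vec.map posFin a)) g i)) (hval a i)
      val : Fin (Cnt (suc N)) → Vec (Fin E) N → ℤ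
      val i a = evℤ (cfE (suc N) (dec (suc N) i)) (pt a)
      val-bd : ∀ i a → ∣ val i a ∣ ℕ.≤ M
      val-bd i a = cfE-bd (suc N) (dec (suc N) i) X W hW (dec-bd (suc N) i) (pt a) (ptB a)
      code : Fin (Cnt (suc N)) → Fin (CntV N)
      code i = enc N (λ a → bucket M (val i a) (val-bd i a))
      count : CntV N ℕ.< Cnt (suc N)
      count = begin-strict
        CntV N ≡⟨ CntV≡ N ⟩
        suc (M ℕ.+ M) ℕ.^ (E ℕ.^ N) <⟨ ℕP.^-monoˡ-< (E ℕ.^ N) ⦃ ℕ.>-nonZero (ℕP.m^n>0 E ⦃ ℕ.>-nonZero E≥1 ⦄ N) ⦄ lt ⟩
        (suc X ℕ.^ 2) ℕ.^ (E ℕ.^ N) ≡⟨ ℕP.^-*-assoc (suc X) 2 (E ℕ.^ N) ⟩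
        suc X ℕ.^ (2 ℕ.* E ℕ.^ N) ≡⟨ ≡.cong (suc X ℕ.^_) (≡.sym L^≡) ⟩
        suc X ℕ.^ (L ℕ.^ suc N) ≡⟨ ≡.sym (Cnt≡ (suc N)) ⟩
        Cnt (suc N) ∎
        where
        open ℕP.≤-Reasoning
        open import Data.Nat.Solver using (module +-*-Solver)
        open +-*-Solver
        lt : suc (M ℕ.+ M) ℕ.< suc X ℕ.^ 2
        lt = ℕP.≤-trans (ℕP.≤-trans (ℕP.≤-reflexive (≡.cong suc (ℕP.+-comm 1 (M ℕ.+ M))))
               (s≤s (ℕP.+-monoʳ-≤ (M ℕ.+ M) (ℕP.≤-trans (Y≥1 W hW) (ℕP.m≤n*m (Y W) 4)))))
             (ℕP.≤-reflexive (solve 1 (λ y → con 1 :+ ((con 2 :* y :* y :+ con 2 :* y :* y) :+ con 4 :* y) := (con 1 :+ con 2 :* y) :* ((con 1 :+ con 2 :* y) :* con 1)) ≡.refl (Y W)))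
      ph = FinP.pigeonhole count code
      i = proj₁ ph
      j = proj₁ (proj₂ ph)
      i<j = proj₁ (proj₂ (proj₂ ph))
      ceq = proj₂ (proj₂ (proj₂ ph))
      c = cfSub (suc N) (dec (suc N) i) (dec (suc N) j)
      nz : ¬ CfZ (suc N) c
      nz z = FinP.<⇒≢ i<j (dec-inj (suc N) i j z)
      vals : ∀ a → val i a ≡ val j a
      vals a = bucket-inj M _ (val-bd i a) _ (val-bd j a) (enc-inj N (λ a → bucket M (val i a) (val-bd i a)) (λ a → bucket M (val j a) (val-bd j a)) ceq a)
      Q : Expr N
      Q = sub (cfE (suc N) c) g
      evQ : ∀ ρ → evℤ Q ρ ≡ evℤ (cfE (suc N) c) (EvalE.evs ℤR g ρ)
      evQ ρ = EvalE-sub.ev-sub ℤR (cfE (suc N) c) g ρ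
      degQ : deg Q ℕ.< E
      degQ = ℕP.≤-<-trans (ℕP.≤-trans (deg-sub Δ (cfE (suc N) c) g hdeg) (ℕP.*-monoˡ-≤ Δ (cfE-deg (suc N) c))) deg<E
      van : ∀ ρ → evℤ (cfE (suc N) c) (EvalE.evs ℤR g ρ) ≡ pos 0
      van ρ = ≡.trans (≡.sym (evQ ρ)) (Uni.gridVan ℤR ℤ-domain posFin posFin-distinct Q degQ (λ a → ≡.trans (evQ (Vec.map posFin a))
        (≡.trans (cfSub-ev (suc N) (dec (suc N) i) (dec (suc N) j) (pt a)) (ℤP.i≡j⇒i-j≡0 (vals a)))) ρ)

-- Pseudo-division

module ZK = RingKit ℤR

infix 4 _≗ₑ_
_≗ₑ_ : ∀ {n} → Expr n → Expr n → Set
e ≗ₑ f = ∀ ρ → evℤ e ρ ≡ evℤ f ρ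

powE : ∀ {n} → Expr n → ℕ → Expr n
powE e zero = con (pos 1)
powE e (suc k) = e ⊗ powE e k

ev-powE : ∀ {n} (e : Expr n) k ρ → evℤ (powE e k) ρ ≡ ZK.pow (evℤ e ρ) k
ev-powE e zero ρ = ≡.refl
ev-powE e (suc k) ρ = ≡.cong (evℤ e ρ ℤ.*_) (ev-powE e k ρ)

splitLast : ∀ {A : Set} {m} → Vec A (suc m) → Vec A m × A
splitLast (x ∷ []) = [] , x
splitLast (x ∷ y ∷ ys) = (x ∷ proj₁ (splitLast (y ∷ ys))) , proj₂ (splitLast (y ∷ ys))

-- Pseudo-division of A by p' + β T^m.
pdiv : ∀ {n m} (p : Vec (Expr n) m) (β : Expr n) k → Vec (Expr n) (k ℕ.+ m) → ℕ × Vec (Expr n) k × Vec (Expr n) m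
pdiv p β zero A = 0 , [] , A
pdiv p β (suc k) (a ∷ A) with pdiv p β k A
... | e , Θ , r with splitLast ((powE β e ⊗ a) ∷ r)
-- `β^e a + T r` has degree at most m: `l` is its coefficient of T^m and `i` the rest. Multiplying
-- by β and subtracting l times the divisor cancels T^m.
... | i , l = suc e , (l ∷ Vec.map (β ⊗_) Θ) , Vec.zipWith (λ u v → β ⊗ u ⊕ (⊖ l) ⊗ v) i p

module VecPoly (R : CRing) where
  open RingKit R renaming (con to scon)
  open EvalE R
  open Uni R

  evV : ∀ {n m} → Vec (Expr n) m → Carrier → Vec Carrier n → Carrier
  evV v t ρ = evP (Vec.toList v) t ρ

  evV-split : ∀ {n m} (v : Vec (Expr n) (suc m)) t ρ → evV v t ρ ≈ evV (proj₁ (splitLast v)) t ρ + ev (proj₂ (splitLast v)) ρ * pow t m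
  evV-split (x ∷ []) t ρ = solve 2 (λ x t → x :+ t :* scon (pos 0) := scon (pos 0) :+ x :* scon (pos 1)) refl (ev x ρ) t
  evV-split {m = suc m} (x ∷ y ∷ ys) t ρ = trans (+-congˡ (*-congˡ (evV-split (y ∷ ys) t ρ)))
    (solve 5 (λ x t u l w → x :+ t :* (u :+ l :* w) := (x :+ t :* u) :+ l :* (t :* w)) refl (ev x ρ) t (evV (proj₁ (splitLast (y ∷ ys))) t ρ) (ev (proj₂ (splitLast (y ∷ ys))) ρ) (pow t m))

  evV-sc : ∀ {n m} (c : Expr n) (v : Vec (Expr n) m) t ρ → evV (Vec.map (c ⊗_) v) t ρ ≈ ev c ρ * evV v t ρ
  evV-sc c [] t ρ = sym (zeroʳ _)
  evV-sc c (b ∷ bs) t ρ = trans (+-congˡ (*-congˡ (evV-sc c bs t ρ)))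
    (solve 4 (λ c b t u → c :* b :+ t :* (c :* u) := c :* (b :+ t :* u)) refl (ev c ρ) (ev b ρ) t (evV bs t ρ))

  evV-zip : ∀ {n m} (β l : Expr n) (i p : Vec (Expr n) m) t ρ →
            evV (Vec.zipWith (λ u v → β ⊗ u ⊕ (⊖ l) ⊗ v) i p) t ρ ≈ ev β ρ * evV i t ρ + - (ev l ρ * evV p t ρ)
  evV-zip β l [] [] t ρ = solve 2 (λ b l → scon (pos 0) := b :* scon (pos 0) :+ :- (l :* scon (pos 0))) refl (ev β ρ) (ev l ρ)
  evV-zip β l (u ∷ i) (v ∷ p) t ρ = trans (+-cong (+-congˡ (*-congʳ (ev-⊖ l ρ))) (*-congˡ (evV-zip β l i p t ρ)))
    (solve 7 (λ b l u v t x y → (b :* u :+ (:- l) :* v) :+ t :* (b :* x :+ :- (l :* y)) := b :* (u :+ t :* x) :+ :- (l :* (v :+ t :* y))) refl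
      (ev β ρ) (ev l ρ) (ev u ρ) (ev v ρ) t (evV i t ρ) (evV p t ρ))

  ev-powE' : ∀ {n} (e : Expr n) k ρ → ev (powE e k) ρ ≈ pow (ev e ρ) k
  ev-powE' e zero ρ = intCast-1
  ev-powE' e (suc k) ρ = *-congˡ (ev-powE' e k ρ)

  pdiv-ev : ∀ {n m} (p : Vec (Expr n) m) (β : Expr n) k (A : Vec (Expr n) (k ℕ.+ m)) t ρ →
            let e , Θ , r = pdiv p β k A in
            pow (ev β ρ) e * evV A t ρ ≈ (evV p t ρ + ev β ρ * pow t m) * evV Θ t ρ + evV r t ρ
  pdiv-ev p β zero A t ρ = solve 3 (λ a u v → scon (pos 1) :* a := (u :+ v) :* scon (pos 0) :+ a) refl (evV A t ρ) (evV p t ρ) _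
  pdiv-ev {m = m} p β (suc k) (a ∷ A) t ρ with pdiv p β k A | pdiv-ev p β k A t ρ
  ... | e , Θ , r | ih = begin
    (b * be) * (a' + t * evV A t ρ)
      ≈⟨ solve 5 (λ b be a t A → (b :* be) :* (a :+ t :* A) := b :* (be :* a :+ t :* (be :* A))) refl b be a' t (evV A t ρ) ⟩
    b * (be * a' + t * (be * evV A t ρ))
      ≈⟨ *-congˡ (+-cong (*-congʳ (sym (ev-powE' β e ρ))) (*-congˡ ih)) ⟩
    b * (ev (powE β e) ρ * a' + t * ((P + b * tm) * evV Θ t ρ + evV r t ρ))
      ≈⟨ solve 6 (λ b x t F Θ r → b :* (x :+ t :* (F :* Θ :+ r)) := b :* (t :* (F :* Θ)) :+ b :* (x :+ t :* r)) refl b (ev (powE β e) ρ * a') t (P + b * tm) (evV Θ t ρ) (evV r t ρ) ⟩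
    b * (t * ((P + b * tm) * evV Θ t ρ)) + b * evV v t ρ
      ≈⟨ +-congˡ (*-congˡ (evV-split v t ρ)) ⟩
    b * (t * ((P + b * tm) * evV Θ t ρ)) + b * (evV i t ρ + ev l ρ * tm)
      ≈⟨ solve 7 (λ b t P tm Θ i l → b :* (t :* ((P :+ b :* tm) :* Θ)) :+ b :* (i :+ l :* tm) := (P :+ b :* tm) :* (l :+ t :* (b :* Θ)) :+ (b :* i :+ :- (l :* P))) refl b t P tm (evV Θ t ρ) (evV i t ρ) (ev l ρ) ⟩
    (P + b * tm) * (ev l ρ + t * (b * evV Θ t ρ)) + (b * evV i t ρ + - (ev l ρ * P))
      ≈⟨ +-cong (*-congˡ (+-congˡ (*-congˡ (sym (evV-sc β Θ t ρ))))) (sym (evV-zip β l i p t ρ)) ⟩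
    (P + b * tm) * (ev l ρ + t * evV (Vec.map (β ⊗_) Θ) t ρ) + evV (Vec.zipWith (λ u v → β ⊗ u ⊕ (⊖ l) ⊗ v) i p) t ρ ∎
    where
    v = (powE β e ⊗ a) ∷ r
    i = proj₁ (splitLast v)
    l = proj₂ (splitLast v)
    b = ev β ρ
    be = pow b e
    a' = ev a ρ
    P = evV p t ρ
    tm = pow t m

-- Radicals and ideals of integer polynomials

-- The radical (up to nonzero integer factors) of the ideal generated by S, presented by closure rules.
data Rad {n} (S : Expr n → Set) : Expr n → Set where
  gen : ∀ {f} → S f → Rad S f
  zer : Rad S (con (pos 0))
  add : ∀ {g h} → Rad S g → Rad S h → Rad S (g ⊕ h)
  mul : ∀ h {g} → Rad S g → Rad S (h ⊗ g)
  ext : ∀ {g h} → Rad S g → g ≗ₑ h → Rad S h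
  sqr : ∀ {g} → Rad S (g ⊗ g) → Rad S g
  tor : ∀ {c g} → ¬ c ≡ pos 0 → Rad S (con c ⊗ g) → Rad S g

data Idl {n} (S : Expr n → Set) : Expr n → Set where
  gen : ∀ {f} → S f → Idl S f
  zer : Idl S (con (pos 0))
  add : ∀ {g h} → Idl S g → Idl S h → Idl S (g ⊕ h)
  mul : ∀ h {g} → Idl S g → Idl S (h ⊗ g)
  ext : ∀ {g h} → Idl S g → g ≗ₑ h → Idl S h

module _ {n : ℕ} {S : Expr n → Set} where
  rad-mono : ∀ {T : Expr n → Set} {h} → (∀ {f} → S f → Rad T f) → Rad S h → Rad T h
  rad-mono m (gen s) = m s
  rad-mono m zer = zer
  rad-mono m (add r s) = add (rad-mono m r) (rad-mono m s)
  rad-mono m (mul h r) = mul h (rad-mono m r)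
  rad-mono m (ext r e) = ext (rad-mono m r) e
  rad-mono m (sqr r) = sqr (rad-mono m r)
  rad-mono m (tor c r) = tor c (rad-mono m r)

  -- Multiplication by `g` passes through every closure rule; under `sqr` it is applied twice, so
  -- that `g² x²` is again a square.
  rad-case : ∀ {ℓ g x} → Rad (λ f → f ≡ ℓ ⊎ S f) x → Rad S (g ⊗ ℓ) → Rad S (g ⊗ x)
  rad-case (gen (inj₁ ≡.refl)) h = h
  rad-case {g = g} (gen (inj₂ s)) h = mul g (gen s)
  rad-case {g = g} zer h = mul g zer
  rad-case {g = g} (add {a} {b} r s) h = ext (add (rad-case r h) (rad-case s h)) λ ρ → ≡.sym (ℤP.*-distribˡ-+ (evℤ g ρ) (evℤ a ρ) (evℤ b ρ))
  rad-case {g = g} (mul k {a} r) h = ext (mul k (rad-case r h)) λ ρ → ZK.solve 3 (λ k g a → k ZK.:* (g ZK.:* a) ZK.:= g ZK.:* (k ZK.:* a)) ≡.refl (evℤ k ρ) (evℤ g ρ) (evℤ a ρ)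
  rad-case {g = g} (ext r e) h = ext (rad-case r h) λ ρ → ≡.cong (evℤ g ρ ℤ.*_) (e ρ)
  rad-case {g = g} {x} (sqr r) h = sqr (ext (mul g (rad-case r h)) λ ρ → ZK.solve 2 (λ g a → g ZK.:* (g ZK.:* (a ZK.:* a)) ZK.:= (g ZK.:* a) ZK.:* (g ZK.:* a)) ≡.refl (evℤ g ρ) (evℤ x ρ))
  rad-case {g = g} {x} (tor {c} nz r) h = tor nz (ext (rad-case r h) λ ρ → ZK.solve 3 (λ g c a → g ZK.:* (c ZK.:* a) ZK.:= c ZK.:* (g ZK.:* a)) ≡.refl (evℤ g ρ) (ZK.intCast c) (evℤ x ρ))

  -- Replaces the case distinction between ℓ = 0 and ℓ ≠ 0: the two premises treat the two cases,
  -- and together they put `g²` into the radical.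
  rad-split : ∀ {ℓ g} → Rad (λ f → f ≡ ℓ ⊎ S f) g → Rad S (g ⊗ ℓ) → Rad S g
  rad-split r h = sqr (rad-case r h)

  -- The product of x^(k+2) and x^k is the square of x^(k+1), so the exponent can be lowered by one.
  rad-pow : ∀ k {x} → Rad S (powE x (suc k)) → Rad S x
  rad-pow zero {x} r = ext r λ ρ → ℤP.*-identityʳ (evℤ x ρ)
  rad-pow (suc k) {x} r = rad-pow k (sqr (ext (mul (powE x k) r) λ ρ → ZK.solve 2 (λ x p → p ZK.:* (x ZK.:* (x ZK.:* p)) ZK.:= (x ZK.:* p) ZK.:* (x ZK.:* p)) ≡.refl (evℤ x ρ) (evℤ (powE x k) ρ)))

pow-≢0 : ∀ c k → ¬ c ≡ pos 0 → ¬ ZK.pow c k ≡ pos 0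
pow-≢0 c zero nz ()
pow-≢0 c (suc k) nz h = pow-≢0 c k nz (ℤ-domain h nz)

rad-ideal : ∀ {n} {S : Expr n → Set} {h} → Rad S h → Σ ℕ λ N → Σ ℤ λ b → ¬ b ≡ pos 0 × Idl S (con b ⊗ powE h N)
rad-ideal {S = S} (gen {f} s) = 1 , pos 1 , (λ ()) , mul (con (pos 1)) (ext (mul (con (pos 1)) (gen s)) λ ρ → ZK.*-comm (ZK.intCast (pos 1)) (evℤ f ρ))
rad-ideal zer = 1 , pos 1 , (λ ()) , ext zer λ ρ → ≡.refl
rad-ideal {S = S} (add {g} {h} r s) with rad-ideal r | rad-ideal s
... | N , b , nb , A | M , b' , nb' , B = N ℕ.+ M , b ℤ.* b' , (λ e → nb' (ℤ-domain e nb)) ,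
   ext (L (N ℕ.+ M) 0 0 (ℕP.≤-reflexive (≡.sym (≡.trans (ℕP.+-identityʳ _) (ℕP.+-identityʳ _))))) λ ρ →
     ≡.trans (≡.cong (λ u → ((evℤ (con (b ℤ.* b')) ρ ℤ.* evℤ (powE (g ⊕ h) (N ℕ.+ M)) ρ) ℤ.* pos 1) ℤ.* u) ≡.refl)
       (≡.trans (ℤP.*-identityʳ _) (ℤP.*-identityʳ _))
  where
  bb = con {_} (b ℤ.* b')
  bb-ev : ∀ ρ → evℤ bb ρ ≡ ZK.intCast b ℤ.* ZK.intCast b'
  bb-ev ρ = ZK.intCast-* b b'
  -- The factors g + h are expanded one at a time. When none is left, either i ≥ N or j ≥ M, so the
  -- product is a multiple of one of the two given elements.
  L : ∀ k i j → N ℕ.+ M ℕ.≤ k ℕ.+ i ℕ.+ j → Idl S (bb ⊗ powE (g ⊕ h) k ⊗ powE g i ⊗ powE h j)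
  L zero i j le with N ℕ.≤? i
  ... | yes N≤i = ext (mul (con b' ⊗ powE g (i ℕ.∸ N) ⊗ powE h j) A) λ ρ →
      ≡.trans (ZK.solve 5 (λ b b' x y w → (b' ZK.:* x ZK.:* w) ZK.:* (b ZK.:* y) ZK.:= ((b ZK.:* b') ZK.:* ZK.con (pos 1)) ZK.:* (x ZK.:* y) ZK.:* w) ≡.refl
               (ZK.intCast b) (ZK.intCast b') (evℤ (powE g (i ℕ.∸ N)) ρ) (evℤ (powE g N) ρ) (evℤ (powE h j) ρ))
        (≡.cong₂ (λ u v → u ℤ.* pos 1 ℤ.* v ℤ.* evℤ (powE h j) ρ) (≡.sym (bb-ev ρ)) (pw g ρ i N N≤i))
    where
    pw : ∀ g ρ i N → N ℕ.≤ i → evℤ (powE g (i ℕ.∸ N)) ρ ℤ.* evℤ (powE g N) ρ ≡ evℤ (powE g i) ρ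
    pw g ρ i N le = ≡.trans (≡.cong₂ ℤ._*_ (ev-powE g (i ℕ.∸ N) ρ) (ev-powE g N ρ)) (≡.trans (≡.sym (ZK.pow-+ (evℤ g ρ) (i ℕ.∸ N) N))
      (≡.trans (≡.cong (ZK.pow (evℤ g ρ)) (ℕP.m∸n+n≡m le)) (≡.sym (ev-powE g i ρ))))
  ... | no N≰i = ext (mul (con b ⊗ powE g i ⊗ powE h (j ℕ.∸ M)) B) λ ρ →
      ≡.trans (ZK.solve 5 (λ b b' x y w → (b ZK.:* w ZK.:* x) ZK.:* (b' ZK.:* y) ZK.:= ((b ZK.:* b') ZK.:* ZK.con (pos 1)) ZK.:* w ZK.:* (x ZK.:* y)) ≡.refl
               (ZK.intCast b) (ZK.intCast b') (evℤ (powE h (j ℕ.∸ M)) ρ) (evℤ (powE h M) ρ) (evℤ (powE g i) ρ))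
        (≡.cong₂ (λ u v → u ℤ.* pos 1 ℤ.* evℤ (powE g i) ρ ℤ.* v) (≡.sym (bb-ev ρ)) (pw ρ))
    where
    M≤j : M ℕ.≤ j
    M≤j = ℕP.+-cancelˡ-≤ N M j (ℕP.≤-trans le (ℕP.+-monoˡ-≤ j (ℕP.<⇒≤ (ℕP.≰⇒> N≰i))))
    pw : ∀ ρ → evℤ (powE h (j ℕ.∸ M)) ρ ℤ.* evℤ (powE h M) ρ ≡ evℤ (powE h j) ρ
    pw ρ = ≡.trans (≡.cong₂ ℤ._*_ (ev-powE h (j ℕ.∸ M) ρ) (ev-powE h M ρ)) (≡.trans (≡.sym (ZK.pow-+ (evℤ h ρ) (j ℕ.∸ M) M))
      (≡.trans (≡.cong (ZK.pow (evℤ h ρ)) (ℕP.m∸n+n≡m M≤j)) (≡.sym (ev-powE h j ρ))))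
  L (suc k) i j le = ext (add (L k (suc i) j (≡.subst (N ℕ.+ M ℕ.≤_) (≡.cong (ℕ._+ j) (≡.sym (ℕP.+-suc k i))) le))
                              (L k i (suc j) (≡.subst (N ℕ.+ M ℕ.≤_) (≡.sym (ℕP.+-suc (k ℕ.+ i) j)) le))) λ ρ →
     ZK.solve 6 (λ c g h w x y → (c ZK.:* w ZK.:* (g ZK.:* x) ZK.:* y) ZK.:+ (c ZK.:* w ZK.:* x ZK.:* (h ZK.:* y)) ZK.:= c ZK.:* ((g ZK.:+ h) ZK.:* w) ZK.:* x ZK.:* y) ≡.refl
       (evℤ bb ρ) (evℤ g ρ) (evℤ h ρ) (evℤ (powE (g ⊕ h) k) ρ) (evℤ (powE g i) ρ) (evℤ (powE h j) ρ)
rad-ideal (mul h {g} r) with rad-ideal r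
... | N , b , nb , A = N , b , nb , ext (mul (powE h N) A) λ ρ →
   ≡.trans (ZK.solve 3 (λ p b q → p ZK.:* (b ZK.:* q) ZK.:= b ZK.:* (p ZK.:* q)) ≡.refl (evℤ (powE h N) ρ) (ZK.intCast b) (evℤ (powE g N) ρ))
     (≡.cong (ZK.intCast b ℤ.*_) (≡.trans (≡.cong₂ ℤ._*_ (ev-powE h N ρ) (ev-powE g N ρ)) (≡.trans (≡.sym (ZK.pow-* (evℤ h ρ) (evℤ g ρ) N)) (≡.sym (ev-powE (h ⊗ g) N ρ)))))
rad-ideal (ext {g} {h} r e) with rad-ideal r
... | N , b , nb , A = N , b , nb , ext A λ ρ → ≡.cong (ZK.intCast b ℤ.*_) (≡.trans (ev-powE g N ρ) (≡.trans (≡.cong (λ u → ZK.pow u N) (e ρ)) (≡.sym (ev-powE h N ρ))))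
rad-ideal (sqr {g} r) with rad-ideal r
... | N , b , nb , A = N ℕ.+ N , b , nb , ext A λ ρ → ≡.cong (ZK.intCast b ℤ.*_) (≡.trans (ev-powE (g ⊗ g) N ρ) (≡.trans (ZK.pow-* (evℤ g ρ) (evℤ g ρ) N)
    (≡.trans (≡.sym (ZK.pow-+ (evℤ g ρ) N N)) (≡.sym (ev-powE g (N ℕ.+ N) ρ)))))
rad-ideal (tor {c} {g} nc r) with rad-ideal r
... | N , b , nb , A = N , b ℤ.* ZK.pow c N , (λ e → pow-≢0 c N nc (ℤ-domain e nb)) , ext A λ ρ →
    ≡.trans (≡.cong (ZK.intCast b ℤ.*_) (≡.trans (ev-powE (con c ⊗ g) N ρ) (ZK.pow-* (ZK.intCast c) (evℤ g ρ) N)))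
    (≡.trans (≡.sym (ℤP.*-assoc (ZK.intCast b) _ _)) (≡.cong₂ ℤ._*_ (≡.trans (≡.cong₂ (λ u v → u ℤ.* ZK.pow v N) (castℤ b) (castℤ c)) (≡.sym (castℤ _))) (≡.sym (ev-powE g N ρ))))

-- Roots and divisibility over an algebraically closed field

module Roots (A : ACF) where
  open ACF A public using (infDom; inv; root)
  open Dom infDom public
  open VecPoly (InfDom.ring infDom) public

  data Lead : ℕ → List Carrier → Set where
    l0 : ∀ {c} → ¬ (c ≈ 0#) → Lead 0 (c ∷ [])
    ls : ∀ {d c cs} → Lead d cs → Lead (suc d) (c ∷ cs)

  lead-quo : ∀ τ {d P} → Lead d P → Lead d (quo τ P)
  lead-quo τ (l0 nz) = l0 λ e → nz (trans (sym (trans (+-congˡ (zeroʳ τ)) (+-identityʳ _))) e)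
  lead-quo τ (ls l) = ls (lead-quo τ l)

  lead-form : ∀ {d cs} → Lead d cs → Σ (List Carrier) λ lo → Σ Carrier λ ℓ → length lo ≡ d × ¬ (ℓ ≈ 0#) × (∀ t → horner cs t ≈ horner lo t + ℓ * pow t d)
  lead-form (l0 {c} nz) = [] , c , ≡.refl , nz , λ t → solve 2 (λ c t → c :+ t :* scon (pos 0) := scon (pos 0) :+ c :* scon (pos 1)) refl c t
  lead-form (ls {d} {c} l) with lead-form l
  ... | lo , ℓ , len , nz , h = c ∷ lo , ℓ , ≡.cong suc len , nz , λ t → trans (+-congˡ (*-congˡ (h t)))
        (solve 5 (λ c t u l w → c :+ t :* (u :+ l :* w) := (c :+ t :* u) :+ l :* (t :* w)) refl c t (horner lo t) ℓ (pow t d))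

  lead-root : ∀ {d cs} → Lead (suc d) cs → Σ Carrier λ τ → horner cs τ ≈ 0#
  lead-root {d} {cs} l with lead-form l
  ... | lo , ℓ , len , nz , h with inv ℓ nz
  ... | ℓ' , ℓℓ' with root (scL ℓ' lo) (≡.subst (1 ℕ.≤_) (≡.sym (≡.trans (scL-len ℓ' lo) len)) (s≤s z≤n))
  ... | τ , e = τ , (begin
    horner cs τ ≈⟨ h τ ⟩
    horner lo τ + ℓ * P ≈⟨ +-congʳ (sym (trans (*-congʳ ℓℓ') (*-identityˡ _))) ⟩
    (ℓ * ℓ') * horner lo τ + ℓ * P ≈⟨ solve 4 (λ l k u p → (l :* k) :* u :+ l :* p := l :* (p :+ k :* u)) refl ℓ ℓ' (horner lo τ) P ⟩
    ℓ * (P + ℓ' * horner lo τ) ≈⟨ *-congˡ (+-cong (reflexive (≡.cong (pow τ) (≡.sym (≡.trans (scL-len ℓ' lo) len)))) (sym (horner-sc ℓ' lo τ))) ⟩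
    ℓ * (pow τ (length (scL ℓ' lo)) + horner (scL ℓ' lo) τ) ≈⟨ *-congˡ e ⟩
    ℓ * 0# ≈⟨ zeroʳ ℓ ⟩
    0# ∎)
    where P = pow τ (suc d)

  factor : ∀ τ a P t → horner (a ∷ P) τ ≈ 0# → horner (a ∷ P) t ≈ (t + - τ) * horner (quo τ P) t
  factor τ a P t e = begin
    a + t * horner P t ≈⟨ +-congˡ (quo-id τ t P) ⟩
    a + (τ * horner P τ + (t + - τ) * Q) ≈⟨ sym (+-assoc _ _ _) ⟩
    (a + τ * horner P τ) + (t + - τ) * Q ≈⟨ +-congʳ e ⟩
    0# + (t + - τ) * Q ≈⟨ +-identityˡ _ ⟩
    (t + - τ) * Q ∎
    where Q = horner (quo τ P) t

  pf-factor : ∀ τ {φ} → PF φ → φ τ ≈ 0# → Σ (Carrier → Carrier) λ ψ → PF ψ × (∀ t → φ t ≈ (t + - τ) * ψ t)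
  pf-factor τ ([] , h) e = (λ _ → 0#) , pf-con 0# , λ t → trans (h t) (sym (zeroʳ _))
  pf-factor τ ((a ∷ P) , h) e = horner (quo τ P) , (quo τ P , λ t → refl) , λ t → trans (h t) (factor τ a P t (trans (sym (h τ)) e))

  -- If every root of f (degree d) is a root of G then f divides G^d; so a remainder of degree < d vanishes.
  rem-zero : ∀ d {cs} → Lead d cs → ∀ {G S Q} → PF G → PF S → PF Q → (∀ τ → horner cs τ ≈ 0# → G τ ≈ 0#) →
             ∀ r → length r ℕ.≤ d → (∀ t → horner r t ≈ S t * pow (G t) d + - (horner cs t * Q t)) → AllZ r
  rem-zero d l pG pS pQ hr [] len h = []
  rem-zero (suc d) {c ∷ cs} (ls l) {G} {S} {Q} pG pS pQ hr (a ∷ P) (s≤s len) h = a≈0 ∷ Pz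
    where
    τ = proj₁ (lead-root (ls {c = c} l))
    cτ = proj₂ (lead-root (ls {c = c} l))
    Gτ = hr τ cτ
    G' = proj₁ (pf-factor τ pG Gτ)
    pG' = proj₁ (proj₂ (pf-factor τ pG Gτ))
    hG = proj₂ (proj₂ (pf-factor τ pG Gτ))
    rτ : horner (a ∷ P) τ ≈ 0#
    rτ = begin
      horner (a ∷ P) τ ≈⟨ h τ ⟩
      S τ * (G τ * pow (G τ) d) + - (horner (c ∷ cs) τ * Q τ) ≈⟨ +-cong (*-congˡ (*-congʳ Gτ)) (-‿cong (*-congʳ cτ)) ⟩
      S τ * (0# * pow (G τ) d) + - (0# * Q τ) ≈⟨ solve 3 (λ s g q → s :* (scon (pos 0) :* g) :+ :- (scon (pos 0) :* q) := scon (pos 0)) refl (S τ) (pow (G τ) d) (Q τ) ⟩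
      0# ∎
    -- Division by `t - τ` uses up one of the d + 1 factors `G`; its cofactor `G'` is absorbed into
    -- `S`.
    rhs : Carrier → Carrier
    rhs t = (S t * G' t) * pow (G t) d + - (horner (quo τ cs) t * Q t)
    prhs : PF rhs
    prhs = pf-+ (pf-* (pf-* pS pG') (pf-pow d pG)) (pf-neg (pf-* (quo τ cs , λ t → refl) pQ))
    diff : ∀ t → horner (quo τ P) t + - rhs t ≈ 0#
    diff = pf-extτ τ (pf-+ (quo τ P , λ t → refl) (pf-neg prhs)) λ t ne → domain {t + - τ} (begin
      (t + - τ) * (horner (quo τ P) t + - rhs t)
        ≈⟨ solve 7 (λ u x s g p c q → u :* (x :+ :- ((s :* g) :* p :+ :- (c :* q))) := (u :* x) :+ :- (s :* ((u :* g) :* p) :+ :- ((u :* c) :* q))) refl (t + - τ) (horner (quo τ P) t) (S t) (G' t) (pow (G t) d) (horner (quo τ cs) t) (Q t) ⟩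
      ((t + - τ) * horner (quo τ P) t) + - (S t * (((t + - τ) * G' t) * pow (G t) d) + - (((t + - τ) * horner (quo τ cs) t) * Q t))
        ≈⟨ +-cong (sym (factor τ a P t rτ)) (-‿cong (+-cong (*-congˡ (*-congʳ (sym (hG t)))) (-‿cong (*-congʳ (sym (factor τ c cs t cτ)))))) ⟩
      horner (a ∷ P) t + - (S t * (G t * pow (G t) d) + - (horner (c ∷ cs) t * Q t)) ≈⟨ x≈y⇒x-y≈0 (h t) ⟩
      0# ∎) (λ e → ne (x-y≈0⇒x≈y e))
    Pz : AllZ P
    Pz = quo-AllZ τ P (rem-zero d (lead-quo τ l) pG (pf-* pS pG') pQ
           (λ σ e → hr σ (trans (factor τ c cs σ cτ) (trans (*-congˡ e) (zeroʳ _)))) (quo τ P)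
           (≡.subst (ℕ._≤ d) (≡.sym (quo-len τ P)) len) (λ t → x-y≈0⇒x≈y (diff t)))
    a≈0 : a ≈ 0#
    a≈0 = trans (sym (trans (+-congˡ (trans (*-congˡ (AllZ⇒0 Pz τ)) (zeroʳ τ))) (+-identityʳ a))) rτ

¬¬-map : ∀ {A B : Set} → (A → B) → ¬ ¬ A → ¬ ¬ B
¬¬-map f h k = h λ a → k (f a)

-- The Nullstellensatz by elimination

-- Equations free of the variable to be eliminated are kept apart in `es`; the others are
-- coefficient lists in that variable.
data Sys {n} (es : List (Expr n)) (ps : List (List (Expr n))) : Expr (suc n) → Set where
  inE : ∀ {e} → e ∈ es → Sys es ps (wk e)
  inP : ∀ {p} → p ∈ ps → Sys es ps (polyE p)

evZP : ∀ {n} (cs : List (Expr n)) t ρ → evℤ (polyE cs) (t ∷ ρ) ≡ Uni.evP ℤR cs t ρ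
evZP cs t ρ = Uni.ev-polyE ℤR cs t ρ

evZw : ∀ {n} (e : Expr n) t ρ → evℤ (wk e) (t ∷ ρ) ≡ evℤ e ρ
evZw e t ρ = EvalE-sub.ev-wk ℤR e t ρ

rad-wk : ∀ {n} {es : List (Expr n)} {ps g} → Rad (_∈ es) g → Rad (Sys es ps) (wk g)
rad-wk (gen s) = gen (inE s)
rad-wk zer = zer
rad-wk (add r s) = add (rad-wk r) (rad-wk s)
rad-wk (mul h r) = mul (wk h) (rad-wk r)
rad-wk (ext {g} {h} r e) = ext (rad-wk r) λ { (t ∷ ρ) → ≡.trans (evZw g t ρ) (≡.trans (e ρ) (≡.sym (evZw h t ρ))) }
rad-wk (sqr r) = sqr (rad-wk r)
rad-wk (tor nc r) = tor nc (rad-wk r)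

rad-poly : ∀ {n} {es : List (Expr n)} {ps} cs → All (Rad (_∈ es)) cs → Rad (Sys es ps) (polyE cs)
rad-poly [] [] = zer
rad-poly (c ∷ cs) (r ∷ rs) = add (rad-wk r) (mul (var zero) (rad-poly cs rs))

-- The extra 1 per polynomial makes the measure drop also when an empty list is discarded.
sizeP : ∀ {n} → List (List (Expr n)) → ℕ
sizeP [] = 0
sizeP (p ∷ ps) = suc (length p) ℕ.+ sizeP ps

asVec : ∀ {A : Set} (xs : List A) → Vec A (length xs)
asVec [] = []
asVec (x ∷ xs) = x ∷ asVec xs

asVec-list : ∀ {A : Set} (xs : List A) → Vec.toList (asVec xs) ≡ xs
asVec-list [] = ≡.refl
asVec-list (x ∷ xs) = ≡.cong (x ∷_) (asVec-list xs)

pad : ∀ {n k} m → Vec (Expr n) k → Vec (Expr n) (k ℕ.+ m)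
pad m v = v Vec.++ Vec.replicate m (con (pos 0))

shift : ∀ {n} → ℕ → List (Expr n) → List (Expr n)
shift zero p = p
shift (suc k) p = con (pos 0) ∷ shift k p

shift-len : ∀ {n} k (p : List (Expr n)) → length (shift k p) ≡ k ℕ.+ length p
shift-len zero p = ≡.refl
shift-len (suc k) p = ≡.cong suc (shift-len k p)

toList-len : ∀ {A : Set} {m} (v : Vec A m) → length (Vec.toList v) ≡ m
toList-len [] = ≡.refl
toList-len (x ∷ v) = ≡.cong suc (toList-len v)

module VecPoly2 (R : CRing) where
  open RingKit R renaming (con to scon)
  open EvalE R
  open Uni R
  open VecPoly R

  evP-zeros : ∀ {n} m t ρ → evV {n} (Vec.replicate m (con (pos 0))) t ρ ≈ 0#
  evP-zeros zero t ρ = refl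
  evP-zeros (suc m) t ρ = trans (+-identityˡ _) (trans (*-congˡ (evP-zeros m t ρ)) (zeroʳ t))

  evV-pad : ∀ {n k} m (v : Vec (Expr n) k) t ρ → evV (pad m v) t ρ ≈ evV v t ρ
  evV-pad m [] t ρ = evP-zeros m t ρ
  evV-pad m (x ∷ v) t ρ = +-congˡ (*-congˡ (evV-pad m v t ρ))

  evP-shift : ∀ {n} k (p : List (Expr n)) t ρ → evP (shift k p) t ρ ≈ pow t k * evP p t ρ
  evP-shift zero p t ρ = sym (*-identityˡ _)
  evP-shift (suc k) p t ρ = trans (+-identityˡ _) (trans (*-congˡ (evP-shift k p t ρ)) (sym (*-assoc _ _ _)))

  -- one elimination step: lead(p) q - lead(q) T^k p
  step-ev : ∀ {n a} k (p : Vec (Expr n) a) (ℓ : Expr n) (q : Vec (Expr n) (k ℕ.+ a)) (μ : Expr n) t ρ →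
            evP (addE (scE ℓ (Vec.toList q)) (scE (⊖ μ) (shift k (Vec.toList p)))) t ρ ≈
            ev ℓ ρ * (evV q t ρ + ev μ ρ * pow t (k ℕ.+ a)) + - ((ev μ ρ * pow t k) * (evV p t ρ + ev ℓ ρ * pow t a))
  step-ev {a = a} k p ℓ q μ t ρ = begin
    evP (addE (scE ℓ (Vec.toList q)) (scE (⊖ μ) (shift k (Vec.toList p)))) t ρ
      ≈⟨ trans (evP-add (scE ℓ (Vec.toList q)) _ t ρ) (+-cong (evP-sc ℓ (Vec.toList q) t ρ) (trans (evP-sc (⊖ μ) (shift k (Vec.toList p)) t ρ) (*-cong (ev-⊖ μ ρ) (evP-shift k (Vec.toList p) t ρ)))) ⟩
    ev ℓ ρ * evV q t ρ + (- ev μ ρ) * (pow t k * evV p t ρ)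
      ≈⟨ solve 6 (λ l q m tk p ta → l :* q :+ (:- m) :* (tk :* p) := l :* (q :+ m :* (tk :* ta)) :+ :- ((m :* tk) :* (p :+ l :* ta))) refl (ev ℓ ρ) (evV q t ρ) (ev μ ρ) (pow t k) (evV p t ρ) (pow t a) ⟩
    ev ℓ ρ * (evV q t ρ + ev μ ρ * (pow t k * pow t a)) + - ((ev μ ρ * pow t k) * (evV p t ρ + ev ℓ ρ * pow t a))
      ≈⟨ +-congʳ (*-congˡ (+-congˡ (*-congˡ (sym (pow-+ t k a))))) ⟩
    ev ℓ ρ * (evV q t ρ + ev μ ρ * pow t (k ℕ.+ a)) + - ((ev μ ρ * pow t k) * (evV p t ρ + ev ℓ ρ * pow t a)) ∎

-- The coefficient `ld` is only formally leading; it is kept apart because the elimination branches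
-- on whether it vanishes at a point.
record LP (n : ℕ) : Set where
  constructor lp
  field
    dg : ℕ
    lo : Vec (Expr n) dg
    ld : Expr n

lpList : ∀ {n} → LP n → List (Expr n)
lpList (lp d v ℓ) = Vec.toList v List.++ (ℓ ∷ [])

toLP : ∀ {n} → Expr n → List (Expr n) → LP n
toLP c [] = lp 0 [] c
toLP c (d ∷ cs) with toLP d cs
... | lp k v ℓ = lp (suc k) (c ∷ v) ℓ

toLP-list : ∀ {n} (c : Expr n) cs → lpList (toLP c cs) ≡ c ∷ cs
toLP-list c [] = ≡.refl
toLP-list c (d ∷ cs) with toLP d cs | toLP-list d cs
... | lp k v ℓ | e = ≡.cong (c ∷_) e

module LPev (R : CRing) where
  open RingKit R renaming (con to scon)
  open EvalE R
  open Uni R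
  open VecPoly R

  evP-lp : ∀ {n} (P : LP n) t ρ → evP (lpList P) t ρ ≈ evV (LP.lo P) t ρ + ev (LP.ld P) ρ * pow t (LP.dg P)
  evP-lp (lp _ [] ℓ) t ρ = solve 2 (λ c t → c :+ t :* scon (pos 0) := scon (pos 0) :+ c :* scon (pos 1)) refl (ev ℓ ρ) t
  evP-lp (lp (suc k) (x ∷ v) ℓ) t ρ = trans (+-congˡ (*-congˡ (evP-lp (lp k v ℓ) t ρ)))
    (solve 5 (λ x t u l w → x :+ t :* (u :+ l :* w) := (x :+ t :* u) :+ l :* (t :* w)) refl (ev x ρ) t (evV v t ρ) (ev ℓ ρ) (pow t k))

  evL-len : ∀ {n} (cs : List (Expr n)) ρ → length (evL cs ρ) ≡ length cs
  evL-len [] ρ = ≡.refl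
  evL-len (c ∷ cs) ρ = ≡.cong suc (evL-len cs ρ)

  powL : ∀ {n} → List (Expr n) → ℕ → List (Expr n)
  powL G zero = con (pos 1) ∷ []
  powL G (suc d) = mulE G (powL G d)

  evP-powL : ∀ {n} (G : List (Expr n)) d t ρ → evP (powL G d) t ρ ≈ pow (evP G t ρ) d
  evP-powL G zero t ρ = trans (+-cong intCast-1 (zeroʳ t)) (+-identityʳ 1#)
  evP-powL G (suc d) t ρ = trans (evP-mul G (powL G d) t ρ) (*-congˡ (evP-powL G d t ρ))

module LZ = LPev ℤR
module VZ = VecPoly ℤR
module V2Z = VecPoly2 ℤR

¬¬-All : ∀ {A : Set} {P : A → Set} {xs} → All (λ x → ¬ ¬ P x) xs → ¬ ¬ All P xs
¬¬-All [] k = k []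
¬¬-All (h ∷ hs) k = h λ p → ¬¬-All hs λ ps → k (p ∷ ps)

-- Weak Nullstellensatz, by eliminating one variable at a time.
module Nullstellensatz (A : ACF) (cz : ∀ c → Dom._≈_ (ACF.infDom A) (Dom.intCast (ACF.infDom A) c) (Dom.0# (ACF.infDom A)) → c ≡ pos 0) where
  open Roots A
  open VecPoly2 (InfDom.ring infDom)
  open LPev (InfDom.ring infDom)

  ZeroAt : ∀ {n} → Vec Carrier n → Expr n → Set
  ZeroAt ρ e = ev e ρ ≈ 0#

  NS : ℕ → Set
  NS n = ∀ (es : List (Expr n)) g → (∀ ρ → All (ZeroAt ρ) es → ev g ρ ≈ 0#) → ¬ ¬ Rad (_∈ es) g

  Hyp : ∀ {n} → List (Expr n) → List (List (Expr n)) → List (Expr n) → Set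
  Hyp es ps G = ∀ t ρ → All (ZeroAt ρ) es → All (λ p → evP p t ρ ≈ 0#) ps → evP G t ρ ≈ 0#

  lead-at : ∀ {n} (P : LP n) ρ → ¬ (ev (LP.ld P) ρ ≈ 0#) → Lead (LP.dg P) (evL (lpList P) ρ)
  lead-at (lp zero [] ℓ) ρ nz = l0 nz
  lead-at (lp (suc k) (x ∷ v) ℓ) ρ nz = ls (lead-at (lp k v ℓ) ρ nz)

  module _ {n : ℕ} (ns : NS n) where

    Rec : ℕ → Set
    Rec m = ∀ (es : List (Expr n)) ps G → sizeP ps ℕ.< m → Hyp es ps G → ¬ ¬ Rad (Sys es ps) (polyE G)

    -- the case where the leading coefficient of P vanishes
    α-case : ∀ es (P : LP n) rest G → Hyp es (lpList P ∷ rest) G → Rec (sizeP (lpList P ∷ rest)) →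
             ¬ ¬ Rad (λ f → f ≡ wk (LP.ld P) ⊎ Sys es (lpList P ∷ rest) f) (polyE G)
    α-case es P@(lp d v ℓ) rest G hyp rec = ¬¬-map (rad-mono mono) (rec (ℓ ∷ es) (Vec.toList v ∷ rest) G size hyp')
      where
      size : suc (length (Vec.toList v)) ℕ.+ sizeP rest ℕ.< suc (length (lpList P)) ℕ.+ sizeP rest
      size = s≤s (ℕP.+-monoˡ-≤ (sizeP rest) (ℕP.≤-reflexive (≡.trans (ℕP.+-comm 1 (length (Vec.toList v))) (≡.sym (ListP.length-++ (Vec.toList v))))))
      hyp' : Hyp (ℓ ∷ es) (Vec.toList v ∷ rest) G
      hyp' t ρ (hℓ ∷ hes) (hv ∷ hr) = hyp t ρ hes (trans (evP-lp P t ρ) (trans (+-cong hv (trans (*-congʳ hℓ) (zeroˡ _))) (+-identityˡ 0#)) ∷ hr)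
      mono : ∀ {f} → Sys (ℓ ∷ es) (Vec.toList v ∷ rest) f → Rad (λ f → f ≡ wk ℓ ⊎ Sys es (lpList P ∷ rest) f) f
      mono (inE (here ≡.refl)) = gen (inj₁ ≡.refl)
      mono (inE (there e)) = gen (inj₂ (inE e))
      mono (inP (there p)) = gen (inj₂ (inP (there p)))
      mono (inP (here ≡.refl)) = ext (add (gen (inj₂ (inP (here ≡.refl)))) (mul (⊖ powE (var zero) d) (gen (inj₁ ≡.refl)))) λ { (t ∷ ρ) →
        ≡.trans (≡.cong₂ ℤ._+_ (≡.trans (evZP (lpList P) t ρ) (LZ.evP-lp P t ρ))
           (≡.cong₂ ℤ._*_ (≡.trans (EvalE.ev-⊖ ℤR (powE (var zero) d) (t ∷ ρ)) (≡.cong ℤ.-_ (ev-powE (var zero) d (t ∷ ρ)))) (evZw ℓ t ρ)))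
        (≡.trans (ZK.solve 3 (λ v l p → (v ZK.:+ l ZK.:* p) ZK.:+ (ZK.:- p) ZK.:* l ZK.:= v) ≡.refl (VZ.evV v t ρ) (evℤ ℓ ρ) (ZK.pow t d)) (≡.sym (evZP (Vec.toList v) t ρ))) }

    sc-ext : ∀ {S : Expr (suc n) → Set} ℓ G → Rad S (polyE (scE ℓ G)) → Rad S (polyE G ⊗ wk ℓ)
    sc-ext ℓ G r = ext r λ { (t ∷ ρ) → ≡.trans (evZP (scE ℓ G) t ρ) (≡.trans (Uni.evP-sc ℤR ℓ G t ρ)
      (≡.trans (ℤP.*-comm (evℤ ℓ ρ) _) (≡.sym (≡.cong₂ ℤ._*_ (evZP G t ρ) (evZw ℓ t ρ))))) }

    -- Where ℓ vanishes, `P` is shortened by `α-case`. Elsewhere `Q` is replaced by `ℓ Q - μ T^k P`,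
    -- of smaller formal degree; multiplying the goal by ℓ makes the replacement harmless at the
    -- zeros of ℓ.
    reduce : ∀ es (P Q : LP n) rest G → LP.dg P ℕ.≤ LP.dg Q → Hyp es (lpList P ∷ lpList Q ∷ rest) G →
             Rec (sizeP (lpList P ∷ lpList Q ∷ rest)) → ¬ ¬ Rad (Sys es (lpList P ∷ lpList Q ∷ rest)) (polyE G)
    reduce es P@(lp a v ℓ) (lp b w μ) rest G le hyp rec = go (b ℕ.∸ a) (≡.sym (ℕP.m∸n+n≡m le)) w hyp rec
      where
      go : ∀ k (e : b ≡ k ℕ.+ a) (w : Vec (Expr n) b) → Hyp es (lpList P ∷ lpList (lp b w μ) ∷ rest) G →
           Rec (sizeP (lpList P ∷ lpList (lp b w μ) ∷ rest)) → ¬ ¬ Rad (Sys es (lpList P ∷ lpList (lp b w μ) ∷ rest)) (polyE G)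
      go k ≡.refl w hyp rec κ = α-case es P (lpList Q ∷ rest) G hyp rec λ rα →
          rec es (lpList P ∷ r ∷ rest) (scE ℓ G) size hyp' λ rβ → κ (rad-split rα (sc-ext ℓ G (rad-mono mono rβ)))
        where
        Q = lp (k ℕ.+ a) w μ
        r = addE (scE ℓ (Vec.toList w)) (scE (⊖ μ) (shift k (Vec.toList v)))
        r-len : length r ≡ k ℕ.+ a
        r-len = ≡.trans (addE-len (scE ℓ (Vec.toList w)) _) (≡.trans (≡.cong₂ ℕ._⊔_ (≡.trans (scE-len ℓ (Vec.toList w)) (toList-len w))
                   (≡.trans (scE-len (⊖ μ) (shift k (Vec.toList v))) (≡.trans (shift-len k (Vec.toList v)) (≡.cong (k ℕ.+_) (toList-len v))))) (ℕP.⊔-idem (k ℕ.+ a)))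
        size : sizeP (lpList P ∷ r ∷ rest) ℕ.< sizeP (lpList P ∷ lpList Q ∷ rest)
        size = ℕP.+-monoʳ-< (suc (length (lpList P))) (ℕP.+-monoˡ-< (sizeP rest) (s≤s (ℕP.≤-reflexive
                 (≡.trans (≡.cong suc r-len) (≡.trans (ℕP.+-comm 1 (k ℕ.+ a)) (≡.sym (≡.trans (ListP.length-++ (Vec.toList w)) (≡.cong (ℕ._+ 1) (toList-len w)))))))))
        hyp' : Hyp es (lpList P ∷ r ∷ rest) (scE ℓ G)
        hyp' t ρ hes (hp ∷ hr ∷ hrest) = trans (evP-sc ℓ G t ρ) (cases {A = ev ℓ ρ ≈ 0#} stable
          (λ z → trans (*-congʳ z) (zeroˡ _))
          (λ nz → trans (*-congˡ (hyp t ρ hes (hp ∷ domain {ev ℓ ρ} (begin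
              ev ℓ ρ * evP (lpList Q) t ρ
                ≈⟨ solve 3 (λ l q m → l :* q := (l :* q :+ :- (m :* scon (pos 0)))) refl (ev ℓ ρ) (evP (lpList Q) t ρ) (ev μ ρ * pow t k) ⟩
              ev ℓ ρ * evP (lpList Q) t ρ + - ((ev μ ρ * pow t k) * 0#)
                ≈⟨ +-cong (*-congˡ (evP-lp Q t ρ)) (-‿cong (*-congˡ (trans (sym hp) (evP-lp P t ρ)))) ⟩
              ev ℓ ρ * (evV w t ρ + ev μ ρ * pow t (k ℕ.+ a)) + - ((ev μ ρ * pow t k) * (evV v t ρ + ev ℓ ρ * pow t a))
                ≈⟨ sym (step-ev k v ℓ w μ t ρ) ⟩
              evP r t ρ ≈⟨ hr ⟩
              0# ∎) nz ∷ hrest))) (zeroʳ _)))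
        mono : ∀ {f} → Sys es (lpList P ∷ r ∷ rest) f → Rad (Sys es (lpList P ∷ lpList Q ∷ rest)) f
        mono (inE e) = gen (inE e)
        mono (inP (here ≡.refl)) = gen (inP (here ≡.refl))
        mono (inP (there (there p))) = gen (inP (there (there p)))
        mono (inP (there (here ≡.refl))) = ext (add (mul (wk ℓ) (gen (inP (there (here ≡.refl))))) (mul (⊖ (wk μ ⊗ powE (var zero) k)) (gen (inP (here ≡.refl))))) λ { (t ∷ ρ) →
          ≡.trans (≡.cong₂ ℤ._+_ (≡.cong₂ ℤ._*_ (evZw ℓ t ρ) (≡.trans (evZP (lpList Q) t ρ) (LZ.evP-lp Q t ρ)))
             (≡.trans (≡.cong₂ ℤ._*_ (≡.trans (EvalE.ev-⊖ ℤR (wk μ ⊗ powE (var zero) k) (t ∷ ρ)) (≡.cong ℤ.-_ (≡.cong₂ ℤ._*_ (evZw μ t ρ) (ev-powE (var zero) k (t ∷ ρ)))))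
                (≡.trans (evZP (lpList P) t ρ) (LZ.evP-lp P t ρ)))
              (≡.sym (ℤP.neg-distribˡ-* (evℤ μ ρ ℤ.* ZK.pow t k) _))))
          (≡.trans (≡.sym (V2Z.step-ev k v ℓ w μ t ρ)) (≡.sym (evZP r t ρ))) }

    -- Where ℓ ≠ 0, all roots of `P` are roots of `G`, so `P` divides `G^d`. Hence the coefficients
    -- of the remainder of `G^d` modulo `P`, times ℓ, vanish on the zeros of `es`, and lie in the
    -- radical by induction on the number of variables.
    single : ∀ es (P : LP n) G → Hyp es (lpList P ∷ []) G → Rec (sizeP (lpList P ∷ [])) → ¬ ¬ Rad (Sys es (lpList P ∷ [])) (polyE G)
    single es P@(lp d v ℓ) G hyp rec κ = α-case es P [] G hyp rec λ rα →
        ¬¬-All (radcoefs rs coefs) λ rcs → κ (rad-split rα (rad-pow (e ℕ.+ d) (β-case rcs)))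
      where
      Gd = powL G d
      A' = pad d (asVec Gd)
      dv = pdiv v ℓ (length Gd) A'
      e = proj₁ dv
      Θ = proj₁ (proj₂ dv)
      rv = proj₂ (proj₂ dv)
      rs = Vec.toList rv
      coefs : ∀ ρ → All (ZeroAt ρ) es → All (λ c → ev (ℓ ⊗ c) ρ ≈ 0#) rs
      coefs ρ hes = All.tabulate λ {c} c∈ → cases {A = ev ℓ ρ ≈ 0#} stable
          (λ z → trans (*-congʳ z) (zeroˡ _))
          (λ nz → trans (*-congˡ (All.lookup (unmap rs (rem-zero d (lead-at P ρ nz) {λ t → evP G t ρ} {λ _ → pow (ev ℓ ρ) e} {λ t → evV Θ t ρ}
              (evL G ρ , λ t → refl) (pf-con _) (evL (Vec.toList Θ) ρ , λ t → refl) (λ τ h → hyp τ ρ hes (h ∷ []))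
              (evL rs ρ) (ℕP.≤-reflexive (≡.trans (evL-len rs ρ) (toList-len rv))) (λ t → begin
                evV rv t ρ
                  ≈⟨ solve 2 (λ f r → r := (f :+ r) :+ :- f) refl ((evV v t ρ + ev ℓ ρ * pow t d) * evV Θ t ρ) (evV rv t ρ) ⟩
                ((evV v t ρ + ev ℓ ρ * pow t d) * evV Θ t ρ + evV rv t ρ) + - ((evV v t ρ + ev ℓ ρ * pow t d) * evV Θ t ρ)
                  ≈⟨ +-cong (sym (pdiv-ev v ℓ (length Gd) A' t ρ)) (-‿cong (*-congʳ (sym (evP-lp P t ρ)))) ⟩
                pow (ev ℓ ρ) e * evV A' t ρ + - (evP (lpList P) t ρ * evV Θ t ρ)
                  ≈⟨ +-congʳ (*-congˡ (trans (evV-pad d (asVec Gd) t ρ) (trans (reflexive (≡.cong (λ l → evP l t ρ) (asVec-list Gd))) (evP-powL G d t ρ)))) ⟩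
                pow (ev ℓ ρ) e * pow (evP G t ρ) d + - (evP (lpList P) t ρ * evV Θ t ρ) ∎))) c∈)) (zeroʳ _))
        where
        unmap : ∀ cs → AllZ (evL cs ρ) → All (ZeroAt ρ) cs
        unmap [] [] = []
        unmap (c ∷ cs) (z ∷ zs) = z ∷ unmap cs zs
      radcoefs : ∀ rs → (∀ ρ → All (ZeroAt ρ) es → All (λ c → ev (ℓ ⊗ c) ρ ≈ 0#) rs) → All (λ c → ¬ ¬ Rad (_∈ es) c) (scE ℓ rs)
      radcoefs [] h = []
      radcoefs (c ∷ cs) h = ns es (ℓ ⊗ c) (λ ρ hes → All.head (h ρ hes)) ∷ radcoefs cs (λ ρ hes → All.tail (h ρ hes))
      X = powE (wk ℓ) d ⊗ powE (polyE G) (suc e)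
      β-case : All (Rad (_∈ es)) (scE ℓ rs) → Rad (Sys es (lpList P ∷ [])) (powE (polyE G ⊗ wk ℓ) (suc (e ℕ.+ d)))
      β-case rcs = ext (mul X (add (mul (wk ℓ ⊗ polyE (Vec.toList Θ)) (gen (inP (here ≡.refl)))) (rad-poly (scE ℓ rs) rcs))) λ { (t ∷ ρ) → eq t ρ }
        where
        eq : ∀ t ρ → evℤ X (t ∷ ρ) ℤ.* ((evℤ (wk ℓ) (t ∷ ρ) ℤ.* evℤ (polyE (Vec.toList Θ)) (t ∷ ρ)) ℤ.* evℤ (polyE (lpList P)) (t ∷ ρ) ℤ.+ evℤ (polyE (scE ℓ rs)) (t ∷ ρ))
             ≡ evℤ (powE (polyE G ⊗ wk ℓ) (suc (e ℕ.+ d))) (t ∷ ρ)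
        eq t ρ = begin'
          where
          l = evℤ ℓ ρ
          g = Uni.evP ℤR G t ρ
          pl = ZK.pow l
          pg = ZK.pow g
          V = VZ.evV v t ρ ℤ.+ l ℤ.* ZK.pow t d
          evX : evℤ X (t ∷ ρ) ≡ pl d ℤ.* pg (suc e)
          evX = ≡.cong₂ ℤ._*_ (≡.trans (ev-powE (wk ℓ) d (t ∷ ρ)) (≡.cong (λ u → ZK.pow u d) (evZw ℓ t ρ)))
                              (≡.trans (ev-powE (polyE G) (suc e) (t ∷ ρ)) (≡.cong (λ u → ZK.pow u (suc e)) (evZP G t ρ)))
          inner : (evℤ (wk ℓ) (t ∷ ρ) ℤ.* evℤ (polyE (Vec.toList Θ)) (t ∷ ρ)) ℤ.* evℤ (polyE (lpList P)) (t ∷ ρ) ℤ.+ evℤ (polyE (scE ℓ rs)) (t ∷ ρ) ≡ l ℤ.* (pl e ℤ.* pg d)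
          inner = ≡.trans (≡.cong₂ ℤ._+_ (≡.cong₂ ℤ._*_ (≡.cong₂ ℤ._*_ (evZw ℓ t ρ) (evZP (Vec.toList Θ) t ρ)) (≡.trans (evZP (lpList P) t ρ) (LZ.evP-lp P t ρ)))
                                          (≡.trans (evZP (scE ℓ rs) t ρ) (Uni.evP-sc ℤR ℓ rs t ρ)))
                  (≡.trans (ZK.solve 4 (λ l θ V r → (l ZK.:* θ) ZK.:* V ZK.:+ l ZK.:* r ZK.:= l ZK.:* (V ZK.:* θ ZK.:+ r)) ≡.refl l (VZ.evV Θ t ρ) V (VZ.evV rv t ρ))
                  (≡.cong (l ℤ.*_) (≡.trans (≡.sym (VZ.pdiv-ev v ℓ (length Gd) A' t ρ)) (≡.cong (pl e ℤ.*_)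
                    (≡.trans (V2Z.evV-pad d (asVec Gd) t ρ) (≡.trans (≡.cong (λ u → Uni.evP ℤR u t ρ) (asVec-list Gd)) (LZ.evP-powL G d t ρ)))))))
          begin' = ≡.trans (≡.cong₂ ℤ._*_ evX inner)
            (≡.trans (ZK.solve 6 (λ l pld g pge ple pgd → (pld ZK.:* (g ZK.:* pge)) ZK.:* (l ZK.:* (ple ZK.:* pgd)) ZK.:= (g ZK.:* (pge ZK.:* pgd)) ZK.:* (l ZK.:* (ple ZK.:* pld))) ≡.refl l (pl d) g (pg e) (pl e) (pg d))
            (≡.trans (≡.cong₂ (λ u w → (g ℤ.* u) ℤ.* (l ℤ.* w)) (≡.sym (ZK.pow-+ g e d)) (≡.sym (ZK.pow-+ l e d)))
            (≡.trans (≡.sym (ZK.pow-* g l (suc (e ℕ.+ d)))) (≡.trans (≡.cong (λ u → ZK.pow u (suc (e ℕ.+ d))) (≡.sym (≡.cong₂ ℤ._*_ (evZP G t ρ) (evZw ℓ t ρ)))) (≡.sym (ev-powE (polyE G ⊗ wk ℓ) (suc (e ℕ.+ d)) (t ∷ ρ)))))))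

    noPoly : ∀ es G → Hyp es [] G → ¬ ¬ Rad (Sys es []) (polyE G)
    noPoly es G hyp = ¬¬-map (rad-poly G) (¬¬-All (go G (λ ρ hes → hornerVan (evL G ρ) (λ t → hyp t ρ hes []))))
      where
      go : ∀ cs → (∀ ρ → All (ZeroAt ρ) es → AllZ (evL cs ρ)) → All (λ c → ¬ ¬ Rad (_∈ es) c) cs
      go [] h = []
      go (c ∷ cs) h = ns es c (λ ρ hes → All.head (h ρ hes)) ∷ go cs (λ ρ hes → All.tail (h ρ hes))

    swapS : ∀ {es p q rest f} → Sys {n} es (p ∷ q ∷ rest) f → Rad (Sys es (q ∷ p ∷ rest)) f
    swapS (inE e) = gen (inE e)
    swapS (inP (here e)) = gen (inP (there (here e)))
    swapS (inP (there (here e))) = gen (inP (here e))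
    swapS (inP (there (there e))) = gen (inP (there (there e)))

    swapH : ∀ es p q rest (G : List (Expr n)) → Hyp es (p ∷ q ∷ rest) G → Hyp es (q ∷ p ∷ rest) G
    swapH es p q rest G hyp t ρ hes (hq ∷ hp ∷ hr) = hyp t ρ hes (hp ∷ hq ∷ hr)

    swap-size : ∀ (p q : List (Expr n)) rest → sizeP (p ∷ q ∷ rest) ≡ sizeP (q ∷ p ∷ rest)
    swap-size p q rest = solveℕ 3 (λ a b c → con 1 :ℕ+ a :ℕ+ (con 1 :ℕ+ b :ℕ+ c) :ℕ= con 1 :ℕ+ b :ℕ+ (con 1 :ℕ+ a :ℕ+ c)) ≡.refl (length p) (length q) (sizeP rest)
      where
      open import Data.Nat.Solver using (module +-*-Solver)
      open +-*-Solver renaming (solve to solveℕ; _:+_ to _:ℕ+_; _:=_ to _:ℕ=_)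

    pair : ∀ es p q rest G → Hyp es (p ∷ q ∷ rest) G → Rec (sizeP (p ∷ q ∷ rest)) → ¬ ¬ Rad (Sys es (p ∷ q ∷ rest)) (polyE G)
    pair es [] q rest G hyp rec = ¬¬-map (rad-mono λ { (inE e) → gen (inE e) ; (inP p) → gen (inP (there p)) })
      (rec es (q ∷ rest) G ℕP.≤-refl (λ t ρ hes hr → hyp t ρ hes (refl ∷ hr)))
    pair es p [] rest G hyp rec = ¬¬-map (rad-mono swapS) (¬¬-map (rad-mono λ { (inE e) → gen (inE e) ; (inP p) → gen (inP (there p)) })
      (rec es (p ∷ rest) G (ℕP.≤-reflexive (swap-size [] p rest)) (λ t ρ hes hr → swapH es p [] rest G hyp t ρ hes (refl ∷ hr))))
    pair es (a ∷ as) (b ∷ bs) rest G hyp rec with ℕP.≤-total (LP.dg (toLP a as)) (LP.dg (toLP b bs))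
    ... | inj₁ le = ≡.subst₂ (λ p q → Hyp es (p ∷ q ∷ rest) G → Rec (sizeP (p ∷ q ∷ rest)) → ¬ ¬ Rad (Sys es (p ∷ q ∷ rest)) (polyE G))
                     (toLP-list a as) (toLP-list b bs) (reduce es (toLP a as) (toLP b bs) rest G le) hyp rec
    ... | inj₂ le = ¬¬-map (rad-mono swapS) (≡.subst₂ (λ p q → Hyp es (p ∷ q ∷ rest) G → Rec (sizeP (p ∷ q ∷ rest)) → ¬ ¬ Rad (Sys es (p ∷ q ∷ rest)) (polyE G))
                     (toLP-list b bs) (toLP-list a as) (reduce es (toLP b bs) (toLP a as) rest G le) (swapH es (a ∷ as) (b ∷ bs) rest G hyp)
                     (≡.subst Rec (swap-size (a ∷ as) (b ∷ bs) rest) rec))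

    eliminate : ∀ m → Rec m
    eliminate (suc m) es ps G (s≤s le) hyp = go ps le hyp
      where
      rec : ∀ {s} → s ℕ.≤ m → Rec s
      rec le es' ps' G' lt = eliminate m es' ps' G' (ℕP.<-≤-trans lt le)
      go : ∀ ps → sizeP ps ℕ.≤ m → Hyp es ps G → ¬ ¬ Rad (Sys es ps) (polyE G)
      go [] le hyp = noPoly es G hyp
      go ([] ∷ []) le hyp = ¬¬-map (rad-mono λ { (inE e) → gen (inE e) ; (inP ()) }) (noPoly es G (λ t ρ hes hr → hyp t ρ hes (refl ∷ hr)))
      go ((a ∷ as) ∷ []) le hyp = ≡.subst (λ p → Hyp es (p ∷ []) G → Rec (sizeP (p ∷ [])) → ¬ ¬ Rad (Sys es (p ∷ [])) (polyE G))
                     (toLP-list a as) (single es (toLP a as) G) hyp (rec le)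
      go (p ∷ q ∷ rest) le hyp = pair es p q rest G hyp (rec le)

  -- Without variables the equations are integers. A nonzero one makes every `g` a torsion element;
  -- if all are zero, `g` is an integer that is zero in the field, hence zero.
  nullstellensatz : ∀ n → NS n
  nullstellensatz zero es g h κ with All.all? (λ e → evℤ e [] ℤ.≟ pos 0) es
  ... | yes az = κ (ext zer λ { [] → ≡.sym (cz (evℤ g []) (trans (sym (ev-hom g [])) (h [] (All.map (λ {e} z → trans (ev-hom e []) (reflexive (≡.cong intCast z))) az)))) })
    where open Hom (InfDom.ring infDom)
  ... | no naz = ⊥-elim (naz (All.tabulate λ {e} e∈ → ℤ-stable λ nz → κ (tor {c = evℤ e []} nz (ext (mul g (gen e∈)) λ { [] →
          ≡.trans (ℤP.*-comm (evℤ g []) (evℤ e [])) (≡.cong (ℤ._* evℤ g []) (≡.sym (castℤ (evℤ e [])))) }))))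
  nullstellensatz (suc n) es g h = ¬¬-map (λ r → ext (rad-mono mono r) λ { (t ∷ ρ) → ≡.trans (evZP (toPoly g) t ρ) (≡.sym (Uni.ev-toPoly ℤR g t ρ)) })
      (eliminate (nullstellensatz n) (suc (sizeP ps)) [] ps (toPoly g) ℕP.≤-refl hyp)
    where
    ps = List.map toPoly es
    hyp : Hyp [] ps (toPoly g)
    hyp t ρ [] hps = trans (sym (ev-toPoly g t ρ)) (h (t ∷ ρ) (conv es hps))
      where
      conv : ∀ es → All (λ p → evP p t ρ ≈ 0#) (List.map toPoly es) → All (ZeroAt (t ∷ ρ)) es
      conv [] [] = []
      conv (e ∷ es) (z ∷ zs) = trans (ev-toPoly e t ρ) z ∷ conv es zs
    mem : ∀ {p} es → p ∈ List.map toPoly es → Σ _ λ e → e ∈ es × p ≡ toPoly e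
    mem (e ∷ es) (here eq) = e , here ≡.refl , eq
    mem (e ∷ es) (there p∈) with mem es p∈
    ... | e' , e∈ , eq = e' , there e∈ , eq
    mono : ∀ {f} → Sys [] ps f → Rad (_∈ es) f
    mono (inP p∈) with mem es p∈
    ... | e , e∈ , ≡.refl = ext (gen e∈) λ { (t ∷ ρ) → ≡.trans (Uni.ev-toPoly ℤR e t ρ) (≡.sym (evZP (toPoly e) t ρ)) }

  no-zero⇒unit : ∀ {n} (es : List (Expr n)) → (∀ ρ → ¬ All (ZeroAt ρ) es) → ¬ ¬ Σ ℤ λ b → ¬ b ≡ pos 0 × Idl (_∈ es) (con b)
  no-zero⇒unit es h = ¬¬-map conv (nullstellensatz _ es (con (pos 1)) (λ ρ hes → ⊥-elim (h ρ hes)))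
    where
    conv : Rad (_∈ es) (con (pos 1)) → Σ ℤ λ b → ¬ b ≡ pos 0 × Idl (_∈ es) (con b)
    conv r with rad-ideal r
    ... | N , b , nb , i = b , nb , ext i λ ρ → ≡.trans (≡.cong (ZK.intCast b ℤ.*_) (≡.trans (ev-powE (con (pos 1)) N ρ) (ZK.pow-1 N))) (ℤP.*-identityʳ _)

-- Total degree and leading forms

module DZ = Dom ℤ-InfDom

anyVec? : ∀ {g} n {P : Vec (Fin g) n → Set} → (∀ a → Dec (P a)) → Dec (Σ (Vec (Fin g) n) P)
anyVec? zero P? with P? []
... | yes p = yes ([] , p)
... | no np = no λ { ([] , p) → np p }
anyVec? (suc n) P? with FinP.any? (λ i → anyVec? n (λ a → P? (i ∷ a)))
... | yes (i , a , p) = yes (i ∷ a , p)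
... | no np = no λ { (i ∷ a , p) → np (i , a , p) }

-- Over the integers non-vanishing can be decided, and the witness has entries below `g`; these
-- small witnesses enter the final bound.
gridSearch : ∀ {n} g (e : Expr n) → deg e ℕ.< g → (Σ (Vec (Fin g) n) λ a → ¬ evℤ e (Vec.map posFin a) ≡ pos 0) ⊎ Uni.Van ℤR e
gridSearch {n} g e d with anyVec? {g} n (λ a → ¬? (evℤ e (Vec.map posFin a) ℤ.≟ pos 0))
... | yes r = inj₁ r
... | no nr = inj₂ (Uni.gridVan ℤR ℤ-domain posFin posFin-distinct e d (λ a → ℤ-stable λ k → nr (a , k)))

zeroCf : ∀ {L} M → Cf L M
zeroCf zero = pos 0
zeroCf (suc M) = Vec.replicate _ (zeroCf M)

zeroCf-Z : ∀ {L} M → CfZ {L} M (zeroCf M)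
zeroCf-Z zero = ≡.refl
zeroCf-Z {L} (suc M) i = ≡.subst (CfZ M) (≡.sym (VecP.lookup-replicate i (zeroCf M))) (zeroCf-Z M)

cfz-ev : ∀ {L} M (c : Cf L M) → CfZ M c → ∀ ρ → evℤ (cfE M c) ρ ≡ pos 0
cfz-evl : ∀ {L} M {l} (v : Vec (Cf L M) l) → (∀ i → CfZ M (lookup v i)) → ∀ t ρ → Uni.evP ℤR (cfEl M v) t ρ ≡ pos 0
cfz-ev zero c z ρ = ≡.trans (castℤ c) z
cfz-ev (suc M) v z (t ∷ ρ) = ≡.trans (evZP (cfEl M v) t ρ) (cfz-evl M v z t ρ)
cfz-evl M [] z t ρ = ≡.refl
cfz-evl M (c ∷ cs) z t ρ = ≡.trans (≡.cong₂ (λ u w → u ℤ.+ t ℤ.* w) (cfz-ev M c (z zero) ρ) (cfz-evl M cs (λ i → z (suc i)) t ρ)) (≡.trans (ℤP.+-identityˡ _) (ℤP.*-zeroʳ t))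

-- homogeneous component of total degree e
hp : ∀ {L} M → ℕ → Cf L M → Cf L M
hpv : ∀ {L} M {l} → ℕ → Vec (Cf L M) l → Vec (Cf L M) l
hp zero zero c = c
hp zero (suc e) c = pos 0
hp (suc M) e v = hpv M e v
hpv M e [] = []
hpv M zero (c ∷ cs) = hp M zero c ∷ Vec.map (λ _ → zeroCf M) cs
hpv M (suc e) (c ∷ cs) = hp M (suc e) c ∷ hpv M e cs

-- No term has total degree above e. The recursive form allows e to be lowered step by step until
-- the form of degree e is nonzero.
Top : ∀ {L} M → ℕ → Cf L M → Set
TopV : ∀ {L} M {l} → ℕ → Vec (Cf L M) l → Set
Top zero e c = ⊤
Top (suc M) e v = TopV M e v
TopV M e [] = ⊤
TopV M zero (c ∷ cs) = Top M zero c × (∀ i → CfZ M (lookup cs i))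
TopV M (suc e) (c ∷ cs) = Top M (suc e) c × TopV M e cs

top-all : ∀ {L} M (c : Cf L M) e → M ℕ.* L ℕ.≤ e → Top M e c
top-allV : ∀ {L} M {l} (v : Vec (Cf L M) l) e → l ℕ.+ M ℕ.* L ℕ.≤ e → TopV M e v
top-all zero c e h = tt
top-all (suc M) v e h = top-allV M v e h
top-allV M [] e h = tt
top-allV M (c ∷ cs) (suc e) (s≤s h) = top-all M c (suc e) (ℕP.≤-trans (ℕP.m≤n+m _ _) (ℕP.≤-trans h (ℕP.n≤1+n e))) , top-allV M cs e h

top-down : ∀ {L} M (c : Cf L M) e → Top M (suc e) c → CfZ M (hp M (suc e) c) → Top M e c
top-downV : ∀ {L} M {l} (v : Vec (Cf L M) l) e → TopV M (suc e) v → (∀ i → CfZ M (lookup (hpv M (suc e) v) i)) → TopV M e v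
top-zero : ∀ {L} M (c : Cf L M) → Top M zero c → CfZ M (hp M zero c) → CfZ M c
top-zeroV : ∀ {L} M {l} (v : Vec (Cf L M) l) → TopV M zero v → (∀ i → CfZ M (lookup (hpv M zero v) i)) → ∀ i → CfZ M (lookup v i)
top-down zero c e t z = tt
top-down (suc M) v e t z = top-downV M v e t z
top-downV M [] e t z = tt
top-downV M (c ∷ cs) zero (tc , ts) z = top-down M c zero tc (z zero) , top-zeroV M cs ts (λ i → z (suc i))
top-downV M (c ∷ cs) (suc e) (tc , ts) z = top-down M c (suc e) tc (z zero) , top-downV M cs e ts (λ i → z (suc i))
top-zero zero c t z = z
top-zero (suc M) v t z = top-zeroV M v t z
top-zeroV M (c ∷ cs) (tc , zs) z zero = top-zero M c tc (z zero)
top-zeroV M (c ∷ cs) (tc , zs) z (suc i) = zs i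

top-find : ∀ {L} M (c : Cf L M) → ¬ CfZ M c → Σ ℕ λ e → e ℕ.≤ M ℕ.* L × Top M e c × ¬ CfZ M (hp M e c)
top-find {L} M c nz = go (M ℕ.* L) ℕP.≤-refl (top-all M c _ ℕP.≤-refl)
  where
  go : ∀ e → e ℕ.≤ M ℕ.* L → Top M e c → Σ ℕ λ e → e ℕ.≤ M ℕ.* L × Top M e c × ¬ CfZ M (hp M e c)
  go e le t with CfZ? M (hp M e c)
  ... | no n = e , le , t , n
  go zero le t | yes z = ⊥-elim (nz (top-zero M c t z))
  go (suc e) le t | yes z = go e (ℕP.≤-trans (ℕP.n≤1+n e) le) (top-down M c e t z)


module LowFun (N : ℕ) where
  Fn : Set
  Fn = ℤ → Vec ℤ N → ℤ

  -- Polynomials in `V` of degree below e over the polynomials in `Z`: what may be neglected against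
  -- V^e.
  Lo : ℕ → Fn → Set
  Lo e h = Σ (Vec (Expr N) e) λ Cs → ∀ V Z → h V Z ≡ VZ.evV Cs V Z

  lo-ext : ∀ {e h h'} → Lo e h → (∀ V Z → h V Z ≡ h' V Z) → Lo e h'
  lo-ext (Cs , eq) f = Cs , λ V Z → ≡.trans (≡.sym (f V Z)) (eq V Z)

  lo-zero : ∀ e → Lo e (λ _ _ → pos 0)
  lo-zero e = Vec.replicate e (con (pos 0)) , λ V Z → ≡.sym (V2Z.evP-zeros e V Z)

  lo-add : ∀ {e h h'} → Lo e h → Lo e h' → Lo e (λ V Z → h V Z ℤ.+ h' V Z)
  lo-add {e} (Cs , eq) (Ds , eq') = zipWith _⊕_ Cs Ds , λ V Z → ≡.trans (≡.cong₂ ℤ._+_ (eq V Z) (eq' V Z)) (go Cs Ds V Z)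
    where
    go : ∀ {e} (Cs Ds : Vec (Expr N) e) V Z → VZ.evV Cs V Z ℤ.+ VZ.evV Ds V Z ≡ VZ.evV (zipWith _⊕_ Cs Ds) V Z
    go [] [] V Z = ≡.refl
    go (c ∷ Cs) (d ∷ Ds) V Z = ≡.trans (ZK.solve 5 (λ a b t u v → (a ZK.:+ t ZK.:* u) ZK.:+ (b ZK.:+ t ZK.:* v) ZK.:= (a ZK.:+ b) ZK.:+ t ZK.:* (u ZK.:+ v)) ≡.refl
      (evℤ c Z) (evℤ d Z) V (VZ.evV Cs V Z) (VZ.evV Ds V Z)) (≡.cong (λ u → (evℤ c Z ℤ.+ evℤ d Z) ℤ.+ V ℤ.* u) (go Cs Ds V Z))

  lo-sc : ∀ {e h} (a : Expr N) → Lo e h → Lo e (λ V Z → evℤ a Z ℤ.* h V Z)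
  lo-sc a (Cs , eq) = Vec.map (a ⊗_) Cs , λ V Z → ≡.trans (≡.cong (evℤ a Z ℤ.*_) (eq V Z)) (≡.sym (VZ.evV-sc a Cs V Z))

  lo-V : ∀ {e h} → Lo e h → Lo (suc e) (λ V Z → V ℤ.* h V Z)
  lo-V (Cs , eq) = con (pos 0) ∷ Cs , λ V Z → ≡.trans (≡.cong (V ℤ.*_) (eq V Z)) (≡.sym (ℤP.+-identityˡ _))

  snoc0 : ∀ {e} → Vec (Expr N) e → Vec (Expr N) (suc e)
  snoc0 [] = con (pos 0) ∷ []
  snoc0 (c ∷ cs) = c ∷ snoc0 cs

  lo-suc : ∀ {e h} → Lo e h → Lo (suc e) h
  lo-suc (Cs , eq) = snoc0 Cs , λ V Z → ≡.trans (eq V Z) (go Cs V Z)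
    where
    go : ∀ {e} (Cs : Vec (Expr N) e) V Z → VZ.evV Cs V Z ≡ VZ.evV (snoc0 Cs) V Z
    go [] V Z = ≡.sym (≡.trans (ℤP.+-identityˡ _) (ℤP.*-zeroʳ V))
    go (c ∷ Cs) V Z = ≡.cong (λ u → evℤ c Z ℤ.+ V ℤ.* u) (go Cs V Z)

  lo-mono : ∀ e (a : Expr N) → Lo (suc e) (λ V Z → ZK.pow V e ℤ.* evℤ a Z)
  lo-mono zero a = a ∷ [] , λ V Z → ≡.trans (ℤP.*-identityˡ _) (≡.sym (≡.trans (≡.cong (λ zz → evℤ a Z ℤ.+ zz) (ℤP.*-zeroʳ V)) (ℤP.+-identityʳ _)))
  lo-mono (suc e) a = lo-ext (lo-V (lo-mono e a)) λ V Z → ≡.sym (ℤP.*-assoc V _ _)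

  lin : ∀ {M} → Vec (Expr N) M → Vec ℤ M → ℤ → Vec ℤ N → Vec ℤ M
  lin [] [] V Z = []
  lin (a ∷ as) (α ∷ αs) V Z = (evℤ a Z ℤ.+ α ℤ.* V) ∷ lin as αs V Z

  -- substituting Z + αV: the coefficient of V^e is the degree e form at α
  topForm : ∀ {L} M (c : Cf L M) e (as : Vec (Expr N) M) αs → Top M e c →
            Lo e (λ V Z → evℤ (cfE M c) (lin as αs V Z) ℤ.+ (ℤ.- (ZK.pow V e ℤ.* evℤ (cfE M (hp M e c)) αs)))
  topFormV : ∀ {L} M {l} (v : Vec (Cf L M) l) e (a : Expr N) (as : Vec (Expr N) M) α αs → TopV M e v →
            Lo e (λ V Z → Uni.evP ℤR (cfEl M v) (evℤ a Z ℤ.+ α ℤ.* V) (lin as αs V Z) ℤ.+ (ℤ.- (ZK.pow V e ℤ.* Uni.evP ℤR (cfEl M (hpv M e v)) α αs)))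
  topForm zero c zero [] [] t = lo-ext (lo-zero 0) λ V Z → ≡.sym (ZK.solve 1 (λ c → c ZK.:+ ZK.:- (ZK.con (pos 1) ZK.:* c) ZK.:= ZK.con (pos 0)) ≡.refl (ZK.intCast c))
  topForm zero c (suc e) [] [] t = lo-ext (lo-c e) λ V Z → ≡.trans (≡.sym (ℤP.+-identityʳ (ZK.intCast c)))
      (≡.cong (λ u → ZK.intCast c ℤ.+ u) (≡.sym (≡.trans (≡.cong ℤ.-_ (ℤP.*-zeroʳ (ZK.pow V (suc e)))) ≡.refl)))
    where
    lo-c : ∀ e → Lo (suc e) (λ V Z → ZK.intCast c)
    lo-c zero = lo-ext (lo-mono 0 (con c)) λ V Z → ℤP.*-identityˡ _
    lo-c (suc e) = lo-suc (lo-c e)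
  topForm (suc M) v e (a ∷ as) (α ∷ αs) t = lo-ext (topFormV M v e a as α αs t) λ V Z →
    ≡.cong₂ (λ u w → u ℤ.+ (ℤ.- (ZK.pow V e ℤ.* w))) (≡.sym (evZP (cfEl M v) _ _)) (≡.sym (evZP (cfEl M (hpv M e v)) α αs))
  topFormV M [] e a as α αs t = lo-ext (lo-zero e) λ V Z → ≡.sym (≡.trans (ℤP.+-identityˡ _) (≡.cong ℤ.-_ (ℤP.*-zeroʳ (ZK.pow V e))))
  topFormV M (c ∷ cs) zero a as α αs (tc , zs) = lo-ext (topForm M c zero as αs tc) λ V Z →
    ≡.cong₂ (λ u w → u ℤ.+ (ℤ.- (ZK.pow V 0 ℤ.* w)))
      (≡.sym (≡.trans (≡.cong (λ u → evℤ (cfE M c) (lin as αs V Z) ℤ.+ (evℤ a Z ℤ.+ α ℤ.* V) ℤ.* u) (cfz-evl M cs zs _ _)) (≡.trans (≡.cong (λ zz → evℤ (cfE M c) (lin as αs V Z) ℤ.+ zz) (ℤP.*-zeroʳ (evℤ a Z ℤ.+ α ℤ.* V))) (ℤP.+-identityʳ (evℤ (cfE M c) (lin as αs V Z))))))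
      (≡.sym (≡.trans (≡.cong (λ u → evℤ (cfE M (hp M 0 c)) αs ℤ.+ α ℤ.* u) (cfz-evl M (Vec.map (λ _ → zeroCf M) cs) (λ i → ≡.subst (CfZ M) (≡.sym (lookup-map (λ _ → zeroCf M) cs i)) (zeroCf-Z M)) α αs))
        (≡.trans (≡.cong (λ zz → evℤ (cfE M (hp M 0 c)) αs ℤ.+ zz) (ℤP.*-zeroʳ α)) (ℤP.+-identityʳ (evℤ (cfE M (hp M 0 c)) αs)))))
  -- The factor `a + α V` lifts the top term of the tail to V^(e+1) with coefficient multiplied by
  -- α; its product with `a` stays at V^e and is recorded by `lo-mono`.
  topFormV M (c ∷ cs) (suc e) a as α αs (tc , ts) = lo-ext
     (lo-add (topForm M c (suc e) as αs tc) (lo-add (lo-suc (lo-sc a ih)) (lo-add (lo-V (lo-sc (con α) ih)) (lo-mono e (a ⊗ con h'))))) λ V Z →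
       ≡.trans (≡.cong₂ (λ u w → (evℤ (cfE M c) (lin as αs V Z) ℤ.+ (ℤ.- (V ℤ.* ZK.pow V e ℤ.* evℤ (cfE M (hp M (suc e) c)) αs))) ℤ.+
            (evℤ a Z ℤ.* (X V Z ℤ.+ (ℤ.- (ZK.pow V e ℤ.* h'))) ℤ.+ (V ℤ.* (u ℤ.* (X V Z ℤ.+ (ℤ.- (ZK.pow V e ℤ.* h')))) ℤ.+ ZK.pow V e ℤ.* (evℤ a Z ℤ.* w)))) (castℤ α) (castℤ h'))
        (ZK.solve 8 (λ c V p k a x h α → (c ZK.:+ ZK.:- (V ZK.:* p ZK.:* k)) ZK.:+ (a ZK.:* (x ZK.:+ ZK.:- (p ZK.:* h)) ZK.:+ (V ZK.:* (α ZK.:* (x ZK.:+ ZK.:- (p ZK.:* h))) ZK.:+ p ZK.:* (a ZK.:* h)))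
            ZK.:= (c ZK.:+ (a ZK.:+ α ZK.:* V) ZK.:* x) ZK.:+ ZK.:- (V ZK.:* p ZK.:* (k ZK.:+ α ZK.:* h))) ≡.refl
          (evℤ (cfE M c) (lin as αs V Z)) V (ZK.pow V e) (evℤ (cfE M (hp M (suc e) c)) αs) (evℤ a Z) (X V Z) h' α)
    where
    ih = topFormV M cs e a as α αs ts
    h' = Uni.evP ℤR (cfEl M (hpv M e cs)) α αs
    X : Fn
    X V Z = Uni.evP ℤR (cfEl M cs) (evℤ a Z ℤ.+ α ℤ.* V) (lin as αs V Z)

scV : ∀ {M} → ℤ → Vec ℤ M → Vec ℤ M
scV s = Vec.map (s ℤ.*_)

hp-hom : ∀ {L} M (c : Cf L M) e s αs → evℤ (cfE M (hp M e c)) (scV s αs) ≡ ZK.pow s e ℤ.* evℤ (cfE M (hp M e c)) αs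
hp-homV : ∀ {L} M {l} (v : Vec (Cf L M) l) e s α αs → Uni.evP ℤR (cfEl M (hpv M e v)) (s ℤ.* α) (scV s αs) ≡ ZK.pow s e ℤ.* Uni.evP ℤR (cfEl M (hpv M e v)) α αs
hp-hom zero c zero s αs = ≡.sym (ℤP.*-identityˡ _)
hp-hom zero c (suc e) s αs = ≡.sym (ℤP.*-zeroʳ (ZK.pow s (suc e)))
hp-hom (suc M) v e s (α ∷ αs) = ≡.trans (evZP (cfEl M (hpv M e v)) (s ℤ.* α) (scV s αs)) (≡.trans (hp-homV M v e s α αs) (≡.cong (ZK.pow s e ℤ.*_) (≡.sym (evZP (cfEl M (hpv M e v)) α αs))))
hp-homV M [] e s α αs = ≡.sym (ℤP.*-zeroʳ (ZK.pow s e))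
hp-homV M (c ∷ cs) zero s α αs = ≡.trans (≡.cong₂ (λ u w → u ℤ.+ (s ℤ.* α) ℤ.* w) (hp-hom M c 0 s αs) (z (s ℤ.* α) (scV s αs)))
   (≡.trans (ZK.solve 3 (λ s α u → ZK.con (pos 1) ZK.:* u ZK.:+ (s ZK.:* α) ZK.:* ZK.con (pos 0) ZK.:= ZK.con (pos 1) ZK.:* (u ZK.:+ α ZK.:* ZK.con (pos 0))) ≡.refl s α (evℤ (cfE M (hp M 0 c)) αs))
     (≡.cong (λ w → pos 1 ℤ.* (evℤ (cfE M (hp M 0 c)) αs ℤ.+ α ℤ.* w)) (≡.sym (z α αs))))
  where
  z : ∀ t ρ → Uni.evP ℤR (cfEl M (Vec.map (λ _ → zeroCf M) cs)) t ρ ≡ pos 0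
  z = cfz-evl M (Vec.map (λ _ → zeroCf M) cs) (λ i → ≡.subst (CfZ M) (≡.sym (lookup-map (λ _ → zeroCf M) cs i)) (zeroCf-Z M))
hp-homV M (c ∷ cs) (suc e) s α αs = ≡.trans (≡.cong₂ (λ u w → u ℤ.+ (s ℤ.* α) ℤ.* w) (hp-hom M c (suc e) s αs) (hp-homV M cs e s α αs))
   (ZK.solve 5 (λ s p u α w → s ZK.:* p ZK.:* u ZK.:+ (s ZK.:* α) ZK.:* (p ZK.:* w) ZK.:= s ZK.:* p ZK.:* (u ZK.:+ α ZK.:* w)) ≡.refl s (ZK.pow s e) (evℤ (cfE M (hp M (suc e) c)) αs) α (Uni.evP ℤR (cfEl M (hpv M e cs)) α αs))

-- a nonzero form does not vanish identically on the hyperplane where its first argument is 1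
module Dehom {L : ℕ} (M : ℕ) where
  hval : ℕ → Cf L M → Vec ℤ M → ℤ
  hval e c αs = evℤ (cfE M (hp M e c)) αs

  -- The value of the form at `(1, s α)` as a polynomial in s: the component of degree i in the
  -- other arguments comes with s^i, which separates the components.
  P : ∀ {l} → ℕ → Vec (Cf L M) l → Vec ℤ M → ℤ → ℤ
  P e [] αs s = pos 0
  P zero (c ∷ cs) αs s = hval 0 c αs
  P (suc e) (c ∷ cs) αs s = ZK.pow s (suc e) ℤ.* hval (suc e) c αs ℤ.+ P e cs αs s

  P-ev : ∀ {l} e (v : Vec (Cf L M) l) αs s → P e v αs s ≡ Uni.evP ℤR (cfEl M (hpv M e v)) (pos 1) (scV s αs)
  P-ev e [] αs s = ≡.refl
  P-ev zero (c ∷ cs) αs s = ≡.sym (≡.trans (≡.cong₂ (λ u w → u ℤ.+ pos 1 ℤ.* w) (≡.trans (hp-hom M c 0 s αs) (ℤP.*-identityˡ _))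
     (cfz-evl M (Vec.map (λ _ → zeroCf M) cs) (λ i → ≡.subst (CfZ M) (≡.sym (lookup-map (λ _ → zeroCf M) cs i)) (zeroCf-Z M)) (pos 1) (scV s αs))) (ℤP.+-identityʳ _))
  P-ev (suc e) (c ∷ cs) αs s = ≡.cong₂ ℤ._+_ (≡.sym (hp-hom M c (suc e) s αs)) (≡.trans (P-ev e cs αs s) (≡.sym (ℤP.*-identityˡ _)))

  P-list : ∀ {l} e (v : Vec (Cf L M) l) αs → Σ (List ℤ) λ cs → length cs ℕ.≤ suc e × (∀ s → P e v αs s ≡ ZK.horner cs s)
  P-list e [] αs = [] , z≤n , λ s → ≡.refl
  P-list zero (c ∷ cs) αs = (hval 0 c αs ∷ []) , s≤s z≤n , λ s → ≡.sym (≡.trans (≡.cong (λ zz → hval 0 c αs ℤ.+ zz) (ℤP.*-zeroʳ s)) (ℤP.+-identityʳ _))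
  P-list (suc e) (c ∷ cs) αs with P-list e cs αs
  ... | ds , len , h = Uni.addL ℤR (sh (suc e)) ds , ℕP.≤-trans (ℕP.≤-reflexive (Uni.addL-len ℤR (sh (suc e)) ds)) (ℕP.⊔-lub (ℕP.≤-reflexive (sh-len (suc e))) (ℕP.≤-trans len (ℕP.n≤1+n (suc e)))) ,
      λ s → ≡.sym (≡.trans (Uni.horner-add ℤR (sh (suc e)) ds s) (≡.cong₂ ℤ._+_ (sh-ev (suc e) s) (≡.sym (h s))))
    where
    sh : ℕ → List ℤ
    sh zero = hval (suc e) c αs ∷ []
    sh (suc k) = pos 0 ∷ sh k
    sh-len : ∀ k → length (sh k) ≡ suc k
    sh-len zero = ≡.refl
    sh-len (suc k) = ≡.cong suc (sh-len k)
    sh-ev : ∀ k s → ZK.horner (sh k) s ≡ ZK.pow s k ℤ.* hval (suc e) c αs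
    sh-ev zero s = ≡.trans (≡.cong (λ zz → hval (suc e) c αs ℤ.+ zz) (ℤP.*-zeroʳ s)) (≡.trans (ℤP.+-identityʳ _) (≡.sym (ℤP.*-identityˡ _)))
    sh-ev (suc k) s = ≡.trans (ℤP.+-identityˡ _) (≡.trans (≡.cong (s ℤ.*_) (sh-ev k s)) (≡.sym (ℤP.*-assoc s _ _)))

  P-zero : ∀ {l} e (v : Vec (Cf L M) l) → (∀ αs s → P e v αs s ≡ pos 0) → ∀ i → CfZ M (lookup (hpv M e v) i)
  P-zero zero (c ∷ cs) h zero = cf-van M (hp M 0 c) (λ αs → h αs (pos 0))
  P-zero zero (c ∷ cs) h (suc i) = ≡.subst (CfZ M) (≡.sym (lookup-map (λ _ → zeroCf M) cs i)) (zeroCf-Z M)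
  P-zero (suc e) (c ∷ cs) h = λ { zero → cf-van M (hp M (suc e) c) hz
                                ; (suc i) → P-zero e cs (λ αs s → ≡.trans (≡.sym (≡.trans (≡.cong (λ u → ZK.pow s (suc e) ℤ.* u ℤ.+ P e cs αs s) (hz αs)) (≡.trans (≡.cong (ℤ._+ P e cs αs s) (ℤP.*-zeroʳ (ZK.pow s (suc e)))) (ℤP.+-identityˡ _)))) (h αs s)) i }
    where
    hz : ∀ αs → hval (suc e) c αs ≡ pos 0
    hz αs with P-list e cs αs
    ... | ds , len , eq = DZ.lead-extract (suc e) (hval (suc e) c αs) ds len (λ s → ≡.trans (≡.cong (λ zz → ZK.pow s (suc e) ℤ.* hval (suc e) c αs ℤ.+ zz) (≡.sym (eq s))) (h αs s))

  dehom : ∀ e (c : Cf L (suc M)) → (∀ αs → evℤ (cfE (suc M) (hp (suc M) e c)) (pos 1 ∷ αs) ≡ pos 0) → CfZ (suc M) (hp (suc M) e c)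
  dehom e v h = P-zero e v (λ αs s → ≡.trans (P-ev e v αs s) (≡.trans (≡.sym (evZP (cfEl M (hpv M e v)) (pos 1) (scV s αs))) (h (scV s αs))))

-- Noether normalisation by linear changes

-- The variables of Expr (suc n) are y (index 0) and x₁, …, xₙ; z₀ = y q₀ and zᵢ = xᵢ + y qᵢ.
base : ∀ n → Vec (Expr (suc n)) (suc n)
base n = con (pos 0) ∷ tabulate (λ i → var (suc i))

zE : ∀ {n} → Vec (Expr n) (suc n) → Vec (Expr (suc n)) (suc n)
zE {n} q = zipWith (λ b r → b ⊕ var zero ⊗ wk r) (base n) q

vE : ∀ {n} → Expr n → Expr (suc n)
vE f = var zero ⊗ wk f

upd : ∀ {n m} → Vec ℤ m → Expr n → Vec (Expr n) m → Vec (Expr n) m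
upd αs f q = zipWith (λ α r → r ⊕ con (ℤ.- α) ⊗ f) αs q

z-ev : ∀ {n} (q : Vec (Expr n) (suc n)) y x i → evℤ (lookup (zE q) i) (y ∷ x) ≡ evℤ (lookup (base n) i) (y ∷ x) ℤ.+ y ℤ.* evℤ (lookup q i) x
z-ev {n} q y x i = ≡.trans (≡.cong (λ e → evℤ e (y ∷ x)) (VecP.lookup-zipWith (λ b r → b ⊕ var zero ⊗ wk r) i (base n) q))
  (≡.cong (λ u → evℤ (lookup (base n) i) (y ∷ x) ℤ.+ y ℤ.* u) (evZw (lookup q i) y x))

upd-ev : ∀ {n m} αs (f : Expr n) (q : Vec (Expr n) m) x i → evℤ (lookup (upd αs f q) i) x ≡ evℤ (lookup q i) x ℤ.- lookup αs i ℤ.* evℤ f x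
upd-ev αs f q x i = ≡.trans (≡.cong (λ e → evℤ e x) (VecP.lookup-zipWith (λ α r → r ⊕ con (ℤ.- α) ⊗ f) i αs q))
  (≡.cong (λ u → evℤ (lookup q i) x ℤ.+ u) (≡.trans (≡.cong (ℤ._* evℤ f x) (castℤ (ℤ.- lookup αs i))) (≡.sym (ℤP.neg-distribˡ-* (lookup αs i) (evℤ f x)))))

base-deg : ∀ n i → deg (lookup (base n) i) ℕ.≤ 1
base-deg n zero = z≤n
base-deg n (suc i) = ℕP.≤-reflexive (≡.cong deg (VecP.lookup∘tabulate (λ i → var (suc i)) i))

zE-deg : ∀ {n} (q : Vec (Expr n) (suc n)) Δ → (∀ i → deg (lookup q i) ℕ.≤ Δ) → ∀ i → deg (lookup (zE q) i) ℕ.≤ suc Δ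
zE-deg {n} q Δ h i = ≡.subst (λ e → deg e ℕ.≤ suc Δ) (≡.sym (VecP.lookup-zipWith (λ b r → b ⊕ var zero ⊗ wk r) i (base n) q))
  (ℕP.⊔-lub (ℕP.≤-trans (base-deg n i) (s≤s z≤n)) (s≤s (ℕP.≤-trans (ℕP.≤-reflexive (deg-wk (lookup q i))) (h i))))

upd-deg : ∀ {n m} αs (f : Expr n) (q : Vec (Expr n) m) Δ → deg f ℕ.≤ Δ → (∀ i → deg (lookup q i) ℕ.≤ Δ) → ∀ i → deg (lookup (upd αs f q) i) ℕ.≤ Δ
upd-deg αs f q Δ hf hq i = ≡.subst (λ e → deg e ℕ.≤ Δ) (≡.sym (VecP.lookup-zipWith (λ α r → r ⊕ con (ℤ.- α) ⊗ f) i αs q)) (ℕP.⊔-lub (hq i) hf)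

vars : ∀ N → Vec (Expr N) N
vars N = tabulate var

evs-vars : ∀ {N} (Z : Vec ℤ N) → EvalE._≈ᵥ_ ℤR (EvalE.evs ℤR (vars N) Z) Z
evs-vars {N} Z = EvalE.≈ᵥ-from ℤR λ i → ≡.trans (lookup-map (λ e → evℤ e Z) (vars N) i) (≡.cong (λ e → evℤ e Z) (VecP.lookup∘tabulate var i))

-- integrality relation for v = y f over ℤ[z'] after the change z' = z - α v
record StepRel {n} (q : Vec (Expr n) (suc n)) (f : Expr n) (q' : Vec (Expr n) (suc n)) : Set where
  field
    αs : Vec ℤ (suc n)
    q'≡ : q' ≡ upd αs f q
    e : ℕ
    ct : ℤ
    ct≢0 : ¬ ct ≡ pos 0
    Cs : Vec (Expr (suc n)) e
    rel : ∀ ρ → let v = evℤ (vE f) ρ in ZK.pow v e ℤ.* ct ℤ.+ VZ.evV Cs v (EvalE.evs ℤR (zE q') ρ) ≡ pos 0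

-- Putting z = z' + α v into the relation gives v^e the coefficient `H(1, α)`. An α at which
-- `T ⊗ Cnd` is nonzero keeps this coefficient nonzero, and at the same time keeps the new `q₀`
-- nonzero at the fixed point x*.
module StepCore (n L : ℕ) (q : Vec (Expr n) (suc n)) (f : Expr n) (c : Cf L (suc (suc n)))
  (van : ∀ ρ → evℤ (cfE (suc (suc n)) c) (EvalE.evs ℤR (vE f ∷ zE q) ρ) ≡ pos 0)
  (x* : Vec ℤ n) (nz : ¬ evℤ (lookup q zero) x* ≡ pos 0)
  (e : ℕ) (top : Top (suc (suc n)) e c) (H≢0 : ¬ CfZ (suc (suc n)) (hp (suc (suc n)) e c)) where
  N = suc n
  open LowFun N
  H = hp (suc N) e c
  q₀* f* : ℤ
  q₀* = evℤ (lookup q zero) x*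
  f* = evℤ f x*
  T Cnd : Expr N
  T = sub (cfE (suc N) H) (con (pos 1) ∷ vars N)
  Cnd = con q₀* ⊕ con (ℤ.- f*) ⊗ var zero

  T-ev : ∀ ρ → evℤ T ρ ≡ evℤ (cfE (suc N) H) (pos 1 ∷ ρ)
  T-ev ρ = ≡.trans (EvalE-sub.ev-sub ℤR (cfE (suc N) H) (con (pos 1) ∷ vars N) ρ) (EvalE.ev-cong ℤR (cfE (suc N) H) (castℤ (pos 1) EvalE.∷ evs-vars ρ))

  T-nv : DZ.NonVan T
  T-nv v = H≢0 (Dehom.dehom N e c (λ ρ → ≡.trans (≡.sym (T-ev ρ)) (v ρ)))

  Cnd-ev : ∀ ρ → evℤ Cnd ρ ≡ q₀* ℤ.- lookup ρ zero ℤ.* f*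
  Cnd-ev ρ = ≡.trans (≡.cong₂ (λ u w → u ℤ.+ w ℤ.* lookup ρ zero) (castℤ q₀*) (castℤ (ℤ.- f*)))
    (ZK.solve 3 (λ q f r → q ZK.:+ (ZK.:- f) ZK.:* r ZK.:= q ZK.:- r ZK.:* f) ≡.refl q₀* f* (lookup ρ zero))

  Cnd-nv : DZ.NonVan Cnd
  Cnd-nv v = nz (≡.trans (≡.sym (≡.trans (Cnd-ev (pos 0 ∷ Vec.replicate n (pos 0))) (ℤP.+-identityʳ q₀*))) (v (pos 0 ∷ Vec.replicate n (pos 0))))

  TC-deg : deg (T ⊗ Cnd) ℕ.< suc N ℕ.* L ℕ.+ 2
  TC-deg = ℕP.≤-trans (s≤s (ℕP.+-mono-≤ (ℕP.≤-trans (deg-sub 1 (cfE (suc N) H) (con (pos 1) ∷ vars N) vdeg) (ℕP.≤-trans (ℕP.≤-reflexive (ℕP.*-identityʳ _)) (cfE-deg (suc N) H))) (ℕP.≤-refl {1})))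
             (ℕP.≤-reflexive (≡.sym (ℕP.+-suc (suc N ℕ.* L) 1)))
    where
    vdeg : ∀ i → deg (lookup (con (pos 1) ∷ vars N) i) ℕ.≤ 1
    vdeg zero = z≤n
    vdeg (suc i) = ℕP.≤-reflexive (≡.cong deg (VecP.lookup∘tabulate var i))

  module Chosen (αs : Vec ℤ N) (good : ¬ evℤ (T ⊗ Cnd) αs ≡ pos 0) where
    q' : Vec (Expr n) N
    q' = upd αs f q
    ct : ℤ
    ct = evℤ (cfE (suc N) H) (pos 1 ∷ αs)

    ct≢0 : ¬ ct ≡ pos 0
    ct≢0 h = good (≡.trans (≡.cong (ℤ._* evℤ Cnd αs) (≡.trans (T-ev αs) h)) (ℤP.*-zeroˡ (evℤ Cnd αs)))

    nz' : ¬ evℤ (lookup q' zero) x* ≡ pos 0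
    nz' h = good (≡.trans (≡.cong (evℤ T αs ℤ.*_) (≡.trans (Cnd-ev αs) (≡.trans (≡.sym (upd-ev αs f q x* zero)) h))) (ℤP.*-zeroʳ (evℤ T αs)))

    lin-lookup : ∀ v Z' {M} (as : Vec (Expr N) M) (βs : Vec ℤ M) i → lookup (lin as βs v Z') i ≡ evℤ (lookup as i) Z' ℤ.+ lookup βs i ℤ.* v
    lin-lookup v Z' (a ∷ as) (β ∷ βs) zero = ≡.refl
    lin-lookup v Z' (a ∷ as) (β ∷ βs) (suc i) = lin-lookup v Z' as βs i

    -- As z' = z - α v, adding α v gives z back; the terms y αᵢ f cancel.
    coord : ∀ y x i → lookup (lin (vars N) αs (evℤ (vE f) (y ∷ x)) (EvalE.evs ℤR (zE q') (y ∷ x))) i ≡ lookup (EvalE.evs ℤR (zE q) (y ∷ x)) i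
    coord y x i = ≡.trans (lin-lookup (evℤ (vE f) ρ) Z' (vars N) αs i)
        (≡.trans (≡.cong (λ u → u ℤ.+ lookup αs i ℤ.* evℤ (vE f) ρ) (≡.trans (≡.cong (λ e → evℤ e Z') (VecP.lookup∘tabulate var i))
           (≡.trans (lookup-map (λ e → evℤ e ρ) (zE q') i) (≡.trans (z-ev q' y x i) (≡.cong (λ u → evℤ (lookup (base n) i) ρ ℤ.+ y ℤ.* u) (upd-ev αs f q x i))))))
        (≡.trans (≡.cong (λ w → (evℤ (lookup (base n) i) ρ ℤ.+ y ℤ.* (evℤ (lookup q i) x ℤ.- lookup αs i ℤ.* evℤ f x)) ℤ.+ lookup αs i ℤ.* (y ℤ.* w)) (evZw f y x))
        (≡.trans (ZK.solve 5 (λ b y q a f → (b ZK.:+ y ZK.:* (q ZK.:- a ZK.:* f)) ZK.:+ a ZK.:* (y ZK.:* f) ZK.:= b ZK.:+ y ZK.:* q) ≡.refl (evℤ (lookup (base n) i) ρ) y (evℤ (lookup q i) x) (lookup αs i) (evℤ f x))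
        (≡.trans (≡.sym (z-ev q y x i)) (≡.sym (lookup-map (λ e → evℤ e ρ) (zE q) i))))))
      where
      ρ = y ∷ x
      Z' = EvalE.evs ℤR (zE q') ρ

    stepRel : Lo e (λ V Z → evℤ (cfE (suc N) c) (lin (con (pos 0) ∷ vars N) (pos 1 ∷ αs) V Z) ℤ.+ (ℤ.- (ZK.pow V e ℤ.* ct))) → StepRel q f q'
    stepRel (Cs , lo) = record { αs = αs ; q'≡ = ≡.refl ; e = e ; ct = ct ; ct≢0 = ct≢0 ; Cs = Cs ; rel = rel }
      where
      rel : ∀ ρ → ZK.pow (evℤ (vE f) ρ) e ℤ.* ct ℤ.+ VZ.evV Cs (evℤ (vE f) ρ) (EvalE.evs ℤR (zE q') ρ) ≡ pos 0
      rel (y ∷ x) = ≡.trans (≡.cong (λ u → ZK.pow v e ℤ.* ct ℤ.+ u) (≡.sym (lo v Z'))) (≡.trans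
        (ZK.solve 2 (λ p u → p ZK.:+ (u ZK.:+ ZK.:- p) ZK.:= u) ≡.refl (ZK.pow v e ℤ.* ct) (evℤ (cfE (suc N) c) (lin (con (pos 0) ∷ vars N) (pos 1 ∷ αs) v Z')))
        (≡.trans (EvalE.ev-cong ℤR (cfE (suc N) c) (≡.trans (ℤP.+-identityˡ _) (ℤP.*-identityˡ v) EvalE.∷ EvalE.≈ᵥ-from ℤR (coord y x))) (van (y ∷ x))))
        where
        v = evℤ (vE f) (y ∷ x)
        Z' = EvalE.evs ℤR (zE q') (y ∷ x)

-- the conclusion of Perron.perron, with its numerical parameters abstracted
Siegel : (N Δ L E : ℕ) → (ℕ → ℕ) → Set
Siegel N Δ L E Y = ∀ W → 1 ℕ.≤ W → (g : Vec (Expr N) (suc N)) → (∀ i → deg (lookup g i) ℕ.≤ Δ) →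
  (∀ (a : Vec (Fin E) N) i → ∣ evℤ (lookup g i) (Vec.map posFin a) ∣ ℕ.≤ W) →
  Σ (Cf L (suc N)) λ c → ¬ CfZ (suc N) c × CfB (2 ℕ.* Y W) (suc N) c × (∀ ρ → evℤ (cfE (suc N) c) (EvalE.evs ℤR g ρ) ≡ pos 0)

module Step (n Δ L E : ℕ) (Y : ℕ → ℕ) (perron : Siegel (suc n) (suc Δ) L E Y) where
  N = suc n

  -- Grid size in the search for α, hence a bound for its entries: `(N + 1) L` for the degree of
  -- `T`, 1 for `Cnd`, and 1 for strictness.
  Λ : ℕ
  Λ = suc N ℕ.* L ℕ.+ 2

  StepOut : (q : Vec (Expr n) N) (f : Expr n) (x* : Vec ℤ n) → Set
  StepOut q f x* = Σ (Vec ℤ N) λ αs → Bdd Λ αs × ¬ evℤ (lookup (upd αs f q) zero) x* ≡ pos 0 × StepRel q f (upd αs f q)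

  from-relation : ∀ q f x* → ¬ evℤ (lookup q zero) x* ≡ pos 0 → (c : Cf L (suc N)) → ¬ CfZ (suc N) c →
    (∀ ρ → evℤ (cfE (suc N) c) (EvalE.evs ℤR (vE f ∷ zE q) ρ) ≡ pos 0) → StepOut q f x*
  from-relation q f x* nz c cnz van with top-find (suc N) c cnz
  ... | e , _ , top , H≢0 with gridSearch (suc N ℕ.* L ℕ.+ 2) (SC.T ⊗ SC.Cnd) SC.TC-deg
    where module SC = StepCore n L q f c van x* nz e top H≢0
  ... | inj₂ v = ⊥-elim (DZ.nonvan-* SC.T SC.Cnd SC.T-nv SC.Cnd-nv v)
    where module SC = StepCore n L q f c van x* nz e top H≢0
  ... | inj₁ (a , good) = Vec.map posFin a , posFin-Bdd a , C.nz' , C.stepRel (LowFun.topForm (suc n) (suc N) c e (con (pos 0) ∷ vars N) (pos 1 ∷ Vec.map posFin a) top)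
    where
    module SC = StepCore n L q f c van x* nz e top H≢0
    module C = SC.Chosen (Vec.map posFin a) good

  gdeg : ∀ (q : Vec (Expr n) N) (g : Expr N) → (∀ i → deg (lookup q i) ℕ.≤ Δ) → deg g ℕ.≤ suc Δ → ∀ i → deg (lookup (g ∷ zE q) i) ℕ.≤ suc Δ
  gdeg q g hq hg zero = hg
  gdeg q g hq hg (suc i) = zE-deg q Δ hq i

  noether-step : ∀ (q : Vec (Expr n) N) (f : Expr n) → (∀ i → deg (lookup q i) ℕ.≤ Δ) → deg f ℕ.≤ Δ →
         ∀ W → 1 ℕ.≤ W → (∀ (a : Vec (Fin E) N) i → ∣ evℤ (lookup (vE f ∷ zE q) i) (Vec.map posFin a) ∣ ℕ.≤ W) →
         ∀ x* → ¬ evℤ (lookup q zero) x* ≡ pos 0 → StepOut q f x*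
  noether-step q f hq hf W hW hval x* nz with perron W hW (vE f ∷ zE q) (gdeg q (vE f) hq (s≤s (ℕP.≤-trans (ℕP.≤-reflexive (deg-wk f)) hf))) hval
  ... | c , cnz , _ , van = from-relation q f x* nz c cnz van

-- The tower of integral extensions

-- the ring generated by z(q) and the y f, f ∈ fs
data InR {n} (q : Vec (Expr n) (suc n)) (fs : List (Expr n)) : Expr (suc n) → Set where
  conR : ∀ c → InR q fs (con c)
  zR : ∀ i → InR q fs (lookup (zE q) i)
  vR : ∀ {f} → f ∈ fs → InR q fs (vE f)
  addR : ∀ {g h} → InR q fs g → InR q fs h → InR q fs (g ⊕ h)
  mulR : ∀ {g h} → InR q fs g → InR q fs h → InR q fs (g ⊗ h)
  extR : ∀ {g h} → InR q fs g → g ≗ₑ h → InR q fs h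

-- ℚ ⊗ 𝒜-span of 𝓑
data SpanQ {N} (𝒜 𝓑 : Expr N → Set) : Expr N → Set where
  gen : ∀ {b} → 𝓑 b → SpanQ 𝒜 𝓑 b
  zer : SpanQ 𝒜 𝓑 (con (pos 0))
  add : ∀ {g h} → SpanQ 𝒜 𝓑 g → SpanQ 𝒜 𝓑 h → SpanQ 𝒜 𝓑 (g ⊕ h)
  mul : ∀ {a h} → 𝒜 a → SpanQ 𝒜 𝓑 h → SpanQ 𝒜 𝓑 (a ⊗ h)
  ext : ∀ {g h} → SpanQ 𝒜 𝓑 g → g ≗ₑ h → SpanQ 𝒜 𝓑 h
  den : ∀ {c h} → ¬ c ≡ pos 0 → SpanQ 𝒜 𝓑 (con c ⊗ h) → SpanQ 𝒜 𝓑 h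

powers : ∀ {N} → Expr N → ℕ → List (Expr N)
powers v zero = []
powers v (suc e) = powE v e ∷ powers v e

pow∈ : ∀ {N} (v : Expr N) e i → i ℕ.< e → powE v i ∈ powers v e
pow∈ v (suc e) i (s≤s i≤e) with ℕP.m≤n⇒m<n∨m≡n i≤e
... | inj₁ lt = there (pow∈ v e i lt)
... | inj₂ ≡.refl = here ≡.refl

∈pow : ∀ {N} (v : Expr N) e {b} → b ∈ powers v e → Σ ℕ λ i → i ℕ.< e × b ≡ powE v i
∈pow v (suc e) (here eq) = e , ℕP.≤-refl , eq
∈pow v (suc e) (there m) with ∈pow v e m
... | i , lt , eq = i , ℕP.≤-trans lt (ℕP.n≤1+n e) , eq

mid-swap : ∀ a b c → a ℤ.* (b ℤ.* c) ≡ b ℤ.* (a ℤ.* c)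
mid-swap a b c = ZK.solve 3 (λ a b c → a ZK.:* (b ZK.:* c) ZK.:= b ZK.:* (a ZK.:* c)) ≡.refl a b c

-- Up to the integer `ct`, the relation expresses v^e by lower powers of v over the ring of z'.
-- Since z = z' + α v, the powers below e therefore span the ring of z and v over that of z', with
-- rational coefficients allowed.
module TowerStep {n} {q q' : Vec (Expr n) (suc n)} {f : Expr n} (fs : List (Expr n)) (sr : StepRel q f q') where
  open StepRel sr
  v = vE f
  𝒜' = InR q' fs
  Pw = powers v e

  -- For e = 0 the relation would read ct = 0.
  e-pos : Σ ℕ λ e' → e ≡ suc e'
  e-pos with e | Cs | rel
  ... | zero | [] | r = ⊥-elim (ct≢0 (≡.trans (≡.sym (≡.trans (ℤP.+-identityʳ _) (ℤP.*-identityˡ ct))) (r (Vec.replicate _ (pos 0)))))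
  ... | suc e' | _ | _ = e' , ≡.refl

  subR : ∀ (G : Expr (suc n)) → 𝒜' (sub G (zE q'))
  subR (con c) = conR c
  subR (var i) = zR i
  subR (G ⊕ H) = addR (subR G) (subR H)
  subR (G ⊗ H) = mulR (subR G) (subR H)

  low-span : ∀ {k} (Ds : Vec (Expr (suc n)) k) j → k ℕ.+ j ℕ.≤ e → Σ (Expr (suc n)) λ h → SpanQ 𝒜' (_∈ Pw) h ×
             (∀ ρ → evℤ h ρ ≡ ZK.pow (evℤ v ρ) j ℤ.* VZ.evV Ds (evℤ v ρ) (EvalE.evs ℤR (zE q') ρ))
  low-span [] j le = con (pos 0) , zer , λ ρ → ≡.sym (ℤP.*-zeroʳ (ZK.pow (evℤ v ρ) j))
  low-span (D ∷ Ds) j le with low-span Ds (suc j) (≡.subst (ℕ._≤ e) (≡.sym (ℕP.+-suc _ j)) le)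
  ... | h , s , eq = sub D (zE q') ⊗ powE v j ⊕ h , add (mul (subR D) (gen (pow∈ v e j (ℕP.≤-trans (s≤s (ℕP.m≤n+m j _)) le)))) s , λ ρ →
      ≡.trans (≡.cong₂ (λ u w → u ℤ.+ w) (≡.cong₂ ℤ._*_ (EvalE-sub.ev-sub ℤR D (zE q') ρ) (ev-powE v j ρ)) (eq ρ))
        (ZK.solve 4 (λ d p v u → d ZK.:* p ZK.:+ (v ZK.:* p) ZK.:* u ZK.:= p ZK.:* (d ZK.:+ v ZK.:* u)) ≡.refl (evℤ D (EvalE.evs ℤR (zE q') ρ)) (ZK.pow (evℤ v ρ) j) (evℤ v ρ) (VZ.evV Ds (evℤ v ρ) (EvalE.evs ℤR (zE q') ρ)))

  pow-next : ∀ i → i ℕ.< e → SpanQ 𝒜' (_∈ Pw) (v ⊗ powE v i)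
  pow-next i lt with ℕP.m≤n⇒m<n∨m≡n lt
  ... | inj₁ lt' = gen (pow∈ v e (suc i) lt')
  ... | inj₂ eq with low-span Cs 0 (ℕP.≤-reflexive (ℕP.+-identityʳ e))
  -- Now the product is v^e itself: the relation gives `ct v^e` in terms of lower powers, and `den`
  -- divides by `ct`.
  ... | h , s , hev = den {c = ct} ct≢0 (ext (mul (conR (ℤ.- pos 1)) s) λ ρ →
      ≡.trans (≡.cong₂ ℤ._*_ (castℤ (ℤ.- pos 1)) (≡.trans (hev ρ) (ℤP.*-identityˡ _)))
      (≡.trans (ZK.solve 2 (λ p u → ZK.con (ℤ.- pos 1) ZK.:* u ZK.:= p ZK.:- (p ZK.:+ u)) ≡.refl (ZK.pow (evℤ v ρ) e ℤ.* ct) (VZ.evV Cs (evℤ v ρ) (EvalE.evs ℤR (zE q') ρ)))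
      (≡.trans (≡.cong (λ u → ZK.pow (evℤ v ρ) e ℤ.* ct ℤ.- u) (rel ρ)) (≡.trans (ℤP.+-identityʳ _) (≡.trans (ℤP.*-comm _ ct)
        (≡.cong₂ ℤ._*_ (≡.sym (castℤ ct)) (≡.trans (≡.cong (ZK.pow (evℤ v ρ)) (≡.sym eq)) (≡.cong (evℤ v ρ ℤ.*_) (≡.sym (ev-powE v i ρ))))))))))

  mul-v : ∀ {h} → SpanQ 𝒜' (_∈ Pw) h → SpanQ 𝒜' (_∈ Pw) (v ⊗ h)
  mul-v (gen b∈) with ∈pow v e b∈
  ... | i , lt , ≡.refl = pow-next i lt
  mul-v zer = ext zer λ ρ → ≡.sym (ℤP.*-zeroʳ (evℤ v ρ))
  mul-v (add {g} {h} s t) = ext (add (mul-v s) (mul-v t)) λ ρ → ≡.sym (ℤP.*-distribˡ-+ (evℤ v ρ) (evℤ g ρ) (evℤ h ρ))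
  mul-v (mul {a} {h} a∈ s) = ext (mul a∈ (mul-v s)) λ ρ → mid-swap (evℤ a ρ) (evℤ v ρ) (evℤ h ρ)
  mul-v (ext s eq) = ext (mul-v s) λ ρ → ≡.cong (evℤ v ρ ℤ.*_) (eq ρ)
  mul-v (den {c} {h} nc s) = den nc (ext (mul-v s) λ ρ → mid-swap (evℤ v ρ) (ZK.intCast c) (evℤ h ρ))

  z-old : ∀ i ρ → evℤ (lookup (zE q') i) ρ ℤ.+ evℤ (con (lookup αs i)) ρ ℤ.* evℤ v ρ ≡ evℤ (lookup (zE q) i) ρ
  z-old i ρ@(y ∷ x) = ≡.trans (≡.cong₂ ℤ._+_ (≡.trans (z-ev q' y x i) (≡.cong (λ u → evℤ (lookup (base n) i) ρ ℤ.+ y ℤ.* u)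
       (≡.trans (≡.cong (λ p → evℤ (lookup p i) x) q'≡) (upd-ev αs f q x i)))) (≡.cong₂ (λ u w → u ℤ.* (y ℤ.* w)) (castℤ (lookup αs i)) (evZw f y x)))
     (≡.trans (ZK.solve 5 (λ b y q a f → (b ZK.:+ y ZK.:* (q ZK.:- a ZK.:* f)) ZK.:+ a ZK.:* (y ZK.:* f) ZK.:= b ZK.:+ y ZK.:* q) ≡.refl (evℤ (lookup (base n) i) ρ) y (evℤ (lookup q i) x) (lookup αs i) (evℤ f x))
       (≡.sym (z-ev q y x i)))

  mul-R : ∀ {g} → InR q (f ∷ fs) g → ∀ {h} → SpanQ 𝒜' (_∈ Pw) h → SpanQ 𝒜' (_∈ Pw) (g ⊗ h)
  mul-R (conR c) s = mul (conR c) s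
  mul-R (zR i) {h} s = ext (add (mul (zR i) s) (mul (conR (lookup αs i)) (mul-v s))) λ ρ →
     ≡.trans (ZK.solve 4 (λ z a v h → z ZK.:* h ZK.:+ a ZK.:* (v ZK.:* h) ZK.:= (z ZK.:+ a ZK.:* v) ZK.:* h) ≡.refl (evℤ (lookup (zE q') i) ρ) (ZK.intCast (lookup αs i)) (evℤ v ρ) (evℤ h ρ))
       (≡.cong (ℤ._* evℤ h ρ) (z-old i ρ))
  mul-R (vR (here ≡.refl)) s = mul-v s
  mul-R (vR (there m)) s = mul (vR m) s
  mul-R (addR {g} {g'} r r') {h} s = ext (add (mul-R r s) (mul-R r' s)) λ ρ → ≡.sym (ℤP.*-distribʳ-+ (evℤ h ρ) (evℤ g ρ) (evℤ g' ρ))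
  mul-R (mulR {g} {g'} r r') {h} s = ext (mul-R r (mul-R r' s)) λ ρ → ≡.sym (ℤP.*-assoc (evℤ g ρ) (evℤ g' ρ) (evℤ h ρ))
  mul-R (extR r eq) {h} s = ext (mul-R r s) λ ρ → ≡.cong (ℤ._* evℤ h ρ) (eq ρ)

  𝓑' : List (Expr (suc n)) → List (Expr (suc n))
  𝓑' 𝓑 = List.cartesianProductWith _⊗_ Pw 𝓑

  times-m : ∀ {𝓑 m} → m ∈ 𝓑 → ∀ {h} → SpanQ 𝒜' (_∈ Pw) h → SpanQ 𝒜' (_∈ 𝓑' 𝓑) (h ⊗ m)
  times-m m∈ (gen b∈) = gen (∈-cartesianProductWith⁺ _⊗_ b∈ m∈)
  times-m {m = m} m∈ zer = ext zer λ ρ → ≡.refl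
  times-m {m = m} m∈ (add {g} {h} s t) = ext (add (times-m m∈ s) (times-m m∈ t)) λ ρ → ≡.sym (ℤP.*-distribʳ-+ (evℤ m ρ) (evℤ g ρ) (evℤ h ρ))
  times-m {m = m} m∈ (mul {a} {h} a∈ s) = ext (mul a∈ (times-m m∈ s)) λ ρ → ≡.sym (ℤP.*-assoc (evℤ a ρ) (evℤ h ρ) (evℤ m ρ))
  times-m {m = m} m∈ (ext s eq) = ext (times-m m∈ s) λ ρ → ≡.cong (ℤ._* evℤ m ρ) (eq ρ)
  times-m {m = m} m∈ (den {c} {h} nc s) = den nc (ext (times-m m∈ s) λ ρ → ℤP.*-assoc (ZK.intCast c) (evℤ h ρ) (evℤ m ρ))

  mul-R' : ∀ {𝓑 g} → InR q (f ∷ fs) g → ∀ {h} → SpanQ 𝒜' (_∈ 𝓑' 𝓑) h → SpanQ 𝒜' (_∈ 𝓑' 𝓑) (g ⊗ h)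
  mul-R' {𝓑} {g} r (gen b∈) with List∈ b∈
    where
    open import Data.List.Membership.Propositional.Properties using (∈-cartesianProductWith⁻)
    List∈ : ∀ {b} → b ∈ 𝓑' 𝓑 → _
    List∈ = ∈-cartesianProductWith⁻ _⊗_ Pw 𝓑
  ... | p , m , p∈ , m∈ , ≡.refl = ext (times-m m∈ (mul-R r (gen p∈))) λ ρ → ℤP.*-assoc (evℤ g ρ) (evℤ p ρ) (evℤ m ρ)
  mul-R' {g = g} r zer = ext zer λ ρ → ≡.sym (ℤP.*-zeroʳ (evℤ g ρ))
  mul-R' {g = k} r (add {g} {h} s t) = ext (add (mul-R' r s) (mul-R' r t)) λ ρ → ≡.sym (ℤP.*-distribˡ-+ (evℤ k ρ) (evℤ g ρ) (evℤ h ρ))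
  mul-R' {g = k} r (mul {a} {h} a∈ s) = ext (mul a∈ (mul-R' r s)) λ ρ → mid-swap (evℤ a ρ) (evℤ k ρ) (evℤ h ρ)
  mul-R' {g = k} r (ext s eq) = ext (mul-R' r s) λ ρ → ≡.cong (evℤ k ρ ℤ.*_) (eq ρ)
  mul-R' {g = k} r (den {c} {h} nc s) = den nc (ext (mul-R' r s) λ ρ → mid-swap (evℤ k ρ) (ZK.intCast c) (evℤ h ρ))

  -- Transitivity of finite generation: generators over the larger ring are multiplied by generators
  -- of the larger ring over the smaller one.
  descend : ∀ {𝓑 h} → SpanQ (InR q (f ∷ fs)) (_∈ 𝓑) h → SpanQ 𝒜' (_∈ 𝓑' 𝓑) h
  descend (gen {b} b∈) = ext (gen (∈-cartesianProductWith⁺ _⊗_ one∈ b∈)) λ ρ → ≡.trans (≡.cong (ℤ._* evℤ b ρ) (castℤ (pos 1))) (ℤP.*-identityˡ _)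
    where
    one∈ : con (pos 1) ∈ Pw
    one∈ = pow∈ v e 0 (≡.subst (0 ℕ.<_) (≡.sym (proj₂ e-pos)) (s≤s z≤n))
  descend zer = zer
  descend (add s t) = add (descend s) (descend t)
  descend (mul a∈ s) = mul-R' a∈ (descend s)
  descend (ext s eq) = ext (descend s) eq
  descend (den nc s) = den nc (descend s)

data Tower {n} : Vec (Expr n) (suc n) → List (Expr n) → Vec (Expr n) (suc n) → Set where
  [] : ∀ {q} → Tower q [] q
  _∷_ : ∀ {q f fs q₁ q'} → StepRel q f q₁ → Tower q₁ fs q' → Tower q (f ∷ fs) q'

tower-span : ∀ {n} {q fs q'} → Tower {n} q fs q' → ∀ 𝓑 → Σ (List (Expr (suc n))) λ 𝓑' → ∀ {h} → SpanQ (InR q fs) (_∈ 𝓑) h → SpanQ (InR q' []) (_∈ 𝓑') h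
tower-span [] 𝓑 = 𝓑 , λ s → s
tower-span (_∷_ {fs = fs} sr tw) 𝓑 with tower-span tw (TowerStep.𝓑' fs sr 𝓑)
... | 𝓑'' , f = 𝓑'' , λ s → f (TowerStep.descend fs sr s)

inR-sub : ∀ {n} {q : Vec (Expr n) (suc n)} {g} → InR q [] g → Σ (Expr (suc n)) λ G → ∀ ρ → evℤ g ρ ≡ evℤ G (EvalE.evs ℤR (zE q) ρ)
inR-sub (conR c) = con c , λ ρ → ≡.refl
inR-sub {q = q} (zR i) = var i , λ ρ → ≡.sym (lookup-map (λ e → evℤ e ρ) (zE q) i)
inR-sub (addR r s) with inR-sub r | inR-sub s
... | G , h | G' , h' = G ⊕ G' , λ ρ → ≡.cong₂ ℤ._+_ (h ρ) (h' ρ)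
inR-sub (mulR r s) with inR-sub r | inR-sub s
... | G , h | G' , h' = G ⊗ G' , λ ρ → ≡.cong₂ ℤ._*_ (h ρ) (h' ρ)
inR-sub (extR r eq) with inR-sub r
... | G , h = G , λ ρ → ≡.trans (≡.sym (eq ρ)) (h ρ)

-- Here z₀ = y f₀ and zᵢ = xᵢ, so the initial ring contains every xᵢ.
start : ∀ {n} → Expr n → Vec (Expr n) (suc n)
start {n} f = f ∷ Vec.replicate n (con (pos 0))

wk-inR : ∀ {n} {f₀ : Expr n} {fs} (h : Expr n) → InR (start f₀) fs (wk h)
wk-inR (con c) = conR c
wk-inR {n} {f₀} (var i) = extR (zR (suc i)) λ { (y ∷ x) → ≡.trans (z-ev (start f₀) y x (suc i))
   (≡.trans (≡.cong₂ (λ e e' → evℤ e (y ∷ x) ℤ.+ y ℤ.* evℤ e' x) (VecP.lookup∘tabulate (λ i → var (suc i)) i) (VecP.lookup-replicate i (con (pos 0))))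
     (≡.trans (≡.cong (λ zz → lookup x i ℤ.+ zz) (ℤP.*-zeroʳ y)) (ℤP.+-identityʳ _))) }
wk-inR (g ⊕ h) = addR (wk-inR g) (wk-inR h)
wk-inR (g ⊗ h) = mulR (wk-inR g) (wk-inR h)

-- Its use is for a nonzero integer b in the ideal: then `y b`, with all its powers, lies in the
-- ring.
idl-inR : ∀ {n} {f₀ : Expr n} {fs g} → Idl (_∈ fs) g → InR (start f₀) fs (vE g)
idl-inR (gen m) = vR m
idl-inR zer = extR (conR (pos 0)) λ ρ → ≡.sym (ℤP.*-zeroʳ (lookup ρ zero))
idl-inR (add {g} {h} r s) = extR (addR (idl-inR r) (idl-inR s)) λ { (y ∷ x) → ≡.sym (ℤP.*-distribˡ-+ y (evℤ (wk g) (y ∷ x)) (evℤ (wk h) (y ∷ x))) }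
idl-inR (mul k {g} r) = extR (mulR (wk-inR k) (idl-inR r)) λ { (y ∷ x) → mid-swap (evℤ (wk k) (y ∷ x)) y (evℤ (wk g) (y ∷ x)) }
idl-inR (ext {g} {h} r eq) = extR (idl-inR r) λ { (y ∷ x) → ≡.cong (y ℤ.*_) (≡.trans (evZw g y x) (≡.trans (eq x) (≡.sym (evZw h y x)))) }

-- Algebraic independence of the coordinates z

-- z₀ = y q₀, zᵢ = xᵢ + y qᵢ are algebraically independent when q₀ ≠ 0: let y → 0.
module Indep (D : InfDom) {n} (q : Vec (Expr n) (suc n)) where
  open Dom D

  zs : Carrier → Vec Carrier n → Vec Carrier (suc n)
  zs y x = evs (zE q) (y ∷ x)

  q₀ : Expr n
  q₀ = lookup q zero

  zs-lookup : ∀ y x i → lookup (zs y x) i ≈ ev (lookup (base n) i) (y ∷ x) + y * ev (lookup q i) x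
  zs-lookup y x i = reflexive (≡.trans (lookup-map (λ e → ev e (y ∷ x)) (zE q) i)
    (≡.trans (≡.cong (λ e → ev e (y ∷ x)) (VecP.lookup-zipWith (λ b r → b ⊕ var zero ⊗ wk r) i (base n) q))
      (≡.cong (λ u → ev (lookup (base n) i) (y ∷ x) + y * u) (ev-wk (lookup q i) y x))))

  base-suc : ∀ y x i → ev (lookup (base n) (suc i)) (y ∷ x) ≡ lookup x i
  base-suc y x i = ≡.cong (λ e → ev e (y ∷ x)) (VecP.lookup∘tabulate (λ i → var (suc i)) i)

  zs-zero : ∀ x → zs 0# x ≈ᵥ 0# ∷ x
  zs-zero x = ≈ᵥ-from λ { zero → trans (zs-lookup 0# x zero) (trans (+-identityˡ _) (zeroˡ _))
                        ; (suc i) → trans (zs-lookup 0# x (suc i)) (trans (+-cong (reflexive (base-suc 0# x i)) (zeroˡ _)) (+-identityʳ _)) }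

  pf-y : ∀ (x : Vec Carrier n) i → PF (λ y → lookup (y ∷ x) i)
  pf-y x zero = pf-id
  pf-y x (suc i) = pf-con _

  indepP : NonVan q₀ → ∀ cs → (∀ y x → ¬ (y ≈ 0#) → ¬ (ev q₀ x ≈ 0#) → evP cs (Vec.head (zs y x)) (Vec.tail (zs y x)) ≈ 0#) → All Van cs
  indepP nz [] h = []
  indepP nz (c ∷ cs) h = c-van ∷ indepP nz cs rest
    where
    E : Expr (suc n)
    E = sub (polyE (c ∷ cs)) (zE q)
    E-ev : ∀ y x → ev E (y ∷ x) ≈ evP (c ∷ cs) (Vec.head (zs y x)) (Vec.tail (zs y x))
    E-ev y x = trans (reflexive (ev-sub (polyE (c ∷ cs)) (zE q) (y ∷ x))) (split (zs y x))
      where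
      split : ∀ ρ → ev (polyE (c ∷ cs)) ρ ≈ evP (c ∷ cs) (Vec.head ρ) (Vec.tail ρ)
      split (t ∷ ρ) = ev-polyE (c ∷ cs) t ρ
    c0 : ∀ x → ¬ (ev q₀ x ≈ 0#) → ev c x ≈ 0#
    c0 x nx = begin
      ev c x ≈⟨ sym (trans (+-congˡ (zeroˡ _)) (+-identityʳ _)) ⟩
      evP (c ∷ cs) 0# x ≈⟨ sym (ev-polyE (c ∷ cs) 0# x) ⟩
      ev (polyE (c ∷ cs)) (0# ∷ x) ≈⟨ ev-cong (polyE (c ∷ cs)) (≈ᵥ-sym (zs-zero x)) ⟩
      ev (polyE (c ∷ cs)) (zs 0# x) ≡⟨ ≡.sym (ev-sub (polyE (c ∷ cs)) (zE q) (0# ∷ x)) ⟩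
      ev E (0# ∷ x) ≈⟨ pf-ext0 (pf-ev E (λ y → y ∷ x) (pf-y x)) (λ y ny → trans (E-ev y x) (h y x ny nx)) 0# ⟩
      0# ∎
    c-van : Van c
    c-van = van-stable {e = c} λ k → nonvan-pt q₀ nz λ { (x₀ , n₀) → k (expr-dom q₀ c (λ x → cases {A = ev q₀ x ≈ 0#} stable
      (λ z → trans (*-congʳ z) (zeroˡ _)) (λ nx → trans (*-congˡ (c0 x nx)) (zeroʳ _))) x₀ n₀) }
    rest : ∀ y x → ¬ (y ≈ 0#) → ¬ (ev q₀ x ≈ 0#) → evP cs (Vec.head (zs y x)) (Vec.tail (zs y x)) ≈ 0#
    rest y x ny nx = domain {Vec.head (zs y x)} (begin
       Vec.head (zs y x) * P ≈⟨ sym (+-identityˡ _) ⟩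
       0# + Vec.head (zs y x) * P ≈⟨ +-congʳ (sym (c-van (Vec.tail (zs y x)))) ⟩
       evP (c ∷ cs) (Vec.head (zs y x)) (Vec.tail (zs y x)) ≈⟨ h y x ny nx ⟩
       0# ∎) (λ e → nx (domain {y} (trans (sym (trans (head-lookup (zs y x)) (trans (zs-lookup y x zero) (+-identityˡ _)))) e) ny))
      where
      P = evP cs (Vec.head (zs y x)) (Vec.tail (zs y x))
      head-lookup : ∀ {m} (v : Vec Carrier (suc m)) → Vec.head v ≈ lookup v zero
      head-lookup (x ∷ v) = refl

  indep : NonVan q₀ → ∀ G → (∀ y x → ¬ (y ≈ 0#) → ev G (zs y x) ≈ 0#) → Van G
  indep nz G h (t ∷ ρ) = trans (ev-toPoly G t ρ) (AllVan⇒evP (indepP nz (toPoly G) (λ y x ny nx → trans (sym (split (zs y x))) (h y x ny))) t ρ)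
    where
    split : ∀ ρ → ev G ρ ≈ evP (toPoly G) (Vec.head ρ) (Vec.tail ρ)
    split (t ∷ ρ) = ev-toPoly G t ρ

splitLast-all : ∀ {A : Set} {P : A → Set} {m} (v : Vec A (suc m)) → (∀ i → P (lookup (proj₁ (splitLast v)) i)) → P (proj₂ (splitLast v)) → ∀ i → P (lookup v i)
splitLast-all (x ∷ []) h l zero = l
splitLast-all (x ∷ y ∷ ys) h l zero = h zero
splitLast-all {P = P} (x ∷ y ∷ ys) h l (suc i) = splitLast-all {P = P} (y ∷ ys) (λ i → h (suc i)) l i

-- Relations between powers of y

module Integrality {n} (q : Vec (Expr n) (suc n)) (q₀-nv : DZ.NonVan (lookup q zero)) where
  N = suc n
  zsℤ : Vec ℤ N → Vec ℤ N
  zsℤ ρ = EvalE.evs ℤR (zE q) ρ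
  yv : Vec ℤ N → ℤ
  yv ρ = lookup ρ zero

  Rel : ℕ → Set
  Rel m = Σ (Vec (Expr N) m) λ α → Σ (Expr N) λ β → DZ.NonVan β × (∀ ρ → VZ.evV α (yv ρ) (zsℤ ρ) ℤ.+ evℤ β (zsℤ ρ) ℤ.* ZK.pow (yv ρ) m ≡ pos 0)

  Ind : ℕ → Set
  Ind m = ∀ (α : Vec (Expr N) m) → (∀ ρ → VZ.evV α (yv ρ) (zsℤ ρ) ≡ pos 0) → ∀ i → DZ.Van (lookup α i)

  ind-suc : ∀ m → Ind m → ¬ Rel m → Ind (suc m)
  ind-suc m ind nr α h = splitLast-all {P = DZ.Van} α (ind i (λ ρ → ≡.trans (≡.sym (≡.trans (≡.cong (λ u → VZ.evV i (yv ρ) (zsℤ ρ) ℤ.+ u ℤ.* ZK.pow (yv ρ) m) (lv (zsℤ ρ))) (ℤP.+-identityʳ _))) (rel ρ))) lv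
    where
    i = proj₁ (splitLast α)
    l = proj₂ (splitLast α)
    rel : ∀ ρ → VZ.evV i (yv ρ) (zsℤ ρ) ℤ.+ evℤ l (zsℤ ρ) ℤ.* ZK.pow (yv ρ) m ≡ pos 0
    rel ρ = ≡.trans (≡.sym (VZ.evV-split α (yv ρ) (zsℤ ρ))) (h ρ)
    lv : DZ.Van l
    lv = DZ.van-stable {e = l} λ nv → nr (i , l , nv , rel)

  -- As long as no relation of degree m exists, `ind-suc` extends independence by one more power.
  -- Existence of a relation is not decided, whence the double negation.
  minimal : ∀ k m → Ind m → Rel (k ℕ.+ m) → ¬ ¬ Σ ℕ λ m₀ → m₀ ℕ.≤ k ℕ.+ m × Ind m₀ × Rel m₀
  minimal zero m ind r κ = κ (m , ℕP.≤-refl , ind , r)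
  minimal (suc k) m ind r κ = ¬¬-em {A = Rel m} λ
    { (yes rm) → κ (m , ℕP.m≤n+m m (suc k) , ind , rm)
    ; (no nr) → minimal k (suc m) (ind-suc m ind nr) (≡.subst Rel (≡.sym (ℕP.+-suc k m)) r) λ { (m₀ , le , i , r') → κ (m₀ , ≡.subst (m₀ ℕ.≤_) (ℕP.+-suc k m) le , i , r') } }

  -- E m is the ℤ[z]-module spanned by 1, y, …, y^(m-1)
  record E (m : ℕ) (h : Expr N) : Set where
    constructor mkE
    field
      coords : Vec (Expr N) m
      coords-eq : ∀ ρ → evℤ h ρ ≡ VZ.evV coords (yv ρ) (zsℤ ρ)

  subz : Expr N → Expr N
  subz G = sub G (zE q)

  subz-ev : ∀ G ρ → evℤ (subz G) ρ ≡ evℤ G (zsℤ ρ)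
  subz-ev G ρ = EvalE-sub.ev-sub ℤR G (zE q) ρ

  E-ext : ∀ {m g h} → E m g → g ≗ₑ h → E m h
  E-ext (mkE t eq) e = mkE t λ ρ → ≡.trans (≡.sym (e ρ)) (eq ρ)

  E-zero : ∀ {m} → E m (con (pos 0))
  E-zero {m} = mkE (Vec.replicate m (con (pos 0))) λ ρ → ≡.sym (V2Z.evP-zeros m (yv ρ) (zsℤ ρ))

  E-add : ∀ {m g h} → E m g → E m h → E m (g ⊕ h)
  E-add (mkE t eq) (mkE s eq') with LowFun.lo-add N {h = λ V Z → VZ.evV t V Z} {h' = λ V Z → VZ.evV s V Z} (t , λ V Z → ≡.refl) (s , λ V Z → ≡.refl)
  ... | r , e = mkE r λ ρ → ≡.trans (≡.cong₂ ℤ._+_ (eq ρ) (eq' ρ)) (e (yv ρ) (zsℤ ρ))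

  E-mul : ∀ {m h} G → E m h → E m (subz G ⊗ h)
  E-mul G (mkE t eq) = mkE (Vec.map (G ⊗_) t) λ ρ → ≡.trans (≡.cong₂ ℤ._*_ (subz-ev G ρ) (eq ρ)) (≡.sym (VZ.evV-sc G t (yv ρ) (zsℤ ρ)))

  -- The sum of `E m` and the ℤ[z]-span of 𝓑, with the generators split off one after another, so
  -- that `uniform` can treat them in turn.
  data SE (m : ℕ) : List (Expr N) → Expr N → Set where
    nil : ∀ {h} → E m h → SE m [] h
    cons : ∀ {b 𝓑 h} (G : Expr N) → SE m 𝓑 (h ⊕ ⊖ (subz G ⊗ b)) → SE m (b ∷ 𝓑) h

  ⊖-ev : ∀ (e : Expr N) ρ → evℤ (⊖ e) ρ ≡ ℤ.- evℤ e ρ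
  ⊖-ev e ρ = EvalE.ev-⊖ ℤR e ρ

  SE-ext : ∀ {m} 𝓑 {g h} → SE m 𝓑 g → g ≗ₑ h → SE m 𝓑 h
  SE-ext [] (nil s) e = nil (E-ext s e)
  SE-ext (b ∷ 𝓑) (cons G s) e = cons G (SE-ext 𝓑 s λ ρ → ≡.cong (ℤ._+ evℤ (⊖ (subz G ⊗ b)) ρ) (e ρ))

  SE-E : ∀ {m} 𝓑 {h} → E m h → SE m 𝓑 h
  SE-E [] e = nil e
  SE-E (b ∷ 𝓑) {h} e = cons (con (pos 0)) (SE-ext 𝓑 (SE-E 𝓑 e) λ ρ → ≡.sym (≡.trans (≡.cong (λ zz → evℤ h ρ ℤ.+ zz) (⊖-ev (subz (con (pos 0)) ⊗ b) ρ)) (ℤP.+-identityʳ _)))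

  SE-add : ∀ {m} 𝓑 {g h} → SE m 𝓑 g → SE m 𝓑 h → SE m 𝓑 (g ⊕ h)
  SE-add [] (nil s) (nil t) = nil (E-add s t)
  SE-add (b ∷ 𝓑) {g} {h} (cons G s) (cons H t) = cons (G ⊕ H) (SE-ext 𝓑 (SE-add 𝓑 s t) λ ρ →
    ≡.trans (≡.cong₂ (λ u w → (evℤ g ρ ℤ.+ u) ℤ.+ (evℤ h ρ ℤ.+ w)) (⊖-ev (subz G ⊗ b) ρ) (⊖-ev (subz H ⊗ b) ρ))
    (≡.trans (ZK.solve 5 (λ g h x y b → (g ZK.:+ ZK.:- (x ZK.:* b)) ZK.:+ (h ZK.:+ ZK.:- (y ZK.:* b)) ZK.:= (g ZK.:+ h) ZK.:+ ZK.:- ((x ZK.:+ y) ZK.:* b)) ≡.refl (evℤ g ρ) (evℤ h ρ) (evℤ (subz G) ρ) (evℤ (subz H) ρ) (evℤ b ρ))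
      (≡.cong (λ u → (evℤ g ρ ℤ.+ evℤ h ρ) ℤ.+ u) (≡.sym (⊖-ev (subz (G ⊕ H) ⊗ b) ρ)))))

  SE-mul : ∀ {m} 𝓑 {h} G → SE m 𝓑 h → SE m 𝓑 (subz G ⊗ h)
  SE-mul [] G (nil s) = nil (E-mul G s)
  SE-mul (b ∷ 𝓑) {h} G (cons H s) = cons (G ⊗ H) (SE-ext 𝓑 (SE-mul 𝓑 G s) λ ρ →
    ≡.trans (≡.cong (λ u → evℤ (subz G) ρ ℤ.* (evℤ h ρ ℤ.+ u)) (⊖-ev (subz H ⊗ b) ρ))
    (≡.trans (ZK.solve 4 (λ g h x b → g ZK.:* (h ZK.:+ ZK.:- (x ZK.:* b)) ZK.:= g ZK.:* h ZK.:+ ZK.:- ((g ZK.:* x) ZK.:* b)) ≡.refl (evℤ (subz G) ρ) (evℤ h ρ) (evℤ (subz H) ρ) (evℤ b ρ))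
      (≡.cong (λ u → evℤ (subz G) ρ ℤ.* evℤ h ρ ℤ.+ u) (≡.sym (⊖-ev (subz (G ⊗ H) ⊗ b) ρ)))))

  SE-gen : ∀ {m} 𝓑 {b} → b ∈ 𝓑 → SE m 𝓑 b
  SE-gen (b ∷ 𝓑) (here ≡.refl) = cons (con (pos 1)) (SE-ext 𝓑 (SE-E 𝓑 E-zero) λ ρ → ≡.sym
    (≡.trans (≡.cong (λ zz → evℤ b ρ ℤ.+ zz) (≡.trans (⊖-ev (con (pos 1) ⊗ b) ρ) (≡.cong ℤ.-_ (≡.trans (≡.cong (ℤ._* evℤ b ρ) (castℤ (pos 1))) (ℤP.*-identityˡ (evℤ b ρ)))))) (ℤP.+-inverseʳ (evℤ b ρ))))
  SE-gen (c ∷ 𝓑) {b} (there b∈) = cons (con (pos 0)) (SE-ext 𝓑 (SE-gen 𝓑 b∈) λ ρ → ≡.sym (≡.trans (≡.cong (λ zz → evℤ b ρ ℤ.+ zz) (⊖-ev (con (pos 0) ⊗ c) ρ)) (ℤP.+-identityʳ _)))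

  -- The denominators in the span are integers and multiply up to a single one, which may depend on
  -- `h`.
  spanQ-SE : ∀ {m} 𝓑 {h} → SpanQ (InR q []) (_∈ 𝓑) h → Σ ℤ λ c → ¬ c ≡ pos 0 × SE m 𝓑 (con c ⊗ h)
  spanQ-SE 𝓑 (gen {b} b∈) = pos 1 , (λ ()) , SE-mul 𝓑 (con (pos 1)) (SE-gen 𝓑 b∈)
  spanQ-SE 𝓑 zer = pos 1 , (λ ()) , SE-mul 𝓑 (con (pos 1)) (SE-E 𝓑 E-zero)
  spanQ-SE 𝓑 (add {g} {h} s t) with spanQ-SE 𝓑 s | spanQ-SE 𝓑 t
  ... | c , nc , u | d , nd , w = c ℤ.* d , (λ e → nd (ℤ-domain e nc)) , SE-ext 𝓑 (SE-add 𝓑 (SE-mul 𝓑 (con d) u) (SE-mul 𝓑 (con c) w)) λ ρ →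
     ≡.trans (ZK.solve 4 (λ c d g h → d ZK.:* (c ZK.:* g) ZK.:+ c ZK.:* (d ZK.:* h) ZK.:= (c ZK.:* d) ZK.:* (g ZK.:+ h)) ≡.refl (ZK.intCast c) (ZK.intCast d) (evℤ g ρ) (evℤ h ρ))
       (≡.cong (ℤ._* (evℤ g ρ ℤ.+ evℤ h ρ)) (≡.sym (ZK.intCast-* c d)))
  spanQ-SE 𝓑 (mul {a} {h} a∈ s) with spanQ-SE 𝓑 s | inR-sub a∈
  ... | c , nc , u | G , eq = c , nc , SE-ext 𝓑 (SE-mul 𝓑 G u) λ ρ → ≡.trans (≡.cong (ℤ._* (ZK.intCast c ℤ.* evℤ h ρ)) (≡.trans (subz-ev G ρ) (≡.sym (eq ρ)))) (mid-swap (evℤ a ρ) (ZK.intCast c) (evℤ h ρ))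
  spanQ-SE 𝓑 (ext s e) with spanQ-SE 𝓑 s
  ... | c , nc , u = c , nc , SE-ext 𝓑 u λ ρ → ≡.cong (ZK.intCast c ℤ.*_) (e ρ)
  spanQ-SE 𝓑 (den {d} {h} nd s) with spanQ-SE 𝓑 s
  ... | c , nc , u = c ℤ.* d , (λ e → nd (ℤ-domain e nc)) , SE-ext 𝓑 u λ ρ → ≡.trans (≡.sym (ℤP.*-assoc (ZK.intCast c) (ZK.intCast d) (evℤ h ρ))) (≡.cong (ℤ._* evℤ h ρ) (≡.sym (ZK.intCast-* c d)))

  one-nv : DZ.NonVan (con {N} (pos 1))
  one-nv v = 1≢0 (v (Vec.replicate N (pos 0)))
    where
    1≢0 : ¬ pos 1 ≡ pos 0
    1≢0 ()

  -- one denominator Δ serves for all elements of the span of 𝓑 that are algebraic over E m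
  uniform : ∀ m 𝓑 → ¬ ¬ Σ (Expr N) λ Δ → DZ.NonVan Δ × (∀ {h} → SE m 𝓑 h → (Σ (Expr N) λ δ → DZ.NonVan δ × E m (subz δ ⊗ h)) → E m (subz Δ ⊗ h))
  uniform m [] κ = κ (con (pos 1) , one-nv , λ { (nil s) _ → E-mul (con (pos 1)) s })
  uniform m (b ∷ 𝓑) κ = ¬¬-em {A = Σ (Expr N) λ δ → DZ.NonVan δ × SE m 𝓑 (subz δ ⊗ b)} λ
    -- A multiple of `b` lies in the span of the others: multiplication by δ eliminates `b` at the
    -- price of a factor δ in the denominator.
    { (yes (δ , nδ , sδ)) → uniform m 𝓑 λ { (Δ , nΔ , u) → κ (Δ ⊗ δ , DZ.nonvan-* Δ δ nΔ nδ , λ {h} → λ { (cons G s) (ε , nε , eε) →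
        E-ext {g = subz Δ ⊗ (subz δ ⊗ h)} (u {subz δ ⊗ h} (SE-ext 𝓑 (SE-add 𝓑 (SE-mul 𝓑 δ s) (SE-mul 𝓑 G sδ)) λ ρ →
             ≡.trans (≡.cong (λ w → evℤ (subz δ) ρ ℤ.* (evℤ h ρ ℤ.+ w) ℤ.+ evℤ (subz G) ρ ℤ.* (evℤ (subz δ) ρ ℤ.* evℤ b ρ)) (⊖-ev (subz G ⊗ b) ρ))
               (ZK.solve 4 (λ d h g b → d ZK.:* (h ZK.:+ ZK.:- (g ZK.:* b)) ZK.:+ g ZK.:* (d ZK.:* b) ZK.:= d ZK.:* h) ≡.refl (evℤ (subz δ) ρ) (evℤ h ρ) (evℤ (subz G) ρ) (evℤ b ρ)))
            (ε , nε , E-ext {g = subz δ ⊗ (subz ε ⊗ h)} (E-mul δ eε) λ ρ → mid-swap (evℤ (subz δ) ρ) (evℤ (subz ε) ρ) (evℤ h ρ)))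
          λ ρ → ≡.sym (ℤP.*-assoc (evℤ (subz Δ) ρ) (evℤ (subz δ) ρ) (evℤ h ρ)) }) }
    ; (no none) → uniform m 𝓑 λ { (Δ , nΔ , u) → κ (Δ , nΔ , λ {h} → λ { (cons G s) (ε , nε , eε) →
        let εGb : SE m 𝓑 (subz (ε ⊗ G) ⊗ b)
            εGb = SE-ext 𝓑 (SE-add 𝓑 {subz ε ⊗ h} (SE-E 𝓑 eε) (SE-mul 𝓑 (con (ℤ.- pos 1)) (SE-mul 𝓑 ε s))) λ ρ →
              ≡.trans (≡.cong₂ (λ w m₁ → evℤ (subz ε) ρ ℤ.* evℤ h ρ ℤ.+ m₁ ℤ.* (evℤ (subz ε) ρ ℤ.* (evℤ h ρ ℤ.+ w))) (⊖-ev (subz G ⊗ b) ρ) (castℤ (ℤ.- pos 1)))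
                (ZK.solve 4 (λ e h g b → e ZK.:* h ZK.:+ (ZK.con (ℤ.- pos 1)) ZK.:* (e ZK.:* (h ZK.:+ ZK.:- (g ZK.:* b))) ZK.:= (e ZK.:* g) ZK.:* b) ≡.refl (evℤ (subz ε) ρ) (evℤ h ρ) (evℤ (subz G) ρ) (evℤ b ρ))
            vG : DZ.Van G
            vG = DZ.van-stable {e = G} λ nG → none (ε ⊗ G , DZ.nonvan-* ε G nε nG , εGb)
        in u {h} (SE-ext 𝓑 {g = h ⊕ ⊖ (subz G ⊗ b)} s λ ρ → ≡.trans (≡.cong (λ zz → evℤ h ρ ℤ.+ zz) (≡.trans (⊖-ev (subz G ⊗ b) ρ) (≡.cong ℤ.-_ (≡.trans (≡.cong (ℤ._* evℤ b ρ) (≡.trans (subz-ev G ρ) (vG (zsℤ ρ)))) (ℤP.*-zeroˡ (evℤ b ρ)))))) (ℤP.+-identityʳ _))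
             (ε , nε , eε) }) } }

  nonvan-powE : ∀ (β : Expr N) k → DZ.NonVan β → DZ.NonVan (powE β k)
  nonvan-powE β zero nβ = one-nv
  nonvan-powE β (suc k) nβ = DZ.nonvan-* β (powE β k) nβ (nonvan-powE β k nβ)

  -- y^j is algebraic over E m, by pseudo-division by a relation of degree m
  y-alg : ∀ {m} (α : Vec (Expr N) m) β → (∀ ρ → VZ.evV α (yv ρ) (zsℤ ρ) ℤ.+ evℤ β (zsℤ ρ) ℤ.* ZK.pow (yv ρ) m ≡ pos 0) →
          ∀ j → Σ ℕ λ e → E m (subz (powE β e) ⊗ powE (var zero) j)
  y-alg {m} α β rel j = e , mkE r λ ρ → ≡.trans (≡.cong₂ ℤ._*_ (≡.trans (subz-ev (powE β e) ρ) (ev-powE β e (zsℤ ρ))) (≡.trans (ev-powE (var zero) j ρ) (≡.sym (A-ev (yv ρ) (zsℤ ρ)))))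
      (≡.trans (VZ.pdiv-ev α β (length T) A (yv ρ) (zsℤ ρ)) (≡.trans (≡.cong (λ u → u ℤ.* VZ.evV Θ (yv ρ) (zsℤ ρ) ℤ.+ VZ.evV r (yv ρ) (zsℤ ρ)) (rel ρ)) (ℤP.+-identityˡ _)))
    where
    T = shift j (con (pos 1) ∷ [])
    A = pad m (asVec T)
    dv = pdiv α β (length T) A
    e = proj₁ dv
    Θ = proj₁ (proj₂ dv)
    r = proj₂ (proj₂ dv)
    A-ev : ∀ t Z → VZ.evV A t Z ≡ ZK.pow t j
    A-ev t Z = ≡.trans (V2Z.evV-pad m (asVec T) t Z) (≡.trans (≡.cong (λ l → Uni.evP ℤR l t Z) (asVec-list T)) (≡.trans (V2Z.evP-shift j (con (pos 1) ∷ []) t Z)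
      (≡.trans (≡.cong (ZK.pow t j ℤ.*_) (≡.trans (≡.cong (λ zz → pos 1 ℤ.+ zz) (ℤP.*-zeroʳ t)) ≡.refl)) (ℤP.*-identityʳ _))))

-- Reduction modulo p

module ModP (A : ACF) (p : ℕ) (cd : CharDom (ACF.infDom A) p) where
  open ACF A using (inv)
  module K = Dom (ACF.infDom A)
  module VK = VecPoly (InfDom.ring (ACF.infDom A))
  module HK = Hom (InfDom.ring (ACF.infDom A))
  open CharDom cd
  open CharP-Div (ACF.infDom A) p cd

  p≥2 : 2 ℕ.≤ p
  p≥2 = go p p≈0 p≢0
    where
    go : ∀ m → K.intCast (pos m) K.≈ K.0# → ¬ m ≡ 0 → 2 ℕ.≤ m
    go zero h nz = ⊥-elim (nz ≡.refl)
    go (suc zero) h nz = ⊥-elim (K.1≉0 (K.trans (K.sym K.intCast-1) h))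
    go (suc (suc m)) h nz = s≤s (s≤s z≤n)

  p*-inj : ∀ {a b} → pos p ℤ.* a ≡ pos p ℤ.* b → a ≡ b
  p*-inj {a} {b} h = ℤP.*-cancelˡ-≡ (pos p) a b ⦃ ℕ.>-nonZero (ℕP.≤-trans (s≤s z≤n) p≥2) ⦄ h

  -- The measure by which every loop that cancels p terminates: some fixed nonzero integer is
  -- divided by p each time.
  ∣p*∣ : ∀ c c' → ¬ c ≡ pos 0 → c ≡ pos p ℤ.* c' → ∣ c' ∣ ℕ.< ∣ c ∣
  ∣p*∣ c c' nc eq = ≡.subst (∣ c' ∣ ℕ.<_) (≡.sym (≡.trans (≡.cong ∣_∣ eq) (ℤP.abs-* (pos p) c'))) (ℕP.<-≤-trans lt (ℕP.*-monoˡ-≤ ∣ c' ∣ p≥2))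
    where
    c'≢0 : ¬ ∣ c' ∣ ≡ 0
    c'≢0 e = nc (≡.trans eq (≡.trans (≡.cong (pos p ℤ.*_) (ℤP.∣i∣≡0⇒i≡0 e)) (ℤP.*-zeroʳ (pos p))))
    lt : ∣ c' ∣ ℕ.< 2 ℕ.* ∣ c' ∣
    lt with ∣ c' ∣ | c'≢0
    ... | zero | n = ⊥-elim (n ≡.refl)
    ... | suc k | _ = s≤s (≡.subst (suc k ℕ.≤_) (≡.sym (ℕP.+-suc k (k ℕ.+ 0))) (s≤s (ℕP.m≤m+n k (k ℕ.+ 0))))

  nvK⇒nvℤ : ∀ {n} (e : Expr n) → K.NonVan e → DZ.NonVan e
  nvK⇒nvℤ e nk v = nk (HK.transfer e v)

  -- removing the powers of p from a nonzero polynomial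
  p-free : ∀ {n} (e : Expr n) w → ¬ evℤ e w ≡ pos 0 → Acc ℕ._<_ ∣ evℤ e w ∣ →
           ¬ ¬ Σ ℤ λ c → ¬ c ≡ pos 0 × Σ (Expr n) λ e' → K.NonVan e' × (∀ ρ → evℤ e ρ ≡ c ℤ.* evℤ e' ρ)
  p-free e w nz (acc rs) κ = ¬¬-em {A = K.Van e} λ
    { (no nv) → κ (pos 1 , (λ ()) , e , nv , λ ρ → ≡.sym (ℤP.*-identityˡ _))
    ; (yes v) → let e' , eq = divide e v in
        p-free e' w (λ h → nz (≡.trans (eq w) (≡.trans (≡.cong (pos p ℤ.*_) h) (ℤP.*-zeroʳ (pos p))))) (rs (∣p*∣ _ _ nz (eq w)))
          λ { (c , nc , e'' , nv , eq') → κ (pos p ℤ.* c , (λ h → nc (p*-inj (≡.trans h (≡.sym (ℤP.*-zeroʳ (pos p)))))) , e'' , nv , λ ρ →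
             ≡.trans (eq ρ) (≡.trans (≡.cong (pos p ℤ.*_) (eq' ρ)) (≡.sym (ℤP.*-assoc (pos p) c _)))) } }

  divideV : ∀ {n m} (v : Vec (Expr n) m) → (∀ i → K.Van (lookup v i)) → Σ (Vec (Expr n) m) λ v' → ∀ t ρ → VZ.evV v t ρ ≡ pos p ℤ.* VZ.evV v' t ρ
  divideV [] h = [] , λ t ρ → ≡.sym (ℤP.*-zeroʳ (pos p))
  divideV (e ∷ v) h with divide e (h zero) | divideV v (λ i → h (suc i))
  ... | e' , eq | v' , eq' = e' ∷ v' , λ t ρ → ≡.trans (≡.cong₂ (λ a b → a ℤ.+ t ℤ.* b) (eq ρ) (eq' t ρ))
     (ZK.solve 4 (λ p a t b → p ZK.:* a ZK.:+ t ZK.:* (p ZK.:* b) ZK.:= p ZK.:* (a ZK.:+ t ZK.:* b)) ≡.refl (pos p) (evℤ e' ρ) t (VZ.evV v' t ρ))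

  vecPoly : ∀ {n m} → Vec (Expr n) m → Expr (suc n)
  vecPoly v = polyE (Vec.toList v)

  vecPoly-van : ∀ {n m} (v : Vec (Expr n) m) → K.Van (vecPoly v) → ∀ i → K.Van (lookup v i)
  vecPoly-van v h = conv v (K.evP-van (Vec.toList v) (λ t ρ → K.trans (K.sym (K.ev-polyE (Vec.toList v) t ρ)) (h (t ∷ ρ))))
    where
    conv : ∀ {m} (v : Vec (Expr _) m) → All K.Van (Vec.toList v) → ∀ i → K.Van (lookup v i)
    conv (x ∷ v) (h ∷ hs) zero = h
    conv (x ∷ v) (h ∷ hs) (suc i) = conv v hs i

  snocV : ∀ {A : Set} {m} → Vec A m → A → Vec A (suc m)
  snocV [] a = a ∷ []
  snocV (x ∷ v) a = x ∷ snocV v a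

  module VSnoc (R : CRing) where
    open RingKit R renaming (con to scon)
    open EvalE R
    open Uni R
    open VecPoly R
    evV-snoc : ∀ {n m} (v : Vec (Expr n) m) β t ρ → evV (snocV v β) t ρ ≈ evV v t ρ + ev β ρ * pow t m
    evV-snoc [] β t ρ = solve 2 (λ x t → x :+ t :* scon (pos 0) := scon (pos 0) :+ x :* scon (pos 1)) refl (ev β ρ) t
    evV-snoc {m = suc m} (x ∷ v) β t ρ = trans (+-congˡ (*-congˡ (evV-snoc v β t ρ)))
      (solve 5 (λ x t u l w → x :+ t :* (u :+ l :* w) := (x :+ t :* u) :+ l :* (t :* w)) refl (ev x ρ) t (evV v t ρ) (ev β ρ) (pow t m))

  module SZ = VSnoc ℤR
  module SK = VSnoc (InfDom.ring (ACF.infDom A))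

  snoc-all : ∀ {B : Set} {P : B → Set} {m} (v : Vec B m) β → (∀ i → P (lookup (snocV v β) i)) → P β
  snoc-all [] β h = h zero
  snoc-all {P = P} (x ∷ v) β h = snoc-all {P = P} v β (λ i → h (suc i))

  module WithZ {n} (q : Vec (Expr n) (suc n)) (q₀K : K.NonVan (lookup q zero)) where
    open Integrality q (nvK⇒nvℤ (lookup q zero) q₀K)
    module IK = Indep (ACF.infDom A) q

    Relation : ∀ {m} → Vec (Expr N) m → Expr N → Set
    Relation {m} α β = ∀ ρ → VZ.evV α (yv ρ) (zsℤ ρ) ℤ.+ evℤ β (zsℤ ρ) ℤ.* ZK.pow (yv ρ) m ≡ pos 0

    Primitive : ∀ {m} → Vec (Expr N) m → Expr N → Set
    Primitive α β = K.NonVan (vecPoly (snocV α β))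

    -- While all coefficients are divisible by p they are divided by p; the nonzero integer β(w)
    -- shrinks, so this comes to an end.
    mk-primitive : ∀ {m} (α : Vec (Expr N) m) β → Relation α β → ∀ w → ¬ evℤ β w ≡ pos 0 → Acc ℕ._<_ ∣ evℤ β w ∣ →
      ¬ ¬ Σ (Vec (Expr N) m) λ α' → Σ (Expr N) λ β' → DZ.NonVan β' × Relation α' β' × Primitive α' β'
    mk-primitive {m} α β rel w nz (acc rs) κ = ¬¬-em {A = K.Van (vecPoly (snocV α β))} λ
      { (no nv) → κ (α , β , (λ v → nz (v w)) , rel , nv)
      ; (yes v) →
        let αβ = vecPoly-van (snocV α β) v
            α' , eq = divideV α (snoc-init α β αβ)
            β' , eq' = divide β (snoc-all {P = K.Van} α β αβ)
        in mk-primitive α' β' (λ ρ → p*-inj (≡.trans (≡.trans (≡.trans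
               (ZK.solve 4 (λ p a b y → p ZK.:* (a ZK.:+ b ZK.:* y) ZK.:= p ZK.:* a ZK.:+ (p ZK.:* b) ZK.:* y) ≡.refl (pos p) (VZ.evV α' (yv ρ) (zsℤ ρ)) (evℤ β' (zsℤ ρ)) (ZK.pow (yv ρ) m))
               (≡.cong₂ (λ a b → a ℤ.+ b ℤ.* ZK.pow (yv ρ) m) (≡.sym (eq (yv ρ) (zsℤ ρ))) (≡.sym (eq' (zsℤ ρ))))) (rel ρ)) (≡.sym (ℤP.*-zeroʳ (pos p)))))
             w (λ h → nz (≡.trans (eq' w) (≡.trans (≡.cong (pos p ℤ.*_) h) (ℤP.*-zeroʳ (pos p))))) (rs (∣p*∣ _ _ nz (eq' w))) κ }
      where
      snoc-init : ∀ {m} (v : Vec (Expr N) m) β → (∀ i → K.Van (lookup (snocV v β) i)) → ∀ i → K.Van (lookup v i)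
      snoc-init (x ∷ v) β h zero = h zero
      snoc-init (x ∷ v) β h (suc i) = snoc-init v β (λ i → h (suc i)) i

    -- Gauss: dividing the cofactor Θ in X · A = Φ · Θ by p as long as p divides X
    gauss : ∀ {m M k} (α : Vec (Expr N) m) β → Primitive α β → (Av : Vec (Expr N) M) (X : Expr N) (Θ : Vec (Expr N) k) →
            (∀ t Z → evℤ X Z ℤ.* VZ.evV Av t Z ≡ (VZ.evV α t Z ℤ.+ evℤ β Z ℤ.* ZK.pow t m) ℤ.* VZ.evV Θ t Z) →
            ∀ w → ¬ evℤ X w ≡ pos 0 → Acc ℕ._<_ ∣ evℤ X w ∣ →
            ¬ ¬ Σ (Expr N) λ X' → Σ (Vec (Expr N) k) λ Θ' → K.NonVan X' ×
              (∀ t Z → evℤ X' Z ℤ.* VZ.evV Av t Z ≡ (VZ.evV α t Z ℤ.+ evℤ β Z ℤ.* ZK.pow t m) ℤ.* VZ.evV Θ' t Z)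
    gauss {m} α β pr Av X Θ eq w nz (acc rs) κ = ¬¬-em {A = K.Van X} λ
      { (no nv) → κ (X , Θ , nv , eq)
      ; (yes v) → K.nonvan-pt Φ pr λ { (ρ₀ , n₀) →
        let Θv = vecPoly-van Θ (K.expr-dom Φ (vecPoly Θ) (ΦΘ v) ρ₀ n₀)
            Θ' , eqΘ = divideV Θ Θv
            X' , eqX = divide X v
        in gauss α β pr Av X' Θ' (λ t Z → p*-inj (≡.trans (≡.sym (ℤP.*-assoc (pos p) _ _)) (≡.trans (≡.cong (ℤ._* VZ.evV Av t Z) (≡.sym (eqX Z)))
              (≡.trans (eq t Z) (≡.trans (≡.cong ((VZ.evV α t Z ℤ.+ evℤ β Z ℤ.* ZK.pow t m) ℤ.*_) (eqΘ t Z)) (mid-swap (VZ.evV α t Z ℤ.+ evℤ β Z ℤ.* ZK.pow t m) (pos p) (VZ.evV Θ' t Z)))))))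
             w (λ h → nz (≡.trans (eqX w) (≡.trans (≡.cong (pos p ℤ.*_) h) (ℤP.*-zeroʳ (pos p))))) (rs (∣p*∣ _ _ nz (eqX w))) κ } }
      where
      Φ : Expr (suc N)
      Φ = vecPoly (snocV α β)
      Φ-ev : ∀ t Z → evℤ Φ (t ∷ Z) ≡ VZ.evV α t Z ℤ.+ evℤ β Z ℤ.* ZK.pow t m
      Φ-ev t Z = ≡.trans (evZP (Vec.toList (snocV α β)) t Z) (SZ.evV-snoc α β t Z)
      ΦΘ : K.Van X → ∀ ρ → K.ev Φ ρ K.* K.ev (vecPoly Θ) ρ K.≈ K.0#
      ΦΘ v (t ∷ Z) = K.trans (HK.transfer≡ (Φ ⊗ vecPoly Θ) (wk X ⊗ vecPoly Av) (λ { (t ∷ Z) → ≡.trans (≡.cong₂ ℤ._*_ (Φ-ev t Z) (evZP (Vec.toList Θ) t Z))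
           (≡.trans (≡.sym (eq t Z)) (≡.sym (≡.cong₂ ℤ._*_ (evZw X t Z) (evZP (Vec.toList Av) t Z)))) }) (t ∷ Z))
         (K.trans (K.*-congʳ (K.trans (K.reflexive (K.ev-wk X t Z)) (v Z))) (K.zeroˡ _))

    toListLen : ∀ {m} (v : Vec (Expr N) m) ρ → length (K.evL (Vec.toList v) ρ) ≡ m
    toListLen [] ρ = ≡.refl
    toListLen (x ∷ v) ρ = ≡.cong suc (toListLen v ρ)

    -- the leading coefficient of a primitive minimal relation is nonzero mod p, since Ψ has this property
    lead-nonvan : ∀ {m M} → m ℕ.≤ M → Ind m → (α : Vec (Expr N) m) (β : Expr N) → DZ.NonVan β → Relation α β → Primitive α β →
                  (Ψ : Vec (Expr N) M) (ψ : Expr N) → Relation Ψ ψ → K.NonVan ψ → K.NonVan β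
    lead-nonvan {m} {M} m≤M ind α β nβ rel pr Ψ ψ relΨ nψ vβ = go (M ℕ.∸ m) (≡.sym (ℕP.m∸n+n≡m m≤M)) Ψ relΨ
      where
      go : ∀ k' → M ≡ k' ℕ.+ m → (Ψ : Vec (Expr N) M) → Relation Ψ ψ → ⊥
      go k' ≡.refl Ψ relΨ = DZ.nonvan-pt (powE β e) (nonvan-powE β e nβ) λ { (w , nw) →
          gauss α β pr Av (powE β e) Θ ident w nw (<-wellFounded _) λ { (X' , Θ' , nX , eq) →
            K.nonvan-pt (X' ⊗ ψ) (K.nonvan-* X' ψ nX nψ) λ { (Z , nZ) → nZ (fin X' Θ' eq Z) } } }
        where
        Av : Vec (Expr N) (suc k' ℕ.+ m)
        Av = snocV Ψ ψ
        dv = pdiv α β (suc k') Av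
        e = proj₁ dv
        Θ = proj₁ (proj₂ dv)
        r = proj₂ (proj₂ dv)
        -- Both polynomials vanish at (y, z), so the remainder is a relation of degree below m and
        -- zero by independence. Thus `ident` holds with a free variable in place of y.
        r-van : ∀ i → DZ.Van (lookup r i)
        r-van = ind r λ ρ → ≡.trans (≡.sym (≡.trans (≡.cong (λ u → u ℤ.* VZ.evV Θ (yv ρ) (zsℤ ρ) ℤ.+ VZ.evV r (yv ρ) (zsℤ ρ)) (rel ρ)) (ℤP.+-identityˡ _)))
          (≡.trans (≡.sym (VZ.pdiv-ev α β (suc k') Av (yv ρ) (zsℤ ρ))) (≡.trans (≡.cong (ZK.pow (evℤ β (zsℤ ρ)) e ℤ.*_) (≡.trans (SZ.evV-snoc Ψ ψ (yv ρ) (zsℤ ρ)) (relΨ ρ))) (ℤP.*-zeroʳ (ZK.pow (evℤ β (zsℤ ρ)) e))))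
        van-evV : ∀ {k} (v : Vec (Expr N) k) → (∀ i → DZ.Van (lookup v i)) → ∀ t Z → VZ.evV v t Z ≡ pos 0
        van-evV [] h t Z = ≡.refl
        van-evV (x ∷ v) h t Z = ≡.trans (≡.cong₂ (λ a b → a ℤ.+ t ℤ.* b) (h zero Z) (van-evV v (λ i → h (suc i)) t Z)) (≡.trans (ℤP.+-identityˡ _) (ℤP.*-zeroʳ t))
        ident : ∀ t Z → evℤ (powE β e) Z ℤ.* VZ.evV Av t Z ≡ (VZ.evV α t Z ℤ.+ evℤ β Z ℤ.* ZK.pow t m) ℤ.* VZ.evV Θ t Z
        ident t Z = ≡.trans (≡.cong (ℤ._* VZ.evV Av t Z) (ev-powE β e Z)) (≡.trans (VZ.pdiv-ev α β (suc k') Av t Z)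
          (≡.trans (≡.cong (λ zz → (VZ.evV α t Z ℤ.+ evℤ β Z ℤ.* ZK.pow t m) ℤ.* VZ.evV Θ t Z ℤ.+ zz) (van-evV r r-van t Z)) (ℤP.+-identityʳ _)))
        fin : ∀ X' (Θ' : Vec (Expr N) (suc k')) → (∀ t Z → evℤ X' Z ℤ.* VZ.evV Av t Z ≡ (VZ.evV α t Z ℤ.+ evℤ β Z ℤ.* ZK.pow t m) ℤ.* VZ.evV Θ' t Z) →
              ∀ Z → K.ev (X' ⊗ ψ) Z K.≈ K.0#
        -- If β were zero modulo p, the product of the divisor and `Θ'` would have degree below k' +
        -- m, whereas `X' Av` has the coefficient `X' ψ` there.
        fin X' Θ' eq Z = K.lead-extract (k' ℕ.+ m) (K.ev (X' ⊗ ψ) Z) rest rest-len λ s → K.begin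
            P s K.* (x K.* K.ev ψ Z) K.+ K.horner rest s
              K.≈⟨ K.+-congˡ (K.trans (K.horner-add (K.scL x (K.evL (Vec.toList Ψ) Z)) _ s) (K.+-cong (K.horner-sc x (K.evL (Vec.toList Ψ) Z) s)
                    (K.trans (K.horner-sc (K.- K.1#) (K.mulL lα lΘ) s) (K.*-congˡ (K.horner-mul lα lΘ s))))) ⟩
            P s K.* (x K.* K.ev ψ Z) K.+ (x K.* VK.evV Ψ s Z K.+ (K.- K.1#) K.* (VK.evV α s Z K.* VK.evV Θ' s Z))
              K.≈⟨ K.solve 6 (λ P x p Ψ a θ → P K.:* (x K.:* p) K.:+ (x K.:* Ψ K.:+ (K.:- K.scon (pos 1)) K.:* (a K.:* θ)) K.:= x K.:* (Ψ K.:+ p K.:* P) K.:+ K.:- (a K.:* θ)) K.refl (P s) x (K.ev ψ Z) (VK.evV Ψ s Z) (VK.evV α s Z) (VK.evV Θ' s Z) ⟩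
            x K.* (VK.evV Ψ s Z K.+ K.ev ψ Z K.* P s) K.+ K.- (VK.evV α s Z K.* VK.evV Θ' s Z)
              K.≈⟨ K.x≈y⇒x-y≈0 (K.trans (K.*-congˡ (K.sym (SK.evV-snoc Ψ ψ s Z))) (K.trans (idK s) (K.*-congʳ (K.trans (K.+-congˡ (K.trans (K.*-congʳ (vβ Z)) (K.zeroˡ _))) (K.+-identityʳ _))))) ⟩
            K.0# K.∎
          where
          x = K.ev X' Z
          P : K.Carrier → K.Carrier
          P s = K.pow s (k' ℕ.+ m)
          lα = K.evL (Vec.toList α) Z
          lΘ = K.evL (Vec.toList Θ') Z
          rest = K.addL (K.scL x (K.evL (Vec.toList Ψ) Z)) (K.scL (K.- K.1#) (K.mulL lα lΘ))
          rest-len : length rest ℕ.≤ k' ℕ.+ m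
          rest-len = ℕP.≤-trans (ℕP.≤-reflexive (K.addL-len (K.scL x (K.evL (Vec.toList Ψ) Z)) _)) (ℕP.⊔-lub
            (ℕP.≤-reflexive (≡.trans (K.scL-len x (K.evL (Vec.toList Ψ) Z)) (toListLen Ψ Z)))
            (ℕP.≤-trans (ℕP.≤-reflexive (K.scL-len (K.- K.1#) (K.mulL lα lΘ))) (ℕP.≤-trans (K.mulL-len lα lΘ k' (ℕP.≤-reflexive (toListLen Θ' Z)))
               (ℕP.≤-reflexive (≡.trans (≡.cong (ℕ._+ k') (toListLen α Z)) (ℕP.+-comm m k'))))))
          idK : ∀ s → x K.* VK.evV Av s Z K.≈ (VK.evV α s Z K.+ K.ev β Z K.* K.pow s m) K.* VK.evV Θ' s Z
          idK s = K.begin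
            x K.* VK.evV Av s Z K.≈⟨ K.*-cong (K.sym (K.reflexive (K.ev-wk X' s Z))) (K.sym (K.ev-polyE (Vec.toList Av) s Z)) ⟩
            K.ev (wk X' ⊗ vecPoly Av) (s ∷ Z) K.≈⟨ HK.transfer≡ (wk X' ⊗ vecPoly Av) (vecPoly (snocV α β) ⊗ vecPoly Θ') (λ { (t ∷ Z) →
                ≡.trans (≡.cong₂ ℤ._*_ (evZw X' t Z) (evZP (Vec.toList Av) t Z)) (≡.trans (eq t Z) (≡.sym (≡.cong₂ ℤ._*_ (≡.trans (evZP (Vec.toList (snocV α β)) t Z) (SZ.evV-snoc α β t Z)) (evZP (Vec.toList Θ') t Z)))) }) (s ∷ Z) ⟩
            K.ev (vecPoly (snocV α β)) (s ∷ Z) K.* K.ev (vecPoly Θ') (s ∷ Z)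
              K.≈⟨ K.*-cong (K.trans (K.ev-polyE (Vec.toList (snocV α β)) s Z) (SK.evV-snoc α β s Z)) (K.ev-polyE (Vec.toList Θ') s Z) ⟩
            (VK.evV α s Z K.+ K.ev β Z K.* K.pow s m) K.* VK.evV Θ' s Z K.∎

    -- removing p from C in C Δ(z) y^j = Σ tᵢ(z) yⁱ, by comparison with β(z)^e y^j = Σ sᵢ(z) yⁱ
    remove-p : ∀ {m} → Ind m → ∀ β → K.NonVan β → ∀ j e (s : Vec (Expr N) m) → (∀ ρ → evℤ (powE β e) (zsℤ ρ) ℤ.* ZK.pow (yv ρ) j ≡ VZ.evV s (yv ρ) (zsℤ ρ)) →
               ∀ Δ C → ¬ C ≡ pos 0 → (t : Vec (Expr N) m) → (∀ ρ → C ℤ.* (evℤ Δ (zsℤ ρ) ℤ.* ZK.pow (yv ρ) j) ≡ VZ.evV t (yv ρ) (zsℤ ρ)) → Acc ℕ._<_ ∣ C ∣ →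
               ¬ ¬ Σ ℤ λ C' → ¬ (K.intCast C' K.≈ K.0#) × Σ (Vec (Expr N) m) λ t' → ∀ ρ → C' ℤ.* (evℤ Δ (zsℤ ρ) ℤ.* ZK.pow (yv ρ) j) ≡ VZ.evV t' (yv ρ) (zsℤ ρ)
    remove-p {m} ind β nβ j e s hs Δ C nC t ht (acc rs) κ = ¬¬-em {A = K.intCast C K.≈ K.0#} λ
      { (no nz) → κ (C , nz , t , ht)
      ; (yes z) → let C' , eqC = char C z in K.nonvan-pt (powE β e) (nvK-pow e) λ { (w , nw) →
          let t' , eqt = divideV t (λ i → K.expr-dom (powE β e) (lookup t i) (λ Z → tv z i Z) w nw)
          in remove-p ind β nβ j e s hs Δ C' (λ h → nC (≡.trans eqC (≡.trans (≡.cong (pos p ℤ.*_) h) (ℤP.*-zeroʳ (pos p))))) t'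
               (λ ρ → p*-inj (≡.trans (≡.sym (ℤP.*-assoc (pos p) C' _)) (≡.trans (≡.cong (ℤ._* (evℤ Δ (zsℤ ρ) ℤ.* ZK.pow (yv ρ) j)) (≡.sym eqC)) (≡.trans (ht ρ) (eqt (yv ρ) (zsℤ ρ))))))
               (rs (∣p*∣ _ _ nC eqC)) κ } }
      where
      nvK-pow : ∀ e → K.NonVan (powE β e)
      nvK-pow zero v = K.1≉0 (K.trans (K.sym K.intCast-1) (v (Vec.replicate N K.0#)))
      nvK-pow (suc e) = K.nonvan-* β (powE β e) nβ (nvK-pow e)
      cmb : ∀ {k} → Vec (Expr N) k → Vec (Expr N) k → Vec (Expr N) k
      cmb = zipWith (λ a b → (con C ⊗ Δ) ⊗ a ⊕ (⊖ powE β e) ⊗ b)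
      cmb-ev : ∀ {k} (a b : Vec (Expr N) k) t Z → VZ.evV (cmb a b) t Z ≡ (C ℤ.* evℤ Δ Z) ℤ.* VZ.evV a t Z ℤ.- evℤ (powE β e) Z ℤ.* VZ.evV b t Z
      cmb-ev [] [] t Z = ZK.solve 2 (λ a b → ZK.con (pos 0) ZK.:= a ZK.:* ZK.con (pos 0) ZK.:- b ZK.:* ZK.con (pos 0)) ≡.refl (C ℤ.* evℤ Δ Z) (evℤ (powE β e) Z)
      cmb-ev (a ∷ as) (b ∷ bs) t Z = ≡.trans (≡.cong₂ (λ u w → u ℤ.+ t ℤ.* w) (cmb1 a b Z) (cmb-ev as bs t Z))
        (ZK.solve 7 (λ c b a x t A B → (c ZK.:* a ZK.:- b ZK.:* x) ZK.:+ t ZK.:* (c ZK.:* A ZK.:- b ZK.:* B) ZK.:= c ZK.:* (a ZK.:+ t ZK.:* A) ZK.:- b ZK.:* (x ZK.:+ t ZK.:* B)) ≡.refl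
          (C ℤ.* evℤ Δ Z) (evℤ (powE β e) Z) (evℤ a Z) (evℤ b Z) t (VZ.evV as t Z) (VZ.evV bs t Z))
        where
        cmb1 : ∀ a b Z → evℤ ((con C ⊗ Δ) ⊗ a ⊕ (⊖ powE β e) ⊗ b) Z ≡ (C ℤ.* evℤ Δ Z) ℤ.* evℤ a Z ℤ.- evℤ (powE β e) Z ℤ.* evℤ b Z
        cmb1 a b Z = ≡.cong₂ (λ u w → (u ℤ.* evℤ Δ Z) ℤ.* evℤ a Z ℤ.+ w) (castℤ C) (≡.trans (≡.cong (ℤ._* evℤ b Z) (⊖-ev (powE β e) Z)) (≡.sym (ℤP.neg-distribˡ-* (evℤ (powE β e) Z) (evℤ b Z))))
      -- Independence gives `C Δ sᵢ = β^e tᵢ` for every i. When C is zero modulo p, so is tᵢ,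
      -- because β is not, and p can be cancelled on both sides.
      cmb-van : ∀ i → DZ.Van (lookup (cmb s t) i)
      cmb-van = ind (cmb s t) λ ρ → ≡.trans (cmb-ev s t (yv ρ) (zsℤ ρ)) (≡.trans (≡.cong₂ (λ u w → (C ℤ.* evℤ Δ (zsℤ ρ)) ℤ.* u ℤ.- evℤ (powE β e) (zsℤ ρ) ℤ.* w) (≡.sym (hs ρ)) (≡.sym (ht ρ)))
        (ZK.solve 4 (λ c d b y → (c ZK.:* d) ZK.:* (b ZK.:* y) ZK.:- b ZK.:* (c ZK.:* (d ZK.:* y)) ZK.:= ZK.con (pos 0)) ≡.refl C (evℤ Δ (zsℤ ρ)) (evℤ (powE β e) (zsℤ ρ)) (ZK.pow (yv ρ) j)))
      tv : K.intCast C K.≈ K.0# → ∀ i Z → K.ev (powE β e) Z K.* K.ev (lookup t i) Z K.≈ K.0#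
      tv z i Z = K.trans (K.solve 2 (λ u w → w K.:= u K.:+ K.:- (u K.:+ K.:- w)) K.refl ((K.intCast C K.* K.ev Δ Z) K.* si) (b K.* ti))
          (K.trans (K.+-cong (K.trans (K.*-congʳ (K.trans (K.*-congʳ z) (K.zeroˡ _))) (K.zeroˡ _)) (K.trans (K.-‿cong vanK) K.-0#≈0#)) (K.+-identityˡ _))
        where
        b = K.ev (powE β e) Z
        ti = K.ev (lookup t i) Z
        si = K.ev (lookup s i) Z
        vanK : (K.intCast C K.* K.ev Δ Z) K.* si K.+ K.- (b K.* ti) K.≈ K.0#
        vanK = K.trans (K.+-congˡ (K.trans (K.-‿distribˡ-* b ti) (K.*-congʳ (K.sym (K.ev-⊖ (powE β e) Z)))))
          (HK.transfer ((con C ⊗ Δ) ⊗ lookup s i ⊕ (⊖ powE β e) ⊗ lookup t i) (λ ρ → ≡.trans (≡.cong (λ e' → evℤ e' ρ) (≡.sym (VecP.lookup-zipWith _ i s t))) (cmb-van i ρ)) Z)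

    -- Along x = P + τ ξ, y = ω / τ the functions z are polynomials in τ.
    module Curve (P : Vec K.Carrier n) (qP : ∀ i → K.ev (lookup q i) P K.≈ K.0#) (x* : Vec K.Carrier n) (ω : K.Carrier) where
      xs : K.Carrier → Vec K.Carrier n
      xs τ = K.line P x* τ

      -- Every qᵢ vanishes at `P`, hence is divisible by τ along the line; this cancels the pole of
      -- y = ω / τ.
      κ : ∀ i → Σ (K.Carrier → K.Carrier) λ ψ → K.PF ψ × (∀ τ → K.ev (lookup q i) (xs τ) K.≈ τ K.* ψ τ)
      κ i = K.pf-div0 (K.pf-ev (lookup q i) xs (K.pf-line P x*)) (K.trans (K.ev-cong (lookup q i) (K.line-0 P x*)) (qP i))

      ζi : Fin (suc n) → K.Carrier → K.Carrier
      ζi i τ = K.ev (lookup (base n) i) (ω ∷ xs τ) K.+ ω K.* proj₁ (κ i) τ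

      ζ : K.Carrier → Vec K.Carrier (suc n)
      ζ τ = tabulate (λ i → ζi i τ)

      ζ-lookup : ∀ τ i → lookup (ζ τ) i ≡ ζi i τ
      ζ-lookup τ i = VecP.lookup∘tabulate (λ i → ζi i τ) i

      base-any : ∀ y y' x i → K.ev (lookup (base n) i) (y ∷ x) K.≈ K.ev (lookup (base n) i) (y' ∷ x)
      base-any y y' x zero = K.refl
      base-any y y' x (suc i) = K.reflexive (≡.trans (IK.base-suc y x i) (≡.sym (IK.base-suc y' x i)))

      ζ-zs : ∀ τ σ → τ K.* σ K.≈ K.1# → IK.zs (ω K.* σ) (xs τ) K.≈ᵥ ζ τ
      ζ-zs τ σ τσ = K.≈ᵥ-from λ i → K.trans (IK.zs-lookup (ω K.* σ) (xs τ) i) (K.trans (K.+-cong (base-any (ω K.* σ) ω (xs τ) i) (K.begin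
          (ω K.* σ) K.* K.ev (lookup q i) (xs τ) K.≈⟨ K.*-congˡ (proj₂ (proj₂ (κ i)) τ) ⟩
          (ω K.* σ) K.* (τ K.* proj₁ (κ i) τ) K.≈⟨ K.solve 4 (λ w s t k → (w K.:* s) K.:* (t K.:* k) K.:= (t K.:* s) K.:* (w K.:* k)) K.refl ω σ τ (proj₁ (κ i) τ) ⟩
          (τ K.* σ) K.* (ω K.* proj₁ (κ i) τ) K.≈⟨ K.*-congʳ τσ ⟩
          K.1# K.* (ω K.* proj₁ (κ i) τ) K.≈⟨ K.*-identityˡ _ ⟩
          ω K.* proj₁ (κ i) τ K.∎)) (K.reflexive (≡.sym (ζ-lookup τ i))))

      pf-ζ : ∀ i → K.PF (λ τ → lookup (ζ τ) i)
      pf-ζ i = K.pf-≈ (K.pf-+ (pf-base i) (K.pf-* (K.pf-con ω) (proj₁ (proj₂ (κ i))))) (λ t → K.reflexive (ζ-lookup t i))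
        where
        pf-base : ∀ i → K.PF (λ τ → K.ev (lookup (base n) i) (ω ∷ xs τ))
        pf-base zero = K.pf-con _
        pf-base (suc i) = K.pf-≈ (K.pf-line P x* i) (λ t → K.reflexive (IK.base-suc ω (xs t) i))

      -- τ^m times a combination of 1, y, …, y^(m-1)
      Cleared : ∀ {m} → Vec (Expr N) m → Set
      Cleared {m} t = Σ (K.Carrier → K.Carrier) λ M → K.PF M × (∀ τ σ → τ K.* σ K.≈ K.1# → K.pow τ m K.* VK.evV t (ω K.* σ) (ζ τ) K.≈ M τ)

      clear-cons : ∀ {m} c (t : Vec (Expr N) m) → Cleared t → Cleared (c ∷ t)
      clear-cons {m} c t (M , pM , h) = (λ τ → K.pow τ (suc m) K.* K.ev c (ζ τ) K.+ ω K.* M τ) ,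
          K.pf-+ (K.pf-* (K.pf-pow (suc m) K.pf-id) (K.pf-ev c ζ pf-ζ)) (K.pf-* (K.pf-con ω) pM) , eq
        where
        eq : ∀ τ σ → τ K.* σ K.≈ K.1# → K.pow τ (suc m) K.* VK.evV (c ∷ t) (ω K.* σ) (ζ τ) K.≈ K.pow τ (suc m) K.* K.ev c (ζ τ) K.+ ω K.* M τ
        eq τ σ τσ = K.begin
          (τ K.* K.pow τ m) K.* (K.ev c (ζ τ) K.+ (ω K.* σ) K.* VK.evV t (ω K.* σ) (ζ τ))
            K.≈⟨ K.solve 6 (λ t p c w s e → (t K.:* p) K.:* (c K.:+ (w K.:* s) K.:* e) K.:= (t K.:* p) K.:* c K.:+ (t K.:* s) K.:* (w K.:* (p K.:* e))) K.refl τ (K.pow τ m) (K.ev c (ζ τ)) ω σ (VK.evV t (ω K.* σ) (ζ τ)) ⟩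
          (τ K.* K.pow τ m) K.* K.ev c (ζ τ) K.+ (τ K.* σ) K.* (ω K.* (K.pow τ m K.* VK.evV t (ω K.* σ) (ζ τ)))
            K.≈⟨ K.+-congˡ (K.trans (K.*-cong τσ (K.*-congˡ (h τ σ τσ))) (K.*-identityˡ _)) ⟩
          (τ K.* K.pow τ m) K.* K.ev c (ζ τ) K.+ ω K.* M τ K.∎

      clear : ∀ {m} (t : Vec (Expr N) m) → Cleared t
      clear [] = (λ _ → K.0#) , K.pf-con K.0# , λ τ σ _ → K.zeroʳ _
      clear (c ∷ t) = clear-cons c t (clear t)

    Identity : ∀ {m} → ℤ → Expr N → ℕ → Vec (Expr N) m → Set
    Identity C Δ j t = ∀ ρ → C ℤ.* (evℤ Δ (zsℤ ρ) ℤ.* ZK.pow (yv ρ) j) ≡ VZ.evV t (yv ρ) (zsℤ ρ)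

    identityK : ∀ {m} C Δ j (t : Vec (Expr N) m) → Identity C Δ j t →
                ∀ y x → K.intCast C K.* (K.ev Δ (IK.zs y x) K.* K.pow y j) K.≈ VK.evV t y (IK.zs y x)
    identityK C Δ j t ht y' x = K.trans (K.*-congˡ (K.*-cong (K.reflexive (≡.sym (K.ev-sub Δ (zE q) (y' ∷ x)))) (K.sym (VK.ev-powE' (var zero) j (y' ∷ x)))))
       (K.trans (HK.transfer≡ (con C ⊗ (subz Δ ⊗ powE (var zero) j)) (sub (vecPoly t) (var zero ∷ zE q))
                   (λ ρ → ≡.trans (≡.cong₂ ℤ._*_ (castℤ C) (≡.cong₂ ℤ._*_ (subz-ev Δ ρ) (ev-powE (var zero) j ρ))) (≡.trans (ht ρ)
                      (≡.sym (≡.trans (EvalE-sub.ev-sub ℤR (vecPoly t) (var zero ∷ zE q) ρ) (evZP (Vec.toList t) (yv ρ) (zsℤ ρ)))))) (y' ∷ x))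
          (K.trans (K.reflexive (K.ev-sub (vecPoly t) (var zero ∷ zE q) (y' ∷ x))) (K.ev-polyE (Vec.toList t) y' (IK.zs y' x))))

    evV-cong : ∀ {k y'} (t : Vec (Expr N) k) {ρ ρ'} → ρ K.≈ᵥ ρ' → VK.evV t y' ρ K.≈ VK.evV t y' ρ'
    evV-cong [] h = K.refl
    evV-cong (c ∷ t) h = K.+-cong (K.ev-cong c h) (K.*-congˡ (evV-cong t h))

    pow-inv : ∀ ω τ σ k → τ K.* σ K.≈ K.1# → K.pow τ k K.* K.pow (ω K.* σ) k K.≈ K.pow ω k
    pow-inv ω τ σ k τσ = K.trans (K.sym (K.pow-* τ (ω K.* σ) k)) (K.pow-cong k (K.trans (K.solve 3 (λ t w s → t K.:* (w K.:* s) K.:= (t K.:* s) K.:* w) K.refl τ ω σ) (K.trans (K.*-congʳ τσ) (K.*-identityˡ ω))))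

    -- for j large, the identity forces Δ(z) to vanish to high order at τ = 0
    module AtPoint (P : Vec K.Carrier n) (qP : ∀ i → K.ev (lookup q i) P K.≈ K.0#) (ω : K.Carrier) (x* : Vec K.Carrier n) (nω : ¬ (ω K.≈ K.0#))
      (Δ : Expr N) (nz : ¬ (K.ev Δ (IK.zs ω x*) K.≈ K.0#)) where
      open Curve P qP x* ω

      DPF : K.PF (λ τ → K.ev Δ (ζ τ))
      DPF = K.pf-ev Δ ζ pf-ζ

      at-one : IK.zs ω x* K.≈ᵥ ζ K.1#
      at-one = K.≈ᵥ-trans (K.evs-cong (zE q) (K.sym (K.*-identityʳ ω) K.∷ K.≈ᵥ-sym (K.line-1 P x*))) (ζ-zs K.1# K.1# (K.*-identityˡ K.1#))

      powω≢0 : ∀ k → ¬ (K.pow ω k K.≈ K.0#)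
      powω≢0 zero = K.1≉0
      powω≢0 (suc k) h = powω≢0 k (K.domain {ω} h nω)

      -- The identity is multiplied by τ^j = τ^ℓ τ^m: on the left y^j = (ω / τ)^j becomes ω^j, and
      -- on the right τ^m alone already clears the poles.
      away : ∀ {m} ℓ C (t : Vec (Expr N) m) → Identity C Δ (ℓ ℕ.+ m) t → (cl : Cleared t) → ∀ τ → ¬ (τ K.≈ K.0#) →
             (K.intCast C K.* K.pow ω (ℓ ℕ.+ m)) K.* K.ev Δ (ζ τ) K.+ K.- (K.pow τ ℓ K.* proj₁ cl τ) K.≈ K.0#
      away {m} ℓ C t ht (Mt , pM , hM) τ nτ = go (inv τ nτ)
        where
        j = ℓ ℕ.+ m
        go : (Σ K.Carrier λ σ → τ K.* σ K.≈ K.1#) → (K.intCast C K.* K.pow ω j) K.* K.ev Δ (ζ τ) K.+ K.- (K.pow τ ℓ K.* Mt τ) K.≈ K.0#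
        go (σ , τσ) = K.x≈y⇒x-y≈0 (K.begin
          (K.intCast C K.* K.pow ω j) K.* K.ev Δ (ζ τ)
            K.≈⟨ K.*-cong (K.*-congˡ (K.sym (pow-inv ω τ σ j τσ))) (K.ev-cong Δ (K.≈ᵥ-sym (ζ-zs τ σ τσ))) ⟩
          (K.intCast C K.* (K.pow τ j K.* K.pow (ω K.* σ) j)) K.* K.ev Δ Z'
            K.≈⟨ K.solve 4 (λ c t y d → (c K.:* (t K.:* y)) K.:* d K.:= t K.:* (c K.:* (d K.:* y))) K.refl (K.intCast C) (K.pow τ j) (K.pow (ω K.* σ) j) (K.ev Δ Z') ⟩
          K.pow τ j K.* (K.intCast C K.* (K.ev Δ Z' K.* K.pow (ω K.* σ) j))
            K.≈⟨ K.*-cong (K.pow-+ τ ℓ m) (identityK C Δ j t ht (ω K.* σ) (xs τ)) ⟩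
          (K.pow τ ℓ K.* K.pow τ m) K.* VK.evV t (ω K.* σ) Z'
            K.≈⟨ K.trans (K.*-assoc (K.pow τ ℓ) (K.pow τ m) (VK.evV t (ω K.* σ) Z')) (K.*-congˡ (K.*-congˡ (evV-cong t (ζ-zs τ σ τσ)))) ⟩
          K.pow τ ℓ K.* (K.pow τ m K.* VK.evV t (ω K.* σ) (ζ τ))
            K.≈⟨ K.*-congˡ (hM τ σ τσ) ⟩
          K.pow τ ℓ K.* Mt τ K.∎)
          where Z' = IK.zs (ω K.* σ) (xs τ)

      -- Let ℓ be the number of coefficients of `Δ` along the curve. The identity for j = ℓ + m
      -- makes this polynomial, up to a nonzero constant, divisible by τ^ℓ, so it vanishes; but τ =
      -- 1 gives the point where `Δ` is nonzero.
      absurd : ∀ {m} C → ¬ (K.intCast C K.≈ K.0#) → (t : Vec (Expr N) m) → Identity C Δ (length (proj₁ DPF) ℕ.+ m) t → ⊥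
      absurd {m} C nC t ht = core DPF (clear t) ht
        where
        core : (D : K.PF (λ τ → K.ev Δ (ζ τ))) → (cl : Cleared t) → Identity C Δ (length (proj₁ D) ℕ.+ m) t → ⊥
        core (ds , hD) cl@(Mt , pM , hM) ht = nz (K.trans (K.ev-cong Δ at-one) (K.trans (hD K.1#) (K.domain {C''} D1 nC'')))
          where
          ℓ = length ds
          C'' = K.intCast C K.* K.pow ω (ℓ ℕ.+ m)
          nC'' : ¬ (C'' K.≈ K.0#)
          nC'' h = powω≢0 (ℓ ℕ.+ m) (K.domain {K.intCast C} h nC)
          all-τ : ∀ τ → C'' K.* K.ev Δ (ζ τ) K.+ K.- (K.pow τ ℓ K.* Mt τ) K.≈ K.0#
          all-τ = K.pf-ext0 (K.pf-+ (K.pf-* (K.pf-con C'') (ds , hD)) (K.pf-neg (K.pf-* (K.pf-pow ℓ K.pf-id) pM))) (away ℓ C t ht cl)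
          dz : K.AllZ (K.scL C'' ds)
          dz = K.order-zero ℓ (K.scL C'' ds) {Mt} (ℕP.≤-reflexive (K.scL-len C'' ds)) pM λ τ →
            K.trans (K.horner-sc C'' ds τ) (K.trans (K.*-congˡ (K.sym (hD τ))) (K.x-y≈0⇒x≈y (all-τ τ)))
          D1 : C'' K.* K.horner ds K.1# K.≈ K.0#
          D1 = K.trans (K.sym (K.horner-sc C'' ds K.1#)) (K.AllZ⇒0 dz K.1#)

    module Contradiction (M : ℕ) (Ψ : Vec (Expr N) M) (ψ : Expr N) (relΨ : Relation Ψ ψ) (ψK : K.NonVan ψ)
      (𝓑 : List (Expr N)) (b : ℤ) (b≢0 : ¬ b ≡ pos 0)
      (span : ∀ j → SpanQ (InR q []) (_∈ 𝓑) (powE (var zero ⊗ wk (con b)) j ⊗ con (pos 1)))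
      (P : Vec K.Carrier n) (qP : ∀ i → K.ev (lookup q i) P K.≈ K.0#) where

      Uniform : ℕ → Expr N → Set
      Uniform m Δ₀ = ∀ {h} → SE m 𝓑 h → (Σ (Expr N) λ δ → DZ.NonVan δ × E m (subz δ ⊗ h)) → E m (subz Δ₀ ⊗ h)

      -- The integer collects `c`, `b^j` and `d`, which may be divisible by p and may vary with j,
      -- while Δ stays fixed; `remove-p` then takes p out of the integer.
      produce : ∀ m → Ind m → (α : Vec (Expr N) m) (β : Expr N) → Relation α β → K.NonVan β → (Δ₀ : Expr N) → Uniform m Δ₀ →
                (d : ℤ) → ¬ d ≡ pos 0 → (Δ : Expr N) → (∀ ρ → evℤ Δ₀ ρ ≡ d ℤ.* evℤ Δ ρ) → ∀ j →
                ¬ ¬ Σ ℤ λ C → ¬ (K.intCast C K.≈ K.0#) × Σ (Vec (Expr N) m) λ t → Identity C Δ j t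
      produce m ind α β rel nβ Δ₀ u d nd Δ Δ-eq j = go (y-alg α β rel j) (spanQ-SE {m} 𝓑 (span j))
        where
        y : Expr N
        y = var zero
        go : (Σ ℕ λ e → E m (subz (powE β e) ⊗ powE y j)) → (Σ ℤ λ c → ¬ c ≡ pos 0 × SE m 𝓑 (con c ⊗ (powE (y ⊗ wk (con b)) j ⊗ con (pos 1)))) →
             ¬ ¬ Σ ℤ λ C → ¬ (K.intCast C K.≈ K.0#) × Σ (Vec (Expr N) m) λ t → Identity C Δ j t
        go (e , alg) (c , nc , se) = from-E (u se₁ (powE β e , nonvan-powE β e (nvK⇒nvℤ β nβ) , E-ext (E-mul (con C₁) alg) λ ρ → mid-swap (ZK.intCast C₁) (evℤ (subz (powE β e)) ρ) (evℤ (powE y j) ρ)))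
          where
          C₁ = c ℤ.* ZK.pow b j
          se₁ : SE m 𝓑 (con C₁ ⊗ powE y j)
          se₁ = SE-ext 𝓑 se λ ρ → ≡.trans (≡.cong₂ (λ v w → v ℤ.* (w ℤ.* pos 1)) (castℤ c) (≡.trans (ev-powE (y ⊗ wk (con b)) j ρ)
                  (≡.trans (ZK.pow-* (yv ρ) (ZK.intCast b) j) (≡.cong (λ v → ZK.pow (yv ρ) j ℤ.* ZK.pow v j) (castℤ b)))))
                (≡.trans (ZK.solve 3 (λ c y b → c ZK.:* ((y ZK.:* b) ZK.:* ZK.con (pos 1)) ZK.:= (c ZK.:* b) ZK.:* y) ≡.refl c (ZK.pow (yv ρ) j) (ZK.pow b j))
                  (≡.sym (≡.cong₂ ℤ._*_ (castℤ C₁) (ev-powE y j ρ))))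
          hs : ∀ ρ → evℤ (powE β e) (zsℤ ρ) ℤ.* ZK.pow (yv ρ) j ≡ VZ.evV (E.coords alg) (yv ρ) (zsℤ ρ)
          hs ρ = ≡.trans (≡.sym (≡.cong₂ ℤ._*_ (subz-ev (powE β e) ρ) (ev-powE y j ρ))) (E.coords-eq alg ρ)
          from-E : E m (subz Δ₀ ⊗ (con C₁ ⊗ powE y j)) → ¬ ¬ Σ ℤ λ C → ¬ (K.intCast C K.≈ K.0#) × Σ (Vec (Expr N) m) λ t → Identity C Δ j t
          from-E (mkE t t-eq) = remove-p ind β nβ j e (E.coords alg) hs Δ (C₁ ℤ.* d)
              (λ h → nd (ℤ-domain {C₁} h λ h' → pow-≢0 b j b≢0 (ℤ-domain {c} h' nc))) t
              (λ ρ → ≡.trans (≡.sym (≡.trans (≡.cong₂ ℤ._*_ (≡.trans (subz-ev Δ₀ ρ) (Δ-eq (zsℤ ρ))) (≡.cong₂ ℤ._*_ (castℤ C₁) (ev-powE y j ρ)))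
                (ZK.solve 4 (λ d D c y → (d ZK.:* D) ZK.:* (c ZK.:* y) ZK.:= (c ZK.:* d) ZK.:* (D ZK.:* y)) ≡.refl d (evℤ Δ (zsℤ ρ)) C₁ (ZK.pow (yv ρ) j)))) (t-eq ρ))
              (<-wellFounded _)

      -- As Δ is nonzero modulo p, independence rules out that it vanishes at all z(ω, x*) with ω ≠
      -- 0. The exponent j is chosen after such a point, beyond the degree of Δ on the curve through
      -- it.
      no-point : ⊥
      no-point = minimal M 0 (λ α h ()) (≡.subst Rel (≡.sym (ℕP.+-identityʳ M)) (Ψ , ψ , nvK⇒nvℤ ψ ψK , relΨ)) λ { (m , m≤M , ind , α₀ , β₀ , nβ₀ , rel₀) →
        DZ.nonvan-pt β₀ nβ₀ λ { (w , nw) → mk-primitive α₀ β₀ rel₀ w nw (<-wellFounded _) λ { (α , β , nβ , rel , pr) →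
        uniform m 𝓑 λ { (Δ₀ , nΔ₀ , u) → DZ.nonvan-pt Δ₀ nΔ₀ λ { (w' , nw') → p-free Δ₀ w' nw' (<-wellFounded _) λ { (d , nd , Δ , nΔ , Δ-eq) →
        nΔ (IK.indep q₀K Δ λ ω x* nω → K.stable λ nz →
          produce m ind α β rel (lead-nonvan (≡.subst (m ℕ.≤_) (ℕP.+-identityʳ M) m≤M) ind α β nβ rel pr Ψ ψ relΨ ψK) Δ₀ u d nd Δ Δ-eq
            (length (proj₁ (AtPoint.DPF P qP ω x* nω Δ nz)) ℕ.+ m) λ { (C , nC , t , ht) → AtPoint.absurd P qP ω x* nω Δ nz C nC t ht }) } } } } } }

-- The arithmetic Nullstellensatz

module CR = CommutativeRing

CommonZero : (A : ACF) → ∀ {n} → List (Expr n) → Set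
CommonZero A {n} fs = Σ (Vec (Dom.Carrier (ACF.infDom A)) n) λ P → All (λ f → Dom._≈_ (ACF.infDom A) (Dom.ev (ACF.infDom A) f P) (Dom.0# (ACF.infDom A))) fs

CharZ : ACF → Set
CharZ A = ∀ c → Dom._≈_ (ACF.infDom A) (Dom.intCast (ACF.infDom A) c) (Dom.0# (ACF.infDom A)) → c ≡ pos 0

record LeadCf {L N : ℕ} (B : ℕ) {l} (v : Vec (Cf L N) l) : Set where
  field
    M : ℕ
    low : Vec (Expr N) M
    lead : Cf L N
    lead≢0 : ¬ CfZ N lead
    lead-bd : CfB B N lead
    split : ∀ t Z → Uni.evP ℤR (cfEl N v) t Z ≡ VZ.evV low t Z ℤ.+ evℤ (cfE N lead) Z ℤ.* ZK.pow t M

leadCf : ∀ {L N} B {l} (v : Vec (Cf L N) l) → (∀ i → CfB B N (lookup v i)) → ¬ (∀ i → CfZ N (lookup v i)) → LeadCf B v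
leadCf B [] hb nz = ⊥-elim (nz λ ())
leadCf {N = N} B (c ∷ cs) hb nz with FinP.all? (λ i → CfZ? N (lookup cs i))
... | no nzs = record { M = suc M ; low = cfE N c ∷ low ; lead = lead ; lead≢0 = lead≢0 ; lead-bd = lead-bd ; split = λ t Z →
      ≡.trans (≡.cong (λ u → evℤ (cfE N c) Z ℤ.+ t ℤ.* u) (split t Z))
        (ZK.solve 5 (λ c t u l w → c ZK.:+ t ZK.:* (u ZK.:+ l ZK.:* w) ZK.:= (c ZK.:+ t ZK.:* u) ZK.:+ l ZK.:* (t ZK.:* w)) ≡.refl (evℤ (cfE N c) Z) t (VZ.evV low t Z) (evℤ (cfE N lead) Z) (ZK.pow t M)) }
  where open LeadCf (leadCf B cs (λ i → hb (suc i)) nzs)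
... | yes zs = record { M = 0 ; low = [] ; lead = c ; lead≢0 = λ z → nz λ { zero → z ; (suc i) → zs i } ; lead-bd = hb zero ; split = λ t Z →
      ≡.trans (≡.cong (λ u → evℤ (cfE N c) Z ℤ.+ t ℤ.* u) (cfz-evl N cs zs t Z))
        (ZK.solve 2 (λ c t → c ZK.:+ t ZK.:* ZK.con (pos 0) ZK.:= ZK.con (pos 0) ZK.:+ c ZK.:* ZK.con (pos 1)) ≡.refl (evℤ (cfE N c) Z) t) }

module Arith (n Δ L E : ℕ) (Y : ℕ → ℕ) (siegel : Siegel (suc n) (suc Δ) L E Y) (Δ<E : Δ ℕ.< E)
  (fs : List (Expr n)) (Fb : ℕ) (1≤Fb : 1 ℕ.≤ Fb) (fs-deg : All (λ f → deg f ℕ.≤ Δ) fs)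
  (fs-val : All (λ f → ∀ (a : Vec (Fin E) n) → ∣ evℤ f (Vec.map posFin a) ∣ ℕ.≤ Fb) fs) where
  open Step n Δ L E Y siegel

  -- The start is an equation with values at most `Fb`, and each of the s steps subtracts a multiple
  -- of an equation by an integer of size at most `Λ`.
  Qb : ℕ → ℕ
  Qb s = Fb ℕ.* (1 ℕ.+ s ℕ.* Λ)

  -- Bounds xᵢ + y qᵢ on the grid, and with it y itself and every y f.
  W : ℕ
  W = E ℕ.+ E ℕ.* Qb (length fs)

  -- The first factor bounds the value of `ψ` at `w`, the second that of `q₀` at x*.
  Bbound : ℕ
  Bbound = ((2 ℕ.* Y W) ℕ.* (L ℕ.* suc (N ℕ.* L) ℕ.^ L) ℕ.^ N) ℕ.* Qb (length fs)

  Qb-mono : ∀ {s t} → s ℕ.≤ t → Qb s ℕ.≤ Qb t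
  Qb-mono h = ℕP.*-monoʳ-≤ Fb (s≤s (ℕP.*-monoˡ-≤ Λ h))

  E≥1 : 1 ℕ.≤ E
  E≥1 = ℕP.≤-trans (s≤s z≤n) Δ<E

  W≥1 : 1 ℕ.≤ W
  W≥1 = ℕP.≤-trans E≥1 (ℕP.m≤m+n E _)

  module From (a* : Vec (Fin E) n) where
    x* : Vec ℤ n
    x* = Vec.map posFin a*

    record Inv (s : ℕ) (q : Vec (Expr n) N) : Set where
      field
        degs : ∀ i → deg (lookup q i) ℕ.≤ Δ
        vals : ∀ (a : Vec (Fin E) n) i → ∣ evℤ (lookup q i) (Vec.map posFin a) ∣ ℕ.≤ Qb s
        nz : ¬ evℤ (lookup q zero) x* ≡ pos 0

    z-val : ∀ s q → s ℕ.≤ length fs → Inv s q → ∀ (a : Vec (Fin E) N) i → ∣ evℤ (lookup (zE q) i) (Vec.map posFin a) ∣ ℕ.≤ W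
    z-val s q s≤ inv (y ∷ x) i = ℕP.≤-trans (ℕP.≤-reflexive (≡.cong ∣_∣ (z-ev q (posFin y) (Vec.map posFin x) i)))
      (ℕP.≤-trans (ℤP.∣i+j∣≤∣i∣+∣j∣ (evℤ (lookup (base n) i) (Vec.map posFin (y ∷ x))) _)
        (ℕP.+-mono-≤ (base-val i) (ℕP.≤-trans (ℕP.≤-reflexive (ℤP.abs-* (posFin y) _))
          (ℕP.*-mono-≤ (ℕP.<⇒≤ (FinP.toℕ<n y)) (ℕP.≤-trans (Inv.vals inv x i) (Qb-mono s≤))))))
      where
      base-val : ∀ i → ∣ evℤ (lookup (base n) i) (Vec.map posFin (y ∷ x)) ∣ ℕ.≤ E
      base-val zero = z≤n
      base-val (suc i) = ≡.subst (λ e → ∣ evℤ e (Vec.map posFin (y ∷ x)) ∣ ℕ.≤ E) (≡.sym (VecP.lookup∘tabulate (λ i → var (suc i)) i)) (posFin-Bdd (y ∷ x) (suc i))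

    v-val : ∀ f → (∀ (a : Vec (Fin E) n) → ∣ evℤ f (Vec.map posFin a) ∣ ℕ.≤ Fb) → ∀ (a : Vec (Fin E) N) → ∣ evℤ (vE f) (Vec.map posFin a) ∣ ℕ.≤ W
    v-val f hf (y ∷ x) = ℕP.≤-trans (ℕP.≤-reflexive (≡.trans (ℤP.abs-* (posFin y) _) (≡.cong (λ u → Fin.toℕ y ℕ.* ∣ u ∣) (evZw f (posFin y) (Vec.map posFin x)))))
      (ℕP.≤-trans (ℕP.*-mono-≤ (ℕP.<⇒≤ (FinP.toℕ<n y)) (ℕP.≤-trans (hf x) (ℕP.m≤m*n Fb (1 ℕ.+ length fs ℕ.* Λ)))) (ℕP.m≤n+m _ E))

    run : ∀ s gs q → All (λ f → deg f ℕ.≤ Δ) gs → All (λ f → ∀ (a : Vec (Fin E) n) → ∣ evℤ f (Vec.map posFin a) ∣ ℕ.≤ Fb) gs →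
          s ℕ.+ length gs ℕ.≤ length fs → Inv s q → Σ (Vec (Expr n) N) λ q' → Inv (length fs) q' × Tower q gs q'
    run s [] q [] [] le inv = q , record { degs = Inv.degs inv ; vals = λ a i → ℕP.≤-trans (Inv.vals inv a i) (Qb-mono (ℕP.m+n≤o⇒m≤o s le)) ; nz = Inv.nz inv } , []
    run s (g ∷ gs) q (dg ∷ dgs) (vg ∷ vgs) le inv = cont (noether-step q g (Inv.degs inv) dg W W≥1 hval x* (Inv.nz inv))
      where
      s≤ : s ℕ.≤ length fs
      s≤ = ℕP.m+n≤o⇒m≤o s le
      hval : ∀ (a : Vec (Fin E) N) i → ∣ evℤ (lookup (vE g ∷ zE q) i) (Vec.map posFin a) ∣ ℕ.≤ W
      hval a zero = v-val g vg a
      hval a (suc i) = z-val s q s≤ inv a i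
      cont : StepOut q g x* → Σ (Vec (Expr n) N) λ q' → Inv (length fs) q' × Tower q (g ∷ gs) q'
      cont (αs , αb , nz' , sr) = let q' , inv' , tw = run (suc s) gs (upd αs g q) dgs vgs (≡.subst (ℕ._≤ length fs) (ℕP.+-suc s (length gs)) le)
                                         (record { degs = upd-deg αs g q Δ dg (Inv.degs inv) ; vals = vals' ; nz = nz' })
                                  in q' , inv' , (sr ∷ tw)
        where
        vals' : ∀ (a : Vec (Fin E) n) i → ∣ evℤ (lookup (upd αs g q) i) (Vec.map posFin a) ∣ ℕ.≤ Qb (suc s)
        vals' a i = ℕP.≤-trans (ℕP.≤-reflexive (≡.cong ∣_∣ (upd-ev αs g q (Vec.map posFin a) i)))
          (ℕP.≤-trans (ℤP.∣i-j∣≤∣i∣+∣j∣ (evℤ (lookup q i) (Vec.map posFin a)) _)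
          (ℕP.≤-trans (ℕP.+-mono-≤ (Inv.vals inv a i) (ℕP.≤-trans (ℕP.≤-reflexive (ℤP.abs-* (lookup αs i) _)) (ℕP.*-mono-≤ (αb i) (vg a))))
            (ℕP.≤-reflexive (solve 3 (λ F s l → F :* (con 1 :+ s :* l) :+ l :* F := F :* (con 1 :+ (con 1 :+ s) :* l)) ≡.refl Fb s Λ))))
          where
          open import Data.Nat.Solver using (module +-*-Solver)
          open +-*-Solver

    -- Each update changes the qᵢ by multiples of an equation, so at a common zero of the equations
    -- they keep the value 0.
    tower-zero : ∀ (R : CRing) {q : Vec (Expr n) N} {gs q'} → Tower q gs q' → ∀ P → All (λ f → CR._≈_ R (EvalE.ev R f P) (CR.0# R)) gs →
                 (∀ i → CR._≈_ R (EvalE.ev R (lookup q i) P) (CR.0# R)) → ∀ i → CR._≈_ R (EvalE.ev R (lookup q' i) P) (CR.0# R)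
    tower-zero R [] P hg hq = hq
    tower-zero R (_∷_ {q} {f} sr tw) P (hf ∷ hg) hq = tower-zero R tw P hg λ i →
       trans (reflexive (≡.trans (≡.cong (λ v → EvalE.ev R (lookup v i) P) (StepRel.q'≡ sr)) (≡.cong (λ e → EvalE.ev R e P) (VecP.lookup-zipWith _ i (StepRel.αs sr) q))))
         (trans (+-cong (hq i) (trans (*-congˡ hf) (zeroʳ _))) (+-identityˡ _))
      where open CR R

    record Final (q' : Vec (Expr n) N) : Set where
      field
        M : ℕ
        low : Vec (Expr N) M
        ψ : Expr N
        rel : ∀ ρ → VZ.evV low (lookup ρ zero) (EvalE.evs ℤR (zE q') ρ) ℤ.+ evℤ ψ (EvalE.evs ℤR (zE q') ρ) ℤ.* ZK.pow (lookup ρ zero) M ≡ pos 0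
        w : Vec ℤ N
        ψw≢0 : ¬ evℤ ψ w ≡ pos 0
        ψw-bd : ∣ evℤ ψ w ∣ ℕ.≤ (2 ℕ.* Y W) ℕ.* (L ℕ.* suc (N ℕ.* L) ℕ.^ L) ℕ.^ N

    final : ∀ q' → Inv (length fs) q' → Final q'
    final q' inv = from (siegel W W≥1 (var zero ∷ zE q') (gdeg q' (var zero) (Inv.degs inv) (s≤s z≤n)) hval)
      where
      hval : ∀ (a : Vec (Fin E) N) i → ∣ evℤ (lookup (var zero ∷ zE q') i) (Vec.map posFin a) ∣ ℕ.≤ W
      hval (y ∷ x) zero = ℕP.≤-trans (ℕP.<⇒≤ (FinP.toℕ<n y)) (ℕP.m≤m+n E _)
      hval a (suc i) = z-val (length fs) q' ℕP.≤-refl inv a i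
      from : (Σ (Cf L (suc N)) λ c → ¬ CfZ (suc N) c × CfB (2 ℕ.* Y W) (suc N) c × (∀ ρ → evℤ (cfE (suc N) c) (EvalE.evs ℤR (var zero ∷ zE q') ρ) ≡ pos 0)) → Final q'
      -- The leading coefficient in y is a nonzero polynomial of degree at most `N L`, so a point
      -- with entries up to `N L` detects it.
      from (c , nz , bd , van) = pick (gridSearch (suc (N ℕ.* L)) (cfE N LC.lead) (s≤s (cfE-deg N LC.lead)))
        where
        module LC = LeadCf (leadCf (2 ℕ.* Y W) c bd nz)
        pick : (Σ (Vec (Fin (suc (N ℕ.* L))) N) λ a → ¬ evℤ (cfE N LC.lead) (Vec.map posFin a) ≡ pos 0) ⊎ Uni.Van ℤR (cfE N LC.lead) → Final q'
        pick (inj₂ v) = ⊥-elim (LC.lead≢0 (cf-van N LC.lead v))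
        pick (inj₁ (a , na)) = record { M = LC.M ; low = LC.low ; ψ = cfE N LC.lead ; w = Vec.map posFin a ; ψw≢0 = na
          ; rel = λ ρ → ≡.trans (≡.sym (LC.split (lookup ρ zero) (EvalE.evs ℤR (zE q') ρ))) (≡.trans (≡.sym (evZP (cfEl N c) (lookup ρ zero) (EvalE.evs ℤR (zE q') ρ))) (van ρ))
          ; ψw-bd = cfE-bd N LC.lead (2 ℕ.* Y W) (suc (N ℕ.* L)) (s≤s z≤n) LC.lead-bd (Vec.map posFin a) (posFin-Bdd a) }

    module Conclude (f₀ : Expr n) (f₀∈ : f₀ ∈ fs) (f₀≢0 : ¬ evℤ f₀ x* ≡ pos 0) where
      inv₀ : Inv 0 (start f₀)
      inv₀ = record
        { degs = λ { zero → All.lookup fs-deg f₀∈ ; (suc i) → ≡.subst (λ e → deg e ℕ.≤ Δ) (≡.sym (VecP.lookup-replicate i (con (pos 0)))) z≤n }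
        ; vals = λ { a zero → ℕP.≤-trans (All.lookup fs-val f₀∈ a) (ℕP.m≤m*n Fb 1)
                   ; a (suc i) → ≡.subst (λ e → ∣ evℤ e (Vec.map posFin a) ∣ ℕ.≤ Qb 0) (≡.sym (VecP.lookup-replicate i (con (pos 0)))) z≤n }
        ; nz = f₀≢0 }

      out : Σ (Vec (Expr n) N) λ q' → Inv (length fs) q' × Tower (start f₀) fs q'
      out = run 0 fs (start f₀) fs-deg fs-val ℕP.≤-refl inv₀

      conclude : (o : Σ (Vec (Expr n) N) λ q' → Inv (length fs) q' × Tower (start f₀) fs q') → Final (proj₁ o) →
        Σ ℕ λ B → 1 ℕ.≤ B × B ℕ.≤ Bbound × ((A₀ : ACF) → CharZ A₀ → ¬ CommonZero A₀ fs →
          ∀ p → ¬ (p ∣ B) → (A : ACF) → CharDom (ACF.infDom A) p → ¬ CommonZero A fs)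
      -- A prime outside this product leaves one value of `ψ` and one of `q₀` nonzero, hence both
      -- polynomials nonzero modulo p.
      conclude (q' , inv , tw) F = ∣ ψw ∣ ℕ.* ∣ q₀* ∣ , ℕP.*-mono-≤ (abs≥1 ψw ψw≢0) (abs≥1 q₀* (Inv.nz inv)) ,
          ℕP.*-mono-≤ ψw-bd (Inv.vals inv a* zero) , claim
        where
        open Final F
        ψw q₀* : ℤ
        ψw = evℤ ψ w
        q₀* = evℤ (lookup q' zero) x*
        abs≥1 : ∀ c → ¬ c ≡ pos 0 → 1 ℕ.≤ ∣ c ∣
        abs≥1 c nc with ∣ c ∣ in eq
        ... | zero = ⊥-elim (nc (ℤP.∣i∣≡0⇒i≡0 eq))
        ... | suc k = s≤s z≤n
        claim : (A₀ : ACF) → CharZ A₀ → ¬ CommonZero A₀ fs → ∀ p → ¬ (p ∣ ∣ ψw ∣ ℕ.* ∣ q₀* ∣) → (A : ACF) → CharDom (ACF.infDom A) p → ¬ CommonZero A fs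
        claim A₀ cz nz₀ p p∤B A cd (P , Pz) = Nullstellensatz.no-zero⇒unit A₀ cz fs (λ ρ z → nz₀ (ρ , z)) λ { (b , nb , ib) →
            MP.WithZ.Contradiction.no-point q' q₀K M low ψ rel ψK (proj₁ ts) b nb
              (λ j → proj₂ ts (mul (powR (idl-inR ib) j) (gen (here ≡.refl)))) P
              (tower-zero (InfDom.ring (ACF.infDom A)) tw P Pz start-zero) }
          where
          module MP = ModP A p cd
          module K = Dom (ACF.infDom A)
          ts = tower-span tw (con (pos 1) ∷ [])
          powR : ∀ {g} → InR (start f₀) fs g → ∀ j → InR (start f₀) fs (powE g j)
          powR r zero = conR (pos 1)
          powR r (suc j) = mulR r (powR r j)
          nonvan : ∀ {m} (e : Expr m) u → ¬ (p ∣ ∣ evℤ e u ∣) → K.NonVan e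
          nonvan e u np v with CharDom.char cd (evℤ e u) (K.trans (K.sym (Hom.ev-hom (InfDom.ring (ACF.infDom A)) e u)) (v (Vec.map K.intCast u)))
          ... | c , eq = np (divides ∣ c ∣ (≡.trans (≡.cong ∣_∣ eq) (≡.trans (ℤP.abs-* (pos p) c) (ℕP.*-comm p ∣ c ∣))))
          q₀K : K.NonVan (lookup q' zero)
          q₀K = nonvan (lookup q' zero) x* (λ d → p∤B (ℕD.∣n⇒∣m*n ∣ ψw ∣ d))
          ψK : K.NonVan ψ
          ψK = nonvan ψ w (λ d → p∤B (ℕD.∣m⇒∣m*n ∣ q₀* ∣ d))
          start-zero : ∀ i → K.ev (lookup (start f₀) i) P K.≈ K.0#
          start-zero zero = All.lookup Pz f₀∈
          start-zero (suc i) = K.reflexive (≡.cong (λ e → K.ev e P) (VecP.lookup-replicate i (con (pos 0))))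

  Result : Set₁
  Result = Σ ℕ λ B → 1 ℕ.≤ B × B ℕ.≤ Bbound × ((A₀ : ACF) → CharZ A₀ → ¬ CommonZero A₀ fs →
          ∀ p → ¬ (p ∣ B) → (A : ACF) → CharDom (ACF.infDom A) p → ¬ CommonZero A fs)

  arithmetic-nullstellensatz : 1 ℕ.≤ Bbound → Result
  arithmetic-nullstellensatz 1≤Bb = go fs (λ m → m) fs-deg inj₁
    where
      -- Looks for an equation that is not identically zero, to serve as the first `q₀`.
      go : ∀ gs → (∀ {g} → g ∈ gs → g ∈ fs) → All (λ f → deg f ℕ.≤ Δ) gs → (∀ {f} → f ∈ fs → f ∈ gs ⊎ Uni.Van ℤR f) → Result
      -- If all equations vanish identically, the origin is a common zero in characteristic 0,
      -- against the assumption, so B = 1 will do.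
      go [] sub [] cov = 1 , s≤s z≤n , 1≤Bb , λ A₀ cz nz₀ _ _ _ _ _ → nz₀ (Vec.replicate n (Dom.0# (ACF.infDom A₀)) , All.tabulate λ {f} f∈ → Hom.transfer (InfDom.ring (ACF.infDom A₀)) f (van (cov f∈)) _)
        where
        van : ∀ {f} → f ∈ [] ⊎ Uni.Van ℤR f → Uni.Van ℤR f
        van (inj₂ v) = v
      go (g ∷ gs) sub (d ∷ ds) cov with gridSearch E g (ℕP.≤-<-trans d Δ<E)
      ... | inj₁ (a* , na) = From.Conclude.conclude a* g (sub (here ≡.refl)) na (From.Conclude.out a* g (sub (here ≡.refl)) na)
              (From.final a* _ (proj₁ (proj₂ (From.Conclude.out a* g (sub (here ≡.refl)) na))))
      ... | inj₂ v = go gs (λ m → sub (there m)) ds λ f∈ → step (cov f∈)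
        where
        step : ∀ {f} → f ∈ (g ∷ gs) ⊎ Uni.Van ℤR f → f ∈ gs ⊎ Uni.Van ℤR f
        step (inj₁ (here ≡.refl)) = inj₂ v
        step (inj₁ (there m)) = inj₁ m
        step (inj₂ v) = inj₂ v

-- Triangular systems and their iterates

-- A triangular system as a telescope: the head entry is X ↦ X·G + H, with G and H polynomials in the later variables.
Tri : ℕ → ℕ → Set
Tri L zero = ⊤
Tri L (suc m) = Cf L m × Cf L m × Tri L m

module TriEval (R : CRing) where
  open RingKit R hiding (con)
  open EvalE R
  open EvalE-sub R

  tri : ∀ {L m} → Tri L m → Vec Carrier m → Vec Carrier m
  tri {m = zero} T [] = []
  tri {m = suc m} (G , H , T) (x ∷ xs) = (x * ev (cfE m G) xs + ev (cfE m H) xs) ∷ tri T xs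

  triIter : ∀ {L m} → ℕ → Tri L m → Vec Carrier m → Vec Carrier m
  triIter zero T x = x
  triIter (suc k) T x = tri T (triIter k T x)

  tri-cong : ∀ {L m} (T : Tri L m) {x y} → x ≈ᵥ y → tri T x ≈ᵥ tri T y
  tri-cong {m = zero} T [] = []
  tri-cong {m = suc m} (G , H , T) (e ∷ es) = +-cong (*-cong e (ev-cong (cfE m G) es)) (ev-cong (cfE m H) es) ∷ tri-cong T es

  PerT : ∀ {L m} → ℕ → Tri L m → Vec Carrier m → Set
  PerT k T x = triIter k T x ≈ᵥ x

-- One more step multiplies by `G` and adds `H`, both taken at the k-th iterate of the later
-- variables; hence the mutual recursion with `itE`.
AE BE : ∀ {L m} → ℕ → Cf L m → Cf L m → Tri L m → Expr m
itE : ∀ {L m} → ℕ → Tri L m → Vec (Expr m) m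
AE zero G H T = con (pos 1)
AE (suc k) G H T = AE k G H T ⊗ sub (cfE _ G) (itE k T)
BE zero G H T = con (pos 0)
BE (suc k) G H T = BE k G H T ⊗ sub (cfE _ G) (itE k T) ⊕ sub (cfE _ H) (itE k T)
itE {m = zero} k T = []
itE {m = suc m} k (G , H , T) = (var zero ⊗ wk (AE k G H T) ⊕ wk (BE k G H T)) ∷ Vec.map wk (itE k T)

-- The k-th iterate acts on the head by X ↦ X·A + B, so its fixed points satisfy X·A' + B = 0 with A' = A - 1.
A'E : ∀ {L m} → ℕ → Cf L m → Cf L m → Tri L m → Expr m
A'E k G H T = AE k G H T ⊕ con (ℤ.- pos 1)

fsT asT : ∀ {L m} → ℕ → Tri L m → List (Expr m)
fsT {m = zero} k T = []
fsT {m = suc m} k (G , H , T) = (var zero ⊗ wk (A'E k G H T) ⊕ wk (BE k G H T)) ∷ List.map wk (fsT k T)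
asT {m = zero} k T = []
asT {m = suc m} k (G , H , T) = wk (A'E k G H T) ∷ List.map wk (asT k T)

module TriLemmas (R : CRing) where
  open RingKit R renaming (con to scon)
  open EvalE R
  open EvalE-sub R
  open TriEval R

  evs-wk : ∀ {m l} (es : Vec (Expr m) l) x xs → evs (Vec.map wk es) (x ∷ xs) ≈ᵥ evs es xs
  evs-wk [] x xs = []
  evs-wk (e ∷ es) x xs = reflexive (ev-wk e x xs) ∷ evs-wk es x xs

  nil≈ : (u v : Vec Carrier 0) → u ≈ᵥ v
  nil≈ [] [] = []

  it-ev : ∀ {L m} k (T : Tri L m) x → evs (itE k T) x ≈ᵥ triIter k T x
  it-head : ∀ {L m} k (G H : Cf L m) (T : Tri L m) x xs → x * ev (AE k G H T) xs + ev (BE k G H T) xs ≈ Vec.head (triIter k (G , H , T) (x ∷ xs))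
  it-tail : ∀ {L m} k (G H : Cf L m) (T : Tri L m) x xs → Vec.tail (triIter k (G , H , T) (x ∷ xs)) ≡ triIter k T xs
  it-tail zero G H T x xs = ≡.refl
  it-tail (suc k) G H T x xs with triIter k (G , H , T) (x ∷ xs) | it-tail k G H T x xs
  ... | u ∷ us | ≡.refl = ≡.refl
  it-head zero G H T x xs = trans (+-congʳ (trans (*-congˡ intCast-1) (*-identityʳ x))) (+-identityʳ x)
  it-head {m = m} (suc k) G H T x xs with triIter k (G , H , T) (x ∷ xs) | it-tail k G H T x xs | it-head k G H T x xs
  ... | u ∷ us | ≡.refl | ih = begin
    x * (a * g) + (b * g + h) ≈⟨ solve 5 (λ x a b g h → x :* (a :* g) :+ (b :* g :+ h) := (x :* a :+ b) :* g :+ h) refl x a b g h ⟩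
    (x * a + b) * g + h ≈⟨ +-cong (*-cong ih (trans (reflexive (ev-sub (cfE m G) (itE k T) xs)) (ev-cong (cfE m G) (it-ev k T xs))))
                                   (trans (reflexive (ev-sub (cfE m H) (itE k T) xs)) (ev-cong (cfE m H) (it-ev k T xs))) ⟩
    u * ev (cfE m G) us + ev (cfE m H) us ∎
    where
    a = ev (AE k G H T) xs
    b = ev (BE k G H T) xs
    g = ev (sub (cfE m G) (itE k T)) xs
    h = ev (sub (cfE m H) (itE k T)) xs
  it-ev {m = zero} k T x = nil≈ _ _
  it-ev {m = suc m} k (G , H , T) (x ∷ xs) with triIter k (G , H , T) (x ∷ xs) | it-tail k G H T x xs | it-head k G H T x xs
  ... | u ∷ us | ≡.refl | hd = trans (+-cong (*-congˡ (reflexive (ev-wk (AE k G H T) x xs))) (reflexive (ev-wk (BE k G H T) x xs))) hd ∷ ≈ᵥ-trans (evs-wk (itE k T) x xs) (it-ev k T xs)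

  Zero : ∀ {m} → Vec Carrier m → Expr m → Set
  Zero ρ e = ev e ρ ≈ 0#

  all-wk : ∀ {m} {es : List (Expr m)} {x xs} → All (Zero xs) es → All (Zero (x ∷ xs)) (List.map wk es)
  all-wk [] = []
  all-wk {es = e ∷ es} {x} {xs} (z ∷ zs) = trans (reflexive (ev-wk e x xs)) z ∷ all-wk zs

  all-unwk : ∀ {m} {es : List (Expr m)} {x xs} → All (Zero (x ∷ xs)) (List.map wk es) → All (Zero xs) es
  all-unwk {es = []} [] = []
  all-unwk {es = e ∷ es} {x} {xs} (z ∷ zs) = trans (reflexive (≡.sym (ev-wk e x xs))) z ∷ all-unwk zs

  head-eq : ∀ {L m} k (G H : Cf L m) (T : Tri L m) x xs → ev (var zero ⊗ wk (A'E k G H T) ⊕ wk (BE k G H T)) (x ∷ xs) ≈ x * ev (A'E k G H T) xs + ev (BE k G H T) xs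
  head-eq k G H T x xs = reflexive (≡.cong₂ (λ u w → x * u + w) (ev-wk (A'E k G H T) x xs) (ev-wk (BE k G H T) x xs))

  A'-ev : ∀ {L m} k (G H : Cf L m) (T : Tri L m) xs → ev (A'E k G H T) xs ≈ ev (AE k G H T) xs + - 1#
  A'-ev k G H T xs = +-congˡ (-‿cong intCast-1)

  per⇒zero : ∀ {L m} k (T : Tri L m) x → PerT k T x → All (Zero x) (fsT k T)
  per⇒zero {m = zero} k T [] p = []
  per⇒zero {m = suc m} k (G , H , T) (x ∷ xs) p with triIter k (G , H , T) (x ∷ xs) | it-tail k G H T x xs | it-head k G H T x xs | p
  ... | u ∷ us | ≡.refl | hd | e ∷ es = (begin
      _ ≈⟨ head-eq k G H T x xs ⟩
      x * ev (A'E k G H T) xs + b ≈⟨ +-congʳ (*-congˡ (A'-ev k G H T xs)) ⟩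
      x * (a + - 1#) + b ≈⟨ solve 3 (λ x a b → x :* (a :+ :- scon (pos 1)) :+ b := (x :* a :+ b) :+ :- x) refl x a b ⟩
      (x * a + b) + - x ≈⟨ x≈y⇒x-y≈0 (trans hd e) ⟩
      0# ∎) ∷ all-wk (per⇒zero k T xs es)
    where
    a = ev (AE k G H T) xs
    b = ev (BE k G H T) xs

  zero⇒per : ∀ {L m} k (T : Tri L m) x → All (Zero x) (fsT k T) → PerT k T x
  zero⇒per {m = zero} k T x z = nil≈ _ _
  zero⇒per {m = suc m} k (G , H , T) (x ∷ xs) (z ∷ zs) with triIter k (G , H , T) (x ∷ xs) | it-tail k G H T x xs | it-head k G H T x xs
  ... | u ∷ us | ≡.refl | hd = x-y≈0⇒x≈y (begin
      u + - x ≈⟨ +-congʳ (sym hd) ⟩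
      (x * a + b) + - x ≈⟨ solve 3 (λ x a b → (x :* a :+ b) :+ :- x := x :* (a :+ :- scon (pos 1)) :+ b) refl x a b ⟩
      x * (a + - 1#) + b ≈⟨ +-congʳ (*-congˡ (sym (A'-ev k G H T xs))) ⟩
      x * ev (A'E k G H T) xs + b ≈⟨ sym (head-eq k G H T x xs) ⟩
      _ ≈⟨ z ⟩
      0# ∎) ∷ zero⇒per k T xs (all-unwk zs)
    where
    a = ev (AE k G H T) xs
    b = ev (BE k G H T) xs

-- From coefficient functions to coefficient arrays

-- Exponents from L on are cut off; by `box-cf` nothing is lost when the support lies below L.
cfFrom : ∀ {L} m → (Vec ℕ m → ℤ) → Cf L m
cfFrom zero c = c []
cfFrom (suc m) c = tabulate (λ a → cfFrom m (λ e → c (toℕ a ∷ e)))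

cfFrom-bd : ∀ {L} m c H → (∀ e → ∣ c e ∣ ℕ.≤ H) → CfB H m (cfFrom {L} m c)
cfFrom-bd zero c H h = h []
cfFrom-bd (suc m) c H h i = ≡.subst (CfB H m) (≡.sym (VecP.lookup∘tabulate (λ a → cfFrom m (λ e → c (toℕ a ∷ e))) i)) (cfFrom-bd m _ H (λ e → h (toℕ i ∷ e)))

module BoxSum (R : CRing) where
  open RingKit R renaming (con to scon)
  open EvalE R
  open Uni R
  open Eval R using (mono)

  sumL : ∀ {A : Set} → (A → Carrier) → List A → Carrier
  sumL f es = foldr _+_ 0# (List.map f es)

  sumL-++ : ∀ {A : Set} (f : A → Carrier) as bs → sumL f (as ++ bs) ≈ sumL f as + sumL f bs
  sumL-++ f [] bs = sym (+-identityˡ _)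
  sumL-++ f (a ∷ as) bs = trans (+-congˡ (sumL-++ f as bs)) (sym (+-assoc _ _ _))

  -- Coefficients are indexed by all naturals, so that sums truncated at different places can be
  -- compared: the box ends at the support bound, the array at L.
  hs : (ℕ → Carrier) → ℕ → Carrier → Carrier
  hs g zero x = 0#
  hs g (suc N) x = g 0 + x * hs (λ i → g (suc i)) N x

  hs-cong : ∀ {g h} N x → (∀ i → g i ≈ h i) → hs g N x ≈ hs h N x
  hs-cong zero x e = refl
  hs-cong (suc N) x e = +-cong (e 0) (*-congˡ (hs-cong N x (λ i → e (suc i))))

  hs-zero : ∀ g N x → (∀ i → g i ≈ 0#) → hs g N x ≈ 0#
  hs-zero g zero x e = refl
  hs-zero g (suc N) x e = trans (+-cong (e 0) (trans (*-congˡ (hs-zero _ N x (λ i → e (suc i)))) (zeroʳ x))) (+-identityˡ _)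

  hs-eq : ∀ g N M x → (∀ i → N ℕ.≤ i → g i ≈ 0#) → (∀ i → M ℕ.≤ i → g i ≈ 0#) → hs g N x ≈ hs g M x
  hs-eq g zero M x hN hM = sym (hs-zero g M x (λ i → hN i z≤n))
  hs-eq g (suc N) zero x hN hM = hs-zero g (suc N) x (λ i → hM i z≤n)
  hs-eq g (suc N) (suc M) x hN hM = +-congˡ (*-congˡ (hs-eq (λ i → g (suc i)) N M x (λ i le → hN (suc i) (s≤s le)) (λ i le → hM (suc i) (s≤s le))))

  boxSum : ∀ b m → (Vec ℕ m → ℤ) → Vec Carrier m → Carrier
  boxSum b m c x = sumL (λ e → intCast (c e) * mono x e) (box b m)

  cfEl-hs : ∀ {L} m (h : ℕ → Vec ℕ m → ℤ) l x xs → evP (cfEl {L} m (tabulate {n = l} (λ a → cfFrom m (h (toℕ a))))) x xs ≈ hs (λ a → ev (cfE {L} m (cfFrom m (h a))) xs) l x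
  cfEl-hs m h zero x xs = refl
  cfEl-hs m h (suc l) x xs = +-congˡ (*-congˡ (cfEl-hs m (λ a → h (suc a)) l x xs))

  cfFrom-zero : ∀ {L} m c x → (∀ e → c e ≡ pos 0) → ev (cfE {L} m (cfFrom m c)) x ≈ 0#
  cfFrom-zero zero c [] h = reflexive (≡.cong intCast (h []))
  cfFrom-zero {L} (suc m) c (x ∷ xs) h = trans (ev-polyE (cfEl m (cfFrom {L} (suc m) c)) x xs) (trans (cfEl-hs {L} m (λ a e → c (a ∷ e)) L x xs)
    (hs-zero _ L x (λ i → cfFrom-zero m (λ e → c (i ∷ e)) xs (λ e → h (i ∷ e)))))

  cfFrom-hs : ∀ {L} m c x xs → ev (cfE {L} (suc m) (cfFrom (suc m) c)) (x ∷ xs) ≈ hs (λ a → ev (cfE {L} m (cfFrom m (λ e → c (a ∷ e)))) xs) L x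
  cfFrom-hs {L} m c x xs = trans (ev-polyE (cfEl m (cfFrom {L} (suc m) c)) x xs) (cfEl-hs {L} m (λ a e → c (a ∷ e)) L x xs)

  box-step : ∀ b m (c : Vec ℕ (suc m) → ℤ) x xs N f → sumL (λ e → intCast (c e) * mono (x ∷ xs) e) (concatMap (λ a → List.map (a ∷_) (box b m)) (applyUpTo f N)) ≈
             sumL (λ a → pow x a * boxSum b m (λ e → c (a ∷ e)) xs) (applyUpTo f N)
  box-step b m c x xs zero f = refl
  box-step b m c x xs (suc N) f = trans (sumL-++ F (List.map (f 0 ∷_) (box b m)) _) (+-cong (inner (box b m)) (box-step b m c x xs N (λ i → f (suc i))))
    where
    F = λ e → intCast (c e) * mono (x ∷ xs) e
    inner : ∀ es → sumL F (List.map (f 0 ∷_) es) ≈ pow x (f 0) * sumL (λ e → intCast (c (f 0 ∷ e)) * mono xs e) es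
    inner [] = sym (zeroʳ _)
    inner (e ∷ es) = trans (+-congˡ (inner es)) (solve 4 (λ i p u s → i :* (p :* u) :+ p :* s := p :* (i :* u :+ s)) refl (intCast (c (f 0 ∷ e))) (pow x (f 0)) (mono xs e) (sumL (λ e → intCast (c (f 0 ∷ e)) * mono xs e) es))

  upTo-hs : ∀ (g : ℕ → Carrier) x N f k → (∀ i → f i ≡ k ℕ.+ i) → sumL (λ a → pow x a * g a) (applyUpTo f N) ≈ pow x k * hs (λ i → g (k ℕ.+ i)) N x
  upTo-hs g x zero f k hf = sym (zeroʳ _)
  upTo-hs g x (suc N) f k hf = begin
    pow x (f 0) * g (f 0) + sumL (λ a → pow x a * g a) (applyUpTo (λ i → f (suc i)) N)
      ≈⟨ +-cong (reflexive (≡.trans (≡.cong (λ a → pow x a * g a) (hf 0)) (≡.cong (λ a → pow x a * g (k ℕ.+ 0)) (ℕP.+-identityʳ k)))) (upTo-hs g x N (λ i → f (suc i)) (suc k) (λ i → ≡.trans (hf (suc i)) (ℕP.+-suc k i))) ⟩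
    pow x k * g (k ℕ.+ 0) + (x * pow x k) * hs (λ i → g (suc k ℕ.+ i)) N x
      ≈⟨ +-congˡ (*-congˡ (hs-cong N x (λ i → reflexive (≡.cong g (≡.sym (ℕP.+-suc k i)))))) ⟩
    pow x k * g (k ℕ.+ 0) + (x * pow x k) * hs (λ i → g (k ℕ.+ suc i)) N x
      ≈⟨ solve 4 (λ p g x h → p :* g :+ (x :* p) :* h := p :* (g :+ x :* h)) refl (pow x k) (g (k ℕ.+ 0)) x (hs (λ i → g (k ℕ.+ suc i)) N x) ⟩
    pow x k * (g (k ℕ.+ 0) + x * hs (λ i → g (k ℕ.+ suc i)) N x) ∎

  box-cf : ∀ {L} m c b x → (∀ e → ¬ c e ≡ pos 0 → ∀ j → lookup e j ℕ.< L) → (∀ e → ¬ c e ≡ pos 0 → VAll.All (ℕ._≤ b) e) → boxSum b m c x ≈ ev (cfE {L} m (cfFrom m c)) x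
  box-cf zero c b [] hd hb = trans (+-identityʳ _) (*-identityʳ _)
  box-cf {L} (suc m) c b (x ∷ xs) hd hb = begin
    boxSum b (suc m) c (x ∷ xs) ≈⟨ box-step b m c x xs (suc b) (λ i → i) ⟩
    sumL (λ a → pow x a * boxSum b m (λ e → c (a ∷ e)) xs) (applyUpTo (λ i → i) (suc b)) ≈⟨ upTo-hs (λ a → boxSum b m (λ e → c (a ∷ e)) xs) x (suc b) (λ i → i) 0 (λ i → ≡.refl) ⟩
    1# * hs (λ a → boxSum b m (λ e → c (a ∷ e)) xs) (suc b) x ≈⟨ *-identityˡ _ ⟩
    hs (λ a → boxSum b m (λ e → c (a ∷ e)) xs) (suc b) x
      ≈⟨ hs-cong (suc b) x (λ a → box-cf {L} m (λ e → c (a ∷ e)) b xs (λ e nz j → hd (a ∷ e) nz (suc j)) (λ e nz → VAll.tail (hb (a ∷ e) nz))) ⟩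
    hs (λ a → ev (cfE {L} m (cfFrom m (λ e → c (a ∷ e)))) xs) (suc b) x
      ≈⟨ hs-eq _ (suc b) L x (λ a le → cfFrom-zero m _ xs (λ e → ℤ-stable λ nz → ℕP.<-irrefl ≡.refl (ℕP.≤-trans le (VAll.head (hb (a ∷ e) nz)))))
                              (λ a le → cfFrom-zero m _ xs (λ e → ℤ-stable λ nz → ℕP.<-irrefl ≡.refl (ℕP.<-≤-trans (hd (a ∷ e) nz zero) le))) ⟩
    hs (λ a → ev (cfE {L} m (cfFrom m (λ e → c (a ∷ e)))) xs) L x ≈⟨ sym (cfFrom-hs {L} m c x xs) ⟩
    ev (cfE {L} (suc m) (cfFrom (suc m) c)) (x ∷ xs) ∎

record Shape {n} (L : ℕ) (cF : Fin n → Vec ℕ n → ℤ) : Set where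
  field
    early : ∀ i e → ¬ cF i e ≡ pos 0 → ∀ j → toℕ j ℕ.< toℕ i → lookup e j ≡ 0
    linear : ∀ i e → ¬ cF i e ≡ pos 0 → lookup e i ℕ.≤ 1
    small : ∀ i e → ¬ cF i e ≡ pos 0 → ∀ j → lookup e j ℕ.< L

tailC : ∀ {m} → (Fin (suc m) → Vec ℕ (suc m) → ℤ) → Fin m → Vec ℕ m → ℤ
tailC cF i e = cF (suc i) (0 ∷ e)

mkTri : ∀ {L} n → (Fin n → Vec ℕ n → ℤ) → Tri L n
mkTri zero cF = tt
mkTri (suc m) cF = cfFrom m (λ e → cF zero (1 ∷ e)) , cfFrom m (λ e → cF zero (0 ∷ e)) , mkTri m (tailC cF)

tail-shape : ∀ {m L} {cF : Fin (suc m) → Vec ℕ (suc m) → ℤ} → Shape L cF → Shape L (tailC cF)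
tail-shape s = record
  { early = λ i e nz j lt → Shape.early s (suc i) (0 ∷ e) nz (suc j) (s≤s lt)
  ; linear = λ i e nz → Shape.linear s (suc i) (0 ∷ e) nz
  ; small = λ i e nz j → Shape.small s (suc i) (0 ∷ e) nz (suc j) }

module Bridge (R : CRing) where
  open RingKit R renaming (con to scon)
  open EvalE R
  open BoxSum R
  open TriEval R
  open Eval R using (eval; apply; iter; _≋_)

  shape-ev : ∀ {L n} (cF : Fin n → Vec ℕ n → ℤ) → Shape L cF → 2 ℕ.≤ L → ∀ x i → ev (cfE {L} n (cfFrom n (cF i))) x ≈ lookup (tri {L} (mkTri n cF) x) i
  shape-ev {L} {suc m} cF s L≥2 (x ∷ xs) zero = begin
    _ ≈⟨ cfFrom-hs {L} m (cF zero) x xs ⟩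
    hs g L x ≈⟨ hs-eq g L 2 x (λ a le → gz a λ e nz → ℕP.<-irrefl ≡.refl (ℕP.<-≤-trans (Shape.small s zero (a ∷ e) nz zero) le))
                              (λ a le → gz a λ e nz → ℕP.<-irrefl ≡.refl (ℕP.≤-trans le (Shape.linear s zero (a ∷ e) nz))) ⟩
    g 0 + x * (g 1 + x * 0#) ≈⟨ solve 3 (λ a b x → a :+ x :* (b :+ x :* scon (pos 0)) := x :* b :+ a) refl (g 0) (g 1) x ⟩
    x * g 1 + g 0 ∎
    where
    g = λ a → ev (cfE {L} m (cfFrom m (λ e → cF zero (a ∷ e)))) xs
    gz : ∀ a → (∀ e → ¬ cF zero (a ∷ e) ≡ pos 0 → ⊥) → g a ≈ 0#
    gz a h = cfFrom-zero m _ xs (λ e → ℤ-stable (h e))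
  shape-ev {L} {suc m} cF s L≥2 (x ∷ xs) (suc i) = begin
    _ ≈⟨ cfFrom-hs {L} m (cF (suc i)) x xs ⟩
    hs g L x ≈⟨ hs-eq g L 1 x (λ a le → gz a λ e nz → ℕP.<-irrefl ≡.refl (ℕP.<-≤-trans (Shape.small s (suc i) (a ∷ e) nz zero) le))
                              (λ a le → gz a λ e nz → ℕP.<-irrefl ≡.refl (≡.subst (1 ℕ.≤_) (Shape.early s (suc i) (a ∷ e) nz zero (s≤s z≤n)) le)) ⟩
    g 0 + x * 0# ≈⟨ trans (+-congˡ (zeroʳ x)) (+-identityʳ _) ⟩
    g 0 ≈⟨ shape-ev {L} (tailC cF) (tail-shape s) L≥2 xs i ⟩
    lookup (tri {L} (mkTri m (tailC cF)) xs) i ∎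
    where
    g = λ a → ev (cfE {L} m (cfFrom m (λ e → cF (suc i) (a ∷ e)))) xs
    gz : ∀ a → (∀ e → ¬ cF (suc i) (a ∷ e) ≡ pos 0 → ⊥) → g a ≈ 0#
    gz a h = cfFrom-zero m _ xs (λ e → ℤ-stable (h e))

  iter-tri : ∀ {L n} (F : Fin n → Poly n) → Shape L (λ i → coeff (F i)) → 2 ℕ.≤ L → ∀ k x → iter k F x ≈ᵥ triIter k (mkTri {L} n (λ i → coeff (F i))) x
  iter-tri F s L≥2 zero x = ≈ᵥ-refl
  iter-tri {L} {n} F s L≥2 (suc k) x = ≈ᵥ-trans (≈ᵥ-from λ i → trans (reflexive (VecP.lookup∘tabulate (λ i → eval (F i) (iter k F x)) i))
     (trans (box-cf {L} n (coeff (F i)) (bound (F i)) (iter k F x) (Shape.small s i) (support (F i))) (shape-ev {L} (λ i → coeff (F i)) s L≥2 (iter k F x) i)))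
     (tri-cong (mkTri {L} n (λ i → coeff (F i))) (iter-tri F s L≥2 k x))

  periodic⇒per : ∀ {L n} (F : Fin n → Poly n) → Shape L (λ i → coeff (F i)) → 2 ℕ.≤ L → ∀ k x → Eval.Periodic R F k x → PerT k (mkTri {L} n (λ i → coeff (F i))) x
  periodic⇒per F s L≥2 k x p = ≈ᵥ-trans (≈ᵥ-sym (iter-tri F s L≥2 k x)) (≈ᵥ-from p)

  per⇒periodic : ∀ {L n} (F : Fin n → Poly n) → Shape L (λ i → coeff (F i)) → 2 ℕ.≤ L → ∀ k x → PerT k (mkTri {L} n (λ i → coeff (F i))) x → Eval.Periodic R F k x
  per⇒periodic F s L≥2 k x p = ≈ᵥ-lookup (≈ᵥ-trans (iter-tri F s L≥2 k x) p)

sum-lookup : ∀ {n} (e : Vec ℕ n) j → lookup e j ℕ.≤ Vec.sum e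
sum-lookup (a ∷ e) zero = ℕP.m≤m+n a _
sum-lookup (a ∷ e) (suc j) = ℕP.≤-trans (sum-lookup e j) (ℕP.m≤n+m _ a)

-- Exponents are at most d, so d + 1 would bound them strictly; d + 2 also leaves room for the
-- linear term when d = 0.
triangular-shape : ∀ {n} (F : Fin n → Poly n) → Triangular F → ∀ d → (∀ i → TotDeg≤ (F i) d) → Shape (suc (suc d)) (λ i → coeff (F i))
triangular-shape {n} F t d td = record
  { early = λ i e nz j lt → proj₁ (info i e nz) j lt
  ; linear = λ i e nz → proj₂ (info i e nz)
  ; small = λ i e nz j → s≤s (ℕP.≤-trans (ℕP.≤-trans (sum-lookup e j) (td i e nz)) (ℕP.n≤1+n d)) }
  where
  open Triangular t
  info : ∀ i e → ¬ coeff (F i) e ≡ pos 0 → (∀ j → toℕ j ℕ.< toℕ i → lookup e j ≡ 0) × lookup e i ℕ.≤ 1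
  info i e nz with coeff (H i) e ℤ.≟ pos 0
  ... | no nH = (λ j lt → H-vars i e nH j (ℕP.<⇒≤ lt)) , ℕP.≤-trans (ℕP.≤-reflexive (H-vars i e nH i ℕP.≤-refl)) z≤n
  -- The monomial then comes from `Xᵢ Gᵢ`, and lowering its i-th exponent by one gives a monomial of
  -- `Gᵢ`.
  ... | yes zH with lookup e i in eq | F-def i e
  ... | zero | fd = ⊥-elim (nz (≡.trans fd (≡.trans (ℤP.+-identityˡ _) zH)))
  ... | suc m | fd = (λ j lt → ≡.trans (≡.sym (VecP.lookup∘updateAt′ j i (λ e → ℕP.<-irrefl (≡.cong toℕ e) lt) e)) (G-vars i (e [ i ]≔ m) nG j (ℕP.<⇒≤ lt))) ,
                     s≤s (ℕP.≤-reflexive (≡.trans (≡.sym (VecP.lookup∘updateAt i e)) (G-vars i (e [ i ]≔ m) nG i ℕP.≤-refl)))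
    where
    nG : ¬ coeff (G i) (e [ i ]≔ m) ≡ pos 0
    nG z = nz (≡.trans fd (≡.trans (≡.cong₂ ℤ._+_ z zH) ≡.refl))

TriB : ∀ {L} → ℕ → ∀ m → Tri L m → Set
TriB H zero T = ⊤
TriB H (suc m) (G , K , T) = CfB H m G × CfB H m K × TriB H m T

mkTri-bd : ∀ {L} n (cF : Fin n → Vec ℕ n → ℤ) H → (∀ i e → ∣ cF i e ∣ ℕ.≤ H) → TriB H n (mkTri {L} n cF)
mkTri-bd zero cF H h = tt
mkTri-bd {L} (suc m) cF H h = cfFrom-bd {L} m _ H (λ e → h zero (1 ∷ e)) , cfFrom-bd {L} m _ H (λ e → h zero (0 ∷ e)) , mkTri-bd {L} m (tailC cF) H (λ i e → h (suc i) (0 ∷ e))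

module StableTri (R : CRing) where
  open CommutativeRing R
  open Stabilise R
  module V = EvalE R
  module V' = EvalE stR
  module T = TriEval R
  module T' = TriEval stR

  ev≡ : ∀ {n} (e : Expr n) ρ → V'.ev e ρ ≡ V.ev e ρ
  ev≡ (con c) ρ = intCast≡ c
  ev≡ (var i) ρ = ≡.refl
  ev≡ (e ⊕ f) ρ = ≡.cong₂ _+_ (ev≡ e ρ) (ev≡ f ρ)
  ev≡ (e ⊗ f) ρ = ≡.cong₂ _*_ (ev≡ e ρ) (ev≡ f ρ)

  tri≡ : ∀ {L m} (T : Tri L m) x → T'.tri T x ≡ T.tri T x
  tri≡ {m = zero} T [] = ≡.refl
  tri≡ {m = suc m} (G , H , T) (x ∷ xs) = ≡.cong₂ _∷_ (≡.cong₂ (λ g h → x * g + h) (ev≡ (cfE m G) xs) (ev≡ (cfE m H) xs)) (tri≡ T xs)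

  triIter≡ : ∀ {L m} k (T : Tri L m) x → T'.triIter k T x ≡ T.triIter k T x
  triIter≡ zero T x = ≡.refl
  triIter≡ (suc k) T x = ≡.trans (≡.cong (T'.tri T) (triIter≡ k T x)) (tri≡ T (T.triIter k T x))

  retᵥ : ∀ {n} {x y : Vec Carrier n} → x V.≈ᵥ y → x V'.≈ᵥ y
  retᵥ V.[] = V'.[]
  retᵥ (e V.∷ es) = ret e V'.∷ retᵥ es

  unretᵥ : ∀ {n} {x y : Vec Carrier n} → x V'.≈ᵥ y → ¬ ¬ (x V.≈ᵥ y)
  unretᵥ V'.[] k = k V.[]
  unretᵥ (e V'.∷ es) k = e λ e → unretᵥ es λ es → k (e V.∷ es)

  ret-per : ∀ {L m} k (T : Tri L m) x → T.PerT k T x → T'.PerT k T x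
  ret-per k T x p = ≡.subst (V'._≈ᵥ x) (≡.sym (triIter≡ k T x)) (retᵥ p)

  unret-per : ∀ {L m} k (T : Tri L m) x → T'.PerT k T x → ¬ ¬ T.PerT k T x
  unret-per k T x p = unretᵥ (≡.subst (V'._≈ᵥ x) (triIter≡ k T x) p)

-- Curves of periodic points through degenerate ones

module Deform (A : ACF) where
  open ACF A using (infDom; inv)
  open Dom infDom
  open TriLemmas (InfDom.ring infDom) using (Zero; all-wk; all-unwk; head-eq)

  pow≉0 : ∀ {x} n → ¬ (x ≈ 0#) → ¬ (pow x n ≈ 0#)
  pow≉0 zero nx e = 1≉0 e
  pow≉0 (suc n) nx e = pow≉0 n nx (domain e nx)

  *≉0 : ∀ {x y} → ¬ (x ≈ 0#) → ¬ (y ≈ 0#) → ¬ (x * y ≈ 0#)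
  *≉0 nx ny e = ny (domain e nx)

  cancel : ∀ {a x y} → ¬ (a ≈ 0#) → a * x ≈ a * y → x ≈ y
  cancel {a} {x} {y} na e = x-y≈0⇒x≈y (domain (trans (solve 3 (λ a x y → a :* (x :+ :- y) := a :* x :+ :- (a :* y)) refl a x y) (x≈y⇒x-y≈0 e)) na)

  Scaled : ∀ {m} → Carrier → Vec Carrier m → Vec Carrier m → Set
  Scaled D v N = ∀ j → D * lookup v j ≈ lookup N j

  -- A power of D clears the denominators of `e` at N / D. The point is described by D v = N instead
  -- of a quotient, so that the curve is polynomial data throughout.
  record Homog {m} (D : Carrier → Carrier) (N : Carrier → Vec Carrier m) (e : Expr m) : Set where
    field
      g : ℕ
      ê : Carrier → Carrier
      pf : PF ê
      eq : ∀ t v → Scaled (D t) v (N t) → pow (D t) g * ev e v ≈ ê t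

  homog : ∀ {m D N} → PF D → (∀ j → PF (λ t → lookup (N t) j)) → (e : Expr m) → Homog D N e
  homog pD pN (con c) = record { g = 0 ; ê = λ _ → intCast c ; pf = pf-con _ ; eq = λ t v s → *-identityˡ _ }
  homog pD pN (var i) = record { g = 1 ; ê = _ ; pf = pN i ; eq = λ t v s → trans (*-congʳ (*-identityʳ _)) (s i) }
  homog {D = D} {N} pD pN (e ⊕ f) = record { g = E.g ℕ.+ F.g ; ê = λ t → E.ê t * pow (D t) F.g + F.ê t * pow (D t) E.g
      ; pf = pf-+ (pf-* E.pf (pf-pow F.g pD)) (pf-* F.pf (pf-pow E.g pD))
      ; eq = λ t v s → trans (*-congʳ (pow-+ (D t) E.g F.g)) (trans (solve 4 (λ p q e f → (p :* q) :* (e :+ f) := (p :* e) :* q :+ (q :* f) :* p) refl (pow (D t) E.g) (pow (D t) F.g) (ev e v) (ev f v))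
          (+-cong (*-congʳ (E.eq t v s)) (*-congʳ (F.eq t v s)))) }
    where
    module E = Homog (homog {N = N} pD pN e)
    module F = Homog (homog {N = N} pD pN f)
  homog {D = D} {N} pD pN (e ⊗ f) = record { g = E.g ℕ.+ F.g ; ê = λ t → E.ê t * F.ê t
      ; pf = pf-* E.pf F.pf
      ; eq = λ t v s → trans (*-congʳ (pow-+ (D t) E.g F.g)) (trans (solve 4 (λ p q e f → (p :* q) :* (e :* f) := (p :* e) :* (q :* f)) refl (pow (D t) E.g) (pow (D t) F.g) (ev e v) (ev f v))
          (*-cong (E.eq t v s) (F.eq t v s))) }
    where
    module E = Homog (homog {N = N} pD pN e)
    module F = Homog (homog {N = N} pD pN f)

  -- A rational curve N/D of common zeros of fs through w, one of whose coordinates is the parameter.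
  record Curve {m} (fs : List (Expr m)) (w : Vec Carrier m) : Set where
    field
      D : Carrier → Carrier
      N : Carrier → Vec Carrier m
      pD : PF D
      pN : ∀ j → PF (λ t → lookup (N t) j)
      t₀ : Carrier
      D≉0 : ¬ (D t₀ ≈ 0#)
      at : Scaled (D t₀) w (N t₀)
      good : ∀ t v → ¬ (D t ≈ 0#) → Scaled (D t) v (N t) → All (Zero v) fs
      free : Fin m
      param : ∀ t → lookup (N t) free ≈ t * D t

  module _ {L m} (k : ℕ) (G H : Cf L m) (T : Tri L m) (x : Carrier) (xs : Vec Carrier m) where
    a b : Expr m
    a = A'E k G H T
    b = BE k G H T

    -- From a = 0 and x a + b = 0 follows b = 0, so the first equation holds for every value of the
    -- head.
    free-head : All (Zero (x ∷ xs)) (fsT k (G , H , T)) → ev a xs ≈ 0# → Curve (fsT k (G , H , T)) (x ∷ xs)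
    free-head (z ∷ zs) a0 = record
      { D = λ _ → 1# ; N = λ t → t ∷ xs ; pD = pf-con 1#
      ; pN = λ { zero → pf-id ; (suc j) → pf-con _ }
      ; t₀ = x ; D≉0 = 1≉0 ; at = λ { zero → *-identityˡ _ ; (suc j) → *-identityˡ _ }
      ; good = good ; free = zero ; param = λ t → sym (*-identityʳ t) }
      where
      b0 : ev b xs ≈ 0#
      b0 = trans (sym (trans (+-congʳ (trans (*-congˡ a0) (zeroʳ x))) (+-identityˡ _))) (trans (sym (head-eq k G H T x xs)) z)
      good : ∀ t v → ¬ (1# ≈ 0#) → Scaled 1# v (t ∷ xs) → All (Zero v) (fsT k (G , H , T))
      good t (u ∷ us) _ s = trans (head-eq k G H T u us) (trans (+-cong (trans (*-congˡ (trans (ev-cong a us≈) a0)) (zeroʳ u)) (trans (ev-cong b us≈) b0)) (+-identityˡ 0#))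
          ∷ all-wk (All.map (λ {f} e → trans (ev-cong f us≈) e) (all-unwk zs))
        where
        us≈ : us ≈ᵥ xs
        us≈ = ≈ᵥ-from λ j → trans (sym (*-identityˡ _)) (s (suc j))

    -- Along the given curve the head must be -b / a. Writing a and b as `ê / D^g` turns this into a
    -- fraction of polynomials, and `D'` is a common denominator for it and the old coordinates.
    extend : Zero (x ∷ xs) (var zero ⊗ wk a ⊕ wk b) → ¬ (ev a xs ≈ 0#) → Curve (fsT k T) xs → Curve (fsT k (G , H , T)) (x ∷ xs)
    extend z na c = record
      { D = D' ; N = N' ; pD = pD'
      ; pN = λ { zero → pf-neg (pf-* B.pf (pf-* (pf-pow A.g C.pD) C.pD)) ; (suc j) → pf-≈ (pf-* pS (C.pN j)) λ t → reflexive (lookup-map (S t *_) (C.N t) j) }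
      ; t₀ = C.t₀ ; D≉0 = *≉0 C.D≉0 (*≉0 Â≉0 (pow≉0 B.g C.D≉0))
      ; at = at' ; good = good' ; free = suc C.free
      ; param = λ t → trans (reflexive (lookup-map (S t *_) (C.N t) C.free)) (trans (*-congˡ (C.param t)) (solve 3 (λ s t d → s :* (t :* d) := t :* (d :* s)) refl (S t) t (C.D t))) }
      where
      module C = Curve c
      module A = Homog (homog {N = C.N} C.pD C.pN a)
      module B = Homog (homog {N = C.N} C.pD C.pN b)
      S D' : Carrier → Carrier
      S t = A.ê t * pow (C.D t) B.g
      pS : PF S
      pS = pf-* A.pf (pf-pow B.g C.pD)
      D' t = C.D t * S t
      pD' : PF D'
      pD' = pf-* C.pD pS
      N' : Carrier → Vec Carrier (suc m)
      N' t = - (B.ê t * (pow (C.D t) A.g * C.D t)) ∷ Vec.map (S t *_) (C.N t)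
      Â≉0 : ¬ (A.ê C.t₀ ≈ 0#)
      Â≉0 e = *≉0 (pow≉0 A.g C.D≉0) na (trans (A.eq C.t₀ xs C.at) e)
      clear : ∀ t u us → Scaled (C.D t) us (C.N t) →
        D' t * u + B.ê t * (pow (C.D t) A.g * C.D t) ≈ (C.D t * (pow (C.D t) A.g * pow (C.D t) B.g)) * (u * ev a us + ev b us)
      clear t u us s = trans (+-cong (*-congʳ (*-congˡ (*-congʳ (sym (A.eq t us s))))) (*-congʳ (sym (B.eq t us s))))
        (solve 6 (λ d p q u a b → (d :* ((p :* a) :* q)) :* u :+ (q :* b) :* (p :* d) := (d :* (p :* q)) :* (u :* a :+ b)) refl
          (C.D t) (pow (C.D t) A.g) (pow (C.D t) B.g) u (ev a us) (ev b us))
      at' : Scaled (D' C.t₀) (x ∷ xs) (N' C.t₀)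
      at' zero = x-y≈0⇒x≈y (trans (+-congˡ (-‿involutive _)) (trans (clear C.t₀ x xs C.at) (trans (*-congˡ (trans (sym (head-eq k G H T x xs)) z)) (zeroʳ _))))
      at' (suc j) = trans (solve 3 (λ d s x → (d :* s) :* x := s :* (d :* x)) refl (C.D C.t₀) (S C.t₀) (lookup xs j)) (trans (*-congˡ (C.at j)) (reflexive (≡.sym (lookup-map (S C.t₀ *_) (C.N C.t₀) j))))
      good' : ∀ t v → ¬ (D' t ≈ 0#) → Scaled (D' t) v (N' t) → All (Zero v) (fsT k (G , H , T))
      good' t (u ∷ us) nD s = trans (head-eq k G H T u us) (domain (trans (sym (clear t u us ss)) (trans (+-congʳ (s zero)) (-‿inverseˡ _))) (*≉0 nd (*≉0 (pow≉0 A.g nd) (pow≉0 B.g nd))))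
          ∷ all-wk (C.good t us nd ss)
        where
        nd : ¬ (C.D t ≈ 0#)
        nd e = nD (trans (*-congʳ e) (zeroˡ _))
        nS : ¬ (S t ≈ 0#)
        nS e = nD (trans (*-congˡ e) (zeroʳ _))
        ss : Scaled (C.D t) us (C.N t)
        ss j = cancel nS (trans (solve 3 (λ d s x → s :* (d :* x) := (d :* s) :* x) refl (C.D t) (S t) (lookup us j)) (trans (s (suc j)) (reflexive (lookup-map (S t *_) (C.N t) j))))

  -- The recursion stops at the first vanishing coefficient seen from the head, so all coefficients
  -- in front of it are nonzero at `w`, as `extend` requires.
  deform : ∀ {L m} k (T : Tri L m) w → All (Zero w) (fsT k T) → Any (Zero w) (asT k T) → ¬ ¬ Curve (fsT k T) w
  deform {m = suc m} k (G , H , T) (x ∷ xs) (z ∷ zs) h κ = ¬¬-em {A = ev (A'E k G H T) xs ≈ 0#} λ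
    { (yes e) → κ (free-head k G H T x xs (z ∷ zs) e)
    ; (no ne) → deform k T xs (all-unwk zs) (tail ne h) λ c → κ (extend k G H T x xs z ne c) }
    where
    any-unwk : ∀ {es : List (Expr m)} → Any (Zero (x ∷ xs)) (List.map wk es) → Any (Zero xs) es
    any-unwk {e ∷ es} (here p) = here (trans (reflexive (≡.sym (ev-wk e x xs))) p)
    any-unwk {e ∷ es} (there p) = there (any-unwk p)
    tail : ¬ (ev (A'E k G H T) xs ≈ 0#) → Any (Zero (x ∷ xs)) (asT k (G , H , T)) → Any (Zero xs) (asT k T)
    tail ne (here p) = ⊥-elim (ne (trans (reflexive (≡.sym (ev-wk (A'E k G H T) x xs))) p))
    tail ne (there p) = any-unwk p

  diffs : List Carrier → Carrier → Carrier
  diffs [] t = 1#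
  diffs (c ∷ cs) t = (t + - c) * diffs cs t

  pf-diffs : ∀ cs → PF (diffs cs)
  pf-diffs [] = pf-con 1#
  pf-diffs (c ∷ cs) = pf-* (pf-+ pf-id (pf-con (- c))) (pf-diffs cs)

  diffs≉0 : ∀ cs → ¬ (∀ t → diffs cs t ≈ 0#)
  diffs≉0 [] h = 1≉0 (h 0#)
  diffs≉0 (c ∷ cs) h = diffs≉0 cs (pf-dom (pf-+ pf-id (pf-con (- c))) (pf-diffs cs) h (c + 1#)
    λ e → 1≉0 (trans (solve 1 (λ c → scon (pos 1) := (c :+ scon (pos 1)) :+ :- c) refl c) e))

  -- The parameter is itself a coordinate. If the curve met only points of `Ps`, every t with D(t) ≠
  -- 0 would be a root of `diffs`, so `D` times `diffs` would vanish identically, against D(t₀) ≠ 0.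
  curve-infinite : ∀ {m} {fs : List (Expr m)} {w} → Curve fs w → (Ps : List (Vec Carrier m)) → ¬ (∀ v → All (Zero v) fs → ¬ ¬ Any (v ≈ᵥ_) Ps)
  curve-infinite {m} {fs} c Ps fin = diffs≉0 cs (pf-dom C.pD (pf-diffs cs) (λ t → stable λ n → avoid t n) C.t₀ C.D≉0)
    where
    module C = Curve c
    cs = List.map (λ P → lookup P C.free) Ps
    root : ∀ t Qs → Any (λ P → t ≈ lookup P C.free) Qs → diffs (List.map (λ P → lookup P C.free) Qs) t ≈ 0#
    root t (Q ∷ Qs) (here p) = trans (*-congʳ (x≈y⇒x-y≈0 p)) (zeroˡ _)
    root t (Q ∷ Qs) (there p) = trans (*-congˡ (root t Qs p)) (zeroʳ _)
    avoid : ∀ t → ¬ ¬ (C.D t * diffs cs t ≈ 0#)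
    avoid t n = fin v (C.good t v nD sc) λ q → n (trans (*-congˡ (root t Ps (Any.map (λ {P} e → trans (cancel nD (trans (*-comm _ _) (trans (sym (C.param t)) (sym (sc C.free))))) (≈ᵥ-lookup e C.free)) q))) (zeroʳ _))
      where
      nD : ¬ (C.D t ≈ 0#)
      nD e = n (trans (*-congʳ e) (zeroˡ _))
      i = inv (C.D t) nD
      v = Vec.map (proj₁ i *_) (C.N t)
      sc : Scaled (C.D t) v (C.N t)
      sc j = trans (*-congˡ (reflexive (lookup-map (proj₁ i *_) (C.N t) j))) (trans (sym (*-assoc _ _ _)) (trans (*-congʳ (proj₂ i)) (*-identityˡ _)))

  no-degenerate : ∀ {L m} k (T : Tri L m) (Ps : List (Vec Carrier m)) → (∀ v → All (Zero v) (fsT k T) → ¬ ¬ Any (v ≈ᵥ_) Ps) →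
    All (λ a → ¬ CommonZero A (a ∷ fsT k T)) (asT k T)
  no-degenerate k T Ps fin = All.tabulate λ a∈ → λ { (w , az ∷ zs) → deform k T w zs (Any.map (λ { ≡.refl → az }) a∈) λ c → curve-infinite c Ps fin }

  -- Once the later coordinates agree, both heads solve the same linear equation with nonzero
  -- leading coefficient.
  unique : ∀ {L m} k (T : Tri L m) x y → All (Zero x) (fsT k T) → All (Zero y) (fsT k T) → All (λ a → ¬ Zero x a) (asT k T) → x ≈ᵥ y
  unique {m = zero} k T [] [] _ _ _ = []
  unique {m = suc m} k (G , H , T) (x ∷ xs) (y ∷ ys) (zx ∷ zxs) (zy ∷ zys) (na ∷ nas) = x-y≈0⇒x≈y (domain (begin
      ev α xs * (x + - y) ≈⟨ solve 4 (λ a b x y → a :* (x :+ :- y) := (x :* a :+ b) :+ :- (y :* a :+ b)) refl (ev α xs) (ev β xs) x y ⟩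
      (x * ev α xs + ev β xs) + - (y * ev α xs + ev β xs) ≈⟨ +-cong (trans (sym (head-eq k G H T x xs)) zx) (-‿cong (trans (+-cong (*-congˡ (ev-cong α es)) (ev-cong β es)) (trans (sym (head-eq k G H T y ys)) zy))) ⟩
      0# + - 0# ≈⟨ -‿inverseʳ 0# ⟩
      0# ∎) (λ e → na (trans (reflexive (ev-wk α x xs)) e))) ∷ es
    where
    α = A'E k G H T
    β = BE k G H T
    unwk : ∀ {es : List (Expr m)} → All (λ e → ¬ Zero (x ∷ xs) e) (List.map wk es) → All (λ e → ¬ Zero xs e) es
    unwk {[]} [] = []
    unwk {e ∷ es} (n ∷ ns) = (λ z → n (trans (reflexive (ev-wk e x xs)) z)) ∷ unwk ns
    es : xs ≈ᵥ ys
    es = unique k T xs ys (all-unwk zxs) (all-unwk zys) (unwk nas)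

-- Degree and size of the iterates

fsT-len : ∀ {L m} k (T : Tri L m) → length (fsT k T) ≡ m
fsT-len {m = zero} k T = ≡.refl
fsT-len {m = suc m} k (G , H , T) = ≡.cong suc (≡.trans (ListP.length-map wk (fsT k T)) (fsT-len k T))

asT-len : ∀ {L m} k (T : Tri L m) → length (asT k T) ≡ m
asT-len {m = zero} k T = ≡.refl
asT-len {m = suc m} k (G , H , T) = ≡.cong suc (≡.trans (ListP.length-map wk (asT k T)) (asT-len k T))

all-map-wk : ∀ {m} {P : Expr m → Set} {Q : Expr (suc m) → Set} {es} → (∀ e → P e → Q (wk e)) → All P es → All Q (List.map wk es)
all-map-wk h ps = AllP.map⁺ (All.map (λ {e} → h e) ps)

module TriDeg (L k : ℕ) where
  -- Each of the k steps multiplies by `G`, of degree at most `m L`, at arguments of degree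
  -- `degBd m`; the successor accounts for the head variable, and the last summand makes the bound
  -- monotone.
  degBd : ℕ → ℕ
  degBd zero = 0
  degBd (suc m) = suc (k ℕ.* (m ℕ.* L ℕ.* degBd m)) ℕ.+ degBd m

  AE-deg : ∀ {m} j (G H : Cf L m) T → j ℕ.≤ k → deg (AE j G H T) ℕ.≤ j ℕ.* (m ℕ.* L ℕ.* degBd m)
  BE-deg : ∀ {m} j (G H : Cf L m) T → j ℕ.≤ k → deg (BE j G H T) ℕ.≤ j ℕ.* (m ℕ.* L ℕ.* degBd m)
  itE-deg : ∀ {m} j (T : Tri L m) → j ℕ.≤ k → ∀ i → deg (lookup (itE j T) i) ℕ.≤ degBd m
  cf-deg : ∀ {m} (G : Cf L m) j T → j ℕ.≤ k → deg (sub (cfE m G) (itE j T)) ℕ.≤ m ℕ.* L ℕ.* degBd m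

  cf-deg {m} G j T le = ℕP.≤-trans (deg-sub (degBd m) (cfE m G) (itE j T) (itE-deg j T le)) (ℕP.*-monoˡ-≤ (degBd m) (cfE-deg m G))
  AE-deg zero G H T le = z≤n
  AE-deg {m} (suc j) G H T le = ℕP.≤-trans (ℕP.+-mono-≤ (AE-deg j G H T (ℕP.<⇒≤ le)) (cf-deg G j T (ℕP.<⇒≤ le)))
    (ℕP.≤-reflexive (ℕP.+-comm (j ℕ.* (m ℕ.* L ℕ.* degBd m)) _))
  BE-deg zero G H T le = z≤n
  BE-deg {m} (suc j) G H T le = ℕP.⊔-lub (ℕP.≤-trans (ℕP.+-mono-≤ (BE-deg j G H T (ℕP.<⇒≤ le)) (cf-deg G j T (ℕP.<⇒≤ le))) (ℕP.≤-reflexive (ℕP.+-comm (j ℕ.* (m ℕ.* L ℕ.* degBd m)) _)))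
    (ℕP.≤-trans (cf-deg H j T (ℕP.<⇒≤ le)) (ℕP.m≤m+n _ _))
  itE-deg {suc m} j (G , H , T) le zero = ℕP.≤-trans (ℕP.⊔-lub
      (s≤s (ℕP.≤-trans (ℕP.≤-reflexive (deg-wk (AE j G H T))) (ℕP.≤-trans (AE-deg j G H T le) (ℕP.*-monoˡ-≤ _ le))))
      (ℕP.≤-trans (ℕP.≤-reflexive (deg-wk (BE j G H T))) (ℕP.≤-trans (BE-deg j G H T le) (ℕP.≤-trans (ℕP.*-monoˡ-≤ _ le) (ℕP.n≤1+n _)))))
    (ℕP.m≤m+n _ (degBd m))
  itE-deg {suc m} j (G , H , T) le (suc i) = ℕP.≤-trans (ℕP.≤-reflexive (≡.trans (≡.cong deg (lookup-map wk (itE j T) i)) (deg-wk (lookup (itE j T) i))))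
    (ℕP.≤-trans (itE-deg j T le i) (ℕP.m≤n+m _ _))

  A'E-deg : ∀ {m} (G H : Cf L m) T → deg (wk (A'E k G H T)) ℕ.≤ k ℕ.* (m ℕ.* L ℕ.* degBd m)
  A'E-deg G H T = ℕP.≤-trans (ℕP.≤-reflexive (deg-wk (A'E k G H T))) (ℕP.⊔-lub (AE-deg k G H T ℕP.≤-refl) z≤n)

  wk-up : ∀ {m} e → deg {m} e ℕ.≤ degBd m → deg (wk e) ℕ.≤ degBd (suc m)
  wk-up e h = ℕP.≤-trans (ℕP.≤-reflexive (deg-wk e)) (ℕP.≤-trans h (ℕP.m≤n+m _ _))

  fsT-deg : ∀ {m} (T : Tri L m) → All (λ f → deg f ℕ.≤ degBd m) (fsT k T)
  fsT-deg {zero} T = []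
  fsT-deg {suc m} (G , H , T) = ℕP.≤-trans (ℕP.⊔-lub (s≤s (A'E-deg G H T)) (ℕP.≤-trans (ℕP.≤-reflexive (deg-wk (BE k G H T))) (ℕP.≤-trans (BE-deg k G H T ℕP.≤-refl) (ℕP.n≤1+n _)))) (ℕP.m≤m+n _ (degBd m))
    ∷ all-map-wk wk-up (fsT-deg T)

  asT-deg : ∀ {m} (T : Tri L m) → All (λ f → deg f ℕ.≤ degBd m) (asT k T)
  asT-deg {zero} T = []
  asT-deg {suc m} (G , H , T) = ℕP.≤-trans (A'E-deg G H T) (ℕP.≤-trans (ℕP.n≤1+n _) (ℕP.m≤m+n _ (degBd m))) ∷ all-map-wk wk-up (asT-deg T)

module ValBd (L h k X : ℕ) where
  -- `cfBd` bounds `G` and `H` along the orbit, so A is at most `cfBd^k` and B at most `k cfBd^k`;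
  -- the factor `X + k` comes from X A + B.
  valBd cfBd : ℕ → ℕ
  cfBd m = h ℕ.* (L ℕ.* valBd m ℕ.^ L) ℕ.^ m
  valBd zero = 1
  valBd (suc m) = (X ℕ.+ k) ℕ.* cfBd m ℕ.^ k ℕ.* valBd m

module TriVal (L h k X : ℕ) (1≤L : 1 ℕ.≤ L) (1≤h : 1 ℕ.≤ h) (1≤X : 1 ℕ.≤ X) where
  open ValBd L h k X public

  ^≥1 : ∀ {a} n → 1 ℕ.≤ a → 1 ℕ.≤ a ℕ.^ n
  ^≥1 {a} n ha = ℕP.m^n>0 a ⦃ ℕ.>-nonZero ha ⦄ n

  valBd≥1 : ∀ m → 1 ℕ.≤ valBd m
  cfBd≥1 : ∀ m → 1 ℕ.≤ cfBd m
  cfBd≥1 m = ℕP.*-mono-≤ 1≤h (^≥1 m (ℕP.*-mono-≤ 1≤L (^≥1 L (valBd≥1 m))))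
  valBd≥1 zero = s≤s z≤n
  valBd≥1 (suc m) = ℕP.*-mono-≤ (ℕP.*-mono-≤ (ℕP.≤-trans 1≤X (ℕP.m≤m+n X k)) (^≥1 k (cfBd≥1 m))) (valBd≥1 m)

  headBd : ∀ m → (X ℕ.+ k) ℕ.* cfBd m ℕ.^ k ℕ.≤ valBd (suc m)
  headBd m = ℕP.m≤m*n _ (valBd m) ⦃ ℕ.>-nonZero (valBd≥1 m) ⦄

  valBd-up : ∀ m → valBd m ℕ.≤ valBd (suc m)
  valBd-up m = ℕP.m≤n*m (valBd m) _ ⦃ ℕ.>-nonZero (ℕP.*-mono-≤ (ℕP.≤-trans 1≤X (ℕP.m≤m+n X k)) (^≥1 k (cfBd≥1 m))) ⦄

  ^-up : ∀ m {i j} → i ℕ.≤ j → cfBd m ℕ.^ i ℕ.≤ cfBd m ℕ.^ j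
  ^-up m le = ℕP.^-monoʳ-≤ (cfBd m) ⦃ ℕ.>-nonZero (cfBd≥1 m) ⦄ le

  sum-bd : ∀ {x y a b} → ∣ x ∣ ℕ.≤ a → ∣ y ∣ ℕ.≤ b → ∣ x ℤ.+ y ∣ ℕ.≤ a ℕ.+ b
  sum-bd {x} {y} p q = ℕP.≤-trans (ℤP.∣i+j∣≤∣i∣+∣j∣ x y) (ℕP.+-mono-≤ p q)

  prod-bd : ∀ {x y a b} → ∣ x ∣ ℕ.≤ a → ∣ y ∣ ℕ.≤ b → ∣ x ℤ.* y ∣ ℕ.≤ a ℕ.* b
  prod-bd {x} {y} p q = ℕP.≤-trans (ℕP.≤-reflexive (ℤP.abs-* x y)) (ℕP.*-mono-≤ p q)

  itE-val : ∀ {m} j (T : Tri L m) → TriB h m T → j ℕ.≤ k → ∀ ρ → Bdd X ρ → Bdd (valBd m) (EvalE.evs ℤR (itE j T) ρ)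
  cf-val : ∀ {m} (G : Cf L m) j T → TriB h m T → CfB h m G → j ℕ.≤ k → ∀ ρ → Bdd X ρ → ∣ evℤ (sub (cfE m G) (itE j T)) ρ ∣ ℕ.≤ cfBd m
  AE-val : ∀ {m} j (G H : Cf L m) T → TriB h (suc m) (G , H , T) → j ℕ.≤ k → ∀ ρ → Bdd X ρ → ∣ evℤ (AE j G H T) ρ ∣ ℕ.≤ cfBd m ℕ.^ j
  BE-val : ∀ {m} j (G H : Cf L m) T → TriB h (suc m) (G , H , T) → j ℕ.≤ k → ∀ ρ → Bdd X ρ → ∣ evℤ (BE j G H T) ρ ∣ ℕ.≤ j ℕ.* cfBd m ℕ.^ j

  cf-val {m} G j T tb gb le ρ hρ = ≡.subst (λ z → ∣ z ∣ ℕ.≤ cfBd m) (≡.sym (EvalE-sub.ev-sub ℤR (cfE m G) (itE j T) ρ))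
    (cfE-bd m G h (valBd m) (valBd≥1 m) gb _ (itE-val j T tb le ρ hρ))
  AE-val zero G H T tb le ρ hρ = s≤s z≤n
  AE-val {m} (suc j) G H T tb@(gb , _ , tb') le ρ hρ = ℕP.≤-trans (prod-bd {evℤ (AE j G H T) ρ} (AE-val j G H T tb (ℕP.<⇒≤ le) ρ hρ) (cf-val G j T tb' gb (ℕP.<⇒≤ le) ρ hρ))
    (ℕP.≤-reflexive (ℕP.*-comm (cfBd m ℕ.^ j) (cfBd m)))
  BE-val zero G H T tb le ρ hρ = z≤n
  BE-val {m} (suc j) G H T tb@(gb , hb , tb') le ρ hρ = begin
    _ ≤⟨ sum-bd {evℤ (BE j G H T) ρ ℤ.* evℤ (sub (cfE m G) (itE j T)) ρ} (prod-bd {evℤ (BE j G H T) ρ} (BE-val j G H T tb (ℕP.<⇒≤ le) ρ hρ) (cf-val G j T tb' gb (ℕP.<⇒≤ le) ρ hρ)) (cf-val H j T tb' hb (ℕP.<⇒≤ le) ρ hρ) ⟩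
    j ℕ.* c ℕ.^ j ℕ.* c ℕ.+ c ≤⟨ ℕP.+-monoʳ-≤ (j ℕ.* c ℕ.^ j ℕ.* c) (ℕP.m≤m*n c (c ℕ.^ j) ⦃ ℕ.>-nonZero (^≥1 j (cfBd≥1 m)) ⦄) ⟩
    j ℕ.* c ℕ.^ j ℕ.* c ℕ.+ c ℕ.* c ℕ.^ j ≡⟨ solve 3 (λ j p c → j :* p :* c :+ c :* p := (con 1 :+ j) :* (c :* p)) ≡.refl j (c ℕ.^ j) c ⟩
    suc j ℕ.* (c ℕ.* c ℕ.^ j) ∎
    where
    open ℕP.≤-Reasoning
    open import Data.Nat.Solver using (module +-*-Solver)
    open +-*-Solver
    c = cfBd m
  itE-val {suc m} j (G , H , T) tb le (x ∷ ρ) hρ zero = begin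
    _ ≡⟨ ≡.cong₂ (λ a b → ∣ x ℤ.* a ℤ.+ b ∣) (EvalE-sub.ev-wk ℤR (AE j G H T) x ρ) (EvalE-sub.ev-wk ℤR (BE j G H T) x ρ) ⟩
    ∣ x ℤ.* evℤ (AE j G H T) ρ ℤ.+ evℤ (BE j G H T) ρ ∣ ≤⟨ sum-bd {x ℤ.* evℤ (AE j G H T) ρ} (prod-bd {x} (hρ zero) (AE-val j G H T tb le ρ (λ i → hρ (suc i)))) (BE-val j G H T tb le ρ (λ i → hρ (suc i))) ⟩
    X ℕ.* cfBd m ℕ.^ j ℕ.+ j ℕ.* cfBd m ℕ.^ j ≡⟨ ≡.sym (ℕP.*-distribʳ-+ (cfBd m ℕ.^ j) X j) ⟩
    (X ℕ.+ j) ℕ.* cfBd m ℕ.^ j ≤⟨ ℕP.*-mono-≤ (ℕP.+-monoʳ-≤ X le) (^-up m le) ⟩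
    (X ℕ.+ k) ℕ.* cfBd m ℕ.^ k ≤⟨ headBd m ⟩
    valBd (suc m) ∎
    where open ℕP.≤-Reasoning
  itE-val {suc m} j (G , H , T) (_ , _ , tb) le (x ∷ ρ) hρ (suc i) = begin
    _ ≡⟨ ≡.cong ∣_∣ (EvalE.≈ᵥ-lookup ℤR (TriLemmas.evs-wk ℤR (itE j T) x ρ) i) ⟩
    _ ≤⟨ itE-val j T tb le ρ (λ i → hρ (suc i)) i ⟩
    valBd m ≤⟨ valBd-up m ⟩
    valBd (suc m) ∎
    where open ℕP.≤-Reasoning

  Small : ∀ m → Expr m → Set
  Small m e = ∀ ρ → Bdd X ρ → ∣ evℤ e ρ ∣ ℕ.≤ 2 ℕ.* valBd m

  small-up : ∀ {m} e → Small m e → Small (suc m) (wk e)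
  small-up {m} e s (x ∷ ρ) hρ = ≡.subst (λ z → ∣ z ∣ ℕ.≤ _) (≡.sym (EvalE-sub.ev-wk ℤR e x ρ)) (ℕP.≤-trans (s ρ (λ i → hρ (suc i))) (ℕP.*-monoʳ-≤ 2 (valBd-up m)))

  A'E-val : ∀ {m} (G H : Cf L m) T → TriB h (suc m) (G , H , T) → ∀ ρ → Bdd X ρ → ∣ evℤ (A'E k G H T) ρ ∣ ℕ.≤ 2 ℕ.* cfBd m ℕ.^ k
  A'E-val {m} G H T tb ρ hρ = ℕP.≤-trans (sum-bd {evℤ (AE k G H T) ρ} (AE-val k G H T tb ℕP.≤-refl ρ hρ) (ℕP.≤-trans (s≤s z≤n) (^≥1 k (cfBd≥1 m))))
    (ℕP.≤-reflexive (≡.cong (cfBd m ℕ.^ k ℕ.+_) (≡.sym (ℕP.+-identityʳ _))))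

  fsT-val : ∀ {m} (T : Tri L m) → TriB h m T → All (Small m) (fsT k T)
  fsT-val {zero} T tb = []
  fsT-val {suc m} (G , H , T) tb@(_ , _ , tb') = hd ∷ all-map-wk small-up (fsT-val T tb')
    where
    open ℕP.≤-Reasoning
    open import Data.Nat.Solver using (module +-*-Solver)
    open +-*-Solver
    c = cfBd m ℕ.^ k
    hd : Small (suc m) (var zero ⊗ wk (A'E k G H T) ⊕ wk (BE k G H T))
    hd (x ∷ ρ) hρ = begin
      _ ≡⟨ ≡.cong ∣_∣ (TriLemmas.head-eq ℤR k G H T x ρ) ⟩
      ∣ x ℤ.* evℤ (A'E k G H T) ρ ℤ.+ evℤ (BE k G H T) ρ ∣ ≤⟨ sum-bd {x ℤ.* evℤ (A'E k G H T) ρ} (prod-bd {x} (hρ zero) (A'E-val G H T tb ρ (λ i → hρ (suc i)))) (BE-val k G H T tb ℕP.≤-refl ρ (λ i → hρ (suc i))) ⟩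
      X ℕ.* (2 ℕ.* c) ℕ.+ k ℕ.* c ≤⟨ ℕP.+-monoʳ-≤ (X ℕ.* (2 ℕ.* c)) (ℕP.m≤m+n (k ℕ.* c) (k ℕ.* c)) ⟩
      X ℕ.* (2 ℕ.* c) ℕ.+ (k ℕ.* c ℕ.+ k ℕ.* c) ≡⟨ solve 3 (λ X k c → X :* (con 2 :* c) :+ (k :* c :+ k :* c) := con 2 :* ((X :+ k) :* c)) ≡.refl X k c ⟩
      2 ℕ.* ((X ℕ.+ k) ℕ.* c) ≤⟨ ℕP.*-monoʳ-≤ 2 (headBd m) ⟩
      2 ℕ.* valBd (suc m) ∎

  asT-val : ∀ {m} (T : Tri L m) → TriB h m T → All (Small m) (asT k T)
  asT-val {zero} T tb = []
  asT-val {suc m} (G , H , T) tb@(_ , _ , tb') = hd ∷ all-map-wk small-up (asT-val T tb')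
    where
    open ℕP.≤-Reasoning
    hd : Small (suc m) (wk (A'E k G H T))
    hd (x ∷ ρ) hρ = begin
      _ ≡⟨ ≡.cong ∣_∣ (EvalE-sub.ev-wk ℤR (A'E k G H T) x ρ) ⟩
      ∣ evℤ (A'E k G H T) ρ ∣ ≤⟨ A'E-val G H T tb ρ (λ i → hρ (suc i)) ⟩
      2 ℕ.* cfBd m ℕ.^ k ≤⟨ ℕP.*-monoʳ-≤ 2 (ℕP.≤-trans (ℕP.m≤n*m _ (X ℕ.+ k) ⦃ ℕ.>-nonZero (ℕP.≤-trans 1≤X (ℕP.m≤m+n X k)) ⦄) (headBd m)) ⟩
      2 ℕ.* valBd (suc m) ∎

-- Growth of the bounds in k

-- f(k) = O(k^e)
record PB (e : ℕ) (f : ℕ → ℕ) : Set where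
  constructor pb
  field
    c : ℕ
    bd : ∀ k → 1 ℕ.≤ k → f k ℕ.≤ c ℕ.* k ℕ.^ e

-- log f(k) = O(k^e)
record BL (e : ℕ) (f : ℕ → ℕ) : Set where
  constructor bl
  field
    g : ℕ → ℕ
    g-pb : PB e g
    le : ∀ k → 1 ℕ.≤ k → f k ℕ.≤ 2 ℕ.^ g k

k^≥1 : ∀ k e → 1 ℕ.≤ k → 1 ℕ.≤ k ℕ.^ e
k^≥1 k e h = ℕP.m^n>0 k ⦃ ℕ.>-nonZero h ⦄ e

pb-weaken : ∀ {e e' f} → e ℕ.≤ e' → PB e f → PB e' f
pb-weaken le (pb c h) = pb c λ k 1≤k → ℕP.≤-trans (h k 1≤k) (ℕP.*-monoʳ-≤ c (ℕP.^-monoʳ-≤ k ⦃ ℕ.>-nonZero 1≤k ⦄ le))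

pb-con : ∀ c → PB 0 (λ _ → c)
pb-con c = pb c λ k _ → ℕP.≤-reflexive (≡.sym (ℕP.*-identityʳ c))

pb-id : PB 1 (λ k → k)
pb-id = pb 1 λ k _ → ℕP.≤-reflexive (≡.sym (≡.trans (ℕP.*-identityˡ _) (ℕP.*-identityʳ k)))

pb-+ : ∀ {e f g} → PB e f → PB e g → PB e (λ k → f k ℕ.+ g k)
pb-+ {e} (pb c h) (pb c' h') = pb (c ℕ.+ c') λ k l → ℕP.≤-trans (ℕP.+-mono-≤ (h k l) (h' k l)) (ℕP.≤-reflexive (≡.sym (ℕP.*-distribʳ-+ (k ℕ.^ e) c c')))

pb-* : ∀ {e e' f g} → PB e f → PB e' g → PB (e ℕ.+ e') (λ k → f k ℕ.* g k)
pb-* {e} {e'} (pb c h) (pb c' h') = pb (c ℕ.* c') λ k l → ℕP.≤-trans (ℕP.*-mono-≤ (h k l) (h' k l))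
  (ℕP.≤-reflexive (≡.trans (solve 4 (λ a b c d → (a :* b) :* (c :* d) := (a :* c) :* (b :* d)) ≡.refl c (k ℕ.^ e) c' (k ℕ.^ e')) (≡.cong (c ℕ.* c' ℕ.*_) (≡.sym (ℕP.^-distribˡ-+-* k e e')))))
  where
  open import Data.Nat.Solver using (module +-*-Solver)
  open +-*-Solver

pb-^ : ∀ {e f} m → PB e f → PB (m ℕ.* e) (λ k → f k ℕ.^ m)
pb-^ zero p = pb-con 1
pb-^ (suc m) p = pb-* p (pb-^ m p)

pb-sc : ∀ {e f} c → PB e f → PB e (λ k → c ℕ.* f k)
pb-sc c p = pb-* (pb-con c) p

n≤2^n : ∀ n → n ℕ.≤ 2 ℕ.^ n
n≤2^n zero = z≤n
n≤2^n (suc n) = ℕP.≤-trans (ℕP.+-mono-≤ (k^≥1 2 n (s≤s z≤n)) (n≤2^n n)) (ℕP.≤-reflexive (≡.cong (2 ℕ.^ n ℕ.+_) (≡.sym (ℕP.+-identityʳ _))))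

bl-weaken : ∀ {e e' f} → e ℕ.≤ e' → BL e f → BL e' f
bl-weaken le (bl g p h) = bl g (pb-weaken le p) h

bl-con : ∀ c → BL 0 (λ _ → c)
bl-con c = bl (λ _ → c) (pb-con c) λ _ _ → n≤2^n c

-- Uses k ≤ 2^k in place of a logarithm; the resulting exponent 1 does not exceed those of the
-- factors it is combined with.
bl-pb : ∀ {e f} → PB e f → BL 1 f
bl-pb {e} (pb c h) = bl (λ k → c ℕ.+ k ℕ.* e) (pb-+ (pb-weaken z≤n (pb-con c)) (pb-* pb-id (pb-con e)))
  λ k l → ℕP.≤-trans (h k l) (ℕP.≤-trans (ℕP.*-mono-≤ (n≤2^n c) (ℕP.≤-trans (ℕP.^-monoˡ-≤ e (n≤2^n k)) (ℕP.≤-reflexive (ℕP.^-*-assoc 2 k e))))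
    (ℕP.≤-reflexive (≡.sym (ℕP.^-distribˡ-+-* 2 c (k ℕ.* e)))))

bl-* : ∀ {e f f'} → BL e f → BL e f' → BL e (λ k → f k ℕ.* f' k)
bl-* (bl g p h) (bl g' p' h') = bl (λ k → g k ℕ.+ g' k) (pb-+ p p') λ k l → ℕP.≤-trans (ℕP.*-mono-≤ (h k l) (h' k l)) (ℕP.≤-reflexive (≡.sym (ℕP.^-distribˡ-+-* 2 (g k) (g' k))))

bl-+ : ∀ {e f f'} → BL e f → BL e f' → BL e (λ k → f k ℕ.+ f' k)
bl-+ (bl g p h) (bl g' p' h') = bl (λ k → 1 ℕ.+ (g k ℕ.+ g' k)) (pb-+ (pb-weaken z≤n (pb-con 1)) (pb-+ p p')) λ k l →
  ℕP.≤-trans (ℕP.+-mono-≤ (ℕP.≤-trans (h k l) (ℕP.^-monoʳ-≤ 2 (ℕP.m≤m+n (g k) (g' k)))) (ℕP.≤-trans (h' k l) (ℕP.^-monoʳ-≤ 2 (ℕP.m≤n+m (g' k) (g k)))))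
   (ℕP.≤-reflexive (≡.cong (2 ℕ.^ (g k ℕ.+ g' k) ℕ.+_) (≡.sym (ℕP.+-identityʳ _))))

bl-^ : ∀ {e e' f m} → BL e f → PB e' m → BL (e' ℕ.+ e) (λ k → f k ℕ.^ m k)
bl-^ {m = m} (bl g p h) q = bl (λ k → m k ℕ.* g k) (pb-* q p) λ k l → ℕP.≤-trans (ℕP.^-monoˡ-≤ (m k) (h k l))
  (ℕP.≤-reflexive (≡.trans (ℕP.^-*-assoc 2 (g k) (m k)) (≡.cong (2 ℕ.^_) (ℕP.*-comm (g k) (m k)))))

bl-^c : ∀ {e f} m → BL e f → BL e (λ k → f k ℕ.^ m)
bl-^c m b = bl-^ b (pb-con m)

bl0 : ∀ {e} c → BL e (λ _ → c)
bl0 c = bl-weaken z≤n (bl-con c)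

-- The bound of the arithmetic Nullstellensatz for s equations with values at most F.
eqsBd : (n L E : ℕ) → (ℕ → ℕ) → (F s : ℕ) → ℕ
eqsBd n L E Y F s = ((2 ℕ.* Y W) ℕ.* (L ℕ.* suc (suc n ℕ.* L) ℕ.^ L) ℕ.^ suc n) ℕ.* Q
  where
  Q = F ℕ.* (1 ℕ.+ s ℕ.* (suc (suc n) ℕ.* L ℕ.+ 2))
  W = E ℕ.+ E ℕ.* Q

opaque
  perronBd : (n L₀ h k Δ : ℕ) → ℕ
  perronBd n L₀ h k Δ = eqsBd n (Perron.L (suc n) (suc Δ)) (Perron.E (suc n) (suc Δ)) (Perron.Y (suc n) (suc Δ))
    (2 ℕ.* ValBd.valBd L₀ h k (Perron.E (suc n) (suc Δ)) n) (suc n)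

module Growth (n' d h : ℕ) where
  n Ld : ℕ
  n = suc n'
  Ld = suc (suc d)

  Δ L E Fb W Bb : ℕ → ℕ
  Δ k = TriDeg.degBd Ld k n
  L k = Perron.L (suc n) (suc (Δ k))
  E k = Perron.E (suc n) (suc (Δ k))

  val : ℕ → ℕ → ℕ
  val k = ValBd.valBd Ld h k (E k)

  Fb k = 2 ℕ.* val k n

  Qb : ℕ → ℕ
  Qb k = Fb k ℕ.* (1 ℕ.+ suc n ℕ.* (suc (suc n) ℕ.* L k ℕ.+ 2))
  W k = E k ℕ.+ E k ℕ.* Qb k
  Bb k = perronBd n Ld h k (Δ k)

  -- The last variable is iterated with constant coefficients and has degree bound 1; every further
  -- variable costs one factor k.
  Δ-pb : ∀ m → PB m (λ k → TriDeg.degBd Ld k (suc m))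
  Δ-pb zero = pb 1 λ k l → ℕP.≤-reflexive (≡.cong (λ z → suc z ℕ.+ 0) (ℕP.*-zeroʳ k))
  Δ-pb (suc m) = pb-+ (pb-+ (pb-weaken z≤n (pb-con 1)) (pb-* pb-id (pb-sc (suc m ℕ.* Ld) (Δ-pb m)))) (pb-weaken (ℕP.n≤1+n m) (Δ-pb m))

  D-pb : PB n' (λ k → Perron.D (suc n) (suc (Δ k)))
  D-pb = pb-sc (suc (suc (suc n))) (pb-+ (pb-weaken z≤n (pb-con 1)) (Δ-pb n'))

  -- L is twice the power n + 1 of D = O(k^(n-1)).
  eL : ℕ
  eL = suc n ℕ.* n'

  L-pb : PB eL L
  L-pb = pb-sc 2 (pb-^ (suc n) D-pb)

  E-pb : PB (n' ℕ.+ eL) E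
  E-pb = pb-* D-pb L-pb

  -- The k-th power of `cfBd` multiplies the logarithm by k for each variable.
  val-bl : ∀ m → BL m (λ k → val k m)
  val-bl zero = bl-con 1
  val-bl (suc m) = bl-* (bl-* (bl-weaken (s≤s z≤n) (bl-+ (bl-pb E-pb) (bl-pb pb-id)))
      (bl-^ (bl-* (bl0 h) (bl-^c m (bl-* (bl0 Ld) (bl-^c Ld (val-bl m))))) pb-id)) (bl-weaken (ℕP.n≤1+n m) (val-bl m))

  1≤n : 1 ℕ.≤ n
  1≤n = s≤s z≤n

  Qb-bl : BL n Qb
  Qb-bl = bl-* (bl-* (bl0 2) (val-bl n)) (bl-weaken 1≤n (bl-+ (bl0 1) (bl-* (bl0 (suc n)) (bl-+ (bl-* (bl0 (suc (suc n))) (bl-pb L-pb)) (bl0 2)))))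

  W-bl : BL n W
  W-bl = bl-+ E-bl (bl-* E-bl Qb-bl)
    where
    E-bl : BL n E
    E-bl = bl-weaken 1≤n (bl-pb E-pb)

  opaque
    unfolding perronBd

    -- The dominant factor is `W^L` inside `Y`: its logarithm is L log W, of order k^eL times k^n.
    Bb-bl : BL (eL ℕ.+ n) Bb
    Bb-bl = bl-* (bl-* (bl-* (bl0 2) (bl-^c (suc (suc n)) (bl-* L-bl (bl-^ W-bl L-pb))))
        (bl-^c (suc n) (bl-* L-bl (bl-weaken (ℕP.+-monoʳ-≤ eL 1≤n) (bl-^ (bl-+ (bl0 1) (bl-* (bl0 (suc n)) (bl-pb L-pb))) L-pb)))))
        (bl-weaken (ℕP.m≤n+m n eL) Qb-bl)
      where
      L-bl : BL (eL ℕ.+ n) L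
      L-bl = bl-weaken (ℕP.≤-trans 1≤n (ℕP.m≤n+m n eL)) (bl-pb L-pb)

  -- The exponent reached is n² + n - 1; the added polynomial in n' = n - 1 is the exact difference
  -- to n (3n - 1).
  eL≤ : eL ℕ.+ n ℕ.≤ n ℕ.* (3 ℕ.* n ℕ.∸ 1)
  eL≤ = ℕP.≤-trans (ℕP.m≤m+n (eL ℕ.+ n) (2 ℕ.* n' ℕ.* n' ℕ.+ 2 ℕ.* n' ℕ.+ 1)) (ℕP.≤-reflexive
    (≡.trans (solve 1 (λ a → (con 2 :+ a) :* a :+ (con 1 :+ a) :+ (con 2 :* a :* a :+ con 2 :* a :+ con 1) := (con 1 :+ a) :* (con 2 :+ con 3 :* a)) ≡.refl n')
      (≡.cong (λ z → n ℕ.* (z ℕ.∸ 1)) (solve 1 (λ a → con 1 :+ (con 2 :+ con 3 :* a) := con 3 :* (con 1 :+ a)) ≡.refl n'))))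
    where
    open import Data.Nat.Solver using (module +-*-Solver)
    open +-*-Solver

  B-bl : BL (n ℕ.* (3 ℕ.* n ℕ.∸ 1)) (λ k → Bb k ℕ.^ n)
  B-bl = bl-weaken eL≤ (bl-^c n Bb-bl)

-- Bad primes and the theorem

open import Data.Nat using (_≤_; _*_; _∸_; _^_; _/_)

-- A prime that does not divide the product divides none of its factors.
collect : ∀ {n} (P : Expr n → ℕ → Set₁) M (as : List (Expr n)) →
  (∀ {a} → a ∈ as → Σ ℕ λ B → 1 ≤ B × B ≤ M × (∀ p → ¬ (p ∣ B) → P a p)) →
  Σ ℕ λ B → 1 ≤ B × B ≤ M ^ length as × (∀ p → ¬ (p ∣ B) → All (λ a → P a p) as)
collect P M [] h = 1 , s≤s z≤n , s≤s z≤n , λ p _ → []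
collect P M (a ∷ as) h with h (here ≡.refl) | collect P M as (λ m → h (there m))
... | B , B≥1 , B≤ , hB | C , C≥1 , C≤ , hC = B * C , ℕP.*-mono-≤ B≥1 C≥1 , ℕP.*-mono-≤ B≤ C≤ ,
      λ p p∤ → hB p (λ d → p∤ (ℕD.∣m⇒∣m*n C d)) ∷ hC p (λ d → p∤ (ℕD.∣n⇒∣m*n B d))

module Primes (n L₀ h k : ℕ) (1≤L₀ : 1 ≤ L₀) (1≤h : 1 ≤ h) (Δ L E : ℕ) (Y : ℕ → ℕ)
  (siegel : Siegel (suc n) (suc Δ) L E Y) (Δ<E : Δ ℕ.< E) (1≤L : 1 ≤ L) (1≤Y : ∀ W → 1 ≤ W → 1 ≤ Y W)
  (T : Tri L₀ n) (tb : TriB h n T) (degs : All (λ f → deg f ≤ Δ) (fsT k T)) (degs' : All (λ f → deg f ≤ Δ) (asT k T)) where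

  1≤E : 1 ≤ E
  1≤E = ℕP.≤-trans (s≤s z≤n) Δ<E

  module V = TriVal L₀ h k E 1≤L₀ 1≤h 1≤E

  Fb : ℕ
  Fb = 2 * V.valBd n

  1≤Fb : 1 ≤ Fb
  1≤Fb = ℕP.*-mono-≤ {1} {2} (s≤s z≤n) (V.valBd≥1 n)

  1≤eqsBd : ∀ s → 1 ≤ eqsBd n L E Y Fb s
  1≤eqsBd s = ℕP.*-mono-≤ (ℕP.*-mono-≤ (ℕP.*-mono-≤ {1} {2} (s≤s z≤n) (1≤Y _ (ℕP.≤-trans 1≤E (ℕP.m≤m+n E _))))
      (V.^≥1 (suc n) (ℕP.*-mono-≤ 1≤L (V.^≥1 L (s≤s z≤n))))) (ℕP.*-mono-≤ 1≤Fb (s≤s z≤n))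

  fs : List (Expr n)
  fs = fsT k T

  Good : Expr n → ℕ → Set₁
  Good a p = ∀ A → CharDom (ACF.infDom A) p → ¬ CommonZero A (a ∷ fs)

  module _ (A₀ : ACF) (cz : CharZ A₀) (nz : All (λ a → ¬ CommonZero A₀ (a ∷ fs)) (asT k T)) where
    one : ∀ {a} → a ∈ asT k T → Σ ℕ λ B → 1 ≤ B × B ≤ eqsBd n L E Y Fb (suc n) × (∀ p → ¬ (p ∣ B) → Good a p)
    one {a} a∈ = conclude (R.arithmetic-nullstellensatz (1≤eqsBd (length (a ∷ fs))))
      where
      vals : All (λ f → ∀ (x : Vec (Fin E) n) → ∣ evℤ f (Vec.map posFin x) ∣ ≤ Fb) (a ∷ fs)
      vals = All.map (λ s x → s (Vec.map posFin x) (posFin-Bdd x)) (All.lookup (V.asT-val T tb) a∈ ∷ V.fsT-val T tb)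
      module R = Arith n Δ L E Y siegel Δ<E (a ∷ fs) Fb 1≤Fb (All.lookup degs' a∈ ∷ degs) vals
      conclude : R.Result → _
      conclude (B , B≥1 , B≤ , hB) = B , B≥1 , ℕP.≤-trans B≤ (ℕP.≤-reflexive (≡.cong (λ s → eqsBd n L E Y Fb (suc s)) (fsT-len k T))) ,
        λ p p∤ A cd → hB A₀ cz (All.lookup nz a∈) p p∤ A cd

    bad-primes : Σ ℕ λ B → 1 ≤ B × B ≤ eqsBd n L E Y Fb (suc n) ^ n × (∀ p → ¬ (p ∣ B) → All (λ a → Good a p) (asT k T))
    bad-primes = ≡.subst (λ l → Σ ℕ λ B → 1 ≤ B × B ≤ eqsBd n L E Y Fb (suc n) ^ l × (∀ p → ¬ (p ∣ B) → All (λ a → Good a p) (asT k T))) (asT-len k T)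
      (collect Good (eqsBd n L E Y Fb (suc n)) (asT k T) one)

perron-siegel : ∀ N Δ → 1 ≤ Δ → Siegel N Δ (Perron.L N Δ) (Perron.E N Δ) (Perron.Y N Δ)
perron-siegel N Δ 1≤Δ = Perron.perron N Δ 1≤Δ

perron-Δ<E : ∀ N Δ → Δ ℕ.< Perron.E N (suc Δ)
perron-Δ<E N Δ = ℕP.≤-trans (ℕP.m≤n*m (suc Δ) (suc (suc N))) (ℕP.m≤m*n (Perron.D N (suc Δ)) (Perron.L N (suc Δ)) ⦃ ℕ.>-nonZero (Perron.L≥1 N (suc Δ) (s≤s z≤n)) ⦄)

opaque
  unfolding perronBd

  perron-bad-primes : ∀ n L₀ h k Δ → 1 ≤ L₀ → 1 ≤ h → (T : Tri L₀ n) → TriB h n T → All (λ f → deg f ≤ Δ) (fsT k T) → All (λ f → deg f ≤ Δ) (asT k T) →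
    (A₀ : ACF) → CharZ A₀ → All (λ a → ¬ CommonZero A₀ (a ∷ fsT k T)) (asT k T) → Σ ℕ λ B → 1 ≤ B × B ≤ perronBd n L₀ h k Δ ^ n ×
      (∀ p → ¬ (p ∣ B) → All (λ a → ∀ A → CharDom (ACF.infDom A) p → ¬ CommonZero A (a ∷ fsT k T)) (asT k T))
  perron-bad-primes n L₀ h k Δ 1≤L₀ 1≤h = Primes.bad-primes n L₀ h k 1≤L₀ 1≤h Δ (Perron.L (suc n) (suc Δ)) (Perron.E (suc n) (suc Δ)) (Perron.Y (suc n) (suc Δ))
      (perron-siegel (suc n) (suc Δ) (s≤s z≤n)) (perron-Δ<E (suc n) Δ) (Perron.L≥1 (suc n) (suc Δ) (s≤s z≤n)) (Perron.Y≥1 (suc n) (suc Δ) (s≤s z≤n))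

system-bad-primes : ∀ n' d h k → 1 ≤ h → (T : Tri (suc (suc d)) (suc n')) → TriB h (suc n') T → (A₀ : ACF) → CharZ A₀ →
  All (λ a → ¬ CommonZero A₀ (a ∷ fsT k T)) (asT k T) → Σ ℕ λ B → 1 ≤ B × B ≤ Growth.Bb n' d h k ^ suc n' ×
    (∀ p → ¬ (p ∣ B) → All (λ a → ∀ A → CharDom (ACF.infDom A) p → ¬ CommonZero A (a ∷ fsT k T)) (asT k T))
system-bad-primes n' d h k 1≤h T tb = perron-bad-primes (suc n') (suc (suc d)) h k (TriDeg.degBd (suc (suc d)) k (suc n')) (s≤s z≤n) 1≤h T tb
  (TriDeg.fsT-deg (suc (suc d)) k T) (TriDeg.asT-deg (suc (suc d)) k T)

module OverField {n d} (F : Fin n → Poly n) (sh : Shape (suc (suc d)) (λ i → coeff (F i))) (k : ℕ) (K : Field 0ℓ 0ℓ) (ac : AlgClosed K) where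
  module FA = FieldACF K ac
  module S = StableTri (Field.commRing K)
  module B = Bridge (Field.commRing K)
  module De = Deform FA.acf
  module TL = TriLemmas (Stabilise.stR (Field.commRing K))
  open Eval (Field.commRing K) using (Periodic; _≋_)

  T : Tri (suc (suc d)) n
  T = mkTri n (λ i → coeff (F i))

  L≥2 : 2 ≤ suc (suc d)
  L≥2 = s≤s (s≤s z≤n)

  zeros : ∀ x → Periodic F k x → All (TL.Zero x) (fsT k T)
  zeros x p = TL.per⇒zero k T x (S.ret-per k T x (B.periodic⇒per F sh L≥2 k x p))

  finite : (Ps : List (Vec (Field.Carrier K) n)) → (∀ w → Periodic F k w → Any (w ≋_) Ps) → ∀ v → All (TL.Zero v) (fsT k T) → ¬ ¬ Any (v S.V'.≈ᵥ_) Ps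
  finite Ps fin v z κ = S.unret-per k T v (TL.zero⇒per k T v z) λ p →
    κ (Any.map (λ e → S.retᵥ (S.V.≈ᵥ-from e)) (fin v (B.per⇒periodic F sh L≥2 k v p)))

  at-most-one : All (λ a → ¬ CommonZero FA.acf (a ∷ fsT k T)) (asT k T) → ∀ Ps → AllPairs (λ x y → ¬ (x ≋ y)) Ps → All (Periodic F k) Ps → length Ps ≤ 1
  at-most-one h [] _ _ = z≤n
  at-most-one h (x ∷ []) _ _ = s≤s z≤n
  at-most-one h (x ∷ y ∷ _) ((ne ∷ _) ∷ _) (px ∷ py ∷ _) = ⊥-elim (S.unretᵥ (De.unique k T x y (zeros x px) (zeros y py) (All.map (λ na z → na (x , z ∷ zeros x px)) h)) λ e → ne (S.V.≈ᵥ-lookup e))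

charZ : ∀ K ac → CharZero K → CharZ (FieldACF.acf K ac)
charZ K ac cz c h = ℤ-stable λ c≢0 → FieldACF.intCast-st K ac c h λ e → go c c≢0 (intCast-abs (Field.commRing K) c e)
  where
  go : ∀ c → ¬ c ≡ pos 0 → ¬ Field._≈_ K (Eval.natCast (Field.commRing K) ∣ c ∣) (Field.0# K)
  go (pos zero) nz = ⊥-elim (nz ≡.refl)
  go (pos (suc m)) nz = cz m
  go (neg m) nz = cz m

theorem2p1 : ∀ (n d H : ℕ) → 1 ≤ n →
    ∃ λ (C : ℕ) →
    ∀ (F : Fin n → Poly n) → Triangular F →
    (∀ i → TotDeg≤ (F i) d) → (∀ i → Coeffs≤ (F i) H) →
    ∀ (k : ℕ) → 1 ≤ k →
    ∀ (K₀ : Field 0ℓ 0ℓ) → AlgClosed K₀ → CharZero K₀ →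
    (∃ λ (Ps : List (Vec (Field.Carrier K₀) n)) →
    ∀ w → Eval.Periodic (Field.commRing K₀) F k w →
    Any (Eval._≋_ (Field.commRing K₀) w) Ps) →
    ∃ λ (B : ℕ) → 1 ≤ B × B ≤ 2 ^ (C * k ^ (n * (3 * n ∸ 1))) ×
    (∀ (p : ℕ) → Prime p → ¬ (p ∣ B) →
    ∀ (K : Field 0ℓ 0ℓ) → AlgClosed K → CharP K p →
    ∀ (Ps : List (Vec (Field.Carrier K) n)) →
    AllPairs (λ x y → ¬ Eval._≋_ (Field.commRing K) x y) Ps →
    All (Eval.Periodic (Field.commRing K) F k) Ps →
    length Ps ≤ C * k ^ (n * (n ∸ 1) / 2))
-- The successor makes the constant positive, so that it also bounds the number of periodic points,
-- which is at most 1.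
theorem2p1 (suc n') d H _ = suc c , λ F tri td cb k 1≤k K₀ ac₀ cz (Ps₀ , fin) →
  let sh = triangular-shape F tri d td
      T = mkTri {suc (suc d)} n (λ i → coeff (F i))
      module O₀ = OverField F sh k K₀ ac₀
      -- `suc H` is a coefficient bound that stays positive for H = 0, as the value estimates
      -- require.
      B , B≥1 , B≤ , hB = system-bad-primes n' d (suc H) k (s≤s z≤n) T
        (mkTri-bd n (λ i → coeff (F i)) (suc H) (λ i e → ℕP.≤-trans (cb i e) (ℕP.n≤1+n H)))
        O₀.FA.acf (charZ K₀ ac₀ cz) (O₀.De.no-degenerate k T Ps₀ (O₀.finite Ps₀ fin))
  in B , B≥1
     , ℕP.≤-trans B≤ (ℕP.≤-trans (BL.le size k 1≤k) (ℕP.^-monoʳ-≤ 2 (ℕP.≤-trans (PB.bd (BL.g-pb size) k 1≤k) (ℕP.*-monoˡ-≤ (k ^ e) (ℕP.n≤1+n c)))))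
     , λ p pr p∤B K ac pK Ps dist per →
         let module O = OverField F sh k K ac
             module S = Stabilise (Field.commRing K)
             cd = charK O.FA.idom p pr (≡.subst (λ u → u S.≈' Field.0# K) (≡.sym (S.natCast≡ p)) (S.ret pK))
         in ℕP.≤-trans (O.at-most-one (All.map (λ h → h O.FA.acf cd) (hB p p∤B)) Ps dist per)
              (ℕP.*-mono-≤ (s≤s {n = c} z≤n) (k^≥1 k (n * (n ∸ 1) / 2) 1≤k))
  where
  n = suc n'
  e = n * (3 * n ∸ 1)
  size = Growth.B-bl n' d (suc H)
  c = PB.c (BL.g-pb size)
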